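{- Let $m\ge2$ and let $\mathcal{H}\in\mathcal{P}(\mathcal{H})$ be a connected $3$-cyclic Type II linear $m$-uniform hypergraph with $k$ edges, where $(k-13)(m-1)\ge46$. If $\mathcal{H}\ne T_2C(c_1=k-9)$, then $\lambda_1(\mathcal{H})\le\lambda_1(T_2C(c_1=k-10,c_2=1))$, and equality holds only when $\mathcal{H}=T_2C(c_1=k-10,c_2=1)$.
   Context: A hypergraph has a finite vertex set and an edge set of non-empty subsets of the vertex set; it is $m$-uniform if all edges have cardinality $m$, and linear if two distinct edges share at most one vertex. The adjacency matrix of a linear $m$-uniform hypergraph has $(i,j)$ entry $\frac{1}{m-1}$ if $i\ne j$ lie in a common edge, and $0$ otherwise; $\lambda_1$ denotes the spectral radius of this matrix. The $m$-th power hypergraph of a graph $G(V,E)$ is the $m$-uniform hypergraph obtained by adding to each edge $e\in E$ $m-2$ new vertices $v_{e,1},\dots,v_{e,m-2}$ (distinct for distinct edges). $\mathcal{P}(\mathcal{H})$ denotes the set of $m$-th power hypergraphs of graphs (a fixed notation for the set, not depending on the particular hypergraph $\mathcal{H}$). A loose cycle of length $l\ge3$, $v_1e_1v_2e_2\dots v_le_lv_1$, is the $m$-uniform hypergraph with edges $e_1,\dots,e_l$ in which $e_{i-1}\cap e_i=\{v_i\}$ (indices mod $l$, the $v_i$ distinct) and non-consecutive edges are disjoint. A linear hypergraph is $3$-cyclic if it contains exactly three loose cycles. An $m$-uniform $3$-cyclic linear hypergraph with $n$ vertices and $k$ edges is of Type II if $n=k(m-1)-2$. Attaching a pendant edge at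 a vertex $v$ means adding a new edge consisting of $v$ and $m-1$ new vertices. $T_2C(c_1=l_1,\dots,c_7=l_7)$ is the hypergraph consisting of three loose cycles of length $3$, $v_1e_1v_2e_2v_3e_3v_1$, $v_1e_4v_4e_5v_5e_6v_1$ and $v_1e_7v_6e_8v_7e_9v_1$, pairwise sharing only the vertex $v_1$, together with $l_i$ pendant edges attached at $v_i$ for $i=1,\dots,7$; when only some of the $c_i$ are listed, the others are $0$. Equality of hypergraphs means isomorphism. -}

module Defs where

open import Data.Bool.Base using (if_then_else_)
open import Data.Bool.Properties using () renaming (_≟_ to _≟ᵇ_)
open import Data.Empty using (⊥-elim)
open import Data.Fin.Base using (Fin; zero; suc; toℕ; _↑ˡ_)
open import Data.Fin.Patterns using (0F; 1F; 2F; 3F; 4F; 5F; 6F; 7F; 8F)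
open import Data.Fin.Properties using (any?; all?) renaming (_≟_ to _≟ᶠ_)
open import Data.Fin.Subset
  using (Subset; _∈_; _∩_; _∪_; ∣_∣; ⁅_⁆; ⊤; ⊥; Nonempty; Empty)
open import Data.Fin.Subset.Properties using (x∈⁅x⁆; _∈?_; nonempty?)
open import Data.Integer.Base using (+_)
open import Data.List.Base as List using (concatMap; allFin)
open import Data.Nat.Base as ℕ using (ℕ; zero; suc; _∸_; NonTrivial; NonZero)
open import Data.Nat.DivMod using (_mod_)
import Data.Nat.Properties as ℕₚ
open import Data.Product.Base using (∃; ∃-syntax; _×_; _,_)
open import Data.Rational.Base as ℚ using (ℚ; 0ℚ; 1ℚ; ½)
import Data.Rational.Properties as ℚₚ
import Data.Rational.Solver as ℚ-Solver
open import Data.Vec.Base as Vec using (Vec; []; _∷_; _++_; lookup; concat; tabulate)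
open import Data.Vec.Properties
  using (≡-dec; lookup-++ˡ; []=⇒lookup; lookup⇒[]=; ++-injectiveˡ; ++-injectiveʳ)
import Data.Vec.Functional as Vector
open import Function.Bundles using (_⇔_; _↔_; Inverse)
open import Function.Definitions using (Injective)
open import Relation.Binary.Construct.Closure.ReflexiveTransitive using (Star)
open import Relation.Binary.PropositionalEquality
  using (_≡_; _≢_; refl; sym; trans; cong; subst)
open import Relation.Nullary using (¬_; does)
open import Relation.Nullary.Decidable using (_×-dec_; ¬?; _→-dec_; toWitness)

-- Real numbers, as Cauchy sequences of rationals. Two sequences denote the
-- same real when they are related by _≈_ below, so this is a setoid.

IsCauchy : (ℕ → ℚ) → Set
IsCauchy s = ∀ ε → 0ℚ ℚ.< ε →
  ∃[ N ] ∀ i j → N ℕ.≤ i → N ℕ.≤ j → ℚ.∣ s i ℚ.- s j ∣ ℚ.< ε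

record ℝ : Set where
  constructor mkℝ
  field
    seq    : ℕ → ℚ
    cauchy : IsCauchy seq

open ℝ public

infix 4 _≈_ _≤_

_≈_ : ℝ → ℝ → Set
x ≈ y = ∀ ε → 0ℚ ℚ.< ε →
  ∃[ N ] ∀ i → N ℕ.≤ i → ℚ.∣ seq x i ℚ.- seq y i ∣ ℚ.< ε

_≤_ : ℝ → ℝ → Set
x ≤ y = ∀ ε → 0ℚ ℚ.< ε →
  ∃[ N ] ∀ i → N ℕ.≤ i → seq x i ℚ.< seq y i ℚ.+ ε

private
  open ℚ-Solver.+-*-Solver
    using (solve; _:=_; _:+_; _:*_; _:-_; :-_)

  -- Unfolding these proofs during conversion checking is prohibitively slow.
  abstract
    half : ∀ ε → ε ℚ.* ½ ℚ.+ ε ℚ.* ½ ≡ ε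
    half ε = trans (sym (ℚₚ.*-distribˡ-+ ε ½ ½)) (ℚₚ.*-identityʳ ε)

    half>0 : ∀ {ε} → 0ℚ ℚ.< ε → 0ℚ ℚ.< ε ℚ.* ½
    half>0 {ε} 0<ε =
      subst (ℚ._< ε ℚ.* ½) (ℚₚ.*-zeroˡ ½) (ℚₚ.*-monoˡ-<-pos ½ 0<ε)

    const-cauchy : ∀ q → IsCauchy (λ _ → q)
    const-cauchy q ε 0<ε = 0 , λ _ _ _ _ →
      subst (ℚ._< ε) (sym (cong ℚ.∣_∣ (ℚₚ.+-inverseʳ q))) 0<ε

    neg-cauchy : ∀ {s} → IsCauchy s → IsCauchy (λ i → ℚ.- s i)
    neg-cauchy {s} cs ε 0<ε with cs ε 0<ε
    ... | N , h = N , λ i j N≤i N≤j →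
      subst (ℚ._< ε)
        (sym (trans (cong ℚ.∣_∣ (solve 2 (λ a b → :- a :- :- b := :- (a :- b)) refl (s i) (s j)))
                    (ℚₚ.∣-p∣≡∣p∣ (s i ℚ.- s j))))
        (h i j N≤i N≤j)

    +-cauchy : ∀ {s t} → IsCauchy s → IsCauchy t → IsCauchy (λ i → s i ℚ.+ t i)
    +-cauchy {s} {t} cs ct ε 0<ε
      with cs (ε ℚ.* ½) (half>0 0<ε) | ct (ε ℚ.* ½) (half>0 0<ε)
    ... | M , h | N , k = M ℕ.⊔ N , λ i j p q → begin-strict
        ℚ.∣ (s i ℚ.+ t i) ℚ.- (s j ℚ.+ t j) ∣
          ≡⟨ cong ℚ.∣_∣ (solve 4 (λ a b c d → (a :+ b) :- (c :+ d) := (a :- c) :+ (b :- d))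
                           refl (s i) (t i) (s j) (t j)) ⟩
        ℚ.∣ (s i ℚ.- s j) ℚ.+ (t i ℚ.- t j) ∣
          ≤⟨ ℚₚ.∣p+q∣≤∣p∣+∣q∣ (s i ℚ.- s j) (t i ℚ.- t j) ⟩
        ℚ.∣ s i ℚ.- s j ∣ ℚ.+ ℚ.∣ t i ℚ.- t j ∣
          <⟨ ℚₚ.+-mono-< (h i j (ℕₚ.m⊔n≤o⇒m≤o M N p) (ℕₚ.m⊔n≤o⇒m≤o M N q))
                         (k i j (ℕₚ.m⊔n≤o⇒n≤o M N p) (ℕₚ.m⊔n≤o⇒n≤o M N q)) ⟩
        ε ℚ.* ½ ℚ.+ ε ℚ.* ½
          ≡⟨ half ε ⟩
        ε ∎
      where open ℚₚ.≤-Reasoning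

    cauchy-bounded : ∀ {s} → IsCauchy s →
      ∃[ B ] ℚ.Positive B × ∃[ N ] ∀ i → N ℕ.≤ i → ℚ.∣ s i ∣ ℚ.≤ B
    cauchy-bounded {s} cs with cs 1ℚ (ℚₚ.positive⁻¹ 1ℚ)
    ... | N , h = B , B>0 , N , bound
      where
      open ℚₚ.≤-Reasoning
      B : ℚ
      B = ℚ.∣ s N ∣ ℚ.+ 1ℚ
      B>0 : ℚ.Positive B
      B>0 = ℚₚ.nonNeg+pos⇒pos ℚ.∣ s N ∣ {{ℚₚ.∣-∣-nonNeg (s N)}} 1ℚ
      bound : ∀ i → N ℕ.≤ i → ℚ.∣ s i ∣ ℚ.≤ B
      bound i N≤i = begin
        ℚ.∣ s i ∣
          ≡⟨ cong ℚ.∣_∣ (solve 2 (λ a b → a := b :+ (a :- b)) refl (s i) (s N)) ⟩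
        ℚ.∣ s N ℚ.+ (s i ℚ.- s N) ∣
          ≤⟨ ℚₚ.∣p+q∣≤∣p∣+∣q∣ (s N) (s i ℚ.- s N) ⟩
        ℚ.∣ s N ∣ ℚ.+ ℚ.∣ s i ℚ.- s N ∣
          ≤⟨ ℚₚ.+-monoʳ-≤ ℚ.∣ s N ∣ (ℚₚ.<⇒≤ (h i N N≤i ℕₚ.≤-refl)) ⟩
        B ∎

    shrink : ∀ B → .{{ℚ.Positive B}} → ∀ ε → 0ℚ ℚ.< ε →
      ∃[ δ ] 0ℚ ℚ.< δ × B ℚ.* δ ≡ ε
    shrink B ε 0<ε = 1/B ℚ.* ε , 0<δ , Bδ≡ε
      where
      instance
        B≢0 : ℚ.NonZero B
        B≢0 = ℚₚ.pos⇒nonZero B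
      1/B : ℚ
      1/B = ℚ.1/ B
      0<δ : 0ℚ ℚ.< 1/B ℚ.* ε
      0<δ = subst (ℚ._< 1/B ℚ.* ε) (ℚₚ.*-zeroʳ 1/B)
              (ℚₚ.*-monoʳ-<-pos 1/B {{ℚₚ.1/pos⇒pos B}} 0<ε)
      Bδ≡ε : B ℚ.* (1/B ℚ.* ε) ≡ ε
      Bδ≡ε = trans (sym (ℚₚ.*-assoc B 1/B ε))
               (trans (cong (ℚ._* ε) (ℚₚ.*-inverseʳ B)) (ℚₚ.*-identityˡ ε))

    mul-close : ∀ {p q B δ ε} → ℚ.Positive B → ℚ.∣ p ∣ ℚ.≤ B → ℚ.∣ q ∣ ℚ.< δ →
      B ℚ.* δ ≡ ε → ℚ.∣ p ℚ.* q ∣ ℚ.< ε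
    mul-close {p} {q} {B} {δ} {ε} B>0 p≤B q<δ eq = begin-strict
        ℚ.∣ p ℚ.* q ∣         ≡⟨ ℚₚ.∣p*q∣≡∣p∣*∣q∣ p q ⟩
        ℚ.∣ p ∣ ℚ.* ℚ.∣ q ∣   ≤⟨ ℚₚ.*-monoʳ-≤-nonNeg ℚ.∣ q ∣ {{ℚₚ.∣-∣-nonNeg q}} p≤B ⟩
        B ℚ.* ℚ.∣ q ∣         <⟨ ℚₚ.*-monoʳ-<-pos B {{B>0}} q<δ ⟩
        B ℚ.* δ               ≡⟨ eq ⟩
        ε ∎
      where open ℚₚ.≤-Reasoning

    *-close : ∀ {B C δ η ε} → ℚ.Positive B → ℚ.Positive C →
      B ℚ.* δ ≡ ε ℚ.* ½ → C ℚ.* η ≡ ε ℚ.* ½ → ∀ w x y z →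
      ℚ.∣ w ∣ ℚ.≤ B → ℚ.∣ x ℚ.- z ∣ ℚ.< δ → ℚ.∣ z ∣ ℚ.≤ C → ℚ.∣ w ℚ.- y ∣ ℚ.< η →
      ℚ.∣ w ℚ.* x ℚ.- y ℚ.* z ∣ ℚ.< ε
    *-close {ε = ε} B>0 C>0 Bδ Cη w x y z w≤B x-z<δ z≤C w-y<η = begin-strict
        ℚ.∣ w ℚ.* x ℚ.- y ℚ.* z ∣
          ≡⟨ cong ℚ.∣_∣ (solve 4 (λ w x y z → w :* x :- y :* z := w :* (x :- z) :+ z :* (w :- y))
                           refl w x y z) ⟩
        ℚ.∣ w ℚ.* (x ℚ.- z) ℚ.+ z ℚ.* (w ℚ.- y) ∣
          ≤⟨ ℚₚ.∣p+q∣≤∣p∣+∣q∣ (w ℚ.* (x ℚ.- z)) (z ℚ.* (w ℚ.- y)) ⟩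
        ℚ.∣ w ℚ.* (x ℚ.- z) ∣ ℚ.+ ℚ.∣ z ℚ.* (w ℚ.- y) ∣
          <⟨ ℚₚ.+-mono-< (mul-close {w} {x ℚ.- z} B>0 w≤B x-z<δ Bδ)
                         (mul-close {z} {w ℚ.- y} C>0 z≤C w-y<η Cη) ⟩
        ε ℚ.* ½ ℚ.+ ε ℚ.* ½
          ≡⟨ half ε ⟩
        ε ∎
      where open ℚₚ.≤-Reasoning

    *-cauchy : ∀ {s t} → IsCauchy s → IsCauchy t → IsCauchy (λ i → s i ℚ.* t i)
    *-cauchy {s} {t} cs ct ε 0<ε =
      let B , B>0 , N₁ , b = cauchy-bounded cs
          C , C>0 , N₂ , c = cauchy-bounded ct
          δ , 0<δ , Bδ     = shrink B {{B>0}} (ε ℚ.* ½) (half>0 0<ε)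
          η , 0<η , Cη     = shrink C {{C>0}} (ε ℚ.* ½) (half>0 0<ε)
          N₃ , h           = ct δ 0<δ
          N₄ , k           = cs η 0<η
          left  : ∀ {i} → (N₁ ℕ.⊔ N₂) ℕ.⊔ (N₃ ℕ.⊔ N₄) ℕ.≤ i → N₁ ℕ.⊔ N₂ ℕ.≤ i
          left  = ℕₚ.m⊔n≤o⇒m≤o (N₁ ℕ.⊔ N₂) (N₃ ℕ.⊔ N₄)
          right : ∀ {i} → (N₁ ℕ.⊔ N₂) ℕ.⊔ (N₃ ℕ.⊔ N₄) ℕ.≤ i → N₃ ℕ.⊔ N₄ ℕ.≤ i
          right = ℕₚ.m⊔n≤o⇒n≤o (N₁ ℕ.⊔ N₂) (N₃ ℕ.⊔ N₄)
      in (N₁ ℕ.⊔ N₂) ℕ.⊔ (N₃ ℕ.⊔ N₄) , λ i j p q →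
        *-close B>0 C>0 Bδ Cη (s i) (t i) (s j) (t j)
          (b i (ℕₚ.m⊔n≤o⇒m≤o N₁ N₂ (left p)))
          (h i j (ℕₚ.m⊔n≤o⇒m≤o N₃ N₄ (right p)) (ℕₚ.m⊔n≤o⇒m≤o N₃ N₄ (right q)))
          (c j (ℕₚ.m⊔n≤o⇒n≤o N₁ N₂ (left q)))
          (k i j (ℕₚ.m⊔n≤o⇒n≤o N₃ N₄ (right p)) (ℕₚ.m⊔n≤o⇒n≤o N₃ N₄ (right q)))

infixl 6 _+ʳ_ _-ʳ_
infixl 7 _*ʳ_
infix 8 -ʳ_

fromℚ : ℚ → ℝ
fromℚ q = mkℝ (λ _ → q) (const-cauchy q)

0ℝ : ℝ
0ℝ = fromℚ 0ℚ

-ʳ_ : ℝ → ℝ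
-ʳ x = mkℝ (λ i → ℚ.- seq x i) (neg-cauchy {seq x} (cauchy x))

_+ʳ_ _-ʳ_ _*ʳ_ : ℝ → ℝ → ℝ
x +ʳ y = mkℝ (λ i → seq x i ℚ.+ seq y i) (+-cauchy {seq x} {seq y} (cauchy x) (cauchy y))
x -ʳ y = x +ʳ (-ʳ y)
x *ʳ y = mkℝ (λ i → seq x i ℚ.* seq y i) (*-cauchy {seq x} {seq y} (cauchy x) (cauchy y))

record ℂ : Set where
  constructor _+i_
  field
    re im : ℝ

open ℂ public

infix 4 _≈ᶜ_
infixl 6 _+ᶜ_
infixl 7 _*ᶜ_

_≈ᶜ_ : ℂ → ℂ → Set
z ≈ᶜ w = re z ≈ re w × im z ≈ im w

fromℝ : ℝ → ℂ
fromℝ x = x +i 0ℝ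

0ℂ : ℂ
0ℂ = fromℝ 0ℝ

_+ᶜ_ _*ᶜ_ : ℂ → ℂ → ℂ
z +ᶜ w = (re z +ʳ re w) +i (im z +ʳ im w)
z *ᶜ w = (re z *ʳ re w -ʳ im z *ʳ im w) +i (re z *ʳ im w +ʳ im z *ʳ re w)

∣_∣² : ℂ → ℝ
∣ z ∣² = re z *ʳ re z +ʳ im z *ʳ im z

Matrix : ℕ → Set
Matrix n = Fin n → Fin n → ℝ

sumᶜ : ∀ {n} → (Fin n → ℂ) → ℂ
sumᶜ = Vector.foldr _+ᶜ_ 0ℂ

record IsEigenvalue {n} (A : Matrix n) (μ : ℂ) : Set where
  field
    vector  : Fin n → ℂ
    nonzero : ¬ (∀ i → vector i ≈ᶜ 0ℂ)
    eigen   : ∀ i → sumᶜ (λ j → fromℝ (A i j) *ᶜ vector j) ≈ᶜ μ *ᶜ vector i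

-- ρ is the maximum of the moduli of the eigenvalues. Since ρ ≥ 0, comparing
-- squares says exactly ∣ μ ∣ ≈ ρ and ∣ μ ∣ ≤ ρ.
record IsSpectralRadius {n} (A : Matrix n) (ρ : ℝ) : Set where
  field
    nonNegative : 0ℝ ≤ ρ
    attained    : ∃[ μ ] IsEigenvalue A μ × ∣ μ ∣² ≈ ρ *ʳ ρ
    maximal     : ∀ μ → IsEigenvalue A μ → ∣ μ ∣² ≤ ρ *ʳ ρ

record Hypergraph : Set where
  field
    order    : ℕ
    size     : ℕ
    edge     : Fin size → Subset order
    nonempty : ∀ e → Nonempty (edge e)
    distinct : Injective _≡_ _≡_ edge

open Hypergraph public

infix 4 _≅_

record _≅_ (G H : Hypergraph) : Set where
  field
    vertices  : Fin (order G) ↔ Fin (order H)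
    edges     : Fin (size G) ↔ Fin (size H)
    incidence : ∀ v e →
      (v ∈ edge G e) ⇔ (Inverse.to vertices v ∈ edge H (Inverse.to edges e))

Uniform : ℕ → Hypergraph → Set
Uniform m H = ∀ e → ∣ edge H e ∣ ≡ m

Linear : Hypergraph → Set
Linear H = ∀ e f → e ≢ f → ∣ edge H e ∩ edge H f ∣ ℕ.≤ 1

Connected : Hypergraph → Set
Connected H = ∀ u v → Star (λ x y → ∃[ e ] x ∈ edge H e × y ∈ edge H e) u v

private
  m∸1≢0 : ∀ m → .{{NonTrivial m}} → NonZero (m ∸ 1)
  m∸1≢0 (suc (suc _)) = _

adjacency : ∀ m → .{{NonTrivial m}} → (H : Hypergraph) → Matrix (order H)
adjacency m H i j =
  if does (¬? (i ≟ᶠ j) ×-dec any? (λ e → (i ∈? edge H e) ×-dec (j ∈? edge H e)))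
  then fromℚ ((+ 1 ℚ./ (m ∸ 1)) {{m∸1≢0 m}})
  else 0ℝ

next : ∀ {l} → Fin l → Fin l
next {suc l} i = suc (toℕ i) mod suc l

-- A loose cycle is a subhypergraph, so it is given by its set C of edges;
-- the starting point and the direction of the traversal are not part of it.
record IsLooseCycle (H : Hypergraph) (C : Subset (size H)) : Set where
  field
    length      : ℕ
    length≥3    : 3 ℕ.≤ length
    v           : Fin length → Fin (order H)
    e           : Fin length → Fin (size H)
    v-distinct  : Injective _≡_ _≡_ v
    consecutive : ∀ i → edge H (e i) ∩ edge H (e (next i)) ≡ ⁅ v (next i) ⁆
    disjoint    : ∀ i j → i ≢ j → j ≢ next i → i ≢ next j →
                  Empty (edge H (e i) ∩ edge H (e j))
    edges       : ∀ f → (f ∈ C) ⇔ (∃[ i ] e i ≡ f)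

ThreeCyclic : Hypergraph → Set
ThreeCyclic H = ∃[ c ] Injective {A = Fin 3} _≡_ _≡_ c ×
  (∀ C → IsLooseCycle H C ⇔ (∃[ i ] c i ≡ C))

TypeII : ℕ → Hypergraph → Set
TypeII m H = order H ℕ.+ 2 ≡ size H ℕ.* (m ∸ 1)

private
  nonempty-++ : ∀ {n d} {p : Subset n} (q : Subset d) → Nonempty p → Nonempty (p ++ q)
  nonempty-++ {d = d} {p = p} q (x , x∈p) =
    x ↑ˡ d , lookup⇒[]= (x ↑ˡ d) (p ++ q) (trans (lookup-++ˡ p q x) ([]=⇒lookup x∈p))

-- The i-th of k consecutive blocks of d elements.
block : ∀ {k} d → Fin k → Subset (k ℕ.* d)
block d i = concat (tabulate (λ j → if does (i ≟ᶠ j) then ⊤ else ⊥))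

-- The vertices of power m G are those of G followed by one block of m ∸ 2
-- new vertices for each edge.
power : ℕ → Hypergraph → Hypergraph
power m G = record
  { order    = order G ℕ.+ size G ℕ.* (m ∸ 2)
  ; size     = size G
  ; edge     = λ e → edge G e ++ block (m ∸ 2) e
  ; nonempty = λ e → nonempty-++ (block (m ∸ 2) e) (nonempty G e)
  ; distinct = λ {e} {f} eq → distinct G (++-injectiveˡ (edge G e) (edge G f) eq)
  }

-- A finite simple graph is a 2-uniform hypergraph.
IsPower : ℕ → Hypergraph → Set
IsPower m H = ∃[ G ] Uniform 2 G × H ≅ power m G

attach : ∀ m → .{{NonTrivial m}} → (H : Hypergraph) → Fin (order H) → Hypergraph
attach m H v = record
  { order    = order H ℕ.+ (m ∸ 1)
  ; size     = suc (size H)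
  ; edge     = edge′
  ; nonempty = λ where
      zero    → nonempty-++ ⊤ (v , x∈⁅x⁆ v)
      (suc e) → nonempty-++ ⊥ (nonempty H e)
  ; distinct = distinct′
  }
  where
  edge′ : Fin (suc (size H)) → Subset (order H ℕ.+ (m ∸ 1))
  edge′ zero    = ⁅ v ⁆ ++ ⊤
  edge′ (suc e) = edge H e ++ ⊥

  ⊤≢⊥ : ∀ m → .{{NonTrivial m}} → ⊤ {m ∸ 1} ≢ ⊥
  ⊤≢⊥ (suc (suc _)) ()

  distinct′ : Injective _≡_ _≡_ edge′
  distinct′ {zero}  {zero}  _  = refl
  distinct′ {zero}  {suc f} eq = ⊥-elim (⊤≢⊥ m (++-injectiveʳ ⁅ v ⁆ (edge H f) eq))
  distinct′ {suc e} {zero}  eq = ⊥-elim (⊤≢⊥ m (sym (++-injectiveʳ (edge H e) ⁅ v ⁆ eq)))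
  distinct′ {suc e} {suc f} eq =
    cong suc (distinct H (++-injectiveˡ (edge H e) (edge H f) eq))

attachAll : ∀ m → .{{NonTrivial m}} → (H : Hypergraph) →
            ∀ {p} → Vec (Fin (order H)) p → Hypergraph
attachAll m H []       = H
attachAll m H (v ∷ vs) = attachAll m (attach m H v) (Vec.map (_↑ˡ (m ∸ 1)) vs)

-- The vertices v₁, …, v₇ are 0F, …, 6F, and e₁, …, e₉ are 0F, …, 8F.
triangles : Fin 9 → Subset 7
triangles 0F = ⁅ 0F ⁆ ∪ ⁅ 1F ⁆
triangles 1F = ⁅ 1F ⁆ ∪ ⁅ 2F ⁆
triangles 2F = ⁅ 2F ⁆ ∪ ⁅ 0F ⁆
triangles 3F = ⁅ 0F ⁆ ∪ ⁅ 3F ⁆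
triangles 4F = ⁅ 3F ⁆ ∪ ⁅ 4F ⁆
triangles 5F = ⁅ 4F ⁆ ∪ ⁅ 0F ⁆
triangles 6F = ⁅ 0F ⁆ ∪ ⁅ 5F ⁆
triangles 7F = ⁅ 5F ⁆ ∪ ⁅ 6F ⁆
triangles 8F = ⁅ 6F ⁆ ∪ ⁅ 0F ⁆

threeTriangles : Hypergraph
threeTriangles = record
  { order    = 7
  ; size     = 9
  ; edge     = triangles
  ; nonempty = toWitness {a? = all? (λ e → nonempty? (triangles e))} _
  ; distinct = λ {e} {f} → toWitness {a? = all? λ e → all? λ f →
      ≡-dec _≟ᵇ_ (triangles e) (triangles f) →-dec (e ≟ᶠ f)} _ e f
  }

-- In an m-uniform loose cycle of length 3, each edge has two of the cycle's
-- vertices vᵢ and m ∸ 2 vertices of its own, so the part of T₂C without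
-- pendant edges is a power of the graph above.
T₂C : ∀ m → .{{NonTrivial m}} → Vec ℕ 7 → Hypergraph
T₂C m l = attachAll m (power m threeTriangles)
  (Vec.fromList (concatMap (λ i → List.replicate (lookup l i) (i ↑ˡ (9 ℕ.* (m ∸ 2)))) (allFin 7)))

{-# OPTIONS --safe #-}
module Submission where

-- Write m = d + 2 and λ = (f + d) / (m − 1). On the power of a graph G the eigenvalue equation reduces, with
-- κ = d / (f + d + 1), to (f + κ) x u = Σ (x v + κ x u), summed over the neighbours v of u. Let f be a rational slightly
-- below the value belonging to T, found by bisecting the polynomial whose root gives an eigenvalue of T. Gaussian
-- elimination yields either a positive strict supersolution of the reduced equation on G, so that ρ ≤ λ < σ, or a nonzero
-- nonnegative subsolution z. In the latter case let u be a vertex where z is maximal. G is connected with two edges more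
-- than vertices, which bounds the number of walks of length two from u, and comparing with the equation for T leaves at
-- most four edges of G avoiding u. As H has only three loose cycles, G is then the graph of T₂C(c₁ = k − 9), that of T, or
-- one of two further graphs, for which the same comparison, made exactly, is a contradiction.

-- Reals are Cauchy sequences without a decidable order, and a spectral radius is only a bound that
-- some complex eigenvalue attains, so no Perron vector of `H` is at hand. Hence only T receives a
-- real eigenvector, with entries polynomial in a bisected root, while `H` is examined at one
-- rational f, where every sign is decidable. Taking f off the root is harmless because the
-- comparison has room. Put h = f - κ and g = h - 1. In the weight of two-step walks from the centre
-- each of the three triangles of T counts 2(1 + κ)/g, and the rest of T counts more than (1 +
-- κf)/g². This strict bound survives a small decrease of f, and the two further graphs do not reach
-- it. The number 46 enters through (k - 4)(m - 1) = (k - 13)(m - 1) + 9(m - 1) ≥ 55 + 9d. Since f(f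
-- + d) exceeds the left side, f lies above 37/5, a rational just below √55. Four is the number of
-- edges of T that avoid its centre.

-- Rational arithmetic: sign certificates, finite sums, Kronecker deltas.

module OrderedField where
  open import Data.Bool.Base using (Bool; true; false; if_then_else_)
  open import Data.Empty using (⊥-elim)
  open import Data.Fin.Base using (Fin; zero; suc; _↑ˡ_; _↑ʳ_)
  open import Data.Fin.Properties using () renaming (_≟_ to _≟ᶠ_)
  open import Data.Maybe.Base using (Maybe; just; nothing)
  open import Data.Nat.Base as ℕ using (ℕ; zero; suc)
  open import Data.Product.Base using (∃-syntax; _×_; _,_)
  open import Data.Sum.Base using (inj₁; inj₂)
  open import Data.Rational.Base
  open import Data.Rational.Properties
  open import Function.Base using (_∘_)
  open import Relation.Nullary using (yes; no; does)
  open import Relation.Nullary.Decidable using (True; toWitness)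
  open import Relation.Binary.PropositionalEquality
  open import Tactic.RingSolver.Core.AlmostCommutativeRing using (AlmostCommutativeRing; fromCommutativeRing)
  open import Algebra.Bundles using (CommutativeRing)
  import Algebra.Properties.Semiring.Sum (CommutativeRing.semiring +-*-commutativeRing) as Sum
  open Sum public using (sum; sum-permute)

  ℚ-ring : AlmostCommutativeRing _ _
  ℚ-ring = fromCommutativeRing +-*-commutativeRing zero?
    where
    zero? : ∀ x → Maybe (0ℚ ≡ x)
    zero? x with 0ℚ ≟ x
    ... | yes p = just p
    ... | no  _ = nothing

  open import Tactic.RingSolver.NonReflective ℚ-ring public using (solve) renaming (_⊜_ to infix 4 _:=_)
  open import Tactic.RingSolver.Core.Expression public
    using (Expr) renaming (Κ to infix 9 #_; _⊕_ to infixl 6 _:+_; _⊗_ to infixl 7 _:*_; ⊝_ to infix 8 :-_)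

  infixl 6 _:-_

  _:-_ : ∀ {n} → Expr ℚ n → Expr ℚ n → Expr ℚ n
  x :- y = x :+ :- y

  -- Recursion makes `ι (suc d)` unfold to `1ℚ + ι d`, so identities in a symbolic d go straight to
  -- the ring solver, with closed numerals as constants.
  ι : ℕ → ℚ
  ι zero    = 0ℚ
  ι (suc n) = 1ℚ + ι n

  0≤1 : 0ℚ ≤ 1ℚ
  0≤1 = nonNegative⁻¹ 1ℚ

  0<1 : 0ℚ < 1ℚ
  0<1 = positive⁻¹ 1ℚ

  ≤-diff : ∀ {a b} → a ≤ b → 0ℚ ≤ b - a
  ≤-diff {a} {b} a≤b = subst (_≤ b - a) (+-inverseʳ a) (+-monoˡ-≤ (- a) a≤b)

  <-diff : ∀ {a b} → a < b → 0ℚ < b - a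
  <-diff {a} {b} a<b = subst (_< b - a) (+-inverseʳ a) (+-monoˡ-< (- a) a<b)

  private
    cancel = solve 2 (λ a b → (b :- a) :+ a := b) refl

  diff-≤ : ∀ {a b} → 0ℚ ≤ b - a → a ≤ b
  diff-≤ {a} {b} p = subst₂ _≤_ (+-identityˡ a) (cancel a b) (+-monoˡ-≤ a p)

  diff-< : ∀ {a b} → 0ℚ < b - a → a < b
  diff-< {a} {b} p = subst₂ _<_ (+-identityˡ a) (cancel a b) (+-monoˡ-< a p)

  by-evaluation : ∀ {a b} {p : True (a ≤? b)} → a ≤ b
  by-evaluation {p = p} = toWitness p

  -- The standard form of an inequality below: a certificate t assembled from nonnegative pieces
  -- with `⊞` and `⊠`, and a ring identity stating that the difference of the two sides is t.
  cert≤ : ∀ {a b t} → 0ℚ ≤ t → b - a ≡ t → a ≤ b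
  cert≤ p eq = diff-≤ (subst (0ℚ ≤_) (sym eq) p)

  cert< : ∀ {a b t} → 0ℚ < t → b - a ≡ t → a < b
  cert< p eq = diff-< (subst (0ℚ <_) (sym eq) p)

  -- Reduces an identity that holds only under the equation x ≡ y to a plain ring identity, c being
  -- the cofactor of x - y.
  modulo : ∀ {x y u v} c → x ≡ y → u + c * (x - y) ≡ v → u ≡ v
  modulo {x} {u = u} c refl e = trans (eq x u c) e
    where
    eq = solve 3 (λ x u c → u := u :+ c :* (x :- x)) refl

  infixl 6 _⊞_ _⊞⁺_ _⁺⊞_
  infixl 7 _⊠_ _⊠⁺_

  _⊞_ : ∀ {a b} → 0ℚ ≤ a → 0ℚ ≤ b → 0ℚ ≤ a + b
  p ⊞ q = +-mono-≤ p q

  _⊠_ : ∀ {a b} → 0ℚ ≤ a → 0ℚ ≤ b → 0ℚ ≤ a * b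
  _⊠_ {a} {b} p q =
    subst (_≤ a * b) (*-zeroʳ a) (*-monoˡ-≤-nonNeg a {{nonNegative p}} q)

  _⊠⁺_ : ∀ {a b} → 0ℚ < a → 0ℚ < b → 0ℚ < a * b
  _⊠⁺_ {a} {b} p q =
    subst (_< a * b) (*-zeroʳ a) (*-monoʳ-<-pos a {{positive p}} q)

  _⁺⊞_ : ∀ {a b} → 0ℚ < a → 0ℚ ≤ b → 0ℚ < a + b
  p ⁺⊞ q = +-mono-<-≤ p q

  _⊞⁺_ : ∀ {a b} → 0ℚ ≤ a → 0ℚ < b → 0ℚ < a + b
  p ⊞⁺ q = +-mono-≤-< p q

  square≥0 : ∀ a → 0ℚ ≤ a * a
  square≥0 a with ≤-total 0ℚ a
  ... | inj₁ p = p ⊠ p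
  ... | inj₂ p = subst (0ℚ ≤_) (neg² a) (n ⊠ n)
    where
    n : 0ℚ ≤ 0ℚ - a
    n = ≤-diff p
    neg² = solve 1 (λ a → (# 0ℚ :- a) :* (# 0ℚ :- a) := a :* a) refl

  recip : ∀ {x} → 0ℚ < x → ∃[ y ] 0ℚ < y × x * y ≡ 1ℚ
  recip {x} p =
    1/ x , positive⁻¹ (1/ x) {{1/pos⇒pos x}} , *-inverseʳ x
    where
    instance
      x>0 : Positive x
      x>0 = positive p
      x≢0 : NonZero x
      x≢0 = pos⇒nonZero x

  cancel-≤ : ∀ {a b c} → 0ℚ < c → c * a ≤ c * b → a ≤ b
  cancel-≤ {c = c} p = *-cancelˡ-≤-pos c {{positive p}}

  scale-≤ : ∀ {a b c} → 0ℚ ≤ c → a ≤ b → c * a ≤ c * b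
  scale-≤ {c = c} p = *-monoˡ-≤-nonNeg c {{nonNegative p}}

  0≤ι : ∀ n → 0ℚ ≤ ι n
  0≤ι zero    = ≤-refl
  0≤ι (suc n) = 0≤1 ⊞ 0≤ι n

  ι-+ : ∀ a b → ι (a ℕ.+ b) ≡ ι a + ι b
  ι-+ zero    b = sym (+-identityˡ (ι b))
  ι-+ (suc a) b = trans (cong (1ℚ +_) (ι-+ a b)) (sym (+-assoc 1ℚ (ι a) (ι b)))

  ι-* : ∀ a b → ι (a ℕ.* b) ≡ ι a * ι b
  ι-* zero    b = sym (*-zeroˡ (ι b))
  ι-* (suc a) b = trans (ι-+ b (a ℕ.* b)) (trans (cong (ι b +_) (ι-* a b)) (eq (ι a) (ι b)))
    where
    eq = solve 2 (λ x y → y :+ x :* y := (# 1ℚ :+ x) :* y) refl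

  ι-mono : ∀ {a b} → a ℕ.≤ b → ι a ≤ ι b
  ι-mono {b = b} ℕ.z≤n = 0≤ι b
  ι-mono (ℕ.s≤s p) = +-monoʳ-≤ 1ℚ (ι-mono p)

  -- Finite sums

  Σ-cong : ∀ {n} {f g : Fin n → ℚ} → (∀ i → f i ≡ g i) → sum f ≡ sum g
  Σ-cong = Sum.sum-cong-≗

  Σ-+ : ∀ {n} (f g : Fin n → ℚ) → sum (λ i → f i + g i) ≡ sum f + sum g
  Σ-+ = Sum.∑-distrib-+

  Σ-*ˡ : ∀ {n} c (f : Fin n → ℚ) → sum (λ i → c * f i) ≡ c * sum f
  Σ-*ˡ c f = sym (Sum.*-distribˡ-sum c f)

  Σ-*ʳ : ∀ {n} c (f : Fin n → ℚ) → sum (λ i → f i * c) ≡ sum f * c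
  Σ-*ʳ c f = sym (Sum.*-distribʳ-sum c f)

  Σ-swap : ∀ {m n} (f : Fin m → Fin n → ℚ) →
    sum (λ i → sum (λ j → f i j)) ≡ sum (λ j → sum (λ i → f i j))
  Σ-swap = Sum.∑-comm

  Σ-mono : ∀ {n} {f g : Fin n → ℚ} → (∀ i → f i ≤ g i) → sum f ≤ sum g
  Σ-mono {zero}  h = ≤-refl
  Σ-mono {suc n} h = +-mono-≤ (h zero) (Σ-mono (h ∘ suc))

  Σ-0 : ∀ {n} {f : Fin n → ℚ} → (∀ i → f i ≡ 0ℚ) → sum f ≡ 0ℚ
  Σ-0 {n} h = trans (Σ-cong h) (Sum.sum-replicate-zero n)

  Σ-nonneg : ∀ {n} {f : Fin n → ℚ} → (∀ i → 0ℚ ≤ f i) → 0ℚ ≤ sum f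
  Σ-nonneg {zero}  h = ≤-refl
  Σ-nonneg {suc n} h = h zero ⊞ Σ-nonneg (h ∘ suc)

  Σ-1 : ∀ n → sum {n} (λ _ → 1ℚ) ≡ ι n
  Σ-1 zero    = refl
  Σ-1 (suc n) = cong (1ℚ +_) (Σ-1 n)

  Σ-const : ∀ n c → sum {n} (λ _ → c) ≡ ι n * c
  Σ-const n c = trans (Σ-cong {n} (λ _ → sym (*-identityˡ c)))
    (trans (Σ-*ʳ {n} c (λ _ → 1ℚ)) (cong (_* c) (Σ-1 n)))

  term≤Σ : ∀ {n} {f : Fin n → ℚ} → (∀ i → 0ℚ ≤ f i) → ∀ i → f i ≤ sum f
  term≤Σ {f = f} h zero    =
    subst (_≤ sum f) (+-identityʳ (f zero)) (+-monoʳ-≤ (f zero) (Σ-nonneg (h ∘ suc)))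
  term≤Σ {f = f} h (suc i) =
    subst (_≤ sum f) (+-identityˡ (f (suc i))) (+-mono-≤ (h zero) (term≤Σ (h ∘ suc) i))

  Σ-++ : ∀ m {n} (f : Fin (m ℕ.+ n) → ℚ) →
    sum f ≡ sum (λ i → f (i ↑ˡ n)) + sum (λ j → f (m ↑ʳ j))
  Σ-++ zero    f = sym (+-identityˡ (sum f))
  Σ-++ (suc m) f = trans (cong (f zero +_) (Σ-++ m (f ∘ suc)))
    (sym (+-assoc (f zero) _ _))

  𝟙 : Bool → ℚ
  𝟙 b = if b then 1ℚ else 0ℚ

  δ : ∀ {n} → Fin n → Fin n → ℚ
  δ i j = 𝟙 (does (i ≟ᶠ j))

  0≤𝟙 : ∀ b → 0ℚ ≤ 𝟙 b
  0≤𝟙 true  = 0≤1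
  0≤𝟙 false = ≤-refl

  𝟙≤1 : ∀ b → 𝟙 b ≤ 1ℚ
  𝟙≤1 true  = ≤-refl
  𝟙≤1 false = 0≤1

  δ-refl : ∀ {n} (i : Fin n) → δ i i ≡ 1ℚ
  δ-refl i with i ≟ᶠ i
  ... | yes _ = refl
  ... | no ¬p = ⊥-elim (¬p refl)

  δ-≢ : ∀ {n} {i j : Fin n} → i ≢ j → δ i j ≡ 0ℚ
  δ-≢ {i = i} {j} i≢j with i ≟ᶠ j
  ... | yes p = ⊥-elim (i≢j p)
  ... | no  _ = refl

  δ-suc : ∀ {n} (i j : Fin n) → δ (suc i) (suc j) ≡ δ i j
  δ-suc i j with i ≟ᶠ j
  ... | yes _ = refl
  ... | no  _ = refl

  Σ-δ : ∀ {n} (i : Fin n) (f : Fin n → ℚ) → sum (λ j → δ i j * f j) ≡ f i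
  Σ-δ zero    f = trans
    (cong₂ _+_ (*-identityˡ (f zero)) (Σ-0 (λ j → *-zeroˡ (f (suc j)))))
    (+-identityʳ (f zero))
  Σ-δ (suc i) f = trans
    (cong₂ _+_ (*-zeroˡ (f zero)) (trans (Σ-cong (λ j → cong (_* f (suc j)) (δ-suc i j))) (Σ-δ i (f ∘ suc))))
    (+-identityˡ (f (suc i)))

-- Matrices with nonpositive off-diagonal entries, and Schur's test.

module LinearAlgebra where
  open OrderedField
  open import Data.Fin.Base using (Fin; zero; suc)
  open import Data.Fin.Properties using () renaming (suc-injective to fsuc-injective)
  open import Data.Nat.Base using (zero; suc)
  open import Data.Product.Base using (∃-syntax; _×_; _,_; proj₁; proj₂)
  open import Data.Sum.Base using (_⊎_; inj₁; inj₂)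
  open import Data.Rational.Base
  open import Data.Rational.Properties
  open import Function.Base using (_∘_)
  open import Relation.Nullary using (yes; no)
  open import Relation.Binary.PropositionalEquality

  infixl 8 _·_

  _·_ : ∀ {m n} → (Fin m → Fin n → ℚ) → (Fin n → ℚ) → Fin m → ℚ
  (M · x) i = sum (λ j → M i j * x j)

  common-lower-bound : ∀ {n} (g : Fin n → ℚ) → (∀ i → 0ℚ < g i) →
    ∃[ ε ] 0ℚ < ε × ∀ i → ε ≤ g i
  common-lower-bound {zero}  g h = 1ℚ , 0<1 , λ ()
  common-lower-bound {suc n} g h
    with common-lower-bound (g ∘ suc) (h ∘ suc)
  ... | ε , 0<ε , ε≤ with ≤-total ε (g zero)
  ... | inj₁ ε≤g₀ = ε , 0<ε , λ { zero → ε≤g₀ ; (suc i) → ε≤ i }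
  ... | inj₂ g₀≤ε = g zero , h zero , λ { zero → ≤-refl ; (suc i) → ≤-trans g₀≤ε (ε≤ i) }

  -- For matrices with nonpositive off-diagonal entries the first is the usual certificate of a
  -- nonsingular M-matrix. The second is what replaces it when elimination meets a pivot that is not
  -- positive.
  Supersolution Subsolution : ∀ {n} → (Fin n → Fin n → ℚ) → Set
  Supersolution M = ∃[ x ] (∀ i → 0ℚ < x i) × (∀ i → 0ℚ < (M · x) i)
  Subsolution M = ∃[ z ] (∀ i → 0ℚ ≤ z i) × (∃[ i ] 0ℚ < z i) × (∀ i → (M · z) i ≤ 0ℚ)

  -- Gaussian elimination on a matrix with nonpositive off-diagonal entries keeps this sign
  -- pattern, as long as the pivot is positive.
  super-or-sub : ∀ {n} (M : Fin n → Fin n → ℚ) → (∀ i j → i ≢ j → M i j ≤ 0ℚ) →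
    Supersolution M ⊎ Subsolution M
  super-or-sub {zero} M off = inj₁ ((λ ()) , (λ ()) , (λ ()))
  super-or-sub {suc n} M off with M zero zero ≤? 0ℚ
  ... | yes pivot≤0 = inj₂ (e₀ , e₀≥0 , (zero , 0<1) , Me₀≤0)
    where
    e₀ : Fin (suc n) → ℚ
    e₀ zero    = 1ℚ
    e₀ (suc _) = 0ℚ
    e₀≥0 : ∀ i → 0ℚ ≤ e₀ i
    e₀≥0 zero    = 0≤1
    e₀≥0 (suc _) = ≤-refl
    M₀≤0 : ∀ i → M i zero ≤ 0ℚ
    M₀≤0 zero    = pivot≤0
    M₀≤0 (suc i) = off (suc i) zero λ ()
    Me₀≤0 : ∀ i → (M · e₀) i ≤ 0ℚ
    Me₀≤0 i = subst (_≤ 0ℚ) (sym eq) (M₀≤0 i)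
      where
      eq : (M · e₀) i ≡ M i zero
      eq = trans (cong₂ _+_ (*-identityʳ (M i zero)) (Σ-0 {n} (λ j → *-zeroʳ (M i (suc j))))) (+-identityʳ (M i zero))
  ... | no pivot≰0 = lift (super-or-sub M′ off′)
    where
    p : ℚ
    p = M zero zero
    0<p : 0ℚ < p
    0<p = ≰⇒> pivot≰0
    r c : Fin n → ℚ
    r j = M zero (suc j)
    c i = M (suc i) zero
    -- The Schur complement of the pivot, multiplied by p to avoid division.
    M′ : Fin n → Fin n → ℚ
    M′ i j = p * M (suc i) (suc j) - c i * r j
    off′ : ∀ i j → i ≢ j → M′ i j ≤ 0ℚ
    off′ i j i≢j = cert≤
      (<⇒≤ 0<p ⊠ ≤-diff (off (suc i) (suc j) (i≢j ∘ fsuc-injective))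
        ⊞ ≤-diff (off (suc i) zero λ ()) ⊠ ≤-diff (off zero (suc j) λ ()))
      (eq p (M (suc i) (suc j)) (c i) (r j))
      where
      eq = solve 4 (λ p m c r → # 0ℚ :- (p :* m :- c :* r) := p :* (# 0ℚ :- m) :+ (# 0ℚ :- c) :* (# 0ℚ :- r)) refl

    -- Back substitution, also multiplied by p. The parameter ε is the value left in the eliminated
    -- row, up to the factor p: positive for a supersolution, zero for a subsolution.
    back : (Fin n → ℚ) → ℚ → Fin (suc n) → ℚ
    back x ε zero    = ε - sum (λ j → r j * x j)
    back x ε (suc j) = p * x j

    back₀ : ∀ x ε → (M · back x ε) zero ≡ p * ε
    back₀ x ε = trans
      (cong (p * (ε - s) +_)
        (trans (Σ-cong (λ j → swap (r j) p (x j))) (Σ-*ˡ p (λ j → r j * x j))))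
      (eq p ε s)
      where
      s : ℚ
      s = sum (λ j → r j * x j)
      swap = solve 3 (λ a b c → a :* (b :* c) := b :* (a :* c)) refl
      eq = solve 3 (λ p ε s → p :* (ε :- s) :+ p :* s := p :* ε) refl

    back₊ : ∀ x ε i → (M · back x ε) (suc i) ≡ (M′ · x) i + c i * ε
    back₊ x ε i = sym (trans
      (cong (_+ c i * ε) (trans
        (Σ-cong (λ j → split p (M (suc i) (suc j)) (c i) (r j) (x j)))
        (trans (Σ-+ (λ j → M (suc i) (suc j) * (p * x j)) (λ j → (- c i) * (r j * x j)))
          (cong (t +_) (Σ-*ˡ (- c i) (λ j → r j * x j))))))
      (eq t (c i) s ε))
      where
      s t : ℚ
      s = sum (λ j → r j * x j)
      t = sum (λ j → M (suc i) (suc j) * (p * x j))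
      split = solve 5 (λ p m c r x → (p :* m :- c :* r) :* x := m :* (p :* x) :+ (:- c) :* (r :* x)) refl
      eq = solve 4 (λ t c s ε → t :+ (:- c) :* s :+ c :* ε := c :* (ε :- s) :+ t) refl

    rx≤0 : ∀ x → (∀ i → 0ℚ ≤ x i) → 0ℚ ≤ 0ℚ - sum (λ j → r j * x j)
    rx≤0 x x≥0 = ≤-diff (subst (sum (λ j → r j * x j) ≤_) (Σ-0 {n} {λ _ → 0ℚ} (λ _ → refl))
      (Σ-mono λ j → cert≤ (≤-diff (off zero (suc j) λ ()) ⊠ x≥0 j) (eq (r j) (x j))))
      where
      eq = solve 2 (λ r x → # 0ℚ :- r :* x := (# 0ℚ :- r) :* x) refl

    lift : Supersolution M′ ⊎ Subsolution M′ → Supersolution M ⊎ Subsolution M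
    lift (inj₁ (x , x>0 , M′x>0)) = inj₁ (back x ε , back>0 , Mpos)
      where
      -- The other rows become (M′ x) i + c i ε with c i ≤ 0. Taking ε ≤ (M′ x) i / (1 - c i) for
      -- all i keeps each of them at least ε.
      d : ∀ i → ∃[ y ] 0ℚ < y × (1ℚ + (0ℚ - c i)) * y ≡ 1ℚ
      d i = recip (0<1 ⁺⊞ ≤-diff (off (suc i) zero λ ()))
      bound : ∃[ ε ] 0ℚ < ε × ∀ i → ε ≤ (M′ · x) i * proj₁ (d i)
      bound = common-lower-bound _ (λ i → M′x>0 i ⊠⁺ proj₁ (proj₂ (d i)))
      ε : ℚ
      ε = proj₁ bound
      0<ε : 0ℚ < ε
      0<ε = proj₁ (proj₂ bound)
      back>0 : ∀ i → 0ℚ < back x ε i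
      back>0 zero    = subst (0ℚ <_) (eq ε (sum (λ j → r j * x j))) (0<ε ⁺⊞ rx≤0 x (λ i → <⇒≤ (x>0 i)))
        where
        eq = solve 2 (λ a b → a :+ (# 0ℚ :- b) := a :- b) refl
      back>0 (suc j) = 0<p ⊠⁺ x>0 j
      Mpos : ∀ i → 0ℚ < (M · back x ε) i
      Mpos zero    = subst (0ℚ <_) (sym (back₀ x ε)) (0<p ⊠⁺ 0<ε)
      Mpos (suc i) = subst (0ℚ <_) (sym (back₊ x ε i))
        (cert< (0<ε ⁺⊞ ≤-diff le) (eq ((M′ · x) i) (c i) ε))
        where
        y = proj₁ (d i)
        eq = solve 3 (λ m c ε → m :+ c :* ε :- # 0ℚ := ε :+ (m :- (# 1ℚ :+ (# 0ℚ :- c)) :* ε)) refl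
        le : (1ℚ + (0ℚ - c i)) * ε ≤ (M′ · x) i
        le = subst ((1ℚ + (0ℚ - c i)) * ε ≤_)
          (trans (eq₂ (1ℚ + (0ℚ - c i)) ((M′ · x) i) y)
            (trans (cong (_* (M′ · x) i) (proj₂ (proj₂ (d i)))) (*-identityˡ _)))
          (scale-≤ (<⇒≤ (0<1 ⁺⊞ ≤-diff (off (suc i) zero λ ()))) (proj₂ (proj₂ bound) i))
          where
          eq₂ = solve 3 (λ a b y → a :* (b :* y) := a :* y :* b) refl
    lift (inj₂ (z , z≥0 , (i , 0<zi) , M′z≤0)) =
      inj₂ (back z 0ℚ , nonneg , (suc i , 0<p ⊠⁺ 0<zi) , le)
      where
      nonneg : ∀ i → 0ℚ ≤ back z 0ℚ i
      nonneg zero    = rx≤0 z z≥0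
      nonneg (suc j) = <⇒≤ 0<p ⊠ z≥0 j
      le : ∀ i → (M · back z 0ℚ) i ≤ 0ℚ
      le zero    = ≤-reflexive (trans (back₀ z 0ℚ) (*-zeroʳ p))
      le (suc i) = subst (_≤ 0ℚ)
        (sym (trans (back₊ z 0ℚ i) (trans (cong ((M′ · z) i +_) (*-zeroʳ (c i))) (+-identityʳ _))))
        (M′z≤0 i)

  -- In the induction step the new cross terms add up to the first weight times Σ pᵢ (b₀ - bᵢ)²,
  -- which `spread` shows to be nonnegative.
  weighted-cauchy-schwarz : ∀ {n} (p b : Fin n → ℚ) → (∀ i → 0ℚ ≤ p i) →
    sum (λ i → p i * b i) * sum (λ i → p i * b i) ≤ sum p * sum (λ i → p i * (b i * b i))
  weighted-cauchy-schwarz {zero}  p b p≥0 = ≤-refl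
  weighted-cauchy-schwarz {suc n} p b p≥0 = cert≤
    (≤-diff (weighted-cauchy-schwarz (p ∘ suc) (b ∘ suc) (p≥0 ∘ suc)) ⊞ p≥0 zero ⊠ spread (p ∘ suc) (b ∘ suc) (p≥0 ∘ suc))
    (eq (p zero) (b zero) (sum (p ∘ suc)) _ _)
    where
    eq = solve 5 (λ p b P T Q → (p :+ P) :* (p :* (b :* b) :+ Q) :- (p :* b :+ T) :* (p :* b :+ T) :=
      (P :* Q :- T :* T) :+ p :* (P :* (b :* b) :- (# 1ℚ :+ # 1ℚ) :* b :* T :+ Q)) refl
    a : ℚ
    a = b zero
    spread : ∀ {m} (p b : Fin m → ℚ) → (∀ i → 0ℚ ≤ p i) →
      0ℚ ≤ sum p * (a * a) - (1ℚ + 1ℚ) * a * sum (λ i → p i * b i) + sum (λ i → p i * (b i * b i))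
    spread {zero}  p b p≥0 = ≤-reflexive (eq₀ a)
      where
      eq₀ = solve 1 (λ a → # 0ℚ := # 0ℚ :* (a :* a) :- (# 1ℚ :+ # 1ℚ) :* a :* # 0ℚ :+ # 0ℚ) refl
    spread {suc m} p b p≥0 = subst (0ℚ ≤_) (eq₁ a (p zero) (b zero) (sum (p ∘ suc)) _ _)
      (p≥0 zero ⊠ square≥0 (a - b zero) ⊞ spread (p ∘ suc) (b ∘ suc) (p≥0 ∘ suc))
      where
      eq₁ = solve 6 (λ a p b P T Q → p :* ((a :- b) :* (a :- b)) :+ (P :* (a :* a) :- (# 1ℚ :+ # 1ℚ) :* a :* T :+ Q) :=
        (p :+ P) :* (a :* a) :- (# 1ℚ :+ # 1ℚ) :* a :* (p :* b :+ T) :+ (p :* (b :* b) :+ Q)) refl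

  -- Schur's test. Write A i j · a j as A i j x j · (a j / x j), apply Cauchy-Schwarz to each row
  -- with weights A i j x j, and use A x ≤ q x once for the rows and once, by symmetry, for the
  -- columns. A positive vector with A x ≤ q x thus bounds the norm without any spectral theorem.
  norm²-bound : ∀ {n} (A : Fin n → Fin n → ℚ) (x : Fin n → ℚ) (q : ℚ) →
    (∀ i j → A i j ≡ A j i) → (∀ i j → 0ℚ ≤ A i j) → (∀ i → 0ℚ < x i) → 0ℚ ≤ q →
    (∀ i → (A · x) i ≤ q * x i) → ∀ a →
    sum (λ i → (A · a) i * (A · a) i) ≤ q * q * sum (λ i → a i * a i)
  norm²-bound A x q A-sym A≥0 x>0 0≤q Ax≤qx a = begin
    sum (λ i → (A · a) i * (A · a) i)
      ≤⟨ Σ-mono row ⟩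
    sum (λ i → q * x i * sum (λ j → A i j * (a j * a j * y j)))
      ≡⟨ Σ-cong (λ i → trans (sym (Σ-*ˡ (q * x i) (λ j → A i j * (a j * a j * y j)))) (Σ-cong λ j → shuffle q (x i) (A i j) (a j * a j * y j))) ⟩
    sum (λ i → sum (λ j → q * (a j * a j * y j) * (A i j * x i)))
      ≡⟨ Σ-swap (λ i j → q * (a j * a j * y j) * (A i j * x i)) ⟩
    sum (λ j → sum (λ i → q * (a j * a j * y j) * (A i j * x i)))
      ≡⟨ Σ-cong (λ j → trans (Σ-*ˡ (q * (a j * a j * y j)) (λ i → A i j * x i))
           (cong (q * (a j * a j * y j) *_) (Σ-cong (λ i → cong (_* x i) (A-sym i j))))) ⟩
    sum (λ j → q * (a j * a j * y j) * (A · x) j)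
      ≤⟨ Σ-mono (λ j → scale-≤ (0≤q ⊠ (square≥0 (a j) ⊠ <⇒≤ (y>0 j))) (Ax≤qx j)) ⟩
    sum (λ j → q * (a j * a j * y j) * (q * x j))
      ≡⟨ Σ-cong (λ j → trans (shuffle₂ q (a j) (y j) (x j))
           (trans (cong (q * q * (a j * a j) *_) (xy (j))) (*-identityʳ _))) ⟩
    sum (λ j → q * q * (a j * a j))
      ≡⟨ Σ-*ˡ (q * q) (λ j → a j * a j) ⟩
    q * q * sum (λ i → a i * a i) ∎
    where
    open ≤-Reasoning
    y : Fin _ → ℚ
    y j = proj₁ (recip (x>0 j))
    y>0 : ∀ j → 0ℚ < y j
    y>0 j = proj₁ (proj₂ (recip (x>0 j)))
    xy : ∀ j → x j * y j ≡ 1ℚ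
    xy j = proj₂ (proj₂ (recip (x>0 j)))
    shuffle = solve 4 (λ q x A b → q :* x :* (A :* b) := q :* b :* (A :* x)) refl
    shuffle₂ = solve 4 (λ q a y x → q :* (a :* a :* y) :* (q :* x) := q :* q :* (a :* a) :* (x :* y)) refl
    weight : ∀ A a x y → x * y ≡ 1ℚ → A * a ≡ A * x * (a * y)
    weight A a x y e = trans (trans (sym (*-identityʳ _)) (cong (A * a *_) (sym e))) (eq A a x y)
      where
      eq = solve 4 (λ A a x y → A :* a :* (x :* y) := A :* x :* (a :* y)) refl
    weight₂ : ∀ A a x y → x * y ≡ 1ℚ → A * x * (a * y * (a * y)) ≡ A * (a * a * y)
    weight₂ A a x y e = trans (eq A a x y) (trans (cong (A * (a * a * y) *_) e) (*-identityʳ _))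
      where
      eq = solve 4 (λ A a x y → A :* x :* (a :* y :* (a :* y)) := A :* (a :* a :* y) :* (x :* y)) refl
    row : ∀ i → (A · a) i * (A · a) i ≤ q * x i * sum (λ j → A i j * (a j * a j * y j))
    row i = begin
      (A · a) i * (A · a) i
        ≡⟨ cong (λ t → t * t) (Σ-cong (λ j → weight (A i j) (a j) (x j) (y j) (xy j))) ⟩
      sum (λ j → A i j * x j * (a j * y j)) * sum (λ j → A i j * x j * (a j * y j))
        ≤⟨ weighted-cauchy-schwarz (λ j → A i j * x j) (λ j → a j * y j) (λ j → A≥0 i j ⊠ <⇒≤ (x>0 j)) ⟩
      (A · x) i * sum (λ j → A i j * x j * (a j * y j * (a j * y j)))
        ≡⟨ cong ((A · x) i *_) (Σ-cong (λ j → weight₂ (A i j) (a j) (x j) (y j) (xy j))) ⟩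
      (A · x) i * sum (λ j → A i j * (a j * a j * y j))
        ≡⟨ *-comm _ (sum (λ j → A i j * (a j * a j * y j))) ⟩
      sum (λ j → A i j * (a j * a j * y j)) * (A · x) i
        ≤⟨ scale-≤ (Σ-nonneg (λ j → A≥0 i j ⊠ (square≥0 (a j) ⊠ <⇒≤ (y>0 j)))) (Ax≤qx i) ⟩
      sum (λ j → A i j * (a j * a j * y j)) * (q * x i)
        ≡⟨ *-comm (sum (λ j → A i j * (a j * a j * y j))) _ ⟩
      q * x i * sum (λ j → A i j * (a j * a j * y j)) ∎

-- Null sequences, the order of the reals, and bounds for complex eigenvalues.

module Reals where
  open OrderedField
  open LinearAlgebra
  open import Defs using (seq; cauchy; fromℚ; 0ℝ; _+ʳ_; _*ʳ_; ℂ; re; im; fromℝ; _*ᶜ_; ∣_∣²; Matrix; sumᶜ; IsEigenvalue)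
    renaming (_≈_ to _≈ʳ_; _≤_ to _≤ʳ_)
  open import Data.Fin.Base using (Fin; zero; suc)
  open import Data.Nat.Base as ℕ using (ℕ; zero; suc)
  import Data.Nat.Properties as ℕₚ
  open import Data.Product.Base using (∃-syntax; _×_; _,_; proj₁; proj₂)
  open import Data.Sum.Base using (inj₁; inj₂)
  open import Data.Rational.Base
  open import Data.Rational.Properties
  open import Function.Base using (_∘_)
  open import Relation.Nullary using (¬_; yes; no)
  open import Relation.Nullary.Negation using (contradiction)
  open import Relation.Binary.PropositionalEquality

  -- Sequences of rationals

  ¼ : ℚ
  ¼ = ½ * ½

  0<½ : 0ℚ < ½
  0<½ = positive⁻¹ ½

  0<¼ : 0ℚ < ¼
  0<¼ = positive⁻¹ ¼

  p≤∣p∣ : ∀ p → p ≤ ∣ p ∣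
  p≤∣p∣ p with ≤-total 0ℚ p
  ... | inj₁ 0≤p = ≤-reflexive (sym (0≤p⇒∣p∣≡p 0≤p))
  ... | inj₂ p≤0 = ≤-trans p≤0 (0≤∣p∣ p)

  ∣p∣²≡p² : ∀ p → ∣ p ∣ * ∣ p ∣ ≡ p * p
  ∣p∣²≡p² p with ∣p∣≡p∨∣p∣≡-p p
  ... | inj₁ e = cong₂ _*_ e e
  ... | inj₂ e = trans (cong₂ _*_ e e) (eq p)
    where
    eq = solve 1 (λ p → :- p :* :- p := p :* p) refl

  ∣p∣<ε⇐p²<ε² : ∀ {p ε} → 0ℚ < ε → p * p < ε * ε → ∣ p ∣ < ε
  ∣p∣<ε⇐p²<ε² {p} {ε} 0<ε p²<ε² with ∣ p ∣ <? ε
  ... | yes lt = lt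
  ... | no ≮ = contradiction (<-≤-trans p²<ε² (subst (ε * ε ≤_) (∣p∣²≡p² p)
    (cert≤ (≤-diff (≮⇒≥ ≮) ⊠ (0≤∣p∣ p ⊞ <⇒≤ 0<ε)) (eq ∣ p ∣ ε)))) (<-irrefl refl)
    where
    eq = solve 2 (λ a b → a :* a :- b :* b := (a :- b) :* (a :+ b)) refl

  -- `x ≈ʳ y` unfolds to `Null` of the termwise difference, so equalities of reals are proved and
  -- used as statements about null sequences.
  Null : (ℕ → ℚ) → Set
  Null s = ∀ ε → 0ℚ < ε → ∃[ N ] ∀ i → N ℕ.≤ i → ∣ s i ∣ < ε

  null-cong : ∀ {s t} → (∀ i → s i ≡ t i) → Null s → Null t
  null-cong e h ε 0<ε = let N , b = h ε 0<ε in
    N , λ i N≤i → subst (λ x → ∣ x ∣ < ε) (e i) (b i N≤i)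

  null-0 : Null (λ _ → 0ℚ)
  null-0 ε 0<ε = 0 , λ _ _ → 0<ε

  halves = solve 1 (λ ε → ε :* # ½ :+ ε :* # ½ := ε) refl

  null-+ : ∀ {s t} → Null s → Null t → Null (λ i → s i + t i)
  null-+ {s} {t} hs ht ε 0<ε =
    let M , b = hs (ε * ½) (0<ε ⊠⁺ 0<½)
        N , c = ht (ε * ½) (0<ε ⊠⁺ 0<½)
    in M ℕ.⊔ N , λ i p → subst (∣ s i + t i ∣ <_) (halves ε)
      (≤-<-trans (∣p+q∣≤∣p∣+∣q∣ (s i) (t i))
        (+-mono-< (b i (ℕₚ.m⊔n≤o⇒m≤o M N p)) (c i (ℕₚ.m⊔n≤o⇒n≤o M N p))))

  null-sum : ∀ {n} {s : Fin n → ℕ → ℚ} → (∀ j → Null (s j)) → Null (λ i → sum (λ j → s j i))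
  null-sum {zero}  h = null-0
  null-sum {suc n} h = null-+ (h zero) (null-sum (h ∘ suc))

  Bounded : (ℕ → ℚ) → Set
  Bounded s = ∃[ B ] 0ℚ < B × ∃[ N ] ∀ i → N ℕ.≤ i → ∣ s i ∣ ≤ B

  cauchy⇒bounded : ∀ x → Bounded (seq x)
  cauchy⇒bounded x = let N , h = cauchy x 1ℚ 0<1 in
    ∣ s N ∣ + 1ℚ , 0≤∣p∣ (s N) ⊞⁺ 0<1 , N , λ i N≤i → subst (_≤ ∣ s N ∣ + 1ℚ)
      (cong ∣_∣ (eq (s N) (s i)))
      (≤-trans (∣p+q∣≤∣p∣+∣q∣ (s N) (s i - s N)) (+-monoʳ-≤ ∣ s N ∣ (<⇒≤ (h i N N≤i ℕₚ.≤-refl))))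
    where
    s = seq x
    eq = solve 2 (λ a b → a :+ (b :- a) := b) refl

  null-* : ∀ {s t} → Null s → Bounded t → Null (λ i → s i * t i)
  null-* {s} {t} hs (B , 0<B , M , b) ε 0<ε =
    let C , 0<C , BC≡1 = recip 0<B
        N , h = hs (ε * C) (0<ε ⊠⁺ 0<C)
    in M ℕ.⊔ N , λ i p → subst₂ _<_ (sym (∣p*q∣≡∣p∣*∣q∣ (s i) (t i)))
      (trans (eq ε C B) (trans (cong (ε *_) BC≡1) (*-identityʳ ε)))
      (≤-<-trans (scale-≤ (0≤∣p∣ (s i)) (b i (ℕₚ.m⊔n≤o⇒m≤o M N p)))
        (*-monoˡ-<-pos B {{positive 0<B}} (h i (ℕₚ.m⊔n≤o⇒n≤o M N p))))
    where
    eq = solve 3 (λ ε C B → ε :* C :* B := ε :* (B :* C)) refl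

  null-squares : ∀ x y → x ≈ʳ y → Null (λ i → seq x i * seq x i - seq y i * seq y i)
  null-squares x y x≈y = null-cong (λ i → eq (seq x i) (seq y i))
    (null-* x≈y (cauchy⇒bounded (x +ʳ y)))
    where
    eq = solve 2 (λ a b → (a :- b) :* (a :+ b) := a :* a :- b :* b) refl

  ≤ʳ-trans : ∀ {x y z} → x ≤ʳ y → y ≤ʳ z → x ≤ʳ z
  ≤ʳ-trans {x} {y} {z} p q ε 0<ε =
    let M , b = p (ε * ½) (0<ε ⊠⁺ 0<½)
        N , c = q (ε * ½) (0<ε ⊠⁺ 0<½)
    in M ℕ.⊔ N , λ i r → subst (seq x i <_)
      (trans (+-assoc (seq z i) (ε * ½) (ε * ½)) (cong (seq z i +_) (halves ε)))
      (<-trans (b i (ℕₚ.m⊔n≤o⇒m≤o M N r)) (+-monoˡ-< (ε * ½) (c i (ℕₚ.m⊔n≤o⇒n≤o M N r))))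

  ≈⇒≤ : ∀ {x y} → x ≈ʳ y → x ≤ʳ y
  ≈⇒≤ {x} {y} h ε 0<ε = let N , b = h ε 0<ε in N , λ i N≤i →
    subst₂ _<_ (eq (seq x i) (seq y i)) (+-comm ε (seq y i))
      (+-monoˡ-< (seq y i) (≤-<-trans (p≤∣p∣ (seq x i - seq y i)) (b i N≤i)))
    where
    eq = solve 2 (λ a b → (a :- b) :+ b := a) refl

  ≈-sym : ∀ {x y} → x ≈ʳ y → y ≈ʳ x
  ≈-sym {x} {y} h ε 0<ε = let N , b = h ε 0<ε in N , λ i N≤i →
    subst (_< ε) (trans (sym (∣-p∣≡∣p∣ (seq x i - seq y i))) (cong ∣_∣ (eq (seq x i) (seq y i)))) (b i N≤i)
    where
    eq = solve 2 (λ a b → :- (a :- b) := b :- a) refl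

  pointwise-≤ : ∀ {x y} → (∀ i → seq x i ≤ seq y i) → x ≤ʳ y
  pointwise-≤ {x} {y} h ε 0<ε = 0 , λ i _ →
    ≤-<-trans (h i) (subst (_< seq y i + ε) (+-identityʳ (seq y i)) (+-monoʳ-< (seq y i) 0<ε))

  -- Nonnegativity of y holds only up to a tolerance. From b > -ε/4 and a ≥ b + ε it would follow
  -- that a² ≥ b² + 2bε + ε² > b² + ε²/2, whence the tolerances ε/4 and ε²/2.
  square-cancel-≤ : ∀ {x y} → 0ℝ ≤ʳ y → x *ʳ x ≤ʳ y *ʳ y → x ≤ʳ y
  square-cancel-≤ {x} {y} 0≤y x²≤y² ε 0<ε =
    let M , b = 0≤y (ε * ¼) (0<ε ⊠⁺ 0<¼)
        N , c = x²≤y² (ε * ε * ½) ((0<ε ⊠⁺ 0<ε) ⊠⁺ 0<½)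
    in M ℕ.⊔ N , λ i p → step (seq x i) (seq y i) (b i (ℕₚ.m⊔n≤o⇒m≤o M N p)) (c i (ℕₚ.m⊔n≤o⇒n≤o M N p))
    where
    step : ∀ a b → 0ℚ < b + ε * ¼ → a * a < b * b + ε * ε * ½ → a < b + ε
    step a b 0<b+ a²<b² with a <? b + ε
    ... | yes lt = lt
    ... | no ≮ = contradiction (<-≤-trans a²<b²
      (cert≤ (≤-diff le ⊠ (≤-diff le ⊞ (0≤1 ⊞ 0≤1) ⊠ ((<⇒≤ 0<b+) ⊞ <⇒≤ (0<ε ⊠⁺ positive⁻¹ (½ + ¼)))) ⊞ (0≤1 ⊞ 0≤1) ⊠ (<⇒≤ 0<ε ⊠ <⇒≤ 0<b+)) (eq a b ε)))
      (<-irrefl refl)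
      where
      le : b + ε ≤ a
      le = ≮⇒≥ ≮
      eq = solve 3 (λ a b ε → a :* a :- (b :* b :+ ε :* ε :* # ½) :=
        (a :- (b :+ ε)) :* ((a :- (b :+ ε)) :+ (# 1ℚ :+ # 1ℚ) :* ((b :+ ε :* # ¼) :+ ε :* (# ½ :+ # ¼))) :+ (# 1ℚ :+ # 1ℚ) :* (ε :* (b :+ ε :* # ¼))) refl

  -- Spectral bounds

  seq-sumᶜ-re : ∀ {n} (z : Fin n → ℂ) t → seq (re (sumᶜ z)) t ≡ sum (λ j → seq (re (z j)) t)
  seq-sumᶜ-re {zero}  z t = refl
  seq-sumᶜ-re {suc n} z t = cong (seq (re (z zero)) t +_) (seq-sumᶜ-re (z ∘ suc) t)

  seq-sumᶜ-im : ∀ {n} (z : Fin n → ℂ) t → seq (im (sumᶜ z)) t ≡ sum (λ j → seq (im (z j)) t)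
  seq-sumᶜ-im {zero}  z t = refl
  seq-sumᶜ-im {suc n} z t = cong (seq (im (z zero)) t +_) (seq-sumᶜ-im (z ∘ suc) t)

  -- The matrix entries are constant sequences, so at each index t the real and imaginary parts of
  -- the vector are rational vectors to which `norm²-bound` applies. The eigenvalue equation itself
  -- holds at t only up to `defect`, which is null.
  module EigenvalueBound {n} (A : Matrix n) (B : Fin n → Fin n → ℚ) (seq-A : ∀ i j t → seq (A i j) t ≡ B i j)
    {ν : ℂ} (eig : IsEigenvalue A ν) where
    open IsEigenvalue eig

    u v : ℕ → Fin n → ℚ
    u t j = seq (re (vector j)) t
    v t j = seq (im (vector j)) t

    row-re : ∀ i t → seq (re (sumᶜ (λ j → fromℝ (A i j) *ᶜ vector j))) t ≡ (B · u t) i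
    row-re i t = trans (seq-sumᶜ-re (λ j → fromℝ (A i j) *ᶜ vector j) t)
      (Σ-cong λ j → trans (eq (seq (A i j) t) (u t j) (v t j)) (cong (_* u t j) (seq-A i j t)))
      where
      eq = solve 3 (λ a x y → a :* x :+ :- (# 0ℚ :* y) := a :* x) refl

    row-im : ∀ i t → seq (im (sumᶜ (λ j → fromℝ (A i j) *ᶜ vector j))) t ≡ (B · v t) i
    row-im i t = trans (seq-sumᶜ-im (λ j → fromℝ (A i j) *ᶜ vector j) t)
      (Σ-cong λ j → trans (eq (seq (A i j) t) (u t j) (v t j)) (cong (_* v t j) (seq-A i j t)))
      where
      eq = solve 3 (λ a x y → a :* y :+ # 0ℚ :* x := a :* y) refl

    U V N² c : ℕ → ℚ
    U t = sum (λ i → u t i * u t i)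
    V t = sum (λ i → v t i * v t i)
    N² t = U t + V t
    c t = seq ∣ ν ∣² t

    defect : ℕ → Fin n → ℚ
    defect t i =
      (seq (re (ν *ᶜ vector i)) t * seq (re (ν *ᶜ vector i)) t - (B · u t) i * (B · u t) i) +
      (seq (im (ν *ᶜ vector i)) t * seq (im (ν *ᶜ vector i)) t - (B · v t) i * (B · v t) i)

    defect-null : ∀ i → Null (λ t → defect t i)
    defect-null i = null-+
      (null-cong (λ t → cong (λ z → seq (re w) t * seq (re w) t - z * z) (row-re i t))
        (null-squares (re w) (re s) (≈-sym {re s} {re w} (proj₁ (eigen i)))))
      (null-cong (λ t → cong (λ z → seq (im w) t * seq (im w) t - z * z) (row-im i t))
        (null-squares (im w) (im s) (≈-sym {im s} {im w} (proj₂ (eigen i)))))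
      where
      w s : ℂ
      w = ν *ᶜ vector i
      s = sumᶜ (λ j → fromℝ (A i j) *ᶜ vector j)

    energy : ∀ t → c t * N² t ≡ sum (defect t) +
      (sum (λ i → (B · u t) i * (B · u t) i) + sum (λ i → (B · v t) i * (B · v t) i))
    energy t = begin
      c t * N² t
        ≡⟨ cong (c t *_) (sym (Σ-+ (λ i → u t i * u t i) (λ i → v t i * v t i))) ⟩
      c t * sum (λ i → u t i * u t i + v t i * v t i)
        ≡⟨ sym (Σ-*ˡ (c t) (λ i → u t i * u t i + v t i * v t i)) ⟩
      sum (λ i → c t * (u t i * u t i + v t i * v t i))
        ≡⟨ Σ-cong (λ i → eq (seq (re ν) t) (seq (im ν) t) (u t i) (v t i) ((B · u t) i) ((B · v t) i)) ⟩
      sum (λ i → defect t i + ((B · u t) i * (B · u t) i + (B · v t) i * (B · v t) i))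
        ≡⟨ Σ-+ (defect t) (λ i → (B · u t) i * (B · u t) i + (B · v t) i * (B · v t) i) ⟩
      sum (defect t) + sum (λ i → (B · u t) i * (B · u t) i + (B · v t) i * (B · v t) i)
        ≡⟨ cong (sum (defect t) +_) (Σ-+ (λ i → (B · u t) i * (B · u t) i) (λ i → (B · v t) i * (B · v t) i)) ⟩
      _ ∎
      where
      open ≡-Reasoning
      eq = solve 6 (λ p s a b A B → (p :* p :+ s :* s) :* (a :* a :+ b :* b) :=
        (((p :* a :+ :- (s :* b)) :* (p :* a :+ :- (s :* b)) :- A :* A) :+ ((p :* b :+ s :* a) :* (p :* b :+ s :* a) :- B :* B))
          :+ (A :* A :+ B :* B)) refl

    -- `nonzero` provides no entry bounded away from zero, only a refutation of all entries
    -- vanishing, so non-nullness is all that can be extracted.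
    N²-not-null : ¬ Null N²
    N²-not-null h = nonzero λ i → null-cong (λ t → eq (u t i)) (small (λ t → u t i) (u≤ i)) ,
                                 null-cong (λ t → eq (v t i)) (small (λ t → v t i) (v≤ i))
      where
      eq = solve 1 (λ a → a := a :- # 0ℚ) refl
      u≤ : ∀ i t → u t i * u t i ≤ N² t
      u≤ i t = subst (_≤ N² t) (+-identityʳ _)
        (+-mono-≤ (term≤Σ (λ j → square≥0 (u t j)) i) (Σ-nonneg (λ j → square≥0 (v t j))))
      v≤ : ∀ i t → v t i * v t i ≤ N² t
      v≤ i t = subst (_≤ N² t) (+-identityˡ _)
        (+-mono-≤ (Σ-nonneg (λ j → square≥0 (u t j))) (term≤Σ (λ j → square≥0 (v t j)) i))
      small : ∀ a → (∀ t → a t * a t ≤ N² t) → Null a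
      small a a²≤ ε 0<ε = let N , b = h (ε * ε) (0<ε ⊠⁺ 0<ε) in N , λ t N≤t →
        ∣p∣<ε⇐p²<ε² 0<ε (≤-<-trans (a²≤ t) (≤-<-trans (p≤∣p∣ (N² t)) (b t N≤t)))

    -- `norm²-bound` turns `energy` into (|ν|² - q²) N² ≤ Σ `defect` at every index. If |ν|² stayed
    -- above q² by a fixed amount, N² would be null.
    bound : ∀ x q → (∀ i j → B i j ≡ B j i) → (∀ i j → 0ℚ ≤ B i j) →
      (∀ i → 0ℚ < x i) → 0ℚ ≤ q → (∀ i → (B · x) i ≤ q * x i) → ∣ ν ∣² ≤ʳ fromℚ q *ʳ fromℚ q
    bound x q B-sym B≥0 x>0 0≤q Bx≤qx ε 0<ε = go (cauchy ∣ ν ∣² (ε * ¼) (0<ε ⊠⁺ 0<¼))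
      where
      excess : ∀ t → (c t - q * q) * N² t ≤ sum (defect t)
      excess t = cert≤ (≤-diff (norm²-bound B x q B-sym B≥0 x>0 0≤q Bx≤qx (u t))
                         ⊞ ≤-diff (norm²-bound B x q B-sym B≥0 x>0 0≤q Bx≤qx (v t)))
        (trans (eq (c t) q (U t) (V t) (sum (defect t)))
          (trans (cong (λ z → sum (defect t) - z + q * q * N² t) (energy t))
            (eq₂ (sum (defect t)) _ _ q (U t) (V t))))
        where
        eq = solve 5 (λ c q a b s → s :- (c :- q :* q) :* (a :+ b) := s :- c :* (a :+ b) :+ q :* q :* (a :+ b)) refl
        eq₂ = solve 6 (λ s a b q x y → s :- (s :+ (a :+ b)) :+ q :* q :* (x :+ y) := q :* q :* x :- a :+ (q :* q :* y :- b)) refl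
      N²≥0 : ∀ t → 0ℚ ≤ N² t
      N²≥0 t = _⊞_ {U t} {V t}
        (Σ-nonneg (λ j → square≥0 (u t j))) (Σ-nonneg (λ j → square≥0 (v t j)))
      go : (∃[ N ] ∀ i j → N ℕ.≤ i → N ℕ.≤ j → ∣ c i - c j ∣ < ε * ¼) →
        ∃[ N ] ∀ i → N ℕ.≤ i → c i < q * q + ε
      -- One comparison of rationals decides: beyond N the sequence c moves by less than ε/4, so it
      -- remains either below q² + ε or above q² + ε/4.
      go (N , h) with c N <? q * q + ε * ½
      ... | yes lt = N , λ i N≤i → <-trans
        (cert< (<-diff (≤-<-trans (p≤∣p∣ (c i - c N)) (h i N N≤i ℕₚ.≤-refl))) (eq (c i) (c N) ε))
        (cert< (<-diff lt ⁺⊞ <⇒≤ (0<ε ⊠⁺ 0<¼)) (eq₂ (c N) (q * q) ε))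
        where
        eq = solve 3 (λ a b ε → b :+ ε :* # ¼ :- a := ε :* # ¼ :- (a :- b)) refl
        eq₂ = solve 3 (λ b q ε → q :+ ε :- (b :+ ε :* # ¼) := q :+ ε :* # ½ :- b :+ ε :* # ¼) refl
      ... | no ≮ = contradiction N²-null N²-not-null
        where
        gap : ∀ t → N ℕ.≤ t → q * q + ε * ¼ ≤ c t
        gap t N≤t = cert≤ (≤-diff (≮⇒≥ ≮) ⊞ <⇒≤ (<-diff (≤-<-trans (p≤∣p∣ (c N - c t)) (h N t ℕₚ.≤-refl N≤t))))
          (eq (c N) (c t) (q * q) ε)
          where
          eq = solve 4 (λ a b q ε → b :- (q :+ ε :* # ¼) := a :- (q :+ ε :* # ½) :+ (ε :* # ¼ :- (a :- b))) refl
        N²-null : Null N²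
        N²-null η 0<η =
          let M , b = null-sum {n} {λ i t → defect t i} defect-null (ε * ¼ * η) ((0<ε ⊠⁺ 0<¼) ⊠⁺ 0<η)
          in M ℕ.⊔ N , λ t p → subst (_< η) (sym (0≤p⇒∣p∣≡p (N²≥0 t)))
            (*-cancelˡ-<-nonNeg (ε * ¼) {{nonNegative (<⇒≤ (0<ε ⊠⁺ 0<¼))}}
              (≤-<-trans (≤-trans
                (cert≤ (N²≥0 t ⊠ ≤-diff (gap t (ℕₚ.m⊔n≤o⇒n≤o M N p))) (eq (c t) (q * q) ε (N² t)))
                (excess t))
              (≤-<-trans (p≤∣p∣ (sum (defect t))) (b t (ℕₚ.m⊔n≤o⇒m≤o M N p)))))
          where
          eq = solve 4 (λ c q ε n → (c :- q) :* n :- ε :* # ¼ :* n := n :* (c :- (q :+ ε :* # ¼))) refl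

-- Polynomials over the rationals, and roots by bisection.

module PolynomialRoots where
  open OrderedField
  open Reals
  open import Defs using (ℝ; mkℝ; seq; fromℚ; -ʳ_; _+ʳ_; _-ʳ_; _*ʳ_)
  open import Data.Nat.Base as ℕ using (ℕ; zero; suc)
  import Data.Nat.Properties as ℕₚ
  import Data.Integer.Base as ℤ
  import Data.Integer.Properties as ℤₚ
  import Data.Rational.Unnormalised.Base as ℚᵘ
  import Data.Rational.Unnormalised.Properties as ℚᵘₚ
  open import Data.Product.Base using (Σ; ∃-syntax; _×_; _,_; proj₁; proj₂)
  open import Data.Sum.Base using (inj₁; inj₂)
  open import Data.Rational.Base
  open import Data.Rational.Properties
  open import Relation.Nullary using (¬_; Dec; yes; no)
  open import Relation.Nullary.Negation using (contradiction)
  open import Relation.Binary.PropositionalEquality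

  toℚᵘ-ι : ∀ n → toℚᵘ (ι n) ℚᵘ.≃ ℚᵘ.mkℚᵘ (ℤ.+ n) 0
  toℚᵘ-ι zero    = ℚᵘₚ.≃-refl
  toℚᵘ-ι (suc n) = ℚᵘₚ.≃-trans (toℚᵘ-homo-+ 1ℚ (ι n))
    (ℚᵘₚ.≃-trans (ℚᵘₚ.+-congʳ (toℚᵘ 1ℚ) (toℚᵘ-ι n))
      (ℚᵘ.*≡* (cong (ℤ._* ℤ.+ 1) (cong (ℤ._+_ (ℤ.+ 1)) (ℤₚ.*-identityʳ (ℤ.+ n))))))

  archimedean : ∀ x → ∃[ n ] x ≤ ι n
  archimedean x@(mkℚ a b c) = ℤ.∣ a ∣ , toℚᵘ-cancel-≤ (ℚᵘₚ.≤-respʳ-≃ (ℚᵘₚ.≃-sym (toℚᵘ-ι ℤ.∣ a ∣)) (ℚᵘ.*≤* le))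
    where
    le : a ℤ.* ℤ.+ 1 ℤ.≤ ℤ.+ ℤ.∣ a ∣ ℤ.* ℤ.+ suc b
    le = ℤₚ.≤-trans (ℤₚ.≤-reflexive (ℤₚ.*-identityʳ a))
      (ℤₚ.≤-trans (i≤∣i∣ a) (ℤₚ.≤-trans (ℤ.+≤+ (ℕₚ.m≤m*n ℤ.∣ a ∣ (suc b))) (ℤₚ.≤-reflexive (ℤₚ.pos-* ℤ.∣ a ∣ (suc b)))))
      where
      i≤∣i∣ : ∀ i → i ℤ.≤ ℤ.+ ℤ.∣ i ∣
      i≤∣i∣ (ℤ.+ n)     = ℤₚ.≤-refl
      i≤∣i∣ (ℤ.-[1+ n ]) = ℤ.-≤+

  1/suc : ∀ d → ι (suc d) * (ℤ.+ 1 / suc d) ≡ 1ℚ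
  1/suc d = toℚᵘ-injective (ℚᵘₚ.≃-trans (toℚᵘ-homo-* (ι (suc d)) (ℤ.+ 1 / suc d))
    (ℚᵘₚ.≃-trans (ℚᵘₚ.*-cong (toℚᵘ-ι (suc d)) (toℚᵘ-fromℚᵘ (ℚᵘ.mkℚᵘ (ℤ.+ 1) d)))
      (ℚᵘ.*≡* (trans (ℤₚ.*-identityʳ (ℤ.+ suc d ℤ.* ℤ.+ 1)) (trans (ℤₚ.*-identityʳ (ℤ.+ suc d))
        (sym (trans (ℤₚ.*-identityˡ (ℤ.+ 1 ℤ.* ℤ.+ suc d)) (ℤₚ.*-identityˡ (ℤ.+ suc d)))))))))

  ½^ : ℕ → ℚ
  ½^ zero    = 1ℚ
  ½^ (suc n) = ½^ n * ½

  0<½^ : ∀ n → 0ℚ < ½^ n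
  0<½^ zero    = 0<1
  0<½^ (suc n) = 0<½^ n ⊠⁺ 0<½

  ½^-bound : ∀ n → ι n * ½^ n ≤ 1ℚ
  ½^-bound zero    = 0≤1
  ½^-bound (suc n) = cert≤
    ((≤-diff (½^-bound n) ⊞ ≤-diff (½^≤1 n)) ⊠ <⇒≤ 0<½) (eq (ι n) (½^ n))
    where
    ½^≤1 : ∀ n → ½^ n ≤ 1ℚ
    ½^≤1 zero    = ≤-refl
    ½^≤1 (suc n) = cert≤ ((≤-diff (½^≤1 n) ⊞ 0≤1) ⊠ <⇒≤ 0<½) (eq (½^ n))
      where
      eq = solve 1 (λ h → # 1ℚ :- h :* # ½ := (# 1ℚ :- h :+ # 1ℚ) :* # ½) refl
    eq = solve 2 (λ n h → # 1ℚ :- (# 1ℚ :+ n) :* (h :* # ½) := (# 1ℚ :- n :* h :+ (# 1ℚ :- h)) :* # ½) refl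

  ½^-small : ∀ W ε → 0ℚ ≤ W → 0ℚ < ε → ∃[ n ] W * ½^ n < ε
  ½^-small W ε 0≤W 0<ε =
    let 1/ε , 0<1/ε , ε/ε = recip 0<ε
        n , W/ε≤n = archimedean ((W + 1ℚ) * 1/ε)
    in n , *-cancelˡ-<-nonNeg 1/ε {{nonNegative (<⇒≤ 0<1/ε)}}
      (cert< (≤-diff (½^-bound n) ⊞ <⇒≤ (0<½^ n) ⊠ ≤-diff W/ε≤n ⊞⁺ 0<½^ n ⊠⁺ 0<1/ε)
        (trans (cong (_- 1/ε * (W * ½^ n)) (trans (*-comm 1/ε ε) ε/ε)) (eq W 1/ε (ι n) (½^ n))))
    where
    eq = solve 4 (λ W e n h → # 1ℚ :- e :* (W :* h) := # 1ℚ :- n :* h :+ h :* (n :- (W :+ # 1ℚ) :* e) :+ h :* e) refl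

  infixl 6 _⊕_ _⊖_
  infixl 7 _⊗_

  -- Syntax, so that one expression can be evaluated at rationals and termwise at reals, and so that
  -- bounds and Lipschitz constants on bounded sets come from structural recursion.
  data Poly : Set where
    con         : ℚ → Poly
    var         : Poly
    _⊕_ _⊖_ _⊗_ : Poly → Poly → Poly

  eval : Poly → ℚ → ℚ
  eval (con c) x = c
  eval var     x = x
  eval (P ⊕ Q) x = eval P x + eval Q x
  eval (P ⊖ Q) x = eval P x - eval Q x
  eval (P ⊗ Q) x = eval P x * eval Q x

  evalʳ : Poly → ℝ → ℝ
  evalʳ (con c) x = fromℚ c
  evalʳ var     x = x
  evalʳ (P ⊕ Q) x = evalʳ P x +ʳ evalʳ Q x
  evalʳ (P ⊖ Q) x = evalʳ P x -ʳ evalʳ Q x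
  evalʳ (P ⊗ Q) x = evalʳ P x *ʳ evalʳ Q x

  seq-eval : ∀ P x t → seq (evalʳ P x) t ≡ eval P (seq x t)
  seq-eval (con c) x t = refl
  seq-eval var     x t = refl
  seq-eval (P ⊕ Q) x t = cong₂ _+_ (seq-eval P x t) (seq-eval Q x t)
  seq-eval (P ⊖ Q) x t = cong₂ _-_ (seq-eval P x t) (seq-eval Q x t)
  seq-eval (P ⊗ Q) x t = cong₂ _*_ (seq-eval P x t) (seq-eval Q x t)

  poly-bound : ∀ P B → 0ℚ ≤ B → ∃[ C ] 0ℚ ≤ C × ∀ x → ∣ x ∣ ≤ B → ∣ eval P x ∣ ≤ C
  poly-bound (con c) B 0≤B = ∣ c ∣ , 0≤∣p∣ c , λ _ _ → ≤-refl
  poly-bound var     B 0≤B = B , 0≤B , λ _ h → h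
  poly-bound (P ⊕ Q) B 0≤B =
    let C , 0≤C , c = poly-bound P B 0≤B
        D , 0≤D , d = poly-bound Q B 0≤B
    in C + D , 0≤C ⊞ 0≤D , λ x h →
      ≤-trans (∣p+q∣≤∣p∣+∣q∣ (eval P x) (eval Q x)) (+-mono-≤ (c x h) (d x h))
  poly-bound (P ⊖ Q) B 0≤B =
    let C , 0≤C , c = poly-bound P B 0≤B
        D , 0≤D , d = poly-bound Q B 0≤B
    in C + D , 0≤C ⊞ 0≤D , λ x h →
      ≤-trans (∣p-q∣≤∣p∣+∣q∣ (eval P x) (eval Q x)) (+-mono-≤ (c x h) (d x h))
  poly-bound (P ⊗ Q) B 0≤B =
    let C , 0≤C , c = poly-bound P B 0≤B
        D , 0≤D , d = poly-bound Q B 0≤B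
    in C * D , 0≤C ⊠ 0≤D , λ x h → subst (_≤ C * D) (sym (∣p*q∣≡∣p∣*∣q∣ (eval P x) (eval Q x)))
      (cert≤ (≤-diff (c x h) ⊠ 0≤D ⊞ 0≤∣p∣ (eval P x) ⊠ ≤-diff (d x h)) (eq C D (∣ eval P x ∣) (∣ eval Q x ∣)))
    where
    eq = solve 4 (λ C D a b → C :* D :- a :* b := (C :- a) :* D :+ a :* (D :- b)) refl

  poly-lipschitz : ∀ P B → 0ℚ ≤ B →
    ∃[ L ] 0ℚ ≤ L × ∀ x y → ∣ x ∣ ≤ B → ∣ y ∣ ≤ B → ∣ eval P x - eval P y ∣ ≤ L * ∣ x - y ∣
  poly-lipschitz (con c) B 0≤B = 0ℚ , ≤-refl , λ x y _ _ →
    ≤-reflexive (trans (cong ∣_∣ (+-inverseʳ c)) (sym (*-zeroˡ ∣ x - y ∣)))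
  poly-lipschitz var     B 0≤B = 1ℚ , 0≤1 , λ x y _ _ → ≤-reflexive (sym (*-identityˡ ∣ x - y ∣))
  poly-lipschitz (P ⊕ Q) B 0≤B =
    let C , 0≤C , c = poly-lipschitz P B 0≤B
        D , 0≤D , d = poly-lipschitz Q B 0≤B
    in C + D , 0≤C ⊞ 0≤D , λ x y hx hy →
      subst₂ _≤_ (cong ∣_∣ (eq (eval P x) (eval Q x) (eval P y) (eval Q y))) (sym (*-distribʳ-+ ∣ x - y ∣ C D))
        (≤-trans (∣p+q∣≤∣p∣+∣q∣ (eval P x - eval P y) (eval Q x - eval Q y)) (+-mono-≤ (c x y hx hy) (d x y hx hy)))
    where
    eq = solve 4 (λ a b c d → (a :- c) :+ (b :- d) := (a :+ b) :- (c :+ d)) refl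
  poly-lipschitz (P ⊖ Q) B 0≤B =
    let C , 0≤C , c = poly-lipschitz P B 0≤B
        D , 0≤D , d = poly-lipschitz Q B 0≤B
    in C + D , 0≤C ⊞ 0≤D , λ x y hx hy →
      subst₂ _≤_ (cong ∣_∣ (eq (eval P x) (eval Q x) (eval P y) (eval Q y))) (sym (*-distribʳ-+ ∣ x - y ∣ C D))
        (≤-trans (∣p-q∣≤∣p∣+∣q∣ (eval P x - eval P y) (eval Q x - eval Q y)) (+-mono-≤ (c x y hx hy) (d x y hx hy)))
    where
    eq = solve 4 (λ a b c d → (a :- c) :- (b :- d) := (a :- b) :- (c :- d)) refl
  poly-lipschitz (P ⊗ Q) B 0≤B =
    let C , 0≤C , c = poly-lipschitz P B 0≤B
        D , 0≤D , d = poly-lipschitz Q B 0≤B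
        E , 0≤E , e = poly-bound P B 0≤B
        F , 0≤F , f = poly-bound Q B 0≤B
    in C * F + E * D , 0≤C ⊠ 0≤F ⊞ 0≤E ⊠ 0≤D , λ x y hx hy →
      let a = eval P x
          b = eval Q x
          a′ = eval P y
          b′ = eval Q y
          h = ∣ x - y ∣
      in subst (_≤ (C * F + E * D) * h) (cong ∣_∣ (eq a b a′ b′))
        (≤-trans (∣p+q∣≤∣p∣+∣q∣ ((a - a′) * b) (a′ * (b - b′)))
          (subst₂ (λ s t → s + t ≤ (C * F + E * D) * h)
            (sym (∣p*q∣≡∣p∣*∣q∣ (a - a′) b)) (sym (∣p*q∣≡∣p∣*∣q∣ a′ (b - b′)))
            (cert≤ (≤-diff (c x y hx hy) ⊠ 0≤F ⊞ 0≤∣p∣ (a - a′) ⊠ ≤-diff (f x hx) ⊞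
                    (≤-diff (d x y hx hy) ⊠ 0≤E ⊞ 0≤∣p∣ (b - b′) ⊠ ≤-diff (e y hy)))
              (eq₂ C F E D h (∣ a - a′ ∣) (∣ b ∣) (∣ a′ ∣) (∣ b - b′ ∣)))))
    where
    eq = solve 4 (λ a b c d → (a :- c) :* b :+ c :* (b :- d) := a :* b :- c :* d) refl
    eq₂ = solve 9 (λ C F E D h u v w z → (C :* F :+ E :* D) :* h :- (u :* v :+ w :* z) :=
      (C :* h :- u) :* F :+ u :* (F :- v) :+ ((D :* h :- z) :* E :+ z :* (E :- w))) refl

  module Bisection (P : Poly) where

    -- The sign at the lower end is strict: every lower end then stays strictly off the root, which
    -- `root-apart` needs.
    record Bracket : Set where
      constructor bracket
      field
        lo hi : ℚ
        lo≤hi : lo ≤ hi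
        below : eval P lo < 0ℚ
        above : 0ℚ ≤ eval P hi

    open Bracket

    width : Bracket → ℚ
    width b = hi b - lo b

    private
      left = solve 2 (λ a b → (a :+ b) :* # ½ :- a := (b :- a) :* # ½) refl
      right = solve 2 (λ a b → b :- (a :+ b) :* # ½ := (b :- a) :* # ½) refl

    bisect : (b : Bracket) →
      Σ Bracket λ b′ → lo b ≤ lo b′ × hi b′ ≤ hi b × width b′ ≡ width b * ½
    bisect b = go (eval P mid <? 0ℚ)
      where
      mid : ℚ
      mid = (lo b + hi b) * ½
      0≤ : 0ℚ ≤ (hi b - lo b) * ½
      0≤ = ≤-diff (lo≤hi b) ⊠ <⇒≤ 0<½
      lo≤mid : lo b ≤ mid
      lo≤mid = cert≤ 0≤ (left (lo b) (hi b))
      mid≤hi : mid ≤ hi b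
      mid≤hi = cert≤ 0≤ (right (lo b) (hi b))
      go : Dec (eval P mid < 0ℚ) →
        Σ Bracket λ b′ → lo b ≤ lo b′ × hi b′ ≤ hi b × width b′ ≡ width b * ½
      go (yes p) = bracket mid (hi b) mid≤hi p (above b) , lo≤mid , ≤-refl , right (lo b) (hi b)
      go (no ≮)  = bracket (lo b) mid lo≤mid (below b) (≮⇒≥ ≮) , ≤-refl , mid≤hi , left (lo b) (hi b)

    iter : Bracket → ℕ → Bracket
    iter b zero    = b
    iter b (suc n) = proj₁ (bisect (iter b n))

    iter-width : ∀ b n → width (iter b n) ≡ width b * ½^ n
    iter-width b zero    = sym (*-identityʳ (width b))
    iter-width b (suc n) = trans (proj₂ (proj₂ (proj₂ (bisect (iter b n)))))
      (trans (cong (_* ½) (iter-width b n)) (*-assoc (width b) (½^ n) ½))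

    iter-lo : ∀ b {m n} → m ℕ.≤′ n → lo (iter b m) ≤ lo (iter b n)
    iter-lo b (ℕ.≤′-reflexive refl) = ≤-refl
    iter-lo b (ℕ.≤′-step {n} p) = ≤-trans (iter-lo b p) (proj₁ (proj₂ (bisect (iter b n))))

    iter-hi : ∀ b {m n} → m ℕ.≤′ n → hi (iter b n) ≤ hi (iter b m)
    iter-hi b (ℕ.≤′-reflexive refl) = ≤-refl
    iter-hi b (ℕ.≤′-step {n} p) = ≤-trans (proj₁ (proj₂ (proj₂ (bisect (iter b n))))) (iter-hi b p)

    width≥0 : ∀ b → 0ℚ ≤ width b
    width≥0 b = ≤-diff (lo≤hi b)

    ∣∣≤ : ∀ {x w} → x ≤ w → - x ≤ w → ∣ x ∣ ≤ w
    ∣∣≤ {x} p q with ∣p∣≡p∨∣p∣≡-p x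
    ... | inj₁ e = subst (_≤ _) (sym e) p
    ... | inj₂ e = subst (_≤ _) (sym e) q

    -- The sequence of lower ends is increasing, so each of its terms, and not only the limit, is at
    -- least `lo b`. Estimates valid for all rationals above `lo b` therefore hold termwise.
    root : Bracket → ℝ
    root b = mkℝ (λ n → lo (iter b n)) λ ε 0<ε →
      let N , h = ½^-small (width b) ε (width≥0 b) 0<ε in
      N , λ i j p q → ≤-<-trans (∣∣≤ (close i j (ℕₚ.≤⇒≤′ p) (ℕₚ.≤⇒≤′ q)) (subst (_≤ width (iter b N)) (swap (lo (iter b i)) (lo (iter b j))) (close j i (ℕₚ.≤⇒≤′ q) (ℕₚ.≤⇒≤′ p))))
        (subst (_< ε) (sym (iter-width b N)) h)
      where
      swap = solve 2 (λ a b → b :- a := :- (a :- b)) refl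
      close : ∀ {N} i j → N ℕ.≤′ i → N ℕ.≤′ j → lo (iter b i) - lo (iter b j) ≤ width (iter b N)
      close {N} i j p q = cert≤
        (≤-diff (iter-hi b p) ⊞ ≤-diff (lo≤hi (iter b i)) ⊞ ≤-diff (iter-lo b q))
        (eq (lo (iter b i)) (hi (iter b i)) (lo (iter b j)) (lo (iter b N)) (hi (iter b N)))
        where
        eq = solve 5 (λ a b c l h → h :- l :- (a :- c) := h :- b :+ (b :- a) :+ (c :- l)) refl

    lo≤root : ∀ b n → lo b ≤ seq (root b) n
    lo≤root b n = iter-lo b {0} {n} (ℕₚ.≤⇒≤′ ℕ.z≤n)

    root≤hi : ∀ b n → seq (root b) n ≤ hi b
    root≤hi b n = ≤-trans (lo≤hi (iter b n)) (iter-hi b {0} {n} (ℕₚ.≤⇒≤′ ℕ.z≤n))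

    -- As P is nonnegative at the upper end, -P at the lower end is at most the variation of P over
    -- the bracket, hence at most a Lipschitz constant times the width.
    value-small : ∀ b → 0ℚ ≤ lo b → ∀ ε → 0ℚ < ε →
      ∃[ N ] ∀ n → N ℕ.≤ n → - eval P (lo (iter b n)) < ε
    value-small b 0≤lo ε 0<ε =
      let B = hi b
          L , 0≤L , lip = poly-lipschitz P B (≤-trans 0≤lo (lo≤hi b))
          N , h = ½^-small (L * width b) ε (0≤L ⊠ width≥0 b) 0<ε
      in N , λ n N≤n →
        let c = iter b n
            p = ℕₚ.≤⇒≤′ (ℕ.z≤n {n})
            0≤lo-c = ≤-trans 0≤lo (iter-lo b p)
            hi-c≤ = iter-hi b p
            0≤hi-c = ≤-trans 0≤lo-c (lo≤hi c)
            l = lip (hi c) (lo c)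
                  (subst (_≤ B) (sym (0≤p⇒∣p∣≡p 0≤hi-c)) hi-c≤)
                  (subst (_≤ B) (sym (0≤p⇒∣p∣≡p 0≤lo-c)) (≤-trans (lo≤hi c) hi-c≤))
            wn : width c ≤ width b * ½^ N
            wn = subst (width c ≤_) (iter-width b N)
              (cert≤ (≤-diff (iter-hi b (ℕₚ.≤⇒≤′ N≤n)) ⊞ ≤-diff (iter-lo b (ℕₚ.≤⇒≤′ N≤n)))
                (eq₂ (hi (iter b N)) (lo (iter b N)) (hi c) (lo c)))
        in ≤-<-trans
          (≤-trans (cert≤ (above c ⊞ ≤-diff (p≤∣p∣ (eval P (hi c) - eval P (lo c)))) (eq (eval P (hi c)) (eval P (lo c)) (∣ eval P (hi c) - eval P (lo c) ∣)))
            (≤-trans l (subst (_≤ L * (width b * ½^ N)) (cong (L *_) (sym (0≤p⇒∣p∣≡p (width≥0 c)))) (scale-≤ 0≤L wn))))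
          (subst (_< ε) (*-assoc L (width b) (½^ N)) h)
      where
      eq = solve 3 (λ h l a → a :- :- l := h :+ (a :- (h :- l))) refl
      eq₂ = solve 4 (λ H L h l → H :- L :- (h :- l) := H :- h :+ (l :- L)) refl

    null-at-root : ∀ b → 0ℚ ≤ lo b → Null (λ n → eval P (seq (root b) n))
    null-at-root b 0≤lo ε 0<ε = let N , h = value-small b 0≤lo ε 0<ε in
      N , λ n N≤n → subst (_< ε)
        (trans (sym (0≤p⇒∣p∣≡p (subst (0ℚ ≤_) (+-identityˡ (- eval P (lo (iter b n)))) (≤-diff (<⇒≤ (below (iter b n)))))))
          (∣-p∣≡∣p∣ (eval P (lo (iter b n))))) (h n N≤n)

    near-root : ∀ b → 0ℚ ≤ lo b → ∀ ε → 0ℚ < ε →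
      Σ Bracket λ b′ → lo b ≤ lo b′ × hi b′ ≤ hi b × - eval P (lo b′) < ε
    near-root b 0≤lo ε 0<ε = let N , h = value-small b 0≤lo ε 0<ε in
      iter b N , iter-lo b {0} {N} (ℕₚ.≤⇒≤′ ℕ.z≤n) , iter-hi b {0} {N} (ℕₚ.≤⇒≤′ ℕ.z≤n) , h N ℕₚ.≤-refl

    -- P at `lo b` is a fixed negative number while P along the root tends to zero, so by the
    -- Lipschitz bound the two cannot coincide. This is the source of the strict inequality between
    -- λ and σ. The constant v is half of |P| at `lo b`.
    root-apart : ∀ b → 0ℚ ≤ lo b → ¬ Null (λ n → seq (root b) n - lo b)
    root-apart b 0≤lo h =
      let L , 0≤L , lip = poly-lipschitz P (hi b) (≤-trans 0≤lo (lo≤hi b))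
          1/L , 0<1/L , L/L = recip (0≤L ⊞⁺ 0<1)
          v = - eval P (lo b) * ½
          0<v : 0ℚ < v
          0<v = subst (0ℚ <_) (+-identityˡ (- eval P (lo b))) (<-diff (below b)) ⊠⁺ 0<½
          M , near = h (v * 1/L) (0<v ⊠⁺ 0<1/L)
          N , small = value-small b 0≤lo v 0<v
          n = M ℕ.⊔ N
          x = seq (root b) n
          inside : ∀ y → lo b ≤ y → y ≤ hi b → ∣ y ∣ ≤ hi b
          inside y p q = subst (_≤ hi b) (sym (0≤p⇒∣p∣≡p (≤-trans 0≤lo p))) q
          l : ∣ eval P x - eval P (lo b) ∣ ≤ L * ∣ x - lo b ∣
          l = lip x (lo b) (inside x (lo≤root b n) (root≤hi b n)) (inside (lo b) ≤-refl (lo≤hi b))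
          s : L * ∣ x - lo b ∣ ≤ v
          s = cert≤ {t = (L + 1ℚ) * (v * 1/L - ∣ x - lo b ∣) + ∣ x - lo b ∣}
            (<⇒≤ (0≤L ⊞⁺ 0<1) ⊠ <⇒≤ (<-diff (near n (ℕₚ.m≤m⊔n M N))) ⊞ 0≤∣p∣ (x - lo b))
            (trans (cong (_- L * ∣ x - lo b ∣) (sym (trans (cong (v *_) L/L) (*-identityʳ v)))) (eq v L 1/L ∣ x - lo b ∣))
      in contradiction
        (≤-<-trans (≤-trans (p≤∣p∣ (eval P x - eval P (lo b))) (≤-trans l s))
          (cert< (<-diff (small n (ℕₚ.m≤n⊔m M N))) (eq₂ (eval P x) (eval P (lo b)))))
        (<-irrefl refl)
      where
      eq = solve 4 (λ v L r a → v :* ((L :+ # 1ℚ) :* r) :- L :* a := (L :+ # 1ℚ) :* (v :* r :- a) :+ a) refl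
      eq₂ = solve 2 (λ p q → p :- q :- :- q :* # ½ := :- q :* # ½ :- :- p) refl

-- Adjacency through edge sums, and powers of a graph.

module AdjacencyOperators where
  open OrderedField
  open LinearAlgebra
  open import Defs hiding (_≈_; _≤_)
  open import Data.Bool.Base using (Bool; true; false; if_then_else_)
  open import Data.Fin.Base using (Fin; zero; suc; _↑ˡ_; _↑ʳ_; splitAt; combine; remQuot)
  open import Data.Fin.Properties using (any?; splitAt-↑ˡ; splitAt-↑ʳ; splitAt⁻¹-↑ˡ; splitAt⁻¹-↑ʳ; remQuot-combine; combine-remQuot) renaming (_≟_ to _≟ᶠ_; suc-injective to fsuc-injective)
  open import Data.Fin.Subset using (Subset; _∈_; ⁅_⁆; ⊤; inside; outside) renaming (⊥ to ∅)
  open import Data.Fin.Subset.Properties using (_∈?_)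
  open import Data.Nat.Base as ℕ using (ℕ; zero; suc)
  open import Data.Product.Base using (∃-syntax; _×_; _,_; proj₁; proj₂)
  open import Data.Sum.Base using (inj₁; inj₂; [_,_]′)
  open import Data.Vec.Base using (lookup; tabulate)
  open import Data.Vec.Properties using (lookup-++ˡ; lookup-++ʳ; lookup-concat; lookup∘tabulate; lookup-replicate; []=⇒lookup; lookup⇒[]=)
  open import Data.Rational.Base hiding (_⊔_; _⊓_)
  open import Data.Rational.Properties
  open import Function.Base using (_∘_)
  open import Function.Bundles using (mk⇔)
  open import Relation.Nullary using (Dec; yes; no; does)
  open import Relation.Nullary.Decidable using (_×-dec_; ¬?; does-⇔; dec-true; dec-false)
  open import Relation.Nullary.Negation using (contradiction)
  open import Relation.Binary.PropositionalEquality

  inc : ∀ H → Fin (size H) → Fin (order H) → Bool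
  inc H e i = lookup (edge H e) i

  inc⇒∈ : ∀ H {e i} → inc H e i ≡ true → i ∈ edge H e
  inc⇒∈ H {e} {i} = lookup⇒[]= i (edge H e)

  ∈⇒inc : ∀ H {e i} → i ∈ edge H e → inc H e i ≡ true
  ∈⇒inc H = []=⇒lookup

  edge-sum : ∀ H → (Fin (order H) → ℚ) → Fin (size H) → ℚ
  edge-sum H x e = sum (λ j → 𝟙 (inc H e j) * x j)

  -- Summing edge by edge, instead of over adjacent pairs, keeps track of powers and attached edges,
  -- whose edges are known explicitly.
  neighbour-sum : ∀ H → (Fin (order H) → ℚ) → Fin (order H) → ℚ
  neighbour-sum H x i = sum (λ e → 𝟙 (inc H e i) * (edge-sum H x e - x i))

  adjacent? : ∀ H (i j : Fin (order H)) → Dec (i ≢ j × ∃[ e ] i ∈ edge H e × j ∈ edge H e)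
  adjacent? H i j = ¬? (i ≟ᶠ j) ×-dec any? (λ e → (i ∈? edge H e) ×-dec (j ∈? edge H e))

  adj : ∀ H → Fin (order H) → Fin (order H) → ℚ
  adj H i j = 𝟙 (does (adjacent? H i j))

  adj-sym : ∀ H i j → adj H i j ≡ adj H j i
  adj-sym H i j = cong 𝟙 (does-⇔ (mk⇔ flip flip) (adjacent? H i j) (adjacent? H j i))
    where
    flip : ∀ {i j} → i ≢ j × (∃[ e ] i ∈ edge H e × j ∈ edge H e) → j ≢ i × (∃[ e ] j ∈ edge H e × i ∈ edge H e)
    flip (i≢j , e , i∈e , j∈e) = i≢j ∘ sym , e , j∈e , i∈e

  -- Linearity phrased for pairs of vertices, the form needed when adjacent pairs are counted by
  -- their edges.
  Separated : Hypergraph → Set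
  Separated H = ∀ {e f i j} → i ≢ j → i ∈ edge H e → j ∈ edge H e → i ∈ edge H f → j ∈ edge H f → e ≡ f

  -- An adjacent pair lies in exactly one common edge, which contributes the only nonzero summand;
  -- the factor with δ removes the diagonal.
  adj-count : ∀ H → Separated H → ∀ i j →
    adj H i j ≡ sum (λ e → 𝟙 (inc H e i) * ((1ℚ - δ i j) * 𝟙 (inc H e j)))
  adj-count H sep i j = go (i ≟ᶠ j) (adjacent? H i j)
    where
    go : Dec (i ≡ j) → (d : Dec (i ≢ j × ∃[ e ] i ∈ edge H e × j ∈ edge H e)) →
      𝟙 (does d) ≡ sum (λ e → 𝟙 (inc H e i) * ((1ℚ - δ i j) * 𝟙 (inc H e j)))
    go (yes refl) (yes (i≢i , _)) = contradiction refl i≢i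
    go (yes refl) (no _) = sym (Σ-0 {size H} λ e →
      trans (cong (λ z → 𝟙 (inc H e i) * ((1ℚ - z) * 𝟙 (inc H e i))) (δ-refl i)) (eq (𝟙 (inc H e i)) (𝟙 (inc H e i))))
      where
      eq : ∀ a b → a * ((1ℚ - 1ℚ) * b) ≡ 0ℚ
      eq a b = trans (cong (a *_) (*-zeroˡ b)) (*-zeroʳ a)
    go (no i≢j) (no ¬adj) = sym (Σ-0 {size H} zero-term)
      where
      zero-term : ∀ e → 𝟙 (inc H e i) * ((1ℚ - δ i j) * 𝟙 (inc H e j)) ≡ 0ℚ
      zero-term e with inc H e i in p | inc H e j in q
      ... | false | b     = *-zeroˡ ((1ℚ - δ i j) * 𝟙 b)
      ... | true  | false = trans (*-identityˡ _) (*-zeroʳ (1ℚ - δ i j))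
      ... | true  | true  = contradiction (i≢j , e , inc⇒∈ H p , inc⇒∈ H q) ¬adj
    go (no i≢j) (yes (_ , f , i∈f , j∈f)) = sym (trans (Σ-cong term) (Σ-δ f (λ _ → 1ℚ)))
      where
      term : ∀ e → 𝟙 (inc H e i) * ((1ℚ - δ i j) * 𝟙 (inc H e j)) ≡ δ f e * 1ℚ
      term e with f ≟ᶠ e
      ... | yes refl rewrite ∈⇒inc H i∈f | ∈⇒inc H j∈f | δ-≢ i≢j = refl
      ... | no f≢e with inc H e i in p | inc H e j in q
      ...   | false | b     = *-zeroˡ ((1ℚ - δ i j) * 𝟙 b)
      ...   | true  | false = trans (*-identityˡ _) (*-zeroʳ (1ℚ - δ i j))
      ...   | true  | true  = contradiction (sep i≢j i∈f j∈f (inc⇒∈ H p) (inc⇒∈ H q)) f≢e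

  𝟙-idem : ∀ b → 𝟙 b * 𝟙 b ≡ 𝟙 b
  𝟙-idem true  = refl
  𝟙-idem false = refl

  adj-neighbour-sum : ∀ H → Separated H → ∀ x i → (adj H · x) i ≡ neighbour-sum H x i
  adj-neighbour-sum H sep x i = begin
    sum (λ j → adj H i j * x j)
      ≡⟨ Σ-cong (λ j → trans (cong (_* x j) (adj-count H sep i j))
           (sym (Σ-*ʳ (x j) (λ e → 𝟙 (inc H e i) * ((1ℚ - δ i j) * 𝟙 (inc H e j)))))) ⟩
    sum (λ j → sum (λ e → 𝟙 (inc H e i) * ((1ℚ - δ i j) * 𝟙 (inc H e j)) * x j))
      ≡⟨ Σ-swap (λ j e → 𝟙 (inc H e i) * ((1ℚ - δ i j) * 𝟙 (inc H e j)) * x j) ⟩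
    sum (λ e → sum (λ j → 𝟙 (inc H e i) * ((1ℚ - δ i j) * 𝟙 (inc H e j)) * x j))
      ≡⟨ Σ-cong inner ⟩
    neighbour-sum H x i ∎
    where
    open ≡-Reasoning
    inner : ∀ e → sum (λ j → 𝟙 (inc H e i) * ((1ℚ - δ i j) * 𝟙 (inc H e j)) * x j) ≡
      𝟙 (inc H e i) * (edge-sum H x e - x i)
    inner e = begin
      sum (λ j → 𝟙 (inc H e i) * ((1ℚ - δ i j) * 𝟙 (inc H e j)) * x j)
        ≡⟨ Σ-cong (λ j → eq (𝟙 (inc H e i)) (δ i j) (𝟙 (inc H e j)) (x j)) ⟩
      sum (λ j → 𝟙 (inc H e i) * (𝟙 (inc H e j) * x j) + (- 𝟙 (inc H e i)) * (δ i j * (𝟙 (inc H e j) * x j)))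
        ≡⟨ Σ-+ (λ j → 𝟙 (inc H e i) * (𝟙 (inc H e j) * x j)) (λ j → (- 𝟙 (inc H e i)) * (δ i j * (𝟙 (inc H e j) * x j))) ⟩
      sum (λ j → 𝟙 (inc H e i) * (𝟙 (inc H e j) * x j)) + sum (λ j → (- 𝟙 (inc H e i)) * (δ i j * (𝟙 (inc H e j) * x j)))
        ≡⟨ cong₂ _+_ (Σ-*ˡ (𝟙 (inc H e i)) (λ j → 𝟙 (inc H e j) * x j))
             (trans (Σ-*ˡ (- 𝟙 (inc H e i)) (λ j → δ i j * (𝟙 (inc H e j) * x j)))
               (cong ((- 𝟙 (inc H e i)) *_) (Σ-δ i (λ j → 𝟙 (inc H e j) * x j)))) ⟩
      𝟙 (inc H e i) * edge-sum H x e + (- 𝟙 (inc H e i)) * (𝟙 (inc H e i) * x i)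
        ≡⟨ eq₂ (𝟙 (inc H e i)) (edge-sum H x e) (x i) ⟩
      𝟙 (inc H e i) * edge-sum H x e - (𝟙 (inc H e i) * 𝟙 (inc H e i)) * x i
        ≡⟨ cong (λ z → 𝟙 (inc H e i) * edge-sum H x e - z * x i) (𝟙-idem (inc H e i)) ⟩
      𝟙 (inc H e i) * edge-sum H x e - 𝟙 (inc H e i) * x i
        ≡⟨ eq₃ (𝟙 (inc H e i)) (edge-sum H x e) (x i) ⟩
      𝟙 (inc H e i) * (edge-sum H x e - x i) ∎
      where
      eq = solve 4 (λ a d b x → a :* ((# 1ℚ :- d) :* b) :* x := a :* (b :* x) :+ (:- a) :* (d :* (b :* x))) refl
      eq₂ = solve 3 (λ a s x → a :* s :+ (:- a) :* (a :* x) := a :* s :- a :* a :* x) refl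
      eq₃ = solve 3 (λ a s x → a :* s :- a :* x := a :* (s :- x)) refl

  lookup-⁅⁆ : ∀ {n} (i j : Fin n) → lookup ⁅ i ⁆ j ≡ does (i ≟ᶠ j)
  lookup-⁅⁆ zero    zero    = refl
  lookup-⁅⁆ zero    (suc j) = lookup-replicate j outside
  lookup-⁅⁆ (suc i) zero    = refl
  lookup-⁅⁆ (suc i) (suc j) = trans (lookup-⁅⁆ i j) (sym (does-suc (i ≟ᶠ j) (suc i ≟ᶠ suc j)))
    where
    does-suc : (d : Dec (i ≡ j)) (d′ : Dec (suc i ≡ suc j)) → does d′ ≡ does d
    does-suc d (yes p) = sym (dec-true d (fsuc-injective p))
    does-suc d (no ¬p) = sym (dec-false d (¬p ∘ cong suc))

  Σ-combine : ∀ k d (g : Fin (k ℕ.* d) → ℚ) → sum g ≡ sum (λ i → sum (λ t → g (combine {k} {d} i t)))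
  Σ-combine zero    d g = refl
  Σ-combine (suc k) d g = trans (Σ-++ d g) (cong (sum (λ t → g (t ↑ˡ (k ℕ.* d))) +_) (Σ-combine k d (g ∘ (d ↑ʳ_))))

  lookup-block : ∀ {k} d (e f : Fin k) t → lookup (block d e) (combine f t) ≡ does (e ≟ᶠ f)
  lookup-block d e f t = trans (lookup-concat (tabulate g) f t)
    (trans (cong (λ v → lookup v t) (lookup∘tabulate g f)) (go (does (e ≟ᶠ f))))
    where
    g : _ → Subset d
    g j = if does (e ≟ᶠ j) then ⊤ else ∅
    go : ∀ b → lookup (if b then ⊤ else ∅) t ≡ b
    go true  = lookup-replicate t inside
    go false = lookup-replicate t outside

  module Power (d : ℕ) (G : Hypergraph) where

    m : ℕ
    m = suc (suc d)

    n k : ℕ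
    n = order G
    k = size G

    P : Hypergraph
    P = power m G

    vertex : Fin n → Fin (order P)
    vertex u = u ↑ˡ (k ℕ.* d)

    new : Fin k → Fin d → Fin (order P)
    new e t = n ↑ʳ combine e t

    fill : ∀ {a} {A : Set a} → (Fin n → A) → (Fin k → A) → Fin (order P) → A
    fill x y i = [ x , y ∘ proj₁ ∘ remQuot {k} d ]′ (splitAt n i)

    fill-vertex : ∀ {a} {A : Set a} (x : Fin n → A) y u → fill x y (vertex u) ≡ x u
    fill-vertex x y u = cong [ x , y ∘ proj₁ ∘ remQuot {k} d ]′ (splitAt-↑ˡ n u (k ℕ.* d))

    fill-new : ∀ {a} {A : Set a} (x : Fin n → A) y e t → fill x y (new e t) ≡ y e
    fill-new x y e t = trans
      (cong [ x , y ∘ proj₁ ∘ remQuot {k} d ]′ (splitAt-↑ʳ n (k ℕ.* d) (combine e t)))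
      (cong (y ∘ proj₁) (remQuot-combine {k} {d} e t))

    inc-vertex : ∀ e u → inc P e (vertex u) ≡ inc G e u
    inc-vertex e u = lookup-++ˡ (edge G e) (block d e) u

    inc-new : ∀ e f t → inc P e (new f t) ≡ does (e ≟ᶠ f)
    inc-new e f t = trans (lookup-++ʳ (edge G e) (block d e) (combine f t)) (lookup-block d e f t)

    edge-sum-fill : ∀ x y e → edge-sum P (fill x y) e ≡ edge-sum G x e + ι d * y e
    edge-sum-fill x y e = trans (Σ-++ n (λ j → 𝟙 (inc P e j) * fill x y j))
      (cong₂ _+_
        (Σ-cong (λ u → cong₂ (λ b z → 𝟙 b * z) (inc-vertex e u) (fill-vertex x y u)))
        (trans (Σ-combine k d (λ j → 𝟙 (inc P e (n ↑ʳ j)) * fill x y (n ↑ʳ j)))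
          (trans (Σ-cong (λ f → trans
              (Σ-cong (λ t → cong₂ (λ b z → 𝟙 b * z) (inc-new e f t) (fill-new x y f t)))
              (trans (Σ-const d (δ e f * y f)) (swap (ι d) (δ e f) (y f)))))
            (Σ-δ e (λ f → ι d * y f)))))
      where
      swap = solve 3 (λ a b c → a :* (b :* c) := b :* (a :* c)) refl

    degree : Fin n → ℚ
    degree u = sum (λ e → 𝟙 (inc G e u))

    -- The values on the new vertices of an edge are chosen so that the equation
    -- neighbour-sum = (f + d) · value holds there.
    spread : ℚ → (Fin n → ℚ) → Fin (order P) → ℚ
    spread f x = fill (λ u → (f + 1ℚ) * x u) (edge-sum G x)

    module _ (f : ℚ) (x : Fin n → ℚ) where

      edge-sum-spread : ∀ e → edge-sum P (spread f x) e ≡ (f + 1ℚ + ι d) * edge-sum G x e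
      edge-sum-spread e = trans (edge-sum-fill (λ u → (f + 1ℚ) * x u) (edge-sum G x) e)
        (trans (cong (_+ ι d * edge-sum G x e)
          (trans (Σ-cong (λ j → swap (𝟙 (inc G e j)) (f + 1ℚ) (x j))) (Σ-*ˡ (f + 1ℚ) (λ j → 𝟙 (inc G e j) * x j))))
          (sym (*-distribʳ-+ (edge-sum G x e) (f + 1ℚ) (ι d))))
        where
        swap = solve 3 (λ a b c → a :* (b :* c) := b :* (a :* c)) refl

      spread-new : ∀ e t → neighbour-sum P (spread f x) (new e t) ≡ (f + ι d) * spread f x (new e t)
      spread-new e t = trans
        (Σ-cong (λ g → cong₂ (λ a z → a * (z - spread f x (new e t)))
          (trans (cong 𝟙 (inc-new g e t)) (δ-comm g e)) (edge-sum-spread g)))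
        (trans (Σ-δ e (λ g → (f + 1ℚ + ι d) * edge-sum G x g - spread f x (new e t)))
          (trans (cong (λ z → (f + 1ℚ + ι d) * edge-sum G x e - z) new-value)
            (trans (eq f (ι d) (edge-sum G x e)) (cong ((f + ι d) *_) (sym new-value)))))
        where
        new-value : spread f x (new e t) ≡ edge-sum G x e
        new-value = fill-new (λ u → (f + 1ℚ) * x u) (edge-sum G x) e t
        δ-comm : ∀ {n} (i j : Fin n) → δ i j ≡ δ j i
        δ-comm i j = cong 𝟙 (does-⇔ (mk⇔ sym sym) (i ≟ᶠ j) (j ≟ᶠ i))
        eq = solve 3 (λ f d s → (f :+ # 1ℚ :+ d) :* s :- s := (f :+ d) :* s) refl

      -- The origin of the reduced equation: comparing with (f + d)(f + 1) x u and dividing by w = f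
      -- + 1 + d gives the coefficients f + κ and κ = d / w, because (f + d)(f + 1) = w (f + κ).
      spread-vertex : ∀ u → neighbour-sum P (spread f x) (vertex u) ≡
        (f + 1ℚ + ι d) * neighbour-sum G x u + ι d * (degree u * x u)
      spread-vertex u = trans
        (Σ-cong (λ e → trans
          (cong₂ (λ b z → 𝟙 b * (z - spread f x (vertex u))) (inc-vertex e u) (edge-sum-spread e))
          (trans (cong (λ z → 𝟙 (inc G e u) * ((f + 1ℚ + ι d) * edge-sum G x e - z)) (fill-vertex (λ u → (f + 1ℚ) * x u) (edge-sum G x) u))
            (eq f (ι d) (𝟙 (inc G e u)) (edge-sum G x e) (x u)))))
        (trans (Σ-+ (λ e → (f + 1ℚ + ι d) * (𝟙 (inc G e u) * (edge-sum G x e - x u))) (λ e → 𝟙 (inc G e u) * (ι d * x u)))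
          (cong₂ _+_ (Σ-*ˡ (f + 1ℚ + ι d) (λ e → 𝟙 (inc G e u) * (edge-sum G x e - x u)))
            (trans (Σ-*ʳ (ι d * x u) (λ e → 𝟙 (inc G e u))) (eq₂ (degree u) (ι d) (x u)))))
        where
        eq = solve 5 (λ f d a s x → a :* ((f :+ # 1ℚ :+ d) :* s :- (f :+ # 1ℚ) :* x) := (f :+ # 1ℚ :+ d) :* (a :* (s :- x)) :+ a :* (d :* x)) refl
        eq₂ = solve 3 (λ a b c → a :* (b :* c) := b :* (a :* c)) refl

    by-kind : ∀ {p} {Q : Fin (order P) → Set p} → (∀ u → Q (vertex u)) → (∀ e t → Q (new e t)) → ∀ i → Q i
    by-kind {Q = Q} hv hn i with splitAt n i in eq
    ... | inj₁ u = subst Q (splitAt⁻¹-↑ˡ eq) (hv u)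
    ... | inj₂ j = subst Q (trans (cong (n ↑ʳ_) (combine-remQuot {k} d j)) (splitAt⁻¹-↑ʳ eq))
      (hn (proj₁ (remQuot {k} d j)) (proj₂ (remQuot {k} d j)))

    new∈ : ∀ {e f t} → new f t ∈ edge P e → e ≡ f
    new∈ {e} {f} {t} p = go (e ≟ᶠ f) (trans (sym (inc-new e f t)) (∈⇒inc P p))
      where
      go : (dec : Dec (e ≡ f)) → does dec ≡ true → e ≡ f
      go (yes e≡f) _ = e≡f

    new∈⁺ : ∀ e t → new e t ∈ edge P e
    new∈⁺ e t = inc⇒∈ P (trans (inc-new e e t) (dec-true (e ≟ᶠ e) refl))

    vertex∈ : ∀ {e u} → vertex u ∈ edge P e → u ∈ edge G e
    vertex∈ {e} {u} p = inc⇒∈ G (trans (sym (inc-vertex e u)) (∈⇒inc P p))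

    vertex∈⁺ : ∀ {e u} → u ∈ edge G e → vertex u ∈ edge P e
    vertex∈⁺ {e} {u} p = inc⇒∈ P (trans (inc-vertex e u) (∈⇒inc G p))

    separated : Separated G → Separated P
    separated sep {e} {f} {i} {j} = by-kind {Q = Q} (λ u → by-kind {Q = λ j → Q′ (vertex u) j}
        (λ v u≢v p q r s → sep (u≢v ∘ cong vertex) (vertex∈ p) (vertex∈ q) (vertex∈ r) (vertex∈ s))
        (λ g t _ _ q _ s → trans (new∈ q) (sym (new∈ s))))
      (λ g t j _ p _ r _ → trans (new∈ p) (sym (new∈ r))) i j
      where
      Q′ : Fin (order P) → Fin (order P) → Set
      Q′ i j = i ≢ j → i ∈ edge P e → j ∈ edge P e → i ∈ edge P f → j ∈ edge P f → e ≡ f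
      Q : Fin (order P) → Set
      Q i = ∀ j → Q′ i j

-- Attaching pendant edges, and vectors on the result.

module PendantEdges where
  open OrderedField
  open AdjacencyOperators
  open import Defs hiding (_≈_; _≤_)
  open import Data.Bool.Base using (true; false)
  open import Data.Fin.Base using (Fin; zero; suc; _↑ˡ_; _↑ʳ_; splitAt)
  open import Data.Fin.Properties using (splitAt-↑ˡ; splitAt-↑ʳ; splitAt⁻¹-↑ˡ; splitAt⁻¹-↑ʳ; ↑ˡ-injective) renaming (_≟_ to _≟ᶠ_)
  open import Data.Fin.Subset using (_∈_; ⁅_⁆; ⊤; inside; outside) renaming (⊥ to ∅)
  open import Data.List.Base using ([]; _∷_)
  open import Data.Nat.Base as ℕ using (ℕ; zero; suc)
  open import Data.Product.Base using (∃-syntax; _,_)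
  open import Data.Sum.Base using (inj₁; inj₂; [_,_]′)
  open import Data.Vec.Base as Vec using (Vec)
  open import Data.Vec.Properties using (lookup-++ˡ; lookup-++ʳ; lookup-replicate)
  open import Data.Rational.Base hiding (_⊔_; _⊓_)
  open import Data.Rational.Properties
  open import Function.Base using (_∘_; const)
  open import Relation.Nullary using (Dec; yes; no; does)
  open import Relation.Nullary.Negation using (contradiction)
  open import Relation.Binary.PropositionalEquality

  δ-↑ˡ : ∀ {n} r (i j : Fin n) → δ (i ↑ˡ r) (j ↑ˡ r) ≡ δ i j
  δ-↑ˡ r i j with i ≟ᶠ j
  ... | yes refl = δ-refl (i ↑ˡ r)
  ... | no i≢j   = δ-≢ (i≢j ∘ ↑ˡ-injective r i j)

  ↑ˡ≢↑ʳ : ∀ {m n} (i : Fin m) (j : Fin n) → i ↑ˡ n ≢ m ↑ʳ j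
  ↑ˡ≢↑ʳ {m} {n} i j eq with trans (sym (splitAt-↑ˡ m i n)) (trans (cong (splitAt m) eq) (splitAt-↑ʳ m n j))
  ... | ()

  module Attach (d : ℕ) (H : Hypergraph) (v : Fin (order H)) where

    A : Hypergraph
    A = attach (suc (suc d)) H v

    old : Fin (order H) → Fin (order A)
    old w = w ↑ˡ suc d

    fresh : Fin (suc d) → Fin (order A)
    fresh t = order H ↑ʳ t

    by-age : ∀ {p} {Q : Fin (order A) → Set p} → (∀ w → Q (old w)) → (∀ t → Q (fresh t)) → ∀ i → Q i
    by-age {Q = Q} ho hf i with splitAt (order H) i in eq
    ... | inj₁ w = subst Q (splitAt⁻¹-↑ˡ eq) (ho w)
    ... | inj₂ t = subst Q (splitAt⁻¹-↑ʳ eq) (hf t)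

    grow : ∀ {a} {B : Set a} → (Fin (order H) → B) → B → Fin (order A) → B
    grow x y i = [ x , const y ]′ (splitAt (order H) i)

    grow-old : ∀ {a} {B : Set a} (x : Fin (order H) → B) y w → grow x y (old w) ≡ x w
    grow-old x y w = cong [ x , const y ]′ (splitAt-↑ˡ (order H) w (suc d))

    grow-fresh : ∀ {a} {B : Set a} (x : Fin (order H) → B) y t → grow x y (fresh t) ≡ y
    grow-fresh x y t = cong [ x , const y ]′ (splitAt-↑ʳ (order H) (suc d) t)

    inc-pendant-old : ∀ w → inc A zero (old w) ≡ does (v ≟ᶠ w)
    inc-pendant-old w = trans (lookup-++ˡ ⁅ v ⁆ ⊤ w) (lookup-⁅⁆ v w)

    inc-pendant-fresh : ∀ t → inc A zero (fresh t) ≡ true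
    inc-pendant-fresh t = trans (lookup-++ʳ ⁅ v ⁆ ⊤ t) (lookup-replicate t inside)

    inc-old : ∀ e w → inc A (suc e) (old w) ≡ inc H e w
    inc-old e w = lookup-++ˡ (edge H e) ∅ w

    inc-fresh : ∀ e t → inc A (suc e) (fresh t) ≡ false
    inc-fresh e t = trans (lookup-++ʳ (edge H e) ∅ t) (lookup-replicate t outside)

    separated : Separated H → Separated A
    separated sep {zero}  {zero}  _ _ _ _ _ = refl
    separated sep {zero}  {suc f} i≢j p q r s = contradiction (pendant-meets f p q r s) i≢j
      where
      pendant-meets : ∀ f {i j} → i ∈ edge A zero → j ∈ edge A zero → i ∈ edge A (suc f) → j ∈ edge A (suc f) → i ≡ j
      pendant-meets f {i} {j} p q r s = trans (only i p r) (sym (only j q s))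
        where
        only : ∀ i → i ∈ edge A zero → i ∈ edge A (suc f) → i ≡ old v
        only = by-age
          (λ w p r → go w (v ≟ᶠ w) (trans (sym (inc-pendant-old w)) (∈⇒inc A {zero} p)))
          (λ t p r → contradiction (trans (sym (∈⇒inc A {suc f} r)) (inc-fresh f t)) λ ())
          where
          go : ∀ w (dec : Dec (v ≡ w)) → does dec ≡ true → old w ≡ old v
          go w (yes refl) _ = refl
    separated sep {suc e} {zero}  i≢j p q r s = sym (separated sep {zero} {suc e} i≢j r s p q)
    separated sep {suc e} {suc f} {i} {j} i≢j p q r s = cong suc (old-edges i j i≢j p q r s)
      where
      old-edges : ∀ i j → i ≢ j → i ∈ edge A (suc e) → j ∈ edge A (suc e) → i ∈ edge A (suc f) → j ∈ edge A (suc f) → e ≡ f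
      old-edges = by-age
        (λ w → by-age
          (λ w′ i≢j p q r s → sep (i≢j ∘ cong old) (down w p) (down w′ q) (down w r) (down w′ s))
          (λ t i≢j p q r s → contradiction (trans (sym (∈⇒inc A {suc e} q)) (inc-fresh e t)) λ ()))
        (λ t j i≢j p q r s → contradiction (trans (sym (∈⇒inc A {suc e} p)) (inc-fresh e t)) λ ())
        where
        down : ∀ w {e} → old w ∈ edge A (suc e) → w ∈ edge H e
        down w {e} p = inc⇒∈ H (trans (sym (inc-old e w)) (∈⇒inc A {suc e} p))

    module _ (x : Fin (order H) → ℚ) (y : ℚ) where

      edge-sum-pendant : edge-sum A (grow x y) zero ≡ x v + ι (suc d) * y
      edge-sum-pendant = trans (Σ-++ (order H) (λ j → 𝟙 (inc A zero j) * grow x y j))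
        (cong₂ _+_
          (trans (Σ-cong (λ w → cong₂ (λ b z → 𝟙 b * z) (inc-pendant-old w) (grow-old x y w))) (Σ-δ v x))
          (trans (Σ-cong (λ t → trans (cong₂ (λ b z → 𝟙 b * z) (inc-pendant-fresh t) (grow-fresh x y t)) (*-identityˡ y)))
            (Σ-const (suc d) y)))

      edge-sum-old : ∀ e → edge-sum A (grow x y) (suc e) ≡ edge-sum H x e
      edge-sum-old e = trans (Σ-++ (order H) (λ j → 𝟙 (inc A (suc e) j) * grow x y j))
        (trans (cong₂ _+_
          (Σ-cong (λ w → cong₂ (λ b z → 𝟙 b * z) (inc-old e w) (grow-old x y w)))
          (Σ-0 {suc d} (λ t → trans (cong (λ b → 𝟙 b * grow x y (fresh t)) (inc-fresh e t)) (*-zeroˡ (grow x y (fresh t))))))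
          (+-identityʳ (edge-sum H x e)))

      neighbour-sum-old : ∀ w → neighbour-sum A (grow x y) (old w) ≡ δ v w * (ι (suc d) * y) + neighbour-sum H x w
      neighbour-sum-old w = cong₂ _+_
        (trans (cong₂ (λ b z → 𝟙 b * z) (inc-pendant-old w) (cong₂ _-_ edge-sum-pendant (grow-old x y w))) (at-v (v ≟ᶠ w)))
        (Σ-cong (λ e → cong₂ (λ b z → 𝟙 b * z) (inc-old e w) (cong₂ _-_ (edge-sum-old e) (grow-old x y w))))
        where
        at-v : (dec : Dec (v ≡ w)) → 𝟙 (does dec) * (x v + ι (suc d) * y - x w) ≡ 𝟙 (does dec) * (ι (suc d) * y)
        at-v (yes refl) = cong (1ℚ *_) (eq (x v) (ι (suc d) * y))
          where
          eq = solve 2 (λ a b → a :+ b :- a := b) refl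
        at-v (no _) = trans (*-zeroˡ (x v + ι (suc d) * y - x w)) (sym (*-zeroˡ (ι (suc d) * y)))

      neighbour-sum-fresh : ∀ t → neighbour-sum A (grow x y) (fresh t) ≡ x v + ι d * y
      neighbour-sum-fresh t = trans (cong₂ _+_
        (trans (cong₂ (λ b z → 𝟙 b * z) (inc-pendant-fresh t) (cong₂ _-_ edge-sum-pendant (grow-fresh x y t))) (eq (x v) (ι d) y))
        (Σ-0 {size H} (λ e → trans (cong (λ b → 𝟙 b * (edge-sum A (grow x y) (suc e) - grow x y (fresh t))) (inc-fresh e t))
          (*-zeroˡ (edge-sum A (grow x y) (suc e) - grow x y (fresh t))))))
        (+-identityʳ (x v + ι d * y))
        where
        eq = solve 3 (λ a d y → # 1ℚ :* (a :+ (# 1ℚ :+ d) :* y :- y) := a :+ d :* y) refl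

  module Pendants (d : ℕ) where

    extend : ∀ {a} {B : Set a} H {p} (vs : Vec (Fin (order H)) p) → (Fin (order H) → B) → Vec B p →
      Fin (order (attachAll (suc (suc d)) H vs)) → B
    extend H Vec.[]       x Vec.[]       = x
    extend H (v Vec.∷ vs) x (y Vec.∷ ys) = extend (attach (suc (suc d)) H v) (Vec.map (_↑ˡ suc d) vs) (Attach.grow d H v x y) ys

    extend-map : ∀ {a b} {B : Set a} {C : Set b} (g : B → C) H {p} (vs : Vec (Fin (order H)) p) x (x′ : Fin (order H) → C) ys →
      (∀ i → x′ i ≡ g (x i)) → ∀ i → extend H vs x′ (Vec.map g ys) i ≡ g (extend H vs x ys i)
    extend-map g H Vec.[]       x x′ Vec.[]       eq = eq
    extend-map g H (v Vec.∷ vs) x x′ (y Vec.∷ ys) eq = extend-map g A (Vec.map old vs) (grow x y) (grow x′ (g y)) ys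
      (by-age (λ w → trans (grow-old x′ (g y) w) (trans (eq w) (cong g (sym (grow-old x y w)))))
              (λ t → trans (grow-fresh x′ (g y) t) (cong g (sym (grow-fresh x y t)))))
      where open Attach d H v

    extend-base : ∀ {a} {B : Set a} H {p} (vs : Vec (Fin (order H)) p) (x : Fin (order H) → B) ys i →
      ∃[ j ] extend H vs x ys j ≡ x i
    extend-base H Vec.[]       x Vec.[]       i = i , refl
    extend-base H (v Vec.∷ vs) x (y Vec.∷ ys) i =
      let j , eq = extend-base A (Vec.map old vs) (grow x y) ys (old i) in j , trans eq (grow-old x y i)
      where open Attach d H v

    extend-all : ∀ {a q} {B : Set a} (Q : B → Set q) H {p} (vs : Vec (Fin (order H)) p) (x : Fin (order H) → B) (y : B) →
      (∀ i → Q (x i)) → Q y → ∀ i → Q (extend H vs x (Vec.replicate p y) i)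
    extend-all Q H Vec.[]       x y qx qy = qx
    extend-all Q H (v Vec.∷ vs) x y qx qy = extend-all Q A (Vec.map old vs) (grow x y) y
      (by-age (λ w → subst Q (sym (grow-old x y w)) (qx w)) (λ t → subst Q (sym (grow-fresh x y t)) qy)) qy
      where open Attach d H v

    separated-attachAll : ∀ H {p} (vs : Vec (Fin (order H)) p) → Separated H → Separated (attachAll (suc (suc d)) H vs)
    separated-attachAll H Vec.[]       sep = sep
    separated-attachAll H (v Vec.∷ vs) sep = separated-attachAll _ (Vec.map (_↑ˡ suc d) vs) (Attach.separated d H v sep)

    -- What the pendant edges still to be attached will add to the neighbour sums. With this term
    -- the equation keeps its shape while edges are attached one after another.
    load : ∀ {n p} → Vec (Fin n) p → Vec ℚ p → Fin n → ℚ
    load Vec.[]       Vec.[]       i = 0ℚ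
    load (v Vec.∷ vs) (y Vec.∷ ys) i = δ v i * (ι (suc d) * y) + load vs ys i

    load-old : ∀ {n p} r (vs : Vec (Fin n) p) ys i → load (Vec.map (_↑ˡ r) vs) ys (i ↑ˡ r) ≡ load vs ys i
    load-old r Vec.[]       Vec.[]       i = refl
    load-old r (v Vec.∷ vs) (y Vec.∷ ys) i = cong₂ (λ a b → a * (ι (suc d) * y) + b) (δ-↑ˡ r v i) (load-old r vs ys i)

    load-fresh : ∀ {n p r} (vs : Vec (Fin n) p) ys (t : Fin r) → load (Vec.map (_↑ˡ r) vs) ys (n ↑ʳ t) ≡ 0ℚ
    load-fresh Vec.[]       Vec.[]       t = refl
    load-fresh (v Vec.∷ vs) (y Vec.∷ ys) t = trans
      (cong₂ (λ a b → a * (ι (suc d) * y) + b) (δ-≢ (↑ˡ≢↑ʳ v t)) (load-fresh vs ys t))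
      (trans (+-identityʳ _) (*-zeroˡ (ι (suc d) * y)))

    -- Each pendant edge at v carries a value y on its new vertices with f y = x v.
    data Fits (f : ℚ) {n} (x : Fin n → ℚ) : ∀ {p} → Vec (Fin n) p → Vec ℚ p → Set where
      []  : Fits f x Vec.[] Vec.[]
      _∷_ : ∀ {p v y} {vs : Vec (Fin n) p} {ys} → x v ≡ f * y → Fits f x vs ys → Fits f x (v Vec.∷ vs) (y Vec.∷ ys)

    fits-old : ∀ {f n r p} {x : Fin n → ℚ} {x′ : Fin (n ℕ.+ r) → ℚ} → (∀ w → x′ (w ↑ˡ r) ≡ x w) →
      {vs : Vec (Fin n) p} {ys : Vec ℚ p} → Fits f x vs ys → Fits f x′ (Vec.map (_↑ˡ r) vs) ys
    fits-old eq []       = []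
    fits-old eq (p ∷ ps) = trans (eq _) p ∷ fits-old eq ps

    -- Each attachment moves one summand from `load` into the neighbour sum. At fresh vertices the
    -- equation holds exactly by `Fits`, so the residue R is extended by zero.
    extend-eigen : ∀ f H {p} (vs : Vec (Fin (order H)) p) x ys R → Fits f x vs ys →
      (∀ i → neighbour-sum H x i + load vs ys i ≡ (f + ι d) * x i + R i) → ∀ i →
      neighbour-sum (attachAll (suc (suc d)) H vs) (extend H vs x ys) i ≡
        (f + ι d) * extend H vs x ys i + extend H vs R (Vec.replicate p 0ℚ) i
    extend-eigen f H Vec.[] x Vec.[] R [] h i = trans (sym (+-identityʳ _)) (h i)
    extend-eigen f H (v Vec.∷ vs) x (y Vec.∷ ys) R (fv ∷ fs) h =
      extend-eigen f A (Vec.map old vs) (grow x y) ys (grow R 0ℚ) (fits-old (grow-old x y) fs)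
        (by-age at-old at-fresh)
      where
      open Attach d H v
      at-old : ∀ w → neighbour-sum A (grow x y) (old w) + load (Vec.map old vs) ys (old w) ≡
        (f + ι d) * grow x y (old w) + grow R 0ℚ (old w)
      at-old w = trans (cong₂ _+_ (neighbour-sum-old x y w) (load-old (suc d) vs ys w))
        (trans (eq (δ v w * (ι (suc d) * y)) (neighbour-sum H x w) (load vs ys w))
          (trans (h w) (sym (cong₂ (λ a b → (f + ι d) * a + b) (grow-old x y w) (grow-old R 0ℚ w)))))
        where
        eq = solve 3 (λ a b c → a :+ b :+ c := b :+ (a :+ c)) refl
      at-fresh : ∀ t → neighbour-sum A (grow x y) (fresh t) + load (Vec.map old vs) ys (fresh t) ≡
        (f + ι d) * grow x y (fresh t) + grow R 0ℚ (fresh t)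
      at-fresh t = trans (cong₂ _+_ (trans (neighbour-sum-fresh x y t) (cong (_+ ι d * y) fv)) (load-fresh vs ys t))
        (trans (eq f (ι d) y) (sym (cong₂ (λ a b → (f + ι d) * a + b) (grow-fresh x y t) (grow-fresh R 0ℚ t))))
        where
        eq = solve 3 (λ f d y → f :* y :+ d :* y :+ # 0ℚ := (f :+ d) :* y :+ # 0ℚ) refl

-- A real eigenvector from rational vectors that solve the equation approximately.

module RealEigenvectors where
  open OrderedField
  open Reals
  open PolynomialRoots
  open AdjacencyOperators
  open import Defs renaming (_≈_ to _≈ʳ_; _≤_ to _≤ʳ_)
  open import Data.Bool.Base using (true; false; if_then_else_)
  open import Data.Fin.Base using (Fin; suc)
  import Data.Integer.Base as ℤ
  open import Data.Nat.Base using (ℕ; suc)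
  import Data.Nat.Properties as ℕₚ
  open import Data.Product.Base using (_,_; proj₁)
  open import Data.Rational.Base hiding (_⊔_; _⊓_)
  open import Data.Rational.Properties
  open import Relation.Nullary using (¬_; does)
  open import Relation.Nullary.Negation using (contradiction)
  open import Relation.Binary.PropositionalEquality

  1/[1+_] : ℕ → ℚ
  1/[1+ d ] = ℤ.+ 1 / suc d

  seq-adjacency : ∀ d H i j t → seq (adjacency (suc (suc d)) H i j) t ≡ 1/[1+ d ] * adj H i j
  seq-adjacency d H i j t = go (does (adjacent? H i j))
    where
    go : ∀ b → seq (if b then fromℚ 1/[1+ d ] else 0ℝ) t ≡ 1/[1+ d ] * 𝟙 b
    go true  = sym (*-identityʳ 1/[1+ d ])
    go false = sym (*-zeroʳ 1/[1+ d ])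

  -- The eigenvector has entries polynomial in the real τ. At each index of the sequence of τ the
  -- equation is one between rationals, and it fails by a null residue R; an entry bounded below by
  -- 1 makes the vector nonzero.
  module RealEigenvalue (d : ℕ) (H : Hypergraph) (sep : Separated H) (τ : ℝ)
    (W : Fin (order H) → Poly) (R : Fin (order H) → ℕ → ℚ)
    (near : ∀ t i → neighbour-sum H (λ j → eval (W j) (seq τ t)) i ≡ (seq τ t + ι d) * eval (W i) (seq τ t) + R i t)
    (R-null : ∀ i → Null (R i)) (i₀ : Fin (order H)) (W≥1 : ∀ t → 1ℚ ≤ eval (W i₀) (seq τ t)) where

    eigenvalue : ℝ
    eigenvalue = (τ +ʳ fromℚ (ι d)) *ʳ fromℚ 1/[1+ d ]

    private
      c : ℚ
      c = 1/[1+ d ]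

      z : Fin (order H) → ℂ
      z i = fromℝ (evalʳ (W i) τ)

      x : ℕ → Fin (order H) → ℚ
      x t i = eval (W i) (seq τ t)

      seq-z : ∀ i t → seq (re (z i)) t ≡ x t i
      seq-z i t = seq-eval (W i) τ t

    isEigenvalue : IsEigenvalue (adjacency (suc (suc d)) H) (fromℝ eigenvalue)
    isEigenvalue = record { vector = z ; nonzero = z≉0 ; eigen = λ i → re-part i , im-part i }
      where
      z≉0 : ¬ (∀ i → z i ≈ᶜ 0ℂ)
      z≉0 h = let N , b = proj₁ (h i₀) 1ℚ 0<1 in contradiction
        (≤-<-trans (≤-trans (W≥1 N) (y≤ (x N i₀))) (subst (λ y → ∣ y - 0ℚ ∣ < 1ℚ) (seq-z i₀ N) (b N ℕₚ.≤-refl)))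
        (<-irrefl refl)
        where
        y≤ : ∀ y → y ≤ ∣ y - 0ℚ ∣
        y≤ y = subst (_≤ ∣ y - 0ℚ ∣) (+-identityʳ y) (p≤∣p∣ (y - 0ℚ))

      re-part : ∀ i → re (sumᶜ (λ j → fromℝ (adjacency (suc (suc d)) H i j) *ᶜ z j)) ≈ʳ re (fromℝ eigenvalue *ᶜ z i)
      re-part i = null-cong eq (null-* (R-null i) (cauchy⇒bounded (fromℚ c)))
        where
        A : Fin (order H) → ℝ
        A = adjacency (suc (suc d)) H i
        eq : ∀ t → R i t * c ≡ seq (re (sumᶜ (λ j → fromℝ (A j) *ᶜ z j))) t - seq (re (fromℝ eigenvalue *ᶜ z i)) t
        eq t = sym (begin
          seq (re (sumᶜ (λ j → fromℝ (A j) *ᶜ z j))) t - ((s + ι d) * c * seq (re (z i)) t + - (0ℚ * 0ℚ))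
            ≡⟨ cong₂ (λ a b → a - ((s + ι d) * c * b + - (0ℚ * 0ℚ)))
                 (trans (seq-sumᶜ-re (λ j → fromℝ (A j) *ᶜ z j) t)
                   (trans (Σ-cong (λ j → trans (cong₂ (λ a b → a * b + - (0ℚ * 0ℚ)) (seq-adjacency d H i j t) (seq-z j t)) (eq₁ c (adj H i j) (x t j))))
                     (trans (Σ-*ˡ c (λ j → adj H i j * x t j)) (cong (c *_) (trans (adj-neighbour-sum H sep (x t) i) (near t i))))))
                 (seq-z i t) ⟩
          c * ((s + ι d) * x t i + R i t) - ((s + ι d) * c * x t i + - (0ℚ * 0ℚ))
            ≡⟨ eq₂ c s (ι d) (x t i) (R i t) ⟩
          R i t * c ∎)
          where
          open ≡-Reasoning
          s : ℚ
          s = seq τ t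
          eq₁ = solve 3 (λ c a x → c :* a :* x :+ :- (# 0ℚ :* # 0ℚ) := c :* (a :* x)) refl
          eq₂ = solve 5 (λ c s d x r → c :* ((s :+ d) :* x :+ r) :- ((s :+ d) :* c :* x :+ :- (# 0ℚ :* # 0ℚ)) := r :* c) refl

      im-part : ∀ i → im (sumᶜ (λ j → fromℝ (adjacency (suc (suc d)) H i j) *ᶜ z j)) ≈ʳ im (fromℝ eigenvalue *ᶜ z i)
      im-part i = null-cong eq null-0
        where
        A : Fin (order H) → ℝ
        A = adjacency (suc (suc d)) H i
        vanish = solve 2 (λ a b → a :* # 0ℚ :+ # 0ℚ :* b := # 0ℚ) refl
        eq : ∀ t → 0ℚ ≡ seq (im (sumᶜ (λ j → fromℝ (A j) *ᶜ z j))) t - seq (im (fromℝ eigenvalue *ᶜ z i)) t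
        eq t = sym (cong₂ _-_
          (trans (seq-sumᶜ-im (λ j → fromℝ (A j) *ᶜ z j) t) (Σ-0 {order H} (λ j → vanish (seq (A j) t) (seq (re (z j)) t))))
          (vanish (seq eigenvalue t) (seq (re (z i)) t)))

-- Isomorphism invariance, graphs, and the reduced operator.

module Graphs where
  open OrderedField
  open LinearAlgebra
  open Reals
  open AdjacencyOperators
  open RealEigenvectors
  open import Defs renaming (_≈_ to _≈ʳ_; _≤_ to _≤ʳ_)
  open import Data.Bool.Base using (true; false; if_then_else_)
  open import Data.Fin.Base using (Fin; zero; suc)
  open import Data.Fin.Permutation using (flip)
  open import Data.Fin.Properties using () renaming (suc-injective to fsuc-injective)
  open import Data.Fin.Subset using (Subset; _∈_; ∣_∣)
  open import Data.Fin.Subset.Properties using (⊆-antisym)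
  open import Data.List.Base using ([]; _∷_)
  open import Data.Nat.Base using (ℕ; zero; suc)
  import Data.Nat.Properties as ℕₚ
  open import Data.Product.Base using (∃-syntax; ∃₂; _×_; _,_; proj₁; proj₂)
  open import Data.Sum.Base as Sum⊎ using (_⊎_; inj₁; inj₂)
  import Data.Vec.Base as Vec
  open import Data.Vec.Base using (lookup; here; there)
  open import Data.Rational.Base hiding (_⊔_; _⊓_; ∣_∣)
  open import Data.Rational.Properties
  open import Function.Base using (_∘_)
  open import Function.Bundles using (Inverse; Equivalence; mk⇔)
  open import Relation.Nullary using (¬_; does)
  open import Relation.Nullary.Decidable using (does-⇔)
  open import Relation.Nullary.Negation using (contradiction)
  open import Relation.Binary.PropositionalEquality

  -- Eigenvalues along isomorphisms

  adjacent-≅ : ∀ {G H} (φ : G ≅ H) → let open Inverse (_≅_.vertices φ) in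
    ∀ i j → does (adjacent? H i j) ≡ does (adjacent? G (from i) (from j))
  adjacent-≅ {G} {H} φ i j = does-⇔ (mk⇔ down up) (adjacent? H i j) (adjacent? G (from i) (from j))
    where
    open Inverse (_≅_.vertices φ)
    module Ed = Inverse (_≅_.edges φ)
    pull : ∀ {v f} → v ∈ edge H f → from v ∈ edge G (Ed.from f)
    pull {v} {f} p = Equivalence.from (_≅_.incidence φ (from v) (Ed.from f))
      (subst₂ (λ v f → v ∈ edge H f) (sym (strictlyInverseˡ v)) (sym (Ed.strictlyInverseˡ f)) p)
    push : ∀ {v e} → from v ∈ edge G e → v ∈ edge H (Ed.to e)
    push {v} {e} p = subst (_∈ edge H (Ed.to e)) (strictlyInverseˡ v) (Equivalence.to (_≅_.incidence φ (from v) e) p)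
    down : i ≢ j × (∃[ f ] i ∈ edge H f × j ∈ edge H f) → from i ≢ from j × (∃[ e ] from i ∈ edge G e × from j ∈ edge G e)
    down (i≢j , f , p , q) =
      (λ eq → i≢j (trans (sym (strictlyInverseˡ i)) (trans (cong to eq) (strictlyInverseˡ j)))) , Ed.from f , pull p , pull q
    up : from i ≢ from j × (∃[ e ] from i ∈ edge G e × from j ∈ edge G e) → i ≢ j × (∃[ f ] i ∈ edge H f × j ∈ edge H f)
    up (i≢j , e , p , q) = i≢j ∘ cong from , Ed.to e , push p , push q

  eigenvalue-≅ : ∀ {d G H μ} → G ≅ H →
    IsEigenvalue (adjacency (suc (suc d)) G) μ → IsEigenvalue (adjacency (suc (suc d)) H) μ
  eigenvalue-≅ {d} {G} {H} {μ} φ eig = record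
    { vector  = vector ∘ from
    ; nonzero = λ h → nonzero λ i → subst (λ j → vector j ≈ᶜ 0ℂ) (strictlyInverseʳ i) (h (to i))
    ; eigen   = λ i → null-cong (λ t → cong (_- seq (re (μ *ᶜ vector (from i))) t) (sum-re i t)) (proj₁ (eigen (from i)))
                   , null-cong (λ t → cong (_- seq (im (μ *ᶜ vector (from i))) t) (sum-im i t)) (proj₂ (eigen (from i)))
    }
    where
    open Inverse (_≅_.vertices φ)
    open IsEigenvalue eig
    term : Fin (order G) → Fin (order G) → ℂ
    term i j = fromℝ (adjacency (suc (suc d)) G i j) *ᶜ vector j
    term′ : Fin (order H) → Fin (order H) → ℂ
    term′ i j = fromℝ (adjacency (suc (suc d)) H i j) *ᶜ vector (from j)
    same : ∀ i j → term (from i) (from j) ≡ term′ i j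
    same i j = cong (λ b → fromℝ (if b then fromℚ 1/[1+ d ] else 0ℝ) *ᶜ vector (from j)) (sym (adjacent-≅ φ i j))
    sum-re : ∀ i t → seq (re (sumᶜ (term (from i)))) t ≡ seq (re (sumᶜ (term′ i))) t
    sum-re i t = trans (seq-sumᶜ-re (term (from i)) t)
      (trans (sum-permute (λ j → seq (re (term (from i) j)) t) (flip (_≅_.vertices φ)))
        (trans (Σ-cong λ j → cong (λ z → seq (re z) t) (same i j)) (sym (seq-sumᶜ-re (term′ i) t))))
    sum-im : ∀ i t → seq (im (sumᶜ (term (from i)))) t ≡ seq (im (sumᶜ (term′ i))) t
    sum-im i t = trans (seq-sumᶜ-im (term (from i)) t)
      (trans (sum-permute (λ j → seq (im (term (from i) j)) t) (flip (_≅_.vertices φ)))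
        (trans (Σ-cong λ j → cong (λ z → seq (im z) t) (same i j)) (sym (seq-sumᶜ-im (term′ i) t))))

  spectral-radius-≅ : ∀ {d G H ρ σ} → G ≅ H → IsSpectralRadius (adjacency (suc (suc d)) G) ρ →
    IsSpectralRadius (adjacency (suc (suc d)) H) σ → ρ ≤ʳ σ
  spectral-radius-≅ {d} {G} {H} {ρ} {σ} φ isρ isσ =
    let μ , eig , ∣μ∣²≈ρ² = IsSpectralRadius.attained isρ in
    square-cancel-≤ {ρ} {σ} (IsSpectralRadius.nonNegative isσ)
      (≤ʳ-trans {ρ *ʳ ρ} {∣ μ ∣²} {σ *ʳ σ} (≈⇒≤ {ρ *ʳ ρ} {∣ μ ∣²} (≈-sym {∣ μ ∣²} {ρ *ʳ ρ} ∣μ∣²≈ρ²))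
        (IsSpectralRadius.maximal isσ μ (eigenvalue-≅ {d} {G} {H} {μ} φ eig)))

  Σ-𝟙 : ∀ {n} (p : Subset n) → sum (λ j → 𝟙 (lookup p j)) ≡ ι ∣ p ∣
  Σ-𝟙 Vec.[]              = refl
  Σ-𝟙 (true Vec.∷ p)  = cong (1ℚ +_) (Σ-𝟙 p)
  Σ-𝟙 (false Vec.∷ p) = trans (+-identityˡ _) (Σ-𝟙 p)

  -- Includes that the edge has no third vertex; hence an edge is determined by the pair that it
  -- joins.
  Joins : ∀ H → Fin (size H) → Fin (order H) → Fin (order H) → Set
  Joins H e a b = a ≢ b × a ∈ edge H e × b ∈ edge H e × (∀ {v} → v ∈ edge H e → v ≡ a ⊎ v ≡ b)

  joins-sym : ∀ {H e a b} → Joins H e a b → Joins H e b a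
  joins-sym (a≢b , a∈ , b∈ , only) = a≢b ∘ sym , b∈ , a∈ , λ v∈ → Sum⊎.swap (only v∈)

  joins-unique : ∀ {H} e f {a b} → Joins H e a b → Joins H f a b → e ≡ f
  joins-unique {H} e f (_ , a∈e , b∈e , e-only) (_ , a∈f , b∈f , f-only) =
    distinct H (⊆-antisym (λ v∈e → either a∈f b∈f (e-only v∈e)) (λ v∈f → either a∈e b∈e (f-only v∈f)))
    where
    either : ∀ {n} {p : Subset n} {v a b} → a ∈ p → b ∈ p → v ≡ a ⊎ v ≡ b → v ∈ p
    either a∈ b∈ (inj₁ refl) = a∈
    either a∈ b∈ (inj₂ refl) = b∈

  no-element : ∀ {n} (p : Subset n) → ∣ p ∣ ≡ 0 → ∀ {v} → ¬ v ∈ p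
  no-element (false Vec.∷ p) eq (there v∈p) = no-element p eq v∈p

  one-element : ∀ {n} (p : Subset n) → ∣ p ∣ ≡ 1 → ∃[ a ] a ∈ p × (∀ {v} → v ∈ p → v ≡ a)
  one-element (true Vec.∷ p) eq = zero , here , λ
    { here → refl ; (there v∈p) → contradiction v∈p (no-element p (ℕₚ.suc-injective eq)) }
  one-element (false Vec.∷ p) eq = let a , a∈p , only = one-element p eq in
    suc a , there a∈p , λ { (there v∈p) → cong suc (only v∈p) }

  two-elements : ∀ {n} (p : Subset n) → ∣ p ∣ ≡ 2 →
    ∃₂ λ a b → a ≢ b × a ∈ p × b ∈ p × (∀ {v} → v ∈ p → v ≡ a ⊎ v ≡ b)
  two-elements (true Vec.∷ p) eq = let b , b∈p , only = one-element p (ℕₚ.suc-injective eq) in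
    zero , suc b , (λ ()) , here , there b∈p , λ { here → inj₁ refl ; (there v∈p) → inj₂ (cong suc (only v∈p)) }
  two-elements (false Vec.∷ p) eq = let a , b , a≢b , a∈p , b∈p , only = two-elements p eq in
    suc a , suc b , (λ e → a≢b (fsuc-injective e)) , there a∈p , there b∈p ,
    λ { (there v∈p) → Sum⊎.map (cong suc) (cong suc) (only v∈p) }

  module Graph (G : Hypergraph) (uniform : Uniform 2 G) where

    n k : ℕ
    n = order G
    k = size G

    endpoints : ∀ e → ∃₂ (Joins G e)
    endpoints e = two-elements (edge G e) (uniform e)

    joins : ∀ {e a b} → a ≢ b → a ∈ edge G e → b ∈ edge G e → Joins G e a b
    joins {e} {a} {b} a≢b a∈e b∈e = a≢b , a∈e , b∈e , other (proj₂ (proj₂ (proj₂ (proj₂ (proj₂ (endpoints e))))))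
      where
      other : ∀ {x y v} → (∀ {v} → v ∈ edge G e → v ≡ x ⊎ v ≡ y) → v ∈ edge G e → v ≡ a ⊎ v ≡ b
      other only v∈e with only a∈e | only b∈e | only v∈e
      ... | inj₁ refl | inj₁ refl | _         = contradiction refl a≢b
      ... | inj₁ refl | inj₂ refl | inj₁ refl = inj₁ refl
      ... | inj₁ refl | inj₂ refl | inj₂ refl = inj₂ refl
      ... | inj₂ refl | inj₁ refl | inj₁ refl = inj₂ refl
      ... | inj₂ refl | inj₁ refl | inj₂ refl = inj₁ refl
      ... | inj₂ refl | inj₂ refl | _         = contradiction refl a≢b

    separated : Separated G
    separated {e} {f} i≢j i∈e j∈e i∈f j∈f =
      joins-unique {G} e f (joins i≢j i∈e j∈e) (joins i≢j i∈f j∈f)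

    A : Fin n → Fin n → ℚ
    A = adj G

    degree : Fin n → ℚ
    degree u = sum (λ e → 𝟙 (inc G e u))

    A·≡ : ∀ x u → (A · x) u ≡ neighbour-sum G x u
    A·≡ = adj-neighbour-sum G separated

    A·1 : ∀ u → (A · (λ _ → 1ℚ)) u ≡ degree u
    A·1 u = trans (A·≡ (λ _ → 1ℚ) u) (Σ-cong λ e →
      trans (cong (λ s → 𝟙 (inc G e u) * (s - 1ℚ)) (trans (Σ-cong λ j → *-identityʳ (𝟙 (inc G e j)))
        (trans (Σ-𝟙 (edge G e)) (cong ι (uniform e))))) (*-identityʳ (𝟙 (inc G e u))))

    Σdegree : sum degree ≡ ι k * ι 2
    Σdegree = trans (Σ-swap (λ u e → 𝟙 (inc G e u)))
      (trans (Σ-cong λ e → trans (Σ-𝟙 (edge G e)) (cong ι (uniform e))) (Σ-const k (ι 2)))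

    -- Scaled by f + d + 1, the matrix whose kernel consists of the graph parts of the
    -- eigenvectors of power (d + 2) G for the eigenvalue (f + d) / (d + 1).
    Reduced : ℕ → ℚ → Fin n → Fin n → ℚ
    Reduced d f u v = (f + ι d) * (f + 1ℚ) * δ u v - ((f + 1ℚ + ι d) * A u v + ι d * (degree u * δ u v))

    Reduced-· : ∀ d f x u → (Reduced d f · x) u ≡
      (f + ι d) * (f + 1ℚ) * x u - ((f + 1ℚ + ι d) * (A · x) u + ι d * (degree u * x u))
    Reduced-· d f x u = begin
      sum (λ v → Reduced d f u v * x v)
        ≡⟨ Σ-cong (λ v → eq (f + ι d) (f + 1ℚ) (δ u v) (f + 1ℚ + ι d) (A u v) (ι d) (degree u) (x v)) ⟩
      sum (λ v → ((f + ι d) * (f + 1ℚ) - ι d * degree u) * (δ u v * x v) + (- (f + 1ℚ + ι d)) * (A u v * x v))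
        ≡⟨ Σ-+ (λ v → ((f + ι d) * (f + 1ℚ) - ι d * degree u) * (δ u v * x v)) (λ v → (- (f + 1ℚ + ι d)) * (A u v * x v)) ⟩
      sum (λ v → ((f + ι d) * (f + 1ℚ) - ι d * degree u) * (δ u v * x v)) + sum (λ v → (- (f + 1ℚ + ι d)) * (A u v * x v))
        ≡⟨ cong₂ _+_
             (trans (Σ-*ˡ ((f + ι d) * (f + 1ℚ) - ι d * degree u) (λ v → δ u v * x v))
               (cong (((f + ι d) * (f + 1ℚ) - ι d * degree u) *_) (Σ-δ u x)))
             (Σ-*ˡ (- (f + 1ℚ + ι d)) (λ v → A u v * x v)) ⟩
      ((f + ι d) * (f + 1ℚ) - ι d * degree u) * x u + (- (f + 1ℚ + ι d)) * (A · x) u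
        ≡⟨ eq₂ (f + ι d) (f + 1ℚ) (f + 1ℚ + ι d) (ι d) (degree u) (x u) ((A · x) u) ⟩
      _ ∎
      where
      open ≡-Reasoning
      eq = solve 8 (λ p q e w a d g x → (p :* q :* e :- (w :* a :+ d :* (g :* e))) :* x := (p :* q :- d :* g) :* (e :* x) :+ (:- w) :* (a :* x)) refl
      eq₂ = solve 7 (λ p q w d g x s → (p :* q :- d :* g) :* x :+ (:- w) :* s := p :* q :* x :- (w :* s :+ d :* (g :* x))) refl

    Reduced-off-diagonal : ∀ d f → 0ℚ ≤ f → ∀ u v → u ≢ v → Reduced d f u v ≤ 0ℚ
    Reduced-off-diagonal d f 0≤f u v u≢v = cert≤ ((0≤f ⊞ 0≤1 ⊞ 0≤ι d) ⊠ 0≤𝟙 _)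
      (trans (cong (λ e → 0ℚ - ((f + ι d) * (f + 1ℚ) * e - ((f + 1ℚ + ι d) * A u v + ι d * (degree u * e)))) (δ-≢ u≢v))
        (eq (f + ι d) (f + 1ℚ) (f + 1ℚ + ι d) (A u v) (ι d) (degree u)))
      where
      eq = solve 6 (λ p q w a d g → # 0ℚ :- (p :* q :* # 0ℚ :- (w :* a :+ d :* (g :* # 0ℚ))) := w :* a) refl

    -- `spread` carries a positive supersolution to a positive vector V on the power: adjacency
    -- gives (f + d) V exactly at the new vertices and at most that at the old ones. Schur's test
    -- then bounds every eigenvalue.
    spectral-bound : ∀ d f → 0ℚ ≤ f → Supersolution (Reduced d f) →
      ∀ {ν} → IsEigenvalue (adjacency (suc (suc d)) (power (suc (suc d)) G)) ν →
      ∣ ν ∣² ≤ʳ fromℚ ((f + ι d) * 1/[1+ d ]) *ʳ fromℚ ((f + ι d) * 1/[1+ d ])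
    spectral-bound d f 0≤f (x , x>0 , Mx>0) {ν} eig =
      bound V ((f + ι d) * c) (λ i j → cong (c *_) (adj-sym P i j)) (λ i j → 0≤c ⊠ 0≤𝟙 _) V>0 ((0≤f ⊞ 0≤ι d) ⊠ 0≤c) BV≤
      where
      open Power d G using (P; vertex; new; spread; spread-vertex; spread-new; by-kind; fill-vertex; fill-new) renaming (separated to power-separated)
      c : ℚ
      c = 1/[1+ d ]
      0≤c : 0ℚ ≤ c
      0≤c = nonNegative⁻¹ c {{normalize-nonNeg 1 (suc d)}}
      open EigenvalueBound (adjacency (suc (suc d)) P) (λ i j → c * adj P i j) (seq-adjacency d P) {ν} eig using (bound)
      V : Fin (order P) → ℚ
      V = spread f x
      V>0 : ∀ i → 0ℚ < V i
      V>0 = by-kind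
        (λ u → subst (0ℚ <_) (sym (fill-vertex (λ u → (f + 1ℚ) * x u) (edge-sum G x) u)) ((0≤f ⊞⁺ 0<1) ⊠⁺ x>0 u))
        (λ e t → subst (0ℚ <_) (sym (fill-new (λ u → (f + 1ℚ) * x u) (edge-sum G x) e t)) (edge>0 e))
        where
        edge>0 : ∀ e → 0ℚ < edge-sum G x e
        edge>0 e = let v , v∈e = nonempty G e in <-≤-trans
          (subst (λ b → 0ℚ < 𝟙 b * x v) (sym (∈⇒inc G v∈e)) (subst (0ℚ <_) (sym (*-identityˡ (x v))) (x>0 v)))
          (term≤Σ (λ j → 0≤𝟙 (inc G e j) ⊠ <⇒≤ (x>0 j)) v)
      AV≤ : ∀ i → (adj P · V) i ≤ (f + ι d) * V i
      AV≤ i = subst (_≤ (f + ι d) * V i) (sym (adj-neighbour-sum P (power-separated separated) V i))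
        (by-kind {Q = λ i → neighbour-sum P V i ≤ (f + ι d) * V i} at-vertex (λ e t → ≤-reflexive (spread-new f x e t)) i)
        where
        at-vertex : ∀ u → neighbour-sum P V (vertex u) ≤ (f + ι d) * V (vertex u)
        at-vertex u = subst₂ _≤_ (sym (trans (spread-vertex f x u) (cong (λ s → (f + 1ℚ + ι d) * s + ι d * (degree u * x u)) (sym (A·≡ x u)))))
          (trans (*-assoc (f + ι d) (f + 1ℚ) (x u)) (cong ((f + ι d) *_) (sym (fill-vertex (λ u → (f + 1ℚ) * x u) (edge-sum G x) u))))
          (diff-≤ (subst (0ℚ ≤_) (Reduced-· d f x u) (<⇒≤ (Mx>0 u))))
      BV≤ : ∀ i → ((λ i j → c * adj P i j) · V) i ≤ (f + ι d) * c * V i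
      BV≤ i = subst₂ _≤_ (trans (sym (Σ-*ˡ c (λ j → adj P i j * V j))) (Σ-cong λ j → sym (*-assoc c (adj P i j) (V j)))) (eq c (f + ι d) (V i))
        (scale-≤ 0≤c (AV≤ i))
        where
        eq = solve 3 (λ c p v → c :* (p :* v) := p :* c :* v) refl

    radius-bound : ∀ d f → 0ℚ ≤ f → Supersolution (Reduced d f) →
      ∀ {H ρ} → H ≅ power (suc (suc d)) G → IsSpectralRadius (adjacency (suc (suc d)) H) ρ →
      ρ ≤ʳ fromℚ ((f + ι d) * 1/[1+ d ])
    radius-bound d f 0≤f sup {H} {ρ} φ isρ = go (IsSpectralRadius.attained isρ)
      where
      v : ℝ
      v = fromℚ ((f + ι d) * 1/[1+ d ])
      0≤v : 0ℝ ≤ʳ v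
      0≤v = pointwise-≤ {0ℝ} {v} λ _ → (0≤f ⊞ 0≤ι d) ⊠ nonNegative⁻¹ 1/[1+ d ] {{normalize-nonNeg 1 (suc d)}}
      go : (∃[ μ ] IsEigenvalue (adjacency (suc (suc d)) H) μ × ∣ μ ∣² ≈ʳ ρ *ʳ ρ) → ρ ≤ʳ v
      go (μ , eig , ∣μ∣²≈ρ²) = square-cancel-≤ {ρ} {v} 0≤v
        (≤ʳ-trans {ρ *ʳ ρ} {∣ μ ∣²} {v *ʳ v} (≈⇒≤ {ρ *ʳ ρ} {∣ μ ∣²} (≈-sym {∣ μ ∣²} {ρ *ʳ ρ} ∣μ∣²≈ρ²))
          (spectral-bound d f 0≤f sup {μ} (eigenvalue-≅ {d} {H} {power (suc (suc d)) G} {μ} φ eig)))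

-- From cycles of a graph to loose cycles of its power.

module LooseCycles where
  open AdjacencyOperators
  open Graphs
  open import Defs hiding (_≈_; _≤_)
  open import Data.Bool.Base using (true)
  open import Data.Fin.Base using (Fin; zero; suc)
  open import Data.Fin.Patterns using (0F; 1F; 2F; 3F)
  open import Data.Fin.Properties using (any?; all?; pigeonhole; <⇒≢; ↑ˡ-injective) renaming (_≟_ to _≟ᶠ_)
  open import Data.Fin.Subset using (Subset; _∈_; _∩_; ⁅_⁆)
  open import Data.Fin.Subset.Properties using (⊆-antisym; x∈p∩q⁺; x∈p∩q⁻; x∈⁅x⁆; x∈⁅y⁆⇒x≡y)
  open import Data.List.Base as List using (List; allFin)
  open import Data.List.Membership.Propositional.Properties using (∈-allFin; ∈-lookup)
  open import Data.List.Relation.Unary.All as All using (All; []; _∷_)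
  open import Data.List.Relation.Unary.AllPairs using ([]; _∷_)
  open import Data.List.Relation.Unary.Unique.Propositional using (Unique)
  open import Data.List.Membership.Propositional using () renaming (_∈_ to _∈ˡ_; _∉_ to _∉ˡ_)
  open import Data.Nat.Base as ℕ using (ℕ; suc)
  import Data.Nat.Properties as ℕₚ
  open import Data.Product.Base using (∃-syntax; _×_; _,_; proj₁; proj₂)
  open import Data.Sum.Base using (_⊎_; inj₁; inj₂)
  open import Data.Empty using () renaming (⊥ to Absurd)
  import Data.Vec.Base as Vec
  open import Data.Vec.Properties using (lookup∘tabulate; []=⇒lookup; lookup⇒[]=)
  open import Function.Base using (_∘_)
  open import Function.Bundles using (Inverse; Equivalence; mk⇔)
  open import Relation.Nullary using (¬_; Dec; yes; does)
  open import Relation.Nullary.Decidable using (toWitness; _→-dec_; ¬?; dec-true)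
  open import Relation.Nullary.Negation using (contradiction)
  open import Relation.Binary.PropositionalEquality

  by-cases : ∀ {n p} {P : Fin n → Set p} → All P (allFin n) → ∀ i → P i
  by-cases ps i = All.lookup ps (∈-allFin i)

  lookup-injective : ∀ {a} {B : Set a} {xs : List B} → Unique xs → ∀ i j → List.lookup xs i ≡ List.lookup xs j → i ≡ j
  lookup-injective (_ ∷ _)    zero    zero    _  = refl
  lookup-injective (x∉ ∷ _)   zero    (suc j) eq = contradiction eq (All.lookup x∉ (∈-lookup j))
  lookup-injective (x∉ ∷ _)   (suc i) zero    eq = contradiction (sym eq) (All.lookup x∉ (∈-lookup i))
  lookup-injective (_ ∷ uniq) (suc i) (suc j) eq = cong suc (lookup-injective uniq i j eq)

  -- All that is needed about `next`, which is defined through remainders. Only lengths 3, 4 and 5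
  -- occur, and for these the laws are checked by evaluation.
  record CyclicOrder (l : ℕ) : Set where
    field
      l≥3    : 3 ℕ.≤ l
      next≢  : (i : Fin l) → next i ≢ i
      next²≢ : (i : Fin l) → next (next i) ≢ i
      inj    : (i j : Fin l) → next i ≡ next j → i ≡ j

  cyclic₃ : CyclicOrder 3
  cyclic₃ = record
    { l≥3 = ℕₚ.≤-refl
    ; next≢ = toWitness {a? = all? λ i → ¬? (next i ≟ᶠ i)} _
    ; next²≢ = toWitness {a? = all? λ i → ¬? (next (next i) ≟ᶠ i)} _
    ; inj = toWitness {a? = all? λ i → all? λ j → (next i ≟ᶠ next j) →-dec (i ≟ᶠ j)} _
    }

  cyclic₄ : CyclicOrder 4
  cyclic₄ = record
    { l≥3 = ℕₚ.m≤m+n 3 1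
    ; next≢ = toWitness {a? = all? λ i → ¬? (next i ≟ᶠ i)} _
    ; next²≢ = toWitness {a? = all? λ i → ¬? (next (next i) ≟ᶠ i)} _
    ; inj = toWitness {a? = all? λ i → all? λ j → (next i ≟ᶠ next j) →-dec (i ≟ᶠ j)} _
    }

  cyclic₅ : CyclicOrder 5
  cyclic₅ = record
    { l≥3 = ℕₚ.m≤m+n 3 2
    ; next≢ = toWitness {a? = all? λ i → ¬? (next i ≟ᶠ i)} _
    ; next²≢ = toWitness {a? = all? λ i → ¬? (next (next i) ≟ᶠ i)} _
    ; inj = toWitness {a? = all? λ i → all? λ j → (next i ≟ᶠ next j) →-dec (i ≟ᶠ j)} _
    }

  record GraphCycle (G : Hypergraph) : Set where
    field
      len    : ℕ
      cyclic : CyclicOrder len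
      v      : Fin len → Fin (order G)
      e      : Fin len → Fin (size G)
      v-inj  : ∀ i j → v i ≡ v j → i ≡ j
      step   : ∀ i → Joins G (e i) (v i) (v (next i))

  -- New vertices lie in a single edge, so the edges of the power meet exactly where those of the
  -- graph do. That `next` applied twice moves every index makes consecutive edges meet in one
  -- vertex only.
  module LooseCycle (d : ℕ) {G H : Hypergraph} (φ : H ≅ power (suc (suc d)) G) (Γ : GraphCycle G) where
    open GraphCycle Γ
    open CyclicOrder cyclic
    open Power d G using (P; vertex; new; by-kind; new∈; vertex∈; vertex∈⁺)
    module V = Inverse (_≅_.vertices φ)
    module E = Inverse (_≅_.edges φ)

    private
      meet : ∀ i j → i ≢ j → j ≢ next i → i ≢ next j → ∀ {w} → w ∈ edge G (e i) → w ∈ edge G (e j) → Absurd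
      meet i j i≢j j≢ni i≢nj w∈i w∈j with proj₂ (proj₂ (proj₂ (step i))) w∈i | proj₂ (proj₂ (proj₂ (step j))) w∈j
      ... | inj₁ p | inj₁ q = i≢j (v-inj i j (trans (sym p) q))
      ... | inj₁ p | inj₂ q = i≢nj (v-inj i (next j) (trans (sym p) q))
      ... | inj₂ p | inj₁ q = j≢ni (v-inj j (next i) (trans (sym q) p))
      ... | inj₂ p | inj₂ q = i≢j (inj i j (v-inj (next i) (next j) (trans (sym p) q)))

      meet-next : ∀ i {w} → w ∈ edge G (e i) → w ∈ edge G (e (next i)) → w ≡ v (next i)
      meet-next i w∈i w∈j with proj₂ (proj₂ (proj₂ (step i))) w∈i | proj₂ (proj₂ (proj₂ (step (next i)))) w∈j
      ... | inj₂ p | _      = p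
      ... | inj₁ p | inj₁ q = q
      ... | inj₁ p | inj₂ q = contradiction (v-inj (next (next i)) i (trans (sym q) p)) (next²≢ i)

      edges-apart : ∀ i → e i ≢ e (next i)
      edges-apart i eq = next≢ i (v-inj (next i) i (sym (meet-next i (proj₁ (proj₂ (step i)))
        (subst (λ f → v i ∈ edge G f) eq (proj₁ (proj₂ (step i)))))))

      meetᴾ : ∀ i j → i ≢ j → j ≢ next i → i ≢ next j → ∀ x → x ∈ edge P (e i) → x ∈ edge P (e j) → Absurd
      meetᴾ i j i≢j j≢ni i≢nj = by-kind
        (λ u p q → meet i j i≢j j≢ni i≢nj (vertex∈ p) (vertex∈ q))
        (λ g t p q → meet i j i≢j j≢ni i≢nj (proj₁ (proj₂ (step i)))
          (subst (λ f → v i ∈ edge G f) (trans (new∈ p) (sym (new∈ q))) (proj₁ (proj₂ (step i)))))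

      meet-nextᴾ : ∀ i x → x ∈ edge P (e i) → x ∈ edge P (e (next i)) → x ≡ vertex (v (next i))
      meet-nextᴾ i = by-kind
        (λ u p q → cong vertex (meet-next i (vertex∈ p) (vertex∈ q)))
        (λ g t p q → contradiction (trans (new∈ p) (sym (new∈ q))) (edges-apart i))

      toP : ∀ {x g} → x ∈ edge H (E.from g) → V.to x ∈ edge P g
      toP {x} {g} p = subst (λ g → V.to x ∈ edge P g) (E.strictlyInverseˡ g) (Equivalence.to (_≅_.incidence φ x (E.from g)) p)

      fromP : ∀ {x g} → x ∈ edge P g → V.from x ∈ edge H (E.from g)
      fromP {x} {g} p = Equivalence.from (_≅_.incidence φ (V.from x) (E.from g))
        (subst₂ (λ x g → x ∈ edge P g) (sym (V.strictlyInverseˡ x)) (sym (E.strictlyInverseˡ g)) p)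

    edge-set : Subset (size H)
    edge-set = Vec.tabulate λ f → does (any? λ i → e i ≟ᶠ E.to f)

    ∈edge-set : ∀ {f} → f ∈ edge-set → ∃[ i ] e i ≡ E.to f
    ∈edge-set {f} p = go (any? λ i → e i ≟ᶠ E.to f) (trans (sym (lookup∘tabulate _ f)) ([]=⇒lookup p))
      where
      go : (dec : Dec (∃[ i ] e i ≡ E.to f)) → does dec ≡ true → ∃[ i ] e i ≡ E.to f
      go (yes q) _ = q

    edge-set∋ : ∀ {f} → (∃[ i ] e i ≡ E.to f) → f ∈ edge-set
    edge-set∋ {f} q = lookup⇒[]= f edge-set (trans (lookup∘tabulate _ f) (dec-true (any? λ i → e i ≟ᶠ E.to f) q))

    isLooseCycle : IsLooseCycle H edge-set
    isLooseCycle = record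
      { length      = len
      ; length≥3    = l≥3
      ; v           = V.from ∘ vertex ∘ v
      ; e           = E.from ∘ e
      ; v-distinct  = λ {i} {j} eq → v-inj i j (↑ˡ-injective _ (v i) (v j)
          (trans (sym (V.strictlyInverseˡ _)) (trans (cong V.to eq) (V.strictlyInverseˡ _))))
      ; consecutive = λ i → ⊆-antisym
          (λ {x} x∈ → let p , q = x∈p∩q⁻ (edge H (E.from (e i))) (edge H (E.from (e (next i)))) x∈ in
            subst (_∈ ⁅ V.from (vertex (v (next i))) ⁆)
              (trans (cong V.from (sym (meet-nextᴾ i (V.to x) (toP p) (toP q)))) (V.strictlyInverseʳ x)) (x∈⁅x⁆ _))
          (λ {x} x∈ → subst (_∈ edge H (E.from (e i)) ∩ edge H (E.from (e (next i)))) (sym (x∈⁅y⁆⇒x≡y _ x∈))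
            (x∈p∩q⁺ (fromP (vertex∈⁺ (proj₁ (proj₂ (proj₂ (step i))))) , fromP (vertex∈⁺ (proj₁ (proj₂ (step (next i))))))))
      ; disjoint    = λ i j i≢j j≢ni i≢nj (x , x∈) →
          let p , q = x∈p∩q⁻ (edge H (E.from (e i))) (edge H (E.from (e j))) x∈ in
          meetᴾ i j i≢j j≢ni i≢nj (V.to x) (toP p) (toP q)
      ; edges       = λ f → mk⇔
          (λ f∈ → let i , eq = ∈edge-set f∈ in i , trans (cong E.from eq) (E.strictlyInverseʳ f))
          (λ (i , eq) → edge-set∋ (i , trans (sym (E.strictlyInverseˡ (e i))) (cong E.to eq)))
      }

  -- Cycles are told apart by their edges avoiding u.
  record CycleAvoiding (G : Hypergraph) (u : Fin (order G)) (L : List (Fin (size G))) : Set where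
    field
      cycle    : GraphCycle G
      contains : ∀ {f} → f ∈ˡ L → ∃[ i ] GraphCycle.e cycle i ≡ f
      only     : ∀ i → ¬ (u ∈ edge G (GraphCycle.e cycle i)) → GraphCycle.e cycle i ∈ˡ L

  Differ : ∀ {k} → List (Fin k) → List (Fin k) → Set
  Differ L L′ = (∃[ f ] f ∈ˡ L × f ∉ˡ L′) ⊎ (∃[ f ] f ∈ˡ L′ × f ∉ˡ L)

  module AtMostThree (d : ℕ) {G H : Hypergraph} (φ : H ≅ power (suc (suc d)) G) (three : ThreeCyclic H)
    (u : Fin (order G)) where

    module E = Inverse (_≅_.edges φ)

    -- By `three` each of the four edge sets is one of three, so two of them agree by the pigeonhole
    -- principle. An edge avoiding u that belongs to just one of the two cycles excludes this.
    no-four-cycles : (L : Fin 4 → List (Fin (size G))) → (∀ i → CycleAvoiding G u (L i)) →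
      (∀ i → All (λ f → ¬ (u ∈ edge G f)) (L i)) →
      Differ (L 0F) (L 1F) → Differ (L 0F) (L 2F) → Differ (L 0F) (L 3F) →
      Differ (L 1F) (L 2F) → Differ (L 1F) (L 3F) → Differ (L 2F) (L 3F) → Absurd
    no-four-cycles L Γ avoid d₀₁ d₀₂ d₀₃ d₁₂ d₁₃ d₂₃ =
      let i , j , i<j , eq = pigeonhole {3} {4} ℕₚ.≤-refl index in
      <⇒≢ i<j (same i j (trans (sym (index-eq i)) (trans (cong (proj₁ three) eq) (index-eq j))))
      where
      module C i = LooseCycle d φ (CycleAvoiding.cycle (Γ i))
      index : Fin 4 → Fin 3
      index i = proj₁ (Equivalence.to (proj₂ (proj₂ three) (C.edge-set i)) (C.isLooseCycle i))
      index-eq : ∀ i → proj₁ three (index i) ≡ C.edge-set i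
      index-eq i = proj₂ (Equivalence.to (proj₂ (proj₂ three) (C.edge-set i)) (C.isLooseCycle i))
      separate : ∀ i j {f} → f ∈ˡ L i → f ∉ˡ L j → C.edge-set i ≢ C.edge-set j
      separate i j {f} f∈ f∉ eq =
        let h , eh = CycleAvoiding.contains (Γ i) f∈
            p = C.edge-set∋ i {E.from f} (h , trans eh (sym (E.strictlyInverseˡ f)))
            h′ , eh′ = C.∈edge-set j (subst (E.from f ∈_) eq p)
            e≡f = trans eh′ (E.strictlyInverseˡ f)
        in f∉ (subst (_∈ˡ L j) e≡f (CycleAvoiding.only (Γ j) h′ (subst (λ g → ¬ (u ∈ edge G g)) (sym e≡f) (All.lookup (avoid i) f∈))))
      differ : ∀ i j → Differ (L i) (L j) → C.edge-set i ≢ C.edge-set j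
      differ i j (inj₁ (f , p , q)) eq = separate i j p q eq
      differ i j (inj₂ (f , p , q)) eq = separate j i p q (sym eq)
      same : ∀ i j → C.edge-set i ≡ C.edge-set j → i ≡ j
      same i j eq = lookup-injective {xs = List.tabulate C.edge-set}
        ((differ 0F 1F d₀₁ ∷ differ 0F 2F d₀₂ ∷ differ 0F 3F d₀₃ ∷ []) ∷ (differ 1F 2F d₁₂ ∷ differ 1F 3F d₁₃ ∷ []) ∷
          (differ 2F 3F d₂₃ ∷ []) ∷ [] ∷ []) i j
        (trans (at i) (trans eq (sym (at j))))
        where
        at : ∀ i → List.lookup (List.tabulate C.edge-set) i ≡ C.edge-set i
        at = by-cases (refl ∷ refl ∷ refl ∷ refl ∷ [])

-- Triangles, quadrilaterals and pentagons near a vertex.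

module CyclesThroughVertices where
  open Graphs
  open LooseCycles
  open import Defs hiding (_≈_; _≤_)
  open import Data.Fin.Base using (Fin)
  open import Data.Fin.Patterns using (0F; 1F; 2F; 3F)
  open import Data.Fin.Subset using (_∈_)
  open import Data.List.Base using ([]; _∷_; lookup)
  open import Data.List.Relation.Unary.All as All using (All; []; _∷_)
  open import Data.List.Relation.Unary.AllPairs using ([]; _∷_)
  open import Data.List.Relation.Unary.Any using (here; there)
  open import Data.Product.Base using (∃-syntax; _,_; proj₁)
  open import Function.Base using (_∘_)
  open import Relation.Nullary.Negation using (contradiction)
  open import Relation.Binary.PropositionalEquality

  module ShortCycles (G : Hypergraph) (u : Fin (order G)) where

    private
      ∋u : ∀ {e x} → Joins G e u x → u ∈ edge G e
      ∋u (_ , u∈ , _) = u∈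

      sym′ : ∀ {e a b} → Joins G e a b → Joins G e b a
      sym′ {e} = joins-sym {G} {e}

    triangle : ∀ {a b s t e} → Joins G s u a → Joins G t u b → Joins G e a b → CycleAvoiding G u (e ∷ [])
    triangle {a} {b} {s} {t} {e} js jt je = record
      { cycle = record
        { len = 3 ; cyclic = cyclic₃ ; v = lookup (u ∷ a ∷ b ∷ []) ; e = lookup (s ∷ e ∷ t ∷ [])
        ; v-inj = lookup-injective ((proj₁ js ∷ proj₁ jt ∷ []) ∷ (proj₁ je ∷ []) ∷ [] ∷ [])
        ; step = by-cases (js ∷ je ∷ sym′ jt ∷ [])
        }
      ; contains = All.lookup {P = λ x → ∃[ i ] lookup (s ∷ e ∷ t ∷ []) i ≡ x} ((1F , refl) ∷ [])
      ; only = by-cases ((λ u∉ → contradiction (∋u js) u∉) ∷ (λ _ → here refl) ∷ (λ u∉ → contradiction (∋u jt) u∉) ∷ [])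
      }

    quadrilateral : ∀ {a w b s t g h} → Joins G s u a → Joins G t u b → Joins G g a w → Joins G h w b →
      u ≢ w → a ≢ b → CycleAvoiding G u (g ∷ h ∷ [])
    quadrilateral {a} {w} {b} {s} {t} {g} {h} js jt jg jh u≢w a≢b = record
      { cycle = record
        { len = 4 ; cyclic = cyclic₄ ; v = lookup (u ∷ a ∷ w ∷ b ∷ []) ; e = lookup (s ∷ g ∷ h ∷ t ∷ [])
        ; v-inj = lookup-injective ((proj₁ js ∷ u≢w ∷ proj₁ jt ∷ []) ∷ (proj₁ jg ∷ a≢b ∷ []) ∷ (proj₁ jh ∷ []) ∷ [] ∷ [])
        ; step = by-cases (js ∷ jg ∷ jh ∷ sym′ jt ∷ [])
        }
      ; contains = All.lookup {P = λ x → ∃[ i ] lookup (s ∷ g ∷ h ∷ t ∷ []) i ≡ x} ((1F , refl) ∷ (2F , refl) ∷ [])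
      ; only = by-cases ((λ u∉ → contradiction (∋u js) u∉) ∷ (λ _ → here refl) ∷ (λ _ → there (here refl)) ∷
          (λ u∉ → contradiction (∋u jt) u∉) ∷ [])
      }

    pentagon : ∀ {y a w b s t f g h} → Joins G s u y → Joins G t u b → Joins G f y a → Joins G g a w → Joins G h w b →
      u ≢ a → u ≢ w → y ≢ w → y ≢ b → a ≢ b → CycleAvoiding G u (f ∷ g ∷ h ∷ [])
    pentagon {y} {a} {w} {b} {s} {t} {f} {g} {h} js jt jf jg jh u≢a u≢w y≢w y≢b a≢b = record
      { cycle = record
        { len = 5 ; cyclic = cyclic₅ ; v = lookup (u ∷ y ∷ a ∷ w ∷ b ∷ []) ; e = lookup (s ∷ f ∷ g ∷ h ∷ t ∷ [])
        ; v-inj = lookup-injective ((proj₁ js ∷ u≢a ∷ u≢w ∷ proj₁ jt ∷ []) ∷ (proj₁ jf ∷ y≢w ∷ y≢b ∷ []) ∷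
            (proj₁ jg ∷ a≢b ∷ []) ∷ (proj₁ jh ∷ []) ∷ [] ∷ [])
        ; step = by-cases (js ∷ jf ∷ jg ∷ jh ∷ sym′ jt ∷ [])
        }
      ; contains = All.lookup {P = λ x → ∃[ i ] lookup (s ∷ f ∷ g ∷ h ∷ t ∷ []) i ≡ x} ((1F , refl) ∷ (2F , refl) ∷ (3F , refl) ∷ [])
      ; only = by-cases ((λ u∉ → contradiction (∋u js) u∉) ∷ (λ _ → here refl) ∷ (λ _ → there (here refl)) ∷
          (λ _ → there (there (here refl))) ∷ (λ u∉ → contradiction (∋u jt) u∉) ∷ [])
      }

    -- The only cycle here that does not pass through u. It takes the place of a pentagon whose
    -- neighbours y and b of u coincide.
    outer-triangle : ∀ {a w b f g h} → Joins G f b a → Joins G g a w → Joins G h w b → CycleAvoiding G u (f ∷ g ∷ h ∷ [])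
    outer-triangle {a} {w} {b} {f} {g} {h} jf jg jh = record
      { cycle = record
        { len = 3 ; cyclic = cyclic₃ ; v = lookup (b ∷ a ∷ w ∷ []) ; e = lookup (f ∷ g ∷ h ∷ [])
        ; v-inj = lookup-injective ((proj₁ jf ∷ (proj₁ jh ∘ sym) ∷ []) ∷ (proj₁ jg ∷ []) ∷ [] ∷ [])
        ; step = by-cases (jf ∷ jg ∷ jh ∷ [])
        }
      ; contains = All.lookup {P = λ x → ∃[ i ] lookup (f ∷ g ∷ h ∷ []) i ≡ x} ((0F , refl) ∷ (1F , refl) ∷ (2F , refl) ∷ [])
      ; only = by-cases ((λ _ → here refl) ∷ (λ _ → there (here refl)) ∷ (λ _ → there (there (here refl))) ∷ [])
      }

-- Isomorphisms of graphs and of their powers.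

module Isomorphisms where
  open AdjacencyOperators
  open PendantEdges
  open Graphs
  open import Defs hiding (_≈_; _≤_)
  open import Data.Bool.Base using (true)
  open import Data.Fin.Base using (Fin; zero; suc; splitAt; combine; remQuot)
  open import Data.Fin.Patterns using (0F)
  open import Data.Fin.Permutation using (_⟨$⟩ʳ_; _⟨$⟩ˡ_; inverseˡ; transpose; _∘ₚ_) renaming (id to idₚ)
  open import Data.Fin.Properties using (+↔⊎; *↔×; splitAt-↑ˡ; splitAt-↑ʳ; remQuot-combine) renaming (_≟_ to _≟ᶠ_)
  open import Data.Fin.Subset using (_∈_)
  open import Data.Fin.Subset.Properties using (⊆-antisym)
  open import Data.Nat.Base as ℕ using (ℕ; zero; suc)
  open import Data.Product.Base using (∃-syntax; ∃₂; _×_; _,_; proj₁; proj₂)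
  open import Data.Product.Function.NonDependent.Propositional using (_×-↔_)
  open import Data.Sum.Base as Sum⊎ using (_⊎_; inj₁; inj₂)
  open import Data.Sum.Function.Propositional using (_⊎-↔_)
  open import Function.Base using (_∘_; case_of_)
  open import Function.Bundles using (Inverse; mk⇔; mk↔ₛ′; _⇔_; _↔_)
  open import Function.Construct.Composition using (_↔-∘_; _⇔-∘_)
  open import Function.Construct.Identity using (↔-id)
  open import Function.Construct.Symmetry using (↔-sym; ⇔-sym)
  open import Relation.Nullary using (¬_; Dec; yes; does)
  open import Relation.Nullary.Decidable using (dec-true; dec-false)
  open import Relation.Nullary.Negation using (contradiction)
  open import Relation.Binary.PropositionalEquality

  transpose-at : ∀ {n} (i j : Fin n) → transpose i j ⟨$⟩ʳ i ≡ j
  transpose-at i j rewrite dec-true (i ≟ᶠ i) refl = refl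

  transpose-fixes : ∀ {n} (i j k : Fin n) → k ≢ i → k ≢ j → transpose i j ⟨$⟩ʳ k ≡ k
  transpose-fixes i j k k≢i k≢j rewrite dec-false (k ≟ᶠ i) k≢i | dec-false (k ≟ᶠ j) k≢j = refl

  -- The permutation found for the remaining points is corrected by one transposition, which by
  -- injectivity fixes the values already matched.
  align : ∀ {p n} (f g : Fin p → Fin n) → (∀ i j → f i ≡ f j → i ≡ j) → (∀ i j → g i ≡ g j → i ≡ j) →
    ∃[ π ] ∀ i → _⟨$⟩ʳ_ {n} {n} π (f i) ≡ g i
  align {zero}  f g f-inj g-inj = idₚ , λ ()
  align {suc p} f g f-inj g-inj = π ∘ₚ transpose (π ⟨$⟩ʳ f zero) (g zero) , agrees
    where
    suc-inj : ∀ {i j : Fin p} → _≡_ {A = Fin (suc p)} (suc i) (suc j) → i ≡ j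
    suc-inj refl = refl
    IH = align (f ∘ suc) (g ∘ suc) (λ i j eq → suc-inj (f-inj _ _ eq)) (λ i j eq → suc-inj (g-inj _ _ eq))
    π = proj₁ IH
    agrees : ∀ i → transpose (π ⟨$⟩ʳ f zero) (g zero) ⟨$⟩ʳ (π ⟨$⟩ʳ f i) ≡ g i
    agrees zero    = transpose-at (π ⟨$⟩ʳ f zero) (g zero)
    agrees (suc i) = trans (transpose-fixes (π ⟨$⟩ʳ f zero) (g zero) _
        (λ eq → case f-inj _ _ (trans (sym (inverseˡ π)) (trans (cong (π ⟨$⟩ˡ_) eq) (inverseˡ π))) of λ ())
        (λ eq → case g-inj (suc i) zero (trans (sym (proj₂ IH i)) eq) of λ ()))
      (proj₂ IH i)

  -- A bijection of vertices that carries edges to edges both ways. The maps of edges are then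
  -- mutually inverse because distinct edges have distinct vertex sets.
  graph-≅ : ∀ {G H} (π : Fin (order G) ↔ Fin (order H)) → let open Inverse π in
    (∀ e → ∃₂ λ a b → ∃[ e′ ] Joins G e a b × Joins H e′ (to a) (to b)) →
    (∀ e′ → ∃₂ λ a b → ∃[ e ] Joins H e′ a b × Joins G e (from a) (from b)) → G ≅ H
  graph-≅ {G} {H} π forth back = record
    { vertices = π ; edges = mk↔ₛ′ fwd bwd fwd-bwd bwd-fwd ; incidence = λ v e → mk⇔ (fwd-∈ v e) (fwd-∋ v e) }
    where
    open Inverse π
    fwd : Fin (size G) → Fin (size H)
    fwd e = let _ , _ , e′ , _ = forth e in e′
    bwd : Fin (size H) → Fin (size G)
    bwd e′ = let _ , _ , e , _ = back e′ in e
    to-inj : ∀ {x y} → to x ≡ to y → x ≡ y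
    to-inj {x} {y} eq = trans (sym (strictlyInverseʳ x)) (trans (cong from eq) (strictlyInverseʳ y))
    fwd-∈ : ∀ v e → v ∈ edge G e → to v ∈ edge H (fwd e)
    fwd-∈ v e v∈ with forth e
    ... | a , b , e′ , (_ , _ , _ , only) , (_ , a∈ , b∈ , _) with only v∈
    ...   | inj₁ refl = a∈
    ...   | inj₂ refl = b∈
    fwd-∋ : ∀ v e → to v ∈ edge H (fwd e) → v ∈ edge G e
    fwd-∋ v e v∈ with forth e
    ... | a , b , e′ , (_ , a∈ , b∈ , _) , (_ , _ , _ , only) with only v∈
    ...   | inj₁ eq = subst (_∈ edge G e) (sym (to-inj eq)) a∈
    ...   | inj₂ eq = subst (_∈ edge G e) (sym (to-inj eq)) b∈
    bwd-∈ : ∀ v e → v ∈ edge H e → from v ∈ edge G (bwd e)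
    bwd-∈ v e v∈ with back e
    ... | a , b , e′ , (_ , _ , _ , only) , (_ , a∈ , b∈ , _) with only v∈
    ...   | inj₁ refl = a∈
    ...   | inj₂ refl = b∈
    bwd-∋ : ∀ v e → from v ∈ edge G (bwd e) → v ∈ edge H e
    bwd-∋ v e v∈ with back e
    ... | a , b , e′ , (_ , a∈ , b∈ , _) , (_ , _ , _ , only) with only v∈
    ...   | inj₁ eq = subst (_∈ edge H e) (trans (sym (strictlyInverseˡ a)) (trans (cong to (sym eq)) (strictlyInverseˡ v))) a∈
    ...   | inj₂ eq = subst (_∈ edge H e) (trans (sym (strictlyInverseˡ b)) (trans (cong to (sym eq)) (strictlyInverseˡ v))) b∈
    fwd-bwd : ∀ e → fwd (bwd e) ≡ e
    fwd-bwd e = distinct H (⊆-antisym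
      (λ {v} v∈ → bwd-∋ v e (fwd-∋ (from v) (bwd e) (subst (_∈ edge H (fwd (bwd e))) (sym (strictlyInverseˡ v)) v∈)))
      (λ {v} v∈ → subst (_∈ edge H (fwd (bwd e))) (strictlyInverseˡ v) (fwd-∈ (from v) (bwd e) (bwd-∈ v e v∈))))
    bwd-fwd : ∀ e → bwd (fwd e) ≡ e
    bwd-fwd e = distinct G (⊆-antisym
      (λ {v} v∈ → fwd-∋ v e (bwd-∋ (to v) (fwd e) (subst (_∈ edge G (bwd (fwd e))) (sym (strictlyInverseʳ v)) v∈)))
      (λ {v} v∈ → subst (_∈ edge G (bwd (fwd e))) (strictlyInverseʳ v) (bwd-∈ (to v) (fwd e) (fwd-∈ v e v∈))))

  Incident : ∀ d G → Fin (size G) → Fin (order G) ⊎ (Fin (size G) × Fin d) → Set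
  Incident d G e (inj₁ x)       = x ∈ edge G e
  Incident d G e (inj₂ (f , _)) = e ≡ f

  -- The vertex set of a power as a disjoint sum in place of a numbering. Attaching an edge to a
  -- power and taking the power of an extended graph number the vertices differently, and this form
  -- hides the difference.
  record PowerOf (d : ℕ) (H G : Hypergraph) : Set where
    field
      vertices  : Fin (order H) ↔ (Fin (order G) ⊎ (Fin (size G) × Fin d))
      edges     : Fin (size H) ↔ Fin (size G)
      incidence : ∀ v e → (v ∈ edge H e) ⇔ Incident d G (Inverse.to edges e) (Inverse.to vertices v)

  power-powerOf : ∀ d G → PowerOf d (power (suc (suc d)) G) G
  power-powerOf d G = record
    { vertices  = (↔-id _ ⊎-↔ *↔×) ↔-∘ +↔⊎
    ; edges     = ↔-id _
    ; incidence = λ v e → by-kind {Q = λ v → (v ∈ edge P e) ⇔ Incident d G e (to v)}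
        (λ u → subst (λ s → (vertex u ∈ edge P e) ⇔ Incident d G e s) (sym (to-vertex u)) (mk⇔ vertex∈ vertex∈⁺))
        (λ f t → subst (λ s → (new f t ∈ edge P e) ⇔ Incident d G e s) (sym (to-new f t)) (mk⇔ new∈ λ { refl → new∈⁺ e t })) v
    }
    where
    open Power d G
    open Inverse ((↔-id (Fin n) ⊎-↔ *↔× {k} {d}) ↔-∘ +↔⊎ {n} {k ℕ.* d}) using (to)
    to-vertex : ∀ u → to (vertex u) ≡ inj₁ u
    to-vertex u = cong (Sum⊎.map _ _) (splitAt-↑ˡ n u (k ℕ.* d))
    to-new : ∀ f t → to (new f t) ≡ inj₂ (f , t)
    to-new f t = trans (cong (Sum⊎.map _ (remQuot {k} d)) (splitAt-↑ʳ n (k ℕ.* d) (combine f t))) (cong inj₂ (remQuot-combine {k} {d} f t))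

  powerOf-≅ : ∀ {d G H} → H ≅ power (suc (suc d)) G → PowerOf d H G
  powerOf-≅ {d} {G} {H} φ = record
    { vertices  = P.vertices ↔-∘ _≅_.vertices φ
    ; edges     = P.edges ↔-∘ _≅_.edges φ
    ; incidence = λ v e → P.incidence (Inverse.to (_≅_.vertices φ) v) (Inverse.to (_≅_.edges φ) e) ⇔-∘ _≅_.incidence φ v e
    }
    where module P = PowerOf (power-powerOf d G)

  ≅-powers : ∀ {d G G′ H H′} → PowerOf d H G → PowerOf d H′ G′ → G ≅ G′ → H ≅ H′
  ≅-powers {d} {G} {G′} {H} {H′} φ φ′ ψ = record
    { vertices  = ↔-sym φ′.vertices ↔-∘ ((ψ.vertices ⊎-↔ (ψ.edges ×-↔ ↔-id _)) ↔-∘ φ.vertices)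
    ; edges     = ↔-sym φ′.edges ↔-∘ (ψ.edges ↔-∘ φ.edges)
    ; incidence = λ v e → back (middle e (Inverse.to φ.vertices v)) ⇔-∘ (move (Inverse.to φ.edges e) (Inverse.to φ.vertices v) ⇔-∘ φ.incidence v e)
    }
    where
    module φ = PowerOf φ
    module φ′ = PowerOf φ′
    module ψ = _≅_ ψ
    τ : Fin (order G) ⊎ (Fin (size G) × Fin d) → Fin (order G′) ⊎ (Fin (size G′) × Fin d)
    τ = Inverse.to (ψ.vertices ⊎-↔ (ψ.edges ×-↔ ↔-id (Fin d)))
    move : ∀ e s → Incident d G e s ⇔ Incident d G′ (Inverse.to ψ.edges e) (τ s)
    move e (inj₁ x)       = ψ.incidence x e
    move e (inj₂ (f , t)) = mk⇔ (cong (Inverse.to ψ.edges))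
      (λ eq → trans (sym (Inverse.strictlyInverseʳ ψ.edges e)) (trans (cong (Inverse.from ψ.edges) eq) (Inverse.strictlyInverseʳ ψ.edges f)))
    middle : ∀ e s → ((Inverse.from φ′.vertices (τ s)) ∈ edge H′ (Inverse.from φ′.edges (Inverse.to ψ.edges (Inverse.to φ.edges e)))) ⇔
      Incident d G′ (Inverse.to ψ.edges (Inverse.to φ.edges e)) (τ s)
    middle e s = subst₂ (λ f w → (Inverse.from φ′.vertices (τ s) ∈ edge H′ (Inverse.from φ′.edges (Inverse.to ψ.edges (Inverse.to φ.edges e)))) ⇔ Incident d G′ f w)
      (Inverse.strictlyInverseˡ φ′.edges _) (Inverse.strictlyInverseˡ φ′.vertices _) (φ′.incidence _ _)
    back : ∀ {A B : Set} → A ⇔ B → B ⇔ A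
    back = ⇔-sym

  -- Attaching pendant edges commutes with taking powers, provided that the edge is attached at an
  -- original vertex of the graph.
  module PowerAttach {d : ℕ} {H G : Hypergraph} (φ : PowerOf d H G) (v : Fin (order H)) (g : Fin (order G))
    (v↦g : Inverse.to (PowerOf.vertices φ) v ≡ inj₁ g) where

    module φ = PowerOf φ
    module V = Inverse φ.vertices
    module E = Inverse φ.edges
    open Attach d H v using (A; old; fresh; by-age; inc-pendant-old; inc-pendant-fresh; inc-old; inc-fresh)

    -- The graph with a pendant edge at g: this is the same construction for edges of size two.
    B : Hypergraph
    B = attach 2 G g

    module B = Attach 0 G g

    shift : Fin (order G) ⊎ (Fin (size G) × Fin d) → Fin (order B) ⊎ (Fin (size B) × Fin d)
    shift (inj₁ x)       = inj₁ (B.old x)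
    shift (inj₂ (e , t)) = inj₂ (suc e , t)

    to′ : Fin (order H) ⊎ Fin (suc d) → Fin (order B) ⊎ (Fin (size B) × Fin d)
    to′ (inj₁ w)       = shift (V.to w)
    -- Of the d + 1 fresh vertices the first becomes the far end of the new graph edge; the other d
    -- are the new vertices which the power adds to that edge.
    to′ (inj₂ zero)    = inj₁ (B.fresh 0F)
    to′ (inj₂ (suc t)) = inj₂ (zero , t)

    unsplit : Fin (order G) ⊎ Fin 1 → Fin (order A)
    unsplit (inj₁ x) = old (V.from (inj₁ x))
    unsplit (inj₂ _) = fresh zero

    vertices-to : Fin (order A) → Fin (order B) ⊎ (Fin (size B) × Fin d)
    vertices-to = to′ ∘ splitAt (order H)

    vertices-from : Fin (order B) ⊎ (Fin (size B) × Fin d) → Fin (order A)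
    vertices-from (inj₁ y)           = unsplit (splitAt (order G) y)
    vertices-from (inj₂ (zero , t))  = fresh (suc t)
    vertices-from (inj₂ (suc e , t)) = old (V.from (inj₂ (e , t)))

    to-old : ∀ w → vertices-to (old w) ≡ shift (V.to w)
    to-old w = cong to′ (splitAt-↑ˡ (order H) w (suc d))

    to-fresh : ∀ t → vertices-to (fresh t) ≡ to′ (inj₂ t)
    to-fresh t = cong to′ (splitAt-↑ʳ (order H) (suc d) t)

    from-shift : ∀ s → vertices-from (shift s) ≡ old (V.from s)
    from-shift (inj₁ x)       = cong unsplit (splitAt-↑ˡ (order G) x 1)
    from-shift (inj₂ (e , t)) = refl

    from-to : ∀ i → vertices-from (vertices-to i) ≡ i
    from-to = by-age
      (λ w → trans (cong vertices-from (to-old w)) (trans (from-shift (V.to w)) (cong old (V.strictlyInverseʳ w))))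
      (λ t → trans (cong vertices-from (to-fresh t)) (at t))
      where
      at : ∀ t → vertices-from (to′ (inj₂ t)) ≡ fresh t
      at zero    = cong unsplit (splitAt-↑ʳ (order G) 1 0F)
      at (suc t) = refl

    to-from : ∀ s → vertices-to (vertices-from s) ≡ s
    to-from (inj₁ y) = B.by-age {Q = λ y → vertices-to (unsplit (splitAt (order G) y)) ≡ inj₁ y}
      (λ x → trans (cong (vertices-to ∘ unsplit) (splitAt-↑ˡ (order G) x 1))
        (trans (to-old (V.from (inj₁ x))) (cong shift (V.strictlyInverseˡ (inj₁ x)))))
      (λ { 0F → trans (cong (vertices-to ∘ unsplit) (splitAt-↑ʳ (order G) 1 0F)) (to-fresh zero) }) y
    to-from (inj₂ (zero , t))  = to-fresh (suc t)
    to-from (inj₂ (suc e , t)) = trans (to-old (V.from (inj₂ (e , t)))) (cong shift (V.strictlyInverseˡ (inj₂ (e , t))))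

    edges-to : Fin (size A) → Fin (size B)
    edges-to zero    = zero
    edges-to (suc e) = suc (E.to e)

    edges-from : Fin (size B) → Fin (size A)
    edges-from zero    = zero
    edges-from (suc e) = suc (E.from e)

    old-pendant : ∀ w → old w ∈ edge A zero → w ≡ v
    old-pendant w p = go (v ≟ᶠ w) (trans (sym (inc-pendant-old w)) (∈⇒inc A {zero} p))
      where
      go : (dec : Dec (v ≡ w)) → does dec ≡ true → w ≡ v
      go (yes refl) _ = refl

    old-pendant⁺ : old v ∈ edge A zero
    old-pendant⁺ = inc⇒∈ A {zero} (trans (inc-pendant-old v) (dec-true (v ≟ᶠ v) refl))

    old-edge : ∀ {w e} → old w ∈ edge A (suc e) ⇔ w ∈ edge H e
    old-edge {w} {e} = mk⇔ (λ p → inc⇒∈ H (trans (sym (inc-old e w)) (∈⇒inc A {suc e} p))) (λ p → inc⇒∈ A {suc e} (trans (inc-old e w) (∈⇒inc H p)))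

    fresh-edge : ∀ {t e} → ¬ (fresh t ∈ edge A (suc e))
    fresh-edge {t} {e} p = contradiction (trans (sym (∈⇒inc A {suc e} p)) (inc-fresh e t)) λ ()

    g-pendant : ∀ x → B.old x ∈ edge B zero → x ≡ g
    g-pendant x p = go (g ≟ᶠ x) (trans (sym (B.inc-pendant-old x)) (∈⇒inc B {zero} p))
      where
      go : (dec : Dec (g ≡ x)) → does dec ≡ true → x ≡ g
      go (yes refl) _ = refl

    g-pendant⁺ : B.old g ∈ edge B zero
    g-pendant⁺ = inc⇒∈ B {zero} (trans (B.inc-pendant-old g) (dec-true (g ≟ᶠ g) refl))

    g-edge : ∀ {x e} → B.old x ∈ edge B (suc e) ⇔ x ∈ edge G e
    g-edge {x} {e} = mk⇔ (λ p → inc⇒∈ G (trans (sym (B.inc-old e x)) (∈⇒inc B {suc e} p))) (λ p → inc⇒∈ B {suc e} (trans (B.inc-old e x) (∈⇒inc G p)))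

    g-fresh : ∀ {t e} → ¬ (B.fresh t ∈ edge B (suc e))
    g-fresh {t} {e} p = contradiction (trans (sym (∈⇒inc B {suc e} p)) (B.inc-fresh e t)) λ ()

    powerOf : PowerOf d A B
    powerOf = record
      { vertices  = mk↔ₛ′ vertices-to vertices-from to-from from-to
      ; edges     = mk↔ₛ′ edges-to edges-from (λ { zero → refl ; (suc e) → cong suc (E.strictlyInverseˡ e) }) (λ { zero → refl ; (suc e) → cong suc (E.strictlyInverseʳ e) })
      ; incidence = λ i e → by-age {Q = λ i → ∀ e → (i ∈ edge A e) ⇔ Incident d B (edges-to e) (vertices-to i)}
          (λ w e → subst (λ s → (old w ∈ edge A e) ⇔ Incident d B (edges-to e) s) (sym (to-old w)) (at-old w e (V.to w) refl))
          (λ t e → subst (λ s → (fresh t ∈ edge A e) ⇔ Incident d B (edges-to e) s) (sym (to-fresh t)) (at-fresh t e)) i e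
      }
      where
      v≡ : ∀ {w} → V.to w ≡ inj₁ g → w ≡ v
      v≡ {w} eq = trans (sym (V.strictlyInverseʳ w)) (trans (cong V.from (trans eq (sym v↦g))) (V.strictlyInverseʳ v))
      at-old : ∀ w e s → V.to w ≡ s → (old w ∈ edge A e) ⇔ Incident d B (edges-to e) (shift s)
      at-old w zero (inj₁ x) eq = mk⇔
        (λ p → subst (λ x → B.old x ∈ edge B zero) (sym (same (old-pendant w p))) g-pendant⁺)
        (λ p → subst (λ w → old w ∈ edge A zero) (sym (v≡ (trans eq (cong inj₁ (g-pendant x p))))) old-pendant⁺)
        where
        same : w ≡ v → x ≡ g
        same refl with trans (sym eq) v↦g
        ... | refl = refl
      at-old w zero (inj₂ (f , t)) eq = mk⇔
        (λ p → contradiction (trans (sym eq) (trans (cong V.to (old-pendant w p)) v↦g)) λ ()) (λ ())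
      at-old w (suc e) (inj₁ x) eq = ⇔-sym g-edge ⇔-∘ (subst (λ s → (w ∈ edge H e) ⇔ Incident d G (E.to e) s) eq (φ.incidence w e) ⇔-∘ old-edge)
      at-old w (suc e) (inj₂ (f , t)) eq = mk⇔ (cong suc) (λ { refl → refl }) ⇔-∘ (subst (λ s → (w ∈ edge H e) ⇔ Incident d G (E.to e) s) eq (φ.incidence w e) ⇔-∘ old-edge)
      at-fresh : ∀ t e → (fresh t ∈ edge A e) ⇔ Incident d B (edges-to e) (to′ (inj₂ t))
      at-fresh zero    zero    = mk⇔ (λ _ → inc⇒∈ B {zero} (B.inc-pendant-fresh 0F)) (λ _ → inc⇒∈ A {zero} (inc-pendant-fresh zero))
      at-fresh zero    (suc e) = mk⇔ (λ p → contradiction p (fresh-edge {zero} {e})) (λ p → contradiction p (g-fresh {0F} {E.to e}))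
      at-fresh (suc t) zero    = mk⇔ (λ _ → refl) (λ _ → inc⇒∈ A {zero} (inc-pendant-fresh (suc t)))
      at-fresh (suc t) (suc e) = mk⇔ (λ p → contradiction p (fresh-edge {suc t} {e})) λ ()

-- Graphs made of a core and leaves at one vertex.

module CoreForms where
  open AdjacencyOperators
  open PendantEdges
  open Graphs
  open Isomorphisms
  open import Defs hiding (_≈_; _≤_)
  open import Data.Fin.Base using (Fin; zero; suc; _↑ˡ_; _↑ʳ_; splitAt; cast; toℕ)
  open import Data.Fin.Patterns using (0F; 1F; 2F; 3F; 4F; 5F; 6F; 7F; 8F)
  open import Data.Fin.Permutation using (_∘ₚ_; cast-id)
  open import Data.Fin.Properties using (all?; splitAt-↑ˡ; splitAt-↑ʳ; splitAt⁻¹-↑ˡ; splitAt⁻¹-↑ʳ; ↑ˡ-injective; toℕ-injective; toℕ-cast) renaming (_≟_ to _≟ᶠ_)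
  open import Data.Fin.Subset using (_∈_)
  open import Data.Fin.Subset.Properties using (_∈?_)
  open import Data.List.Base as List using (List; []; _∷_; map; _++_)
  open import Data.List.Membership.Propositional using () renaming (_∈_ to _∈ˡ_)
  open import Data.List.Membership.Propositional.Properties using (∈-tabulate⁺; ∈-tabulate⁻; ∈-map⁺; ∈-map⁻; ∈-++⁺ˡ; ∈-++⁺ʳ; ∈-++⁻)
  open import Data.List.Relation.Unary.Any using (here)
  open import Data.Nat.Base as ℕ using (ℕ; zero; suc)
  import Data.Nat.Properties as ℕₚ
  open import Data.Product.Base using (∃-syntax; ∃₂; _×_; _,_; proj₁; proj₂)
  open import Data.Sum.Base as Sum⊎ using (_⊎_; inj₁; inj₂; [_,_]′)
  import Data.Vec.Base as Vec
  open import Function.Base using (_∘_; const)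
  open import Function.Bundles using (Inverse; Equivalence; _↔_)
  open import Function.Construct.Symmetry using (↔-sym)
  open import Relation.Nullary.Decidable using (toWitness; ¬?; _×-dec_; _⊎-dec_; _→-dec_)
  open import Relation.Nullary.Negation using (contradiction)
  open import Relation.Binary.PropositionalEquality

  -- A certificate that determines the graph up to isomorphism once the number of vertices is known.
  -- It is produced for the graph of `T₂C` by following the attachments and for an unknown graph by
  -- counting.
  record CoreForm {p} (o : Fin p) (E : List (Fin p × Fin p)) (G : Hypergraph) : Set where
    field
      ι     : Fin p → Fin (order G)
      ι-inj : ∀ i j → ι i ≡ ι j → i ≡ j
      core  : ∀ {i j} → (i , j) ∈ˡ E → ∃[ e ] Joins G e (ι i) (ι j)
      leaf  : ∀ x → (∀ i → ι i ≢ x) → ∃[ e ] Joins G e (ι o) x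
      cover : ∀ e → (∃₂ λ i j → (i , j) ∈ˡ E × Joins G e (ι i) (ι j)) ⊎
                    (∃[ x ] (∀ i → ι i ≢ x) × Joins G e (ι o) x)

  -- Leaves at o are interchangeable, so any bijection of the vertices that matches the two cores is
  -- an isomorphism.
  core-≅ : ∀ {p} {o : Fin p} {E G H} → order G ≡ order H → CoreForm o E G → CoreForm o E H → G ≅ H
  core-≅ {o = o} {E} {G} {H} n≡ C C′ = graph-≅ {G} {H} π (forth C C′ π agrees) (λ e → forth′ e)
    where
    module C = CoreForm C
    module C′ = CoreForm C′
    cast-inj : ∀ {x y} → cast n≡ x ≡ cast n≡ y → x ≡ y
    cast-inj {x} {y} eq = toℕ-injective (trans (sym (toℕ-cast n≡ x)) (trans (cong toℕ eq) (toℕ-cast n≡ y)))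
    aligned = align (cast n≡ ∘ C.ι) C′.ι (λ i j eq → C.ι-inj i j (cast-inj eq)) C′.ι-inj
    π : Fin (order G) ↔ Fin (order H)
    π = cast-id n≡ ∘ₚ proj₁ aligned
    agrees : ∀ i → Inverse.to π (C.ι i) ≡ C′.ι i
    agrees = proj₂ aligned
    forth : ∀ {G H} (C : CoreForm o E G) (C′ : CoreForm o E H) (π : Fin (order G) ↔ Fin (order H)) →
      (∀ i → Inverse.to π (CoreForm.ι C i) ≡ CoreForm.ι C′ i) →
      ∀ e → ∃₂ λ a b → ∃[ e′ ] Joins G e a b × Joins H e′ (Inverse.to π a) (Inverse.to π b)
    forth {G} {H} C C′ π agrees e with CoreForm.cover C e
    ... | inj₁ (i , j , ij∈ , je) = _ , _ , proj₁ (CoreForm.core C′ ij∈) , je ,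
      subst₂ (Joins H _) (sym (agrees i)) (sym (agrees j)) (proj₂ (CoreForm.core C′ ij∈))
    ... | inj₂ (x , x∉ , je) =
      let e′ , je′ = CoreForm.leaf C′ (Inverse.to π x) (λ i eq → x∉ i (to-inj (trans (agrees i) eq)))
      in _ , _ , e′ , je , subst (λ a → Joins H e′ a (Inverse.to π x)) (sym (agrees o)) je′
      where
      to-inj : ∀ {x y} → Inverse.to π x ≡ Inverse.to π y → x ≡ y
      to-inj {x} {y} eq = trans (sym (Inverse.strictlyInverseʳ π x)) (trans (cong (Inverse.from π) eq) (Inverse.strictlyInverseʳ π y))
    forth′ : ∀ e′ → ∃₂ λ a b → ∃[ e ] Joins H e′ a b × Joins G e (Inverse.from π a) (Inverse.from π b)
    forth′ = forth C′ C (↔-sym π)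
      (λ i → trans (cong (Inverse.from π) (sym (agrees i))) (Inverse.strictlyInverseʳ π (C.ι i)))

  module PendantEdge (G : Hypergraph) (g : Fin (order G)) where

    open Attach 0 G g using (A; old; fresh; by-age; inc-old; inc-fresh; inc-pendant-old; inc-pendant-fresh) public
    -- With d = 0 the power has no new vertices, and the incidence facts about `attach` on graphs
    -- are available from this instance.
    open PowerAttach (power-powerOf 0 G) (g ↑ˡ (size G ℕ.* 0)) g (cong (Sum⊎.map _ _) (splitAt-↑ˡ (order G) g (size G ℕ.* 0)))
      using (g-pendant; g-pendant⁺; g-edge; g-fresh)

    joins-old : ∀ {e a b} → Joins G e a b → Joins A (suc e) (old a) (old b)
    joins-old {e} (a≢b , a∈ , b∈ , only) =
      a≢b ∘ ↑ˡ-injective 1 _ _ , Equivalence.from g-edge a∈ , Equivalence.from g-edge b∈ ,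
      λ {v} → by-age {Q = λ v → v ∈ edge A (suc e) → v ≡ old _ ⊎ v ≡ old _}
        (λ w w∈ → Sum⊎.map (cong old) (cong old) (only (Equivalence.to g-edge w∈)))
        (λ t t∈ → contradiction t∈ (g-fresh {t} {e})) v

    joins-pendant : Joins A zero (old g) (fresh 0F)
    joins-pendant = ↑ˡ≢↑ʳ g 0F , g-pendant⁺ , inc⇒∈ A {zero} (inc-pendant-fresh 0F) ,
      λ {v} → by-age {Q = λ v → v ∈ edge A zero → v ≡ old g ⊎ v ≡ fresh 0F}
        (λ w w∈ → inj₁ (cong old (g-pendant w w∈))) (λ { 0F _ → inj₂ refl }) v

    fresh≢old : ∀ w → old w ≢ fresh 0F
    fresh≢old w = ↑ˡ≢↑ʳ w 0F

    missing-old : ∀ {p} {ι : Fin p → Fin (order G)} {x} → (∀ i → ι i ≢ x) → ∀ i → old (ι i) ≢ old x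
    missing-old x∉ i eq = x∉ i (↑ˡ-injective 1 _ _ eq)

  attach-leaf : ∀ {p} {o : Fin p} {E G} (C : CoreForm o E G) → CoreForm o E (attach 2 G (CoreForm.ι C o))
  attach-leaf {o = o} {E} {G} C = record
    { ι     = old ∘ ι
    ; ι-inj = λ i j eq → ι-inj i j (↑ˡ-injective 1 _ _ eq)
    ; core  = λ ij∈ → suc (proj₁ (core ij∈)) , joins-old (proj₂ (core ij∈))
    ; leaf  = by-age
        (λ x x∉ → let e , je = leaf x (λ i eq → x∉ i (cong old eq)) in suc e , joins-old je)
        (λ { 0F _ → zero , joins-pendant })
    ; cover = λ
        { zero    → inj₂ (fresh 0F , (λ i → fresh≢old (ι i)) , joins-pendant)
        ; (suc e) → Sum⊎.map (λ (i , j , ij∈ , je) → i , j , ij∈ , joins-old je)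
            (λ (x , x∉ , je) → old x , missing-old x∉ , joins-old je) (cover e)
        }
    }
    where
    open CoreForm C
    open PendantEdge G (ι o)

  extend-core : ∀ {p} → List (Fin p × Fin p) → Fin p → List (Fin (p ℕ.+ 1) × Fin (p ℕ.+ 1))
  extend-core {p} E j = map (λ (a , b) → a ↑ˡ 1 , b ↑ˡ 1) E ++ (j ↑ˡ 1 , p ↑ʳ 0F) ∷ []

  attach-core : ∀ {p} {o : Fin p} {E G} (C : CoreForm o E G) j → CoreForm (o ↑ˡ 1) (extend-core E j) (attach 2 G (CoreForm.ι C j))
  attach-core {p} {o} {E} {G} C j = record
    { ι     = ι′
    ; ι-inj = by-part
        (λ a → by-part (λ b eq → cong (_↑ˡ 1) (ι-inj a b (↑ˡ-injective 1 _ _ (trans (sym (ι′-old a)) (trans eq (ι′-old b))))))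
          (λ eq → contradiction (trans (sym (ι′-old a)) (trans eq ι′-new)) (fresh≢old (ι a))))
        (by-part (λ b eq → contradiction (trans (sym (ι′-old b)) (trans (sym eq) ι′-new)) (fresh≢old (ι b)))
          (λ _ → refl))
    ; core  = λ ij∈ → [ old-core , new-core ]′ (∈-++⁻ (map (λ (a , b) → a ↑ˡ 1 , b ↑ˡ 1) E) ij∈)
    ; leaf  = by-age
        (λ x x∉ → let e , je = leaf x (λ i eq → x∉ (i ↑ˡ 1) (trans (ι′-old i) (cong old eq))) in
          suc e , subst (λ a → Joins A (suc e) a (old x)) (sym (ι′-old o)) (joins-old je))
        (λ { 0F x∉ → contradiction ι′-new (x∉ (p ↑ʳ 0F)) })
    ; cover = λ
        { zero    → inj₁ (j ↑ˡ 1 , p ↑ʳ 0F , ∈-++⁺ʳ (map _ E) (here refl) , new-joins)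
        ; (suc e) → Sum⊎.map
            (λ (a , b , ab∈ , je) → a ↑ˡ 1 , b ↑ˡ 1 , ∈-++⁺ˡ (∈-map⁺ _ ab∈) ,
              subst₂ (Joins A (suc e)) (sym (ι′-old a)) (sym (ι′-old b)) (joins-old je))
            (λ (x , x∉ , je) → old x ,
              by-part (λ i eq → missing-old {x = x} x∉ i (trans (sym (ι′-old i)) eq)) (λ eq → fresh≢old x (trans (sym eq) ι′-new)) ,
              subst (λ a → Joins A (suc e) a (old x)) (sym (ι′-old o)) (joins-old je)) (cover e)
        }
    }
    where
    open CoreForm C
    open PendantEdge G (ι j)
    ι′ : Fin (p ℕ.+ 1) → Fin (order A)
    ι′ i = [ old ∘ ι , const (fresh 0F) ]′ (splitAt p i)
    ι′-old : ∀ i → ι′ (i ↑ˡ 1) ≡ old (ι i)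
    ι′-old i = cong [ old ∘ ι , const (fresh 0F) ]′ (splitAt-↑ˡ p i 1)
    ι′-new : ι′ (p ↑ʳ 0F) ≡ fresh 0F
    ι′-new = cong [ old ∘ ι , const (fresh 0F) ]′ (splitAt-↑ʳ p 1 0F)
    by-part : ∀ {Q : Fin (p ℕ.+ 1) → Set} → (∀ i → Q (i ↑ˡ 1)) → Q (p ↑ʳ 0F) → ∀ i → Q i
    by-part {Q} qo qn i with splitAt p i in eq
    ... | inj₁ a  = subst Q (splitAt⁻¹-↑ˡ eq) (qo a)
    ... | inj₂ 0F = subst Q (splitAt⁻¹-↑ʳ eq) qn
    new-joins : Joins A zero (ι′ (j ↑ˡ 1)) (ι′ (p ↑ʳ 0F))
    new-joins = subst₂ (Joins A zero) (sym (ι′-old j)) (sym ι′-new) joins-pendant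
    old-core : ∀ {i k} → (i , k) ∈ˡ map (λ (a , b) → a ↑ˡ 1 , b ↑ˡ 1) E → ∃[ e ] Joins A e (ι′ i) (ι′ k)
    old-core ik∈ with ∈-map⁻ (λ (a , b) → a ↑ˡ 1 , b ↑ˡ 1) ik∈
    ... | (a , b) , ab∈ , refl = suc (proj₁ (core ab∈)) ,
      subst₂ (Joins A (suc (proj₁ (core ab∈)))) (sym (ι′-old a)) (sym (ι′-old b)) (joins-old (proj₂ (core ab∈)))
    new-core : ∀ {i k} → (i , k) ∈ˡ (j ↑ˡ 1 , p ↑ʳ 0F) ∷ [] → ∃[ e ] Joins A e (ι′ i) (ι′ k)
    new-core (here refl) = zero , new-joins

  triangle-ends : Fin 9 → Fin 7 × Fin 7
  triangle-ends 0F = 0F , 1F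
  triangle-ends 1F = 1F , 2F
  triangle-ends 2F = 2F , 0F
  triangle-ends 3F = 0F , 3F
  triangle-ends 4F = 3F , 4F
  triangle-ends 5F = 4F , 0F
  triangle-ends 6F = 0F , 5F
  triangle-ends 7F = 5F , 6F
  triangle-ends 8F = 6F , 0F

  triangle-edges : List (Fin 7 × Fin 7)
  triangle-edges = List.tabulate triangle-ends

  triangles-core : CoreForm 0F triangle-edges threeTriangles
  triangles-core = record
    { ι     = λ i → i
    ; ι-inj = λ _ _ eq → eq
    ; core  = λ ij∈ → let e , eq = ∈-tabulate⁻ {f = triangle-ends} ij∈ in
        e , subst (λ (a , b) → Joins threeTriangles e a b) (sym eq) (joins e)
    ; leaf  = λ x x∉ → contradiction refl (x∉ x)
    ; cover = λ e → inj₁ (proj₁ (triangle-ends e) , proj₂ (triangle-ends e) , ∈-tabulate⁺ {f = triangle-ends} e , joins e)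
    }
    where
    joins : ∀ e → Joins threeTriangles e (proj₁ (triangle-ends e)) (proj₂ (triangle-ends e))
    joins e = let a≢b , a∈ , b∈ , only = toWitness {a? = all? λ e → let a , b = triangle-ends e in
                    ¬? (a ≟ᶠ b) ×-dec ((a ∈? triangles e) ×-dec ((b ∈? triangles e) ×-dec
                      (all? λ v → (v ∈? triangles e) →-dec ((v ≟ᶠ a) ⊎-dec (v ≟ᶠ b)))))} _ e
              in a≢b , a∈ , b∈ , λ {v} → only v

  -- A hypergraph seen as the power of a graph with the given core; the core vertices o and j
  -- have to be traced through the attachments.
  record Model (d : ℕ) (H : Hypergraph) {p} (o j : Fin p) (E : List (Fin p × Fin p)) (v₀ v₁ : Fin (order H)) : Set where
    field
      graph   : Hypergraph
      powerOf : PowerOf d H graph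
      form    : CoreForm o E graph
      at-o    : Inverse.to (PowerOf.vertices powerOf) v₀ ≡ inj₁ (CoreForm.ι form o)
      at-j    : Inverse.to (PowerOf.vertices powerOf) v₁ ≡ inj₁ (CoreForm.ι form j)

  open Model


  module _ {d H p} {o j : Fin p} {E : List (Fin p × Fin p)} {v₀ v₁ : Fin (order H)} (M : Model d H o j E v₀ v₁) where

    open CoreForm (form M)

    private
      module AtO = PowerAttach (powerOf M) v₀ (ι o) (at-o M)
      module AtJ = PowerAttach (powerOf M) v₁ (ι j) (at-j M)

    model-leaf : Model d (attach (suc (suc d)) H v₀) o j E (v₀ ↑ˡ suc d) (v₁ ↑ˡ suc d)
    model-leaf = record
      { graph   = attach 2 (graph M) (ι o)
      ; powerOf = AtO.powerOf
      ; form    = attach-leaf (form M)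
      ; at-o    = trans (AtO.to-old v₀) (cong AtO.shift (at-o M))
      ; at-j    = trans (AtO.to-old v₁) (cong AtO.shift (at-j M))
      }

    model-core : ∃[ G ] PowerOf d (attach (suc (suc d)) H v₁) G × CoreForm (o ↑ˡ 1) (extend-core E j) G × order G ≡ order (graph M) ℕ.+ 1
    model-core = attach 2 (graph M) (ι j) , AtJ.powerOf , attach-core (form M) j , refl

  -- The shape of the attachment vector of `T₂C`: the pendant edges at the centre, then one
  -- elsewhere. As a predicate it survives the renumbering that each attachment applies to the
  -- remaining vertices.
  data Stars {n} (v₀ v₁ : Fin n) : ∀ {q} → Vec.Vec (Fin n) q → Set where
    stop : Stars v₀ v₁ (v₁ Vec.∷ Vec.[])
    more : ∀ {q} {vs : Vec.Vec (Fin n) q} → Stars v₀ v₁ vs → Stars v₀ v₁ (v₀ Vec.∷ vs)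

  data Constant {n} (v₀ : Fin n) : ∀ {q} → Vec.Vec (Fin n) q → Set where
    none : Constant v₀ Vec.[]
    more : ∀ {q} {vs : Vec.Vec (Fin n) q} → Constant v₀ vs → Constant v₀ (v₀ Vec.∷ vs)

  stars-map : ∀ {m n} (f : Fin m → Fin n) {v₀ v₁ q} {vs : Vec.Vec (Fin m) q} → Stars v₀ v₁ vs → Stars (f v₀) (f v₁) (Vec.map f vs)
  stars-map f stop     = stop
  stars-map f (more s) = more (stars-map f s)

  constant-map : ∀ {m n} (f : Fin m → Fin n) {v₀ q} {vs : Vec.Vec (Fin m) q} → Constant v₀ vs → Constant (f v₀) (Vec.map f vs)
  constant-map f none     = none
  constant-map f (more s) = more (constant-map f s)

  stars-list : ∀ {n} a (v₀ v₁ : Fin n) → Stars v₀ v₁ (Vec.fromList (List.replicate a v₀ ++ v₁ ∷ []))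
  stars-list zero    v₀ v₁ = stop
  stars-list (suc a) v₀ v₁ = more (stars-list a v₀ v₁)

  constant-list : ∀ {n} a (v₀ : Fin n) → Constant v₀ (Vec.fromList (List.replicate a v₀ ++ []))
  constant-list zero    v₀ = none
  constant-list (suc a) v₀ = more (constant-list a v₀)

  stars-model : ∀ {d H p} {o j : Fin p} {E v₀ v₁ q} {vs : Vec.Vec (Fin (order H)) q} → Stars v₀ v₁ vs → (M : Model d H o j E v₀ v₁) →
    ∃[ G ] PowerOf d (attachAll (suc (suc d)) H vs) G × CoreForm (o ↑ˡ 1) (extend-core E j) G × order G ≡ order (graph M) ℕ.+ q
  stars-model stop M = model-core M
  stars-model {d} {q = suc q} (more s) M =
    let G , P , C , eq = stars-model (stars-map (_↑ˡ suc d) s) (model-leaf M)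
    in G , P , C , trans eq (ℕₚ.+-assoc (order (graph M)) 1 q)

  constant-model : ∀ {d H p} {o j : Fin p} {E v₀ v₁ q} {vs : Vec.Vec (Fin (order H)) q} → Constant v₀ vs → (M : Model d H o j E v₀ v₁) →
    ∃[ G ] PowerOf d (attachAll (suc (suc d)) H vs) G × CoreForm o E G × order G ≡ order (graph M) ℕ.+ q
  constant-model none M = graph M , powerOf M , form M , sym (ℕₚ.+-identityʳ (order (graph M)))
  constant-model {d} {q = suc q} (more s) M =
    let G , P , C , eq = constant-model (constant-map (_↑ˡ suc d) s) (model-leaf M)
    in G , P , C , trans eq (ℕₚ.+-assoc (order (graph M)) 1 q)

  triangles-model : ∀ d → Model d (power (suc (suc d)) threeTriangles) {7} 0F 1F triangle-edges (Power.vertex d threeTriangles 0F) (Power.vertex d threeTriangles 1F)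
  triangles-model d = record
    { graph = threeTriangles ; powerOf = power-powerOf d threeTriangles ; form = triangles-core ; at-o = refl ; at-j = refl }

  length-replicate-++ : ∀ {A : Set} a (x : A) xs → List.length (List.replicate a x ++ xs) ≡ a ℕ.+ List.length xs
  length-replicate-++ zero    x xs = refl
  length-replicate-++ (suc a) x xs = cong suc (length-replicate-++ a x xs)

  one-pendant-off : ∀ d a {H G} → PowerOf d H G → CoreForm {8} 0F (extend-core triangle-edges 1F) G → order G ≡ 8 ℕ.+ a →
    H ≅ T₂C (suc (suc d)) (a Vec.∷ 1 Vec.∷ 0 Vec.∷ 0 Vec.∷ 0 Vec.∷ 0 Vec.∷ 0 Vec.∷ Vec.[])
  one-pendant-off d a P C n≡ =
    let G′ , P′ , C′ , n′≡ = stars-model (stars-list a (Power.vertex d threeTriangles 0F) (Power.vertex d threeTriangles 1F)) (triangles-model d)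
    in ≅-powers P P′ (core-≅ (trans n≡ (sym (trans n′≡ (trans (cong (7 ℕ.+_) (length-replicate-++ a (Power.vertex d threeTriangles 0F) (Power.vertex d threeTriangles 1F ∷ []))) (cong (7 ℕ.+_) (ℕₚ.+-comm a 1)))))) C C′)

  all-pendants-at-centre : ∀ d a {H G} → PowerOf d H G → CoreForm {7} 0F triangle-edges G → order G ≡ 7 ℕ.+ a →
    H ≅ T₂C (suc (suc d)) (a Vec.∷ 0 Vec.∷ 0 Vec.∷ 0 Vec.∷ 0 Vec.∷ 0 Vec.∷ 0 Vec.∷ Vec.[])
  all-pendants-at-centre d a P C n≡ =
    let G′ , P′ , C′ , n′≡ = constant-model (constant-list a (Power.vertex d threeTriangles 0F)) (triangles-model d)
    in ≅-powers P P′ (core-≅ (trans n≡ (sym (trans n′≡ (trans (cong (7 ℕ.+_) (length-replicate-++ a (Power.vertex d threeTriangles 0F) [])) (cong (7 ℕ.+_) (ℕₚ.+-identityʳ a)))))) C C′)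

-- Edge counts in a connected graph with two edges more than vertices.

module EdgeCounts where
  open OrderedField
  open LinearAlgebra
  open AdjacencyOperators
  open Graphs
  open import Defs hiding (_≈_; _≤_)
  open import Data.Bool.Base using (Bool; true; false; _∨_)
  open import Data.Fin.Base using (Fin; zero; suc)
  open import Data.Fin.Properties using (any?) renaming (_≟_ to _≟ᶠ_)
  open import Data.Fin.Subset using (_∈_)
  open import Data.Fin.Subset.Properties using (_∈?_)
  open import Data.Nat.Base as ℕ using (ℕ; zero; suc)
  open import Data.Product.Base using (∃-syntax; ∃₂; _×_; _,_)
  open import Data.Rational.Base hiding (_⊔_; _⊓_; ∣_∣)
  open import Data.Rational.Properties
  open import Relation.Binary.Construct.Closure.ReflexiveTransitive using (Star; ε; _◅_)
  open import Relation.Nullary using (¬_; Dec; yes; no; does)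
  open import Relation.Nullary.Decidable using (_×-dec_; dec-true; dec-false)
  open import Data.Bool.Properties using () renaming (_≟_ to _≟ᵇ_)
  open import Relation.Nullary.Negation using (contradiction)
  open import Relation.Binary.PropositionalEquality

  module Form {n} (A : Fin n → Fin n → ℚ) (A-sym : ∀ x y → A x y ≡ A y x) (A≥0 : ∀ x y → 0ℚ ≤ A x y) where

    ⟨_,_⟩ : (Fin n → ℚ) → (Fin n → ℚ) → ℚ
    ⟨ p , q ⟩ = sum (λ x → p x * (A · q) x)

    ·-+ : ∀ p q x → (A · (λ y → p y + q y)) x ≡ (A · p) x + (A · q) x
    ·-+ p q x = trans (Σ-cong λ y → *-distribˡ-+ (A x y) (p y) (q y)) (Σ-+ (λ y → A x y * p y) (λ y → A x y * q y))

    ·-mono : ∀ {p q} → (∀ y → p y ≤ q y) → ∀ x → (A · p) x ≤ (A · q) x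
    ·-mono h x = Σ-mono λ y → scale-≤ (A≥0 x y) (h y)

    ·-δ : ∀ y x → (A · δ y) x ≡ A x y
    ·-δ y x = trans (Σ-cong λ z → *-comm (A x z) (δ y z)) (Σ-δ y (A x))

    form-sym : ∀ p q → ⟨ p , q ⟩ ≡ ⟨ q , p ⟩
    form-sym p q = begin
      sum (λ x → p x * sum (λ y → A x y * q y))
        ≡⟨ Σ-cong (λ x → trans (sym (Σ-*ˡ (p x) (λ y → A x y * q y))) (Σ-cong λ y → eq (p x) (A x y) (q y))) ⟩
      sum (λ x → sum (λ y → q y * (A x y * p x)))
        ≡⟨ Σ-swap (λ x y → q y * (A x y * p x)) ⟩
      sum (λ y → sum (λ x → q y * (A x y * p x)))
        ≡⟨ Σ-cong (λ y → trans (Σ-*ˡ (q y) (λ x → A x y * p x)) (cong (q y *_) (Σ-cong λ x → cong (_* p x) (A-sym x y)))) ⟩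
      ⟨ q , p ⟩ ∎
      where
      open ≡-Reasoning
      eq = solve 3 (λ p a q → p :* (a :* q) := q :* (a :* p)) refl

    form-+ˡ : ∀ p q r → ⟨ (λ x → p x + q x) , r ⟩ ≡ ⟨ p , r ⟩ + ⟨ q , r ⟩
    form-+ˡ p q r = trans (Σ-cong λ x → *-distribʳ-+ ((A · r) x) (p x) (q x)) (Σ-+ (λ x → p x * (A · r) x) (λ x → q x * (A · r) x))

    form-+ʳ : ∀ p q r → ⟨ r , (λ x → p x + q x) ⟩ ≡ ⟨ r , p ⟩ + ⟨ r , q ⟩
    form-+ʳ p q r = trans (form-sym r (λ x → p x + q x)) (trans (form-+ˡ p q r) (cong₂ _+_ (form-sym p r) (form-sym q r)))

    form-δ : ∀ x q → ⟨ δ x , q ⟩ ≡ (A · q) x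
    form-δ x q = Σ-δ x (A · q)

    form-≥0 : ∀ {p q} → (∀ x → 0ℚ ≤ p x) → (∀ x → 0ℚ ≤ q x) → 0ℚ ≤ ⟨ p , q ⟩
    form-≥0 hp hq = Σ-nonneg λ x → hp x ⊠ Σ-nonneg λ y → A≥0 x y ⊠ hq y

    -- Counting the pairs with an entry in s twice, and correcting for those inside s.
    form-≥ : ∀ s p → (∀ x → s x ≤ p x) → ⟨ s , p ⟩ + ⟨ s , p ⟩ ≤ ⟨ p , p ⟩ + ⟨ s , s ⟩
    form-≥ s p s≤p = cert≤ (form-≥0 (λ x → ≤-diff (s≤p x)) (λ x → ≤-diff (s≤p x)))
      (trans (cong₂ (λ a b → a + b - (⟨ s , p ⟩ + ⟨ s , p ⟩)) expand (refl {x = ⟨ s , s ⟩}))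
        (trans (cong (λ a → ⟨ s , s ⟩ + ⟨ s , r ⟩ + (⟨ r , s ⟩ + ⟨ r , r ⟩) + ⟨ s , s ⟩ - (a + a)) sp)
          (trans (cong (λ a → ⟨ s , s ⟩ + ⟨ s , r ⟩ + (a + ⟨ r , r ⟩) + ⟨ s , s ⟩ - (⟨ s , s ⟩ + ⟨ s , r ⟩ + (⟨ s , s ⟩ + ⟨ s , r ⟩))) (form-sym r s))
            (eq ⟨ s , s ⟩ ⟨ s , r ⟩ ⟨ r , r ⟩))))
      where
      r : Fin n → ℚ
      r x = p x - s x
      p≡ : ∀ x → p x ≡ s x + r x
      p≡ x = eq (p x) (s x)
        where
        eq = solve 2 (λ p s → p := s :+ (p :- s)) refl
      sp : ⟨ s , p ⟩ ≡ ⟨ s , s ⟩ + ⟨ s , r ⟩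
      sp = trans (Σ-cong λ x → cong (s x *_) (Σ-cong λ y → cong (A x y *_) (p≡ y))) (form-+ʳ s r s)
      expand : ⟨ p , p ⟩ ≡ ⟨ s , s ⟩ + ⟨ s , r ⟩ + (⟨ r , s ⟩ + ⟨ r , r ⟩)
      expand = trans (Σ-cong λ x → cong₂ _*_ (p≡ x) (Σ-cong λ y → cong (A x y *_) (p≡ y)))
        (trans (form-+ˡ s r (λ x → s x + r x)) (cong₂ _+_ (form-+ʳ s r s) (form-+ʳ s r r)))
      eq = solve 3 (λ a b c → a :+ b :+ (b :+ c) :+ a :- (a :+ b :+ (a :+ b)) := c) refl

  module Connectivity (G : Hypergraph) (uniform : Uniform 2 G) (connected : Connected G)
    (order+2 : order G ℕ.+ 2 ≡ size G) where

    open Graph G uniform public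

    A≥0 : ∀ x y → 0ℚ ≤ A x y
    A≥0 x y = 0≤𝟙 _

    open Form A (adj-sym G) A≥0 public

    A-irrefl : ∀ x → A x x ≡ 0ℚ
    A-irrefl x = cong 𝟙 (dec-false (adjacent? G x x) λ (x≢x , _) → x≢x refl)

    A-edge : ∀ {x y e} → x ≢ y → x ∈ edge G e → y ∈ edge G e → A x y ≡ 1ℚ
    A-edge x≢y p q = cong 𝟙 (dec-true (adjacent? G _ _) (x≢y , _ , p , q))

    Set? : Set
    Set? = Fin n → Bool

    ⟦_⟧ : Set? → Fin n → ℚ
    ⟦ χ ⟧ x = 𝟙 (χ x)

    ∥_∥ : Set? → ℚ
    ∥ χ ∥ = sum ⟦ χ ⟧

    ιn : ι n + ι 2 ≡ ι k
    ιn = trans (sym (ι-+ n 2)) (cong ι order+2)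

    insert : Fin n → Set? → Set?
    insert y χ x = χ x ∨ does (y ≟ᶠ x)

    insert≡ : ∀ y χ → χ y ≡ false → ∀ x → ⟦ insert y χ ⟧ x ≡ ⟦ χ ⟧ x + δ y x
    insert≡ y χ ∉ x with y ≟ᶠ x
    ... | yes refl rewrite ∉ = refl
    ... | no _ with χ x
    ...   | true  = refl
    ...   | false = refl

    ∣insert∣ : ∀ y χ → χ y ≡ false → ∥ insert y χ ∥ ≡ ∥ χ ∥ + 1ℚ
    ∣insert∣ y χ ∉ = trans (Σ-cong (insert≡ y χ ∉)) (trans (Σ-+ ⟦ χ ⟧ (δ y)) (cong (∥ χ ∥ +_)
      (trans (Σ-cong λ x → sym (*-identityʳ (δ y x))) (Σ-δ y (λ _ → 1ℚ)))))

    form-insert : ∀ y χ → χ y ≡ false → ⟨ ⟦ insert y χ ⟧ , ⟦ insert y χ ⟧ ⟩ ≡ ⟨ ⟦ χ ⟧ , ⟦ χ ⟧ ⟩ + ι 2 * (A · ⟦ χ ⟧) y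
    form-insert y χ ∉ = begin
      ⟨ ⟦ insert y χ ⟧ , ⟦ insert y χ ⟧ ⟩
        ≡⟨ Σ-cong (λ x → cong₂ _*_ (insert≡ y χ ∉ x) (Σ-cong λ z → cong (A x z *_) (insert≡ y χ ∉ z))) ⟩
      ⟨ (λ x → ⟦ χ ⟧ x + δ y x) , (λ x → ⟦ χ ⟧ x + δ y x) ⟩
        ≡⟨ trans (form-+ˡ ⟦ χ ⟧ (δ y) (λ x → ⟦ χ ⟧ x + δ y x)) (cong₂ _+_ (form-+ʳ ⟦ χ ⟧ (δ y) ⟦ χ ⟧) (form-+ʳ ⟦ χ ⟧ (δ y) (δ y))) ⟩
      ⟨ ⟦ χ ⟧ , ⟦ χ ⟧ ⟩ + ⟨ ⟦ χ ⟧ , δ y ⟩ + (⟨ δ y , ⟦ χ ⟧ ⟩ + ⟨ δ y , δ y ⟩)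
        ≡⟨ cong₂ (λ a b → ⟨ ⟦ χ ⟧ , ⟦ χ ⟧ ⟩ + a + (⟨ δ y , ⟦ χ ⟧ ⟩ + b)) (form-sym ⟦ χ ⟧ (δ y))
             (trans (form-δ y (δ y)) (trans (·-δ y y) (A-irrefl y))) ⟩
      ⟨ ⟦ χ ⟧ , ⟦ χ ⟧ ⟩ + ⟨ δ y , ⟦ χ ⟧ ⟩ + (⟨ δ y , ⟦ χ ⟧ ⟩ + 0ℚ)
        ≡⟨ cong (λ a → ⟨ ⟦ χ ⟧ , ⟦ χ ⟧ ⟩ + a + (a + 0ℚ)) (form-δ y ⟦ χ ⟧) ⟩
      ⟨ ⟦ χ ⟧ , ⟦ χ ⟧ ⟩ + (A · ⟦ χ ⟧) y + ((A · ⟦ χ ⟧) y + 0ℚ)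
        ≡⟨ eq ⟨ ⟦ χ ⟧ , ⟦ χ ⟧ ⟩ ((A · ⟦ χ ⟧) y) ⟩
      ⟨ ⟦ χ ⟧ , ⟦ χ ⟧ ⟩ + ι 2 * (A · ⟦ χ ⟧) y ∎
      where
      open ≡-Reasoning
      eq = solve 2 (λ a b → a :+ b :+ (b :+ # 0ℚ) := a :+ # ι 2 :* b) refl

    form-total : ⟨ (λ _ → 1ℚ) , (λ _ → 1ℚ) ⟩ ≡ ι k * ι 2
    form-total = trans (Σ-cong λ x → trans (*-identityˡ _) (A·1 x)) Σdegree

    Boundary : Set? → Set
    Boundary χ = ∃₂ λ x y → χ x ≡ true × χ y ≡ false × ∃[ e ] x ∈ edge G e × y ∈ edge G e

    boundary? : ∀ χ → Dec (Boundary χ)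
    boundary? χ = any? λ x → any? λ y → (χ x ≟ᵇ true) ×-dec ((χ y ≟ᵇ false) ×-dec
      any? λ e → (x ∈? edge G e) ×-dec (y ∈? edge G e))

    no-boundary : ∀ χ {x} → χ x ≡ true → ¬ Boundary χ → ∀ y → χ y ≡ true
    no-boundary χ {x} x∈ none y = walk (connected x y) x∈
      where
      walk : ∀ {x y} → Star (λ x y → ∃[ e ] x ∈ edge G e × y ∈ edge G e) x y → χ x ≡ true → χ y ≡ true
      walk ε x∈ = x∈
      walk {x} (_◅_ {j = y} (e , p , q) path) x∈ with χ y in eq
      ... | true  = walk path eq
      ... | false = contradiction (x , y , x∈ , eq , e , p , q) none

    -- A nonempty vertex set S spans at most |S| + 2 edges. Enlarge S through the boundary one
    -- vertex at a time: each new vertex brings at least one edge, and when the boundary is empty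
    -- connectedness makes S everything, with n + 2 edges in total. The form counts every edge
    -- twice.
    inside : ∀ χ {x} → χ x ≡ true → ⟨ ⟦ χ ⟧ , ⟦ χ ⟧ ⟩ ≤ ι 2 * ∥ χ ∥ + ι 4
    inside χ {x} x∈ = cert≤ (≤-diff (grow n χ x∈ (subst (ι n ≤_) (+-comm (ι n) ∥ χ ∥) (subst (_≤ ι n + ∥ χ ∥) (+-identityʳ (ι n)) (+-monoʳ-≤ (ι n) (Σ-nonneg λ x → 0≤𝟙 (χ x)))))))
      (modulo (ι 2) (sym ιn) (eq (ι n) (ι k) ∥ χ ∥ ⟨ ⟦ χ ⟧ , ⟦ χ ⟧ ⟩))
      where
      eq = solve 4 (λ n k c s → # ι 2 :* c :+ # ι 4 :- s :+ # ι 2 :* (k :- (n :+ # ι 2)) := # ι 2 :* k :- (s :+ # ι 2 :* (n :- c))) refl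
      -- m bounds the number of vertices still outside and serves as recursion depth.
      grow : ∀ m χ {x} → χ x ≡ true → ι n ≤ ∥ χ ∥ + ι m → ⟨ ⟦ χ ⟧ , ⟦ χ ⟧ ⟩ + ι 2 * (ι n - ∥ χ ∥) ≤ ι 2 * ι k
      grow m χ x∈ le with boundary? χ
      ... | no none = ≤-reflexive (trans (cong₂ (λ a b → a + ι 2 * (ι n - b))
          (trans (Σ-cong λ x → cong₂ _*_ (full x) (Σ-cong λ y → cong (A x y *_) (full y))) form-total)
          (trans (Σ-cong full) (Σ-1 n)))
        (eq₁ (ι n) (ι k)))
        where
        full : ∀ y → ⟦ χ ⟧ y ≡ 1ℚ
        full y = cong 𝟙 (no-boundary χ x∈ none y)
        eq₁ = solve 2 (λ n k → k :* # ι 2 :+ # ι 2 :* (n :- n) := # ι 2 :* k) refl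
      grow zero χ x∈ le | yes (x , y , _ , ∉ , _) = contradiction (≤-<-trans le (subst₂ _<_ (sym (+-identityʳ ∥ χ ∥)) refl
          (<-≤-trans (subst (∥ χ ∥ <_) (sym (∣insert∣ y χ ∉)) (subst (_< ∥ χ ∥ + 1ℚ) (+-identityʳ ∥ χ ∥) (+-monoʳ-< ∥ χ ∥ 0<1)))
            (subst (∥ insert y χ ∥ ≤_) (Σ-1 n) (Σ-mono λ x → 𝟙≤1 (insert y χ x)))))) (<-irrefl refl)
      grow (suc m) χ x∈ le | yes (x , y , x∈χ , ∉ , e , p , q) = ≤-trans
        (cert≤ {t = ι 2 * ((A · ⟦ χ ⟧) y - 1ℚ)} (0≤ι 2 ⊠ ≤-diff 1≤)
          (trans (cong₂ (λ a b → a + ι 2 * (ι n - b) - (⟨ ⟦ χ ⟧ , ⟦ χ ⟧ ⟩ + ι 2 * (ι n - ∥ χ ∥))) (form-insert y χ ∉) (∣insert∣ y χ ∉))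
            (eq₁ ⟨ ⟦ χ ⟧ , ⟦ χ ⟧ ⟩ ((A · ⟦ χ ⟧) y) (ι n) ∥ χ ∥)))
        (grow m (insert y χ) {x} (cong (_∨ does (y ≟ᶠ x)) x∈χ)
          (subst (ι n ≤_) (trans (sym (+-assoc ∥ χ ∥ 1ℚ (ι m))) (cong (_+ ι m) (sym (∣insert∣ y χ ∉)))) le))
        where
        eq₁ = solve 4 (λ s a n c → s :+ # ι 2 :* a :+ # ι 2 :* (n :- (c :+ # 1ℚ)) :- (s :+ # ι 2 :* (n :- c)) := # ι 2 :* (a :- # 1ℚ)) refl
        x≢y : y ≢ x
        x≢y refl = contradiction (trans (sym ∉) x∈χ) λ ()
        1≤ : 1ℚ ≤ (A · ⟦ χ ⟧) y
        1≤ = subst (_≤ (A · ⟦ χ ⟧) y) (cong₂ _*_ (A-edge x≢y q p) (cong 𝟙 x∈χ))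
          (term≤Σ (λ z → A≥0 y z ⊠ 0≤𝟙 (χ z)) x)

    -- The count for the set enlarged by u: edges inside plus edges to u are at most the number of
    -- elements plus three.
    inside-at : ∀ u ψ → ψ u ≡ false → ⟨ ⟦ ψ ⟧ , ⟦ ψ ⟧ ⟩ + ι 2 * (A · ⟦ ψ ⟧) u ≤ ι 2 * ∥ ψ ∥ + ι 6
    inside-at u ψ ∉ = subst₂ _≤_ (form-insert u ψ ∉)
      (trans (cong (λ c → ι 2 * c + ι 4) (∣insert∣ u ψ ∉)) (eq ∥ ψ ∥))
      (inside (insert u ψ) {u} (u∈ (ψ u) (u ≟ᶠ u)))
      where
      u∈ : ∀ b (d : Dec (u ≡ u)) → b ∨ does d ≡ true
      u∈ true  _ = refl
      u∈ false d = dec-true d refl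
      eq = solve 1 (λ c → # ι 2 :* (c :+ # 1ℚ) :+ # ι 4 := # ι 2 :* c :+ # ι 6) refl

-- Edges within a neighbourhood, and common neighbours.

module Neighbourhoods where
  open OrderedField
  open LinearAlgebra
  open AdjacencyOperators
  open EdgeCounts
  open import Defs hiding (_≈_; _≤_)
  open import Data.Bool.Base using (true; false; _∧_; _∨_)
  open import Data.Fin.Base using (Fin)
  open import Data.Fin.Properties using () renaming (_≟_ to _≟ᶠ_)
  open import Data.Nat.Base as ℕ using (ℕ)
  open import Data.Product.Base using (_,_)
  open import Data.Rational.Base hiding (_⊔_; _⊓_; ∣_∣)
  open import Data.Rational.Properties
  open import Relation.Nullary using (Dec; yes; no; does)
  open import Relation.Nullary.Decidable using (dec-true; dec-false)
  open import Relation.Nullary.Negation using (contradiction)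
  open import Relation.Binary.PropositionalEquality

  halve : ∀ {a b} → a + a ≤ b + b → a ≤ b
  halve {a} {b} h = cancel-≤ (0<1 ⁺⊞ 0≤1) (subst₂ _≤_ (eq a) (eq b) h)
    where
    eq = solve 1 (λ a → a :+ a := (# 1ℚ :+ # 1ℚ) :* a) refl

  0≤1-𝟙 : ∀ b → 0ℚ ≤ 1ℚ - 𝟙 b
  0≤1-𝟙 b = ≤-diff (𝟙≤1 b)

  0≤δ : ∀ {n} (i j : Fin n) → 0ℚ ≤ δ i j
  0≤δ i j = 0≤𝟙 (does (i ≟ᶠ j))

  module Local (G : Hypergraph) (uniform : Uniform 2 G) (connected : Connected G)
    (order+2 : order G ℕ.+ 2 ≡ size G) (u : Fin (order G)) where

    open Connectivity G uniform connected order+2 public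

    N : Fin n → Set?
    N x y = does (adjacent? G x y)

    A·A : ∀ x → (A · A x) x ≡ degree x
    A·A x = trans (Σ-cong λ y → trans (𝟙-idem (N x y)) (sym (*-identityʳ (A x y)))) (A·1 x)

    ΣA : ∀ x → sum (A x) ≡ degree x
    ΣA x = trans (Σ-cong λ y → sym (*-identityʳ (A x y))) (A·1 x)

    -- Every neighbour of x already accounts for one edge, the one to x, so `inside-at` leaves at
    -- most three edges among the neighbours: x lies in at most three triangles.
    neighbourhood : ∀ x → ⟨ A x , A x ⟩ ≤ ι 6
    neighbourhood x = cert≤ (≤-diff (inside-at x (N x) (dec-false (adjacent? G x x) λ (x≢x , _) → x≢x refl)))
      (trans (eq ⟨ A x , A x ⟩ (degree x)) (cong₂ (λ a b → ι 2 * b + ι 6 - (⟨ A x , A x ⟩ + ι 2 * a)) (sym (A·A x)) (sym (ΣA x))))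
      where
      eq = solve 2 (λ s d → # ι 6 :- s := # ι 2 :* d :+ # ι 6 :- (s :+ # ι 2 :* d)) refl

    ν : Fin n → ℚ
    ν = A u

    d : ℚ
    d = degree u

    private
      row : ∀ x y ψ → A x y ≡ 1ℚ → (∀ b → N u b ≡ true → N x b ≡ true → ψ b ≡ true) → ψ y ≡ true →
        (A · ν) x + (1ℚ - ν y) ≤ (A · ⟦ ψ ⟧) x
      row x y ψ Axy hψ ψy = subst (_≤ (A · ⟦ ψ ⟧) x)
        (trans (Σ-+ (λ b → A x b * ν b) (λ b → δ y b * (1ℚ - ν y))) (cong ((A · ν) x +_) (Σ-δ y (λ _ → 1ℚ - ν y))))
        (Σ-mono pointwise)
        where
        pointwise : ∀ b → A x b * ν b + δ y b * (1ℚ - ν y) ≤ A x b * ⟦ ψ ⟧ b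
        pointwise b with y ≟ᶠ b
        ... | yes refl rewrite Axy | ψy = ≤-reflexive (eq (ν y))
          where
          eq = solve 1 (λ v → # 1ℚ :* v :+ # 1ℚ :* (# 1ℚ :- v) := # 1ℚ :* # 1ℚ) refl
        ... | no _ = subst (_≤ A x b * ⟦ ψ ⟧ b) (eq (A x b * ν b) (1ℚ - ν y)) (go (N x b) (N u b) (hψ b))
          where
          eq = solve 2 (λ a v → a := a :+ # 0ℚ :* v) refl
          go : ∀ p q → (q ≡ true → p ≡ true → ψ b ≡ true) → 𝟙 p * 𝟙 q ≤ 𝟙 p * ⟦ ψ ⟧ b
          go false q     h = ≤-reflexive (trans (*-zeroˡ (𝟙 q)) (sym (*-zeroˡ (⟦ ψ ⟧ b))))
          go true  false h = subst (0ℚ ≤_) (sym (*-identityˡ (⟦ ψ ⟧ b))) (0≤𝟙 (ψ b))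
          go true  true  h rewrite h refl refl = ≤-refl

    -- Apply `inside-at` to x, y and the neighbours of u adjacent to x or y. The set has as many
    -- elements as edges to u, plus one for each of x and y that is not adjacent to u. Its edges at
    -- x or y number at least the two codegrees plus the same corrections, less one for the edge xy
    -- counted twice. This leaves 3 + 1 for the codegrees.
    codegrees : ∀ {x y} → x ≢ u → y ≢ u → x ≢ y → A x y ≡ 1ℚ → (A · ν) x + (A · ν) y ≤ ι 4
    codegrees {x} {y} x≢u y≢u x≢y Axy = halve (cert≤
      (≤-diff (inside-at u ψ ψu) ⊞ ≤-diff (form-≥ s ⟦ ψ ⟧ s≤ψ) ⊞ 0≤ι 2 ⊠ (≤-diff row-x ⊞ ≤-diff row-y) ⊞ 0≤ι 2 ⊠ ≤-diff card)
      (trans (eq ((A · ν) x) ((A · ν) y) ⟨ ⟦ ψ ⟧ , ⟦ ψ ⟧ ⟩ ((A · ⟦ ψ ⟧) u) ∥ ψ ∥ ((A · ⟦ ψ ⟧) x) ((A · ⟦ ψ ⟧) y) (ν x) (ν y))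
        (cong₂ (λ a b → ι 2 * ∥ ψ ∥ + ι 6 - (⟨ ⟦ ψ ⟧ , ⟦ ψ ⟧ ⟩ + ι 2 * (A · ⟦ ψ ⟧) u) + (⟨ ⟦ ψ ⟧ , ⟦ ψ ⟧ ⟩ + a - (b + b))
            + ι 2 * ((A · ⟦ ψ ⟧) x - ((A · ν) x + (1ℚ - ν y)) + ((A · ⟦ ψ ⟧) y - ((A · ν) y + (1ℚ - ν x))))
            + ι 2 * ((A · ⟦ ψ ⟧) u + ((1ℚ - ν x) + (1ℚ - ν y)) - ∥ ψ ∥))
          (sym ss) (sym sψ))))
      where
      ψ : Set?
      ψ b = (N u b ∧ (N x b ∨ N y b)) ∨ (does (x ≟ᶠ b) ∨ does (y ≟ᶠ b))
      s : Fin n → ℚ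
      s b = δ x b + δ y b
      ψu : ψ u ≡ false
      ψu rewrite dec-false (adjacent? G u u) (λ (u≢u , _) → u≢u refl) | dec-false (x ≟ᶠ u) x≢u | dec-false (y ≟ᶠ u) y≢u = refl
      ∨-trueʳ : ∀ a {b} → b ≡ true → a ∨ b ≡ true
      ∨-trueʳ true  _ = refl
      ∨-trueʳ false e = e
      ψx : ψ x ≡ true
      ψx = ∨-trueʳ (N u x ∧ (N x x ∨ N y x)) (cong (_∨ does (y ≟ᶠ x)) (dec-true (x ≟ᶠ x) refl))
      ψy : ψ y ≡ true
      ψy = ∨-trueʳ (N u y ∧ (N x y ∨ N y y)) (∨-trueʳ (does (x ≟ᶠ y)) (dec-true (y ≟ᶠ y) refl))
      row-x : (A · ν) x + (1ℚ - ν y) ≤ (A · ⟦ ψ ⟧) x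
      row-x = row x y ψ Axy (λ b p q → cong₂ (λ a c → (a ∧ (c ∨ N y b)) ∨ (does (x ≟ᶠ b) ∨ does (y ≟ᶠ b))) p q) ψy
      row-y : (A · ν) y + (1ℚ - ν x) ≤ (A · ⟦ ψ ⟧) y
      row-y = row y x ψ (trans (adj-sym G y x) Axy)
        (λ b p q → trans (cong₂ (λ a c → (a ∧ (N x b ∨ c)) ∨ (does (x ≟ᶠ b) ∨ does (y ≟ᶠ b))) p q)
          (cong (λ t → t ∨ (does (x ≟ᶠ b) ∨ does (y ≟ᶠ b))) (∨-trueʳ (N x b) refl))) ψx
      card : ∥ ψ ∥ ≤ (A · ⟦ ψ ⟧) u + ((1ℚ - ν x) + (1ℚ - ν y))
      card = subst (∥ ψ ∥ ≤_)
        (trans (Σ-+ (λ b → ν b * ⟦ ψ ⟧ b) (λ b → δ x b * (1ℚ - ν x) + δ y b * (1ℚ - ν y)))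
          (cong ((A · ⟦ ψ ⟧) u +_) (trans (Σ-+ (λ b → δ x b * (1ℚ - ν x)) (λ b → δ y b * (1ℚ - ν y)))
            (cong₂ _+_ (Σ-δ x (λ _ → 1ℚ - ν x)) (Σ-δ y (λ _ → 1ℚ - ν y))))))
        (Σ-mono pointwise)
        where
        pointwise : ∀ b → ⟦ ψ ⟧ b ≤ ν b * ⟦ ψ ⟧ b + (δ x b * (1ℚ - ν x) + δ y b * (1ℚ - ν y))
        pointwise b with N u b in Nub
        ... | true = cert≤ (0≤δ x b ⊠ 0≤1-𝟙 (N u x) ⊞ 0≤δ y b ⊠ 0≤1-𝟙 (N u y))
          (eq₁ (𝟙 ((N x b ∨ N y b) ∨ (does (x ≟ᶠ b) ∨ does (y ≟ᶠ b)))) (δ x b * (1ℚ - ν x)) (δ y b * (1ℚ - ν y)))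
          where
          eq₁ = solve 3 (λ p q r → # 1ℚ :* p :+ (q :+ r) :- p := q :+ r) refl
        ... | false = go (x ≟ᶠ b) (y ≟ᶠ b)
          where
          go : (dx : Dec (x ≡ b)) (dy : Dec (y ≡ b)) → 𝟙 (does dx ∨ does dy) ≤
            0ℚ * 𝟙 (does dx ∨ does dy) + (𝟙 (does dx) * (1ℚ - ν x) + 𝟙 (does dy) * (1ℚ - ν y))
          go (yes refl) dy rewrite Nub = cert≤ (0≤𝟙 (does dy) ⊠ 0≤1-𝟙 (N u y)) (eq₁ (𝟙 (does dy) * (1ℚ - ν y)))
            where
            eq₁ = solve 1 (λ r → # 0ℚ :* # 1ℚ :+ (# 1ℚ :* (# 1ℚ :- # 0ℚ) :+ r) :- # 1ℚ := r) refl
          go (no _) (yes refl) rewrite Nub = ≤-reflexive (eq₁ (ν x))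
            where
            eq₁ = solve 1 (λ v → # 1ℚ := # 0ℚ :* # 1ℚ :+ (# 0ℚ :* (# 1ℚ :- v) :+ # 1ℚ :* (# 1ℚ :- # 0ℚ))) refl
          go (no _) (no _) = ≤-reflexive (eq₁ (ν x) (ν y))
            where
            eq₁ = solve 2 (λ v w → # 0ℚ := # 0ℚ :* # 0ℚ :+ (# 0ℚ :* (# 1ℚ :- v) :+ # 0ℚ :* (# 1ℚ :- w))) refl
      s≤ψ : ∀ b → s b ≤ ⟦ ψ ⟧ b
      s≤ψ b = go (N u b ∧ (N x b ∨ N y b)) (x ≟ᶠ b) (y ≟ᶠ b)
        where
        go : ∀ p (dx : Dec (x ≡ b)) (dy : Dec (y ≡ b)) → 𝟙 (does dx) + 𝟙 (does dy) ≤ 𝟙 (p ∨ (does dx ∨ does dy))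
        go p (yes refl) (yes refl) = contradiction refl x≢y
        go p (yes refl) (no _) = ≤-reflexive (cong 𝟙 (sym (∨-trueʳ p {true ∨ false} refl)))
        go p (no _) (yes refl) = ≤-reflexive (cong 𝟙 (sym (∨-trueʳ p {false ∨ true} refl)))
        go p (no _) (no _) = 0≤𝟙 (p ∨ false)
      sψ : ⟨ s , ⟦ ψ ⟧ ⟩ ≡ (A · ⟦ ψ ⟧) x + (A · ⟦ ψ ⟧) y
      sψ = trans (form-+ˡ (δ x) (δ y) ⟦ ψ ⟧) (cong₂ _+_ (form-δ x ⟦ ψ ⟧) (form-δ y ⟦ ψ ⟧))
      ss : ⟨ s , s ⟩ ≡ ι 2
      ss = trans (form-+ˡ (δ x) (δ y) s) (cong₂ _+_ (half x y Axy) (trans (form-δ y s) (trans (·-+ (δ x) (δ y) y)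
        (cong₂ _+_ (trans (·-δ x y) (trans (adj-sym G y x) Axy)) (trans (·-δ y y) (A-irrefl y))))))
        where
        half : ∀ x y → A x y ≡ 1ℚ → ⟨ δ x , (λ b → δ x b + δ y b) ⟩ ≡ 1ℚ
        half x y Axy = trans (form-δ x (λ b → δ x b + δ y b)) (trans (·-+ (δ x) (δ y) x)
          (cong₂ _+_ (trans (·-δ x x) (A-irrefl x)) (trans (·-δ y x) Axy)))
      eq = solve 9 (λ cx cy Q C m rx ry vx vy → # ι 4 :+ # ι 4 :- (cx :+ cy :+ (cx :+ cy)) :=
        # ι 2 :* m :+ # ι 6 :- (Q :+ # ι 2 :* C) :+ (Q :+ # ι 2 :- (rx :+ ry :+ (rx :+ ry)))
          :+ # ι 2 :* (rx :- (cx :+ (# 1ℚ :- vy)) :+ (ry :- (cy :+ (# 1ℚ :- vx))))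
          :+ # ι 2 :* (C :+ ((# 1ℚ :- vx) :+ (# 1ℚ :- vy)) :- m)) refl

-- Walk counts relative to a chosen vertex.

module Estimates where
  open OrderedField
  open LinearAlgebra
  open AdjacencyOperators
  open Neighbourhoods
  open import Defs hiding (_≈_; _≤_)
  open import Data.Bool.Base using (true; false)
  open import Data.Fin.Base using (Fin)
  open import Data.Fin.Properties using () renaming (_≟_ to _≟ᶠ_)
  open import Data.Nat.Base as ℕ using (ℕ)
  open import Data.Product.Base using (_,_)
  open import Data.Rational.Base hiding (_⊔_; _⊓_; ∣_∣)
  open import Data.Rational.Properties
  open import Relation.Nullary using (Dec; yes; no; does)
  open import Relation.Binary.PropositionalEquality

  module Estimate (G : Hypergraph) (uniform : Uniform 2 G) (connected : Connected G)
    (order+2 : order G ℕ.+ 2 ≡ size G) (u : Fin (order G)) where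

    open Local G uniform connected order+2 u public

    o : Fin n → ℚ
    o x = 1ℚ - δ u x

    o-u : o u ≡ 0ℚ
    o-u = cong (λ a → 1ℚ - a) (δ-refl u)

    o-≢ : ∀ {x} → x ≢ u → o x ≡ 1ℚ
    o-≢ x≢u = cong (λ a → 1ℚ - a) (δ-≢ (λ u≡x → x≢u (sym u≡x)))

    0≤o : ∀ x → 0ℚ ≤ o x
    0≤o x = 0≤1-𝟙 (does (u ≟ᶠ x))

    o≤1 : ∀ x → o x ≤ 1ℚ
    o≤1 x = cert≤ (0≤δ u x) (eq (δ u x))
      where
      eq = solve 1 (λ a → # 1ℚ :- (# 1ℚ :- a) := a) refl

    ν-u : ν u ≡ 0ℚ
    ν-u = A-irrefl u

    0≤ν : ∀ x → 0ℚ ≤ ν x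
    0≤ν x = 0≤𝟙 (N u x)

    ν≤1 : ∀ x → ν x ≤ 1ℚ
    ν≤1 x = 𝟙≤1 (N u x)

    ν≤o : ∀ x → ν x ≤ o x
    ν≤o x with x ≟ᶠ u
    ... | yes refl = ≤-reflexive (trans ν-u (sym o-u))
    ... | no x≢u   = subst (ν x ≤_) (sym (o-≢ x≢u)) (ν≤1 x)

    -- p counts the edges avoiding u. Below, c x counts the common neighbours of x and u, and D x is
    -- the degree of x after u is removed.
    p : ℚ
    p = ι k - d

    c D : Fin n → ℚ
    c = A · ν
    D = A · o

    0≤c : ∀ x → 0ℚ ≤ c x
    0≤c x = Σ-nonneg λ y → A≥0 x y ⊠ 0≤ν y

    0≤D : ∀ x → 0ℚ ≤ D x
    0≤D x = Σ-nonneg λ y → A≥0 x y ⊠ 0≤o y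

    split-u : ∀ (q : Fin n → ℚ) x → (A · q) x ≡ (A · (λ y → o y * q y)) x + A x u * q u
    split-u q x = trans
      (Σ-cong λ y → eq (A x y) (δ u y) (q y))
      (trans (Σ-+ (λ y → A x y * (o y * q y)) (λ y → δ u y * (A x y * q y)))
        (cong ((A · (λ y → o y * q y)) x +_) (Σ-δ u (λ y → A x y * q y))))
      where
      eq = solve 3 (λ a e q → a :* q := a :* ((# 1ℚ :- e) :* q) :+ e :* (a :* q)) refl

    D≡ : ∀ x → degree x ≡ D x + ν x
    D≡ x = trans (sym (A·1 x)) (trans (split-u (λ _ → 1ℚ) x)
      (cong₂ _+_ (Σ-cong λ y → cong (A x y *_) (*-identityʳ (o y))) (trans (*-identityʳ (A x u)) (adj-sym G x u))))

    D-u : D u ≡ d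
    D-u = trans (sym (+-identityʳ (D u))) (trans (cong (D u +_) (sym ν-u)) (sym (D≡ u)))

    form-o : ⟨ o , o ⟩ ≡ p + p
    form-o = modulo (- 1ℚ) total (eq ⟨ o , o ⟩ d (ι k))
      where
      total : ⟨ o , o ⟩ + ι 2 * d ≡ ι k * ι 2
      total = begin
        ⟨ o , o ⟩ + ι 2 * d
          ≡⟨ cong (λ a → ⟨ o , o ⟩ + ι 2 * a) (sym D-u) ⟩
        ⟨ o , o ⟩ + ι 2 * D u
          ≡⟨ eq₁ ⟨ o , o ⟩ (D u) ⟩
        ⟨ o , o ⟩ + D u + (D u + 0ℚ)
          ≡⟨ cong₂ (λ a b → ⟨ o , o ⟩ + a + (D u + b)) (sym (trans (form-sym o (δ u)) (form-δ u o)))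
               (sym (trans (form-δ u (δ u)) (trans (·-δ u u) (A-irrefl u)))) ⟩
        ⟨ o , o ⟩ + ⟨ o , δ u ⟩ + (D u + ⟨ δ u , δ u ⟩)
          ≡⟨ cong (λ a → ⟨ o , o ⟩ + ⟨ o , δ u ⟩ + (a + ⟨ δ u , δ u ⟩)) (sym (form-δ u o)) ⟩
        ⟨ o , o ⟩ + ⟨ o , δ u ⟩ + (⟨ δ u , o ⟩ + ⟨ δ u , δ u ⟩)
          ≡⟨ sym (trans (form-+ˡ o (δ u) (λ x → o x + δ u x)) (cong₂ _+_ (form-+ʳ o (δ u) o) (form-+ʳ o (δ u) (δ u)))) ⟩
        ⟨ (λ x → o x + δ u x) , (λ x → o x + δ u x) ⟩
          ≡⟨ Σ-cong (λ x → cong₂ _*_ (one x) (Σ-cong λ y → cong (A x y *_) (one y))) ⟩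
        ⟨ (λ _ → 1ℚ) , (λ _ → 1ℚ) ⟩
          ≡⟨ form-total ⟩
        ι k * ι 2 ∎
        where
        open ≡-Reasoning
        eq₁ = solve 2 (λ a b → a :+ # ι 2 :* b := a :+ b :+ (b :+ # 0ℚ)) refl
        one : ∀ x → o x + δ u x ≡ 1ℚ
        one x = eq₂ (δ u x)
          where
          eq₂ = solve 1 (λ a → # 1ℚ :- a :+ a := # 1ℚ) refl
      eq = solve 3 (λ s d k → s :+ :- # 1ℚ :* (s :+ # ι 2 :* d :- k :* # ι 2) := k :- d :+ (k :- d)) refl

    -- The form counts each edge off u once for every end in the set α. Only the at most three edges
    -- inside α are counted twice.
    at-most-p : ∀ α → (∀ x → α x ≤ o x) → ⟨ α , α ⟩ ≤ ι 6 → ⟨ α , o ⟩ ≤ p + ι 3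
    at-most-p α α≤o h = halve (≤-trans (form-≥ α o α≤o) (cert≤ (≤-diff h) (trans (cong (λ a → p + ι 3 + (p + ι 3) - (a + ⟨ α , α ⟩)) form-o) (eq p ⟨ α , α ⟩))))
      where
      eq = solve 2 (λ p a → p :+ # ι 3 :+ (p :+ # ι 3) :- (p :+ p :+ a) := # ι 6 :- a) refl

    ν-edges : ⟨ ν , o ⟩ ≤ p + ι 3
    ν-edges = at-most-p ν ν≤o (neighbourhood u)

    two-steps : ∀ x → sum (λ y → A x y * (o y * D y)) ≤ p + ι 3
    two-steps x = subst (_≤ p + ι 3) (Σ-cong λ y → *-assoc (A x y) (o y) (D y))
      (at-most-p (λ y → A x y * o y) (λ y → αy≤ y)
        (≤-trans (Σ-mono λ y → scale₂ (A≥0 x y ⊠ 0≤o y) (α≤A y) (·-mono α≤A y) (Σ-nonneg λ z → A≥0 y z ⊠ A≥0 x z)) (neighbourhood x)))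
      where
      αy≤ : ∀ y → A x y * o y ≤ o y
      αy≤ y = subst (A x y * o y ≤_) (*-identityˡ (o y)) (subst₂ _≤_ (*-comm (o y) (A x y)) (*-comm (o y) 1ℚ) (scale-≤ (0≤o y) (𝟙≤1 (N x y))))
      α≤A : ∀ y → A x y * o y ≤ A x y
      α≤A y = subst (A x y * o y ≤_) (*-identityʳ (A x y)) (scale-≤ (A≥0 x y) (o≤1 y))
      scale₂ : ∀ {a a′ b b′} → 0ℚ ≤ a → a ≤ a′ → b ≤ b′ → 0ℚ ≤ b′ → a * b ≤ a′ * b′
      scale₂ {a} {a′} {b} {b′} 0≤a a≤ b≤ 0≤b′ = cert≤ (0≤a ⊠ ≤-diff b≤ ⊞ ≤-diff a≤ ⊠ 0≤b′) (eq a a′ b b′)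
        where
        eq = solve 4 (λ a a′ b b′ → a′ :* b′ :- a :* b := a :* (b′ :- b) :+ (a′ :- a) :* b′) refl

    δ≤ : ∀ {x} (q : Fin n → ℚ) → (∀ y → 0ℚ ≤ q y) → q x ≡ 1ℚ → ∀ y → δ x y ≤ q y
    δ≤ {x} q 0≤q qx y with x ≟ᶠ y
    ... | yes refl = ≤-reflexive (sym qx)
    ... | no _     = 0≤q y

    row≤ : ∀ {x} (q : Fin n → ℚ) → (∀ y → 0ℚ ≤ q y) → q x ≡ 1ℚ → (A · q) x + (A · q) x ≤ ⟨ q , q ⟩
    row≤ {x} q 0≤q qx = subst₂ _≤_ (cong₂ _+_ (form-δ x q) (form-δ x q))
      (trans (cong (⟨ q , q ⟩ +_) (trans (form-δ x (δ x)) (trans (·-δ x x) (A-irrefl x)))) (+-identityʳ ⟨ q , q ⟩))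
      (form-≥ (δ x) q (δ≤ q 0≤q qx))

    D≤p : ∀ {x} → x ≢ u → D x ≤ p
    D≤p {x} x≢u = halve (subst (D x + D x ≤_) form-o (row≤ o 0≤o (o-≢ x≢u)))

    -- A neighbour x of u lies in at most three triangles with u, so c x ≤ 3. Otherwise the first
    -- term vanishes and c x ≤ p ≤ 8 ≤ f + 3.
    ν+c : ∀ f → ι 5 ≤ f → ∀ {x} → x ≢ u → p ≤ ι 8 → f * ν x + c x ≤ f + ι 3
    ν+c f 5≤f {x} x≢u p≤8 with N u x in eq
    ... | true = cert≤ (≤-diff c≤3) (eq₁ f (c x))
      where
      c≤3 : c x ≤ ι 3
      c≤3 = halve (≤-trans (row≤ ν 0≤ν (cong 𝟙 eq)) (≤-trans (neighbourhood u) by-evaluation))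
      eq₁ = solve 2 (λ f c → f :+ # ι 3 :- (f :* # 1ℚ :+ c) := # ι 3 :- c) refl
    ... | false = cert≤ (≤-diff (≤-trans (·-mono ν≤o x) (≤-trans (D≤p x≢u) p≤8)) ⊞ ≤-diff 5≤f) (eq₁ f (c x))
      where
      eq₁ = solve 2 (λ f c → f :+ # ι 3 :- (f :* # 0ℚ :+ c) := # ι 8 :- c :+ (f :- # ι 5)) refl

    -- The sum runs over the edges xy avoiding u, each with weight c x + c y, and `codegrees` bounds
    -- this weight by four. Doubling makes the sum symmetric in the two ends.
    o-c-D : sum (λ x → c x * (o x * D x)) ≤ ι 4 * p
    o-c-D = halve (subst₂ _≤_ double (trans (Σ-*ˡ (ι 4) (λ x → o x * D x)) (trans (cong (ι 4 *_) form-o) (*-distribˡ-+ (ι 4) p p))) (Σ-mono pointwise))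
      where
      oc : Fin n → ℚ
      oc x = c x * o x
      S : ℚ
      S = sum (λ x → c x * (o x * D x))
      S≡ : S ≡ ⟨ oc , o ⟩
      S≡ = Σ-cong λ x → sym (*-assoc (c x) (o x) (D x))
      double : sum (λ x → c x * (o x * D x) + o x * (A · oc) x) ≡ S + S
      double = trans (Σ-+ (λ x → c x * (o x * D x)) (λ x → o x * (A · oc) x))
        (cong (S +_) (trans (form-sym o oc) (sym S≡)))
      pointwise : ∀ x → c x * (o x * D x) + o x * (A · oc) x ≤ ι 4 * (o x * D x)
      pointwise x = subst₂ _≤_
        (trans (Σ-+ (λ y → c x * o x * (A x y * o y)) (λ y → o x * (A x y * oc y)))
          (cong₂ _+_ (trans (Σ-*ˡ (c x * o x) (λ y → A x y * o y)) (*-assoc (c x) (o x) (D x))) (Σ-*ˡ (o x) (λ y → A x y * oc y))))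
        (trans (Σ-*ˡ (ι 4 * o x) (λ y → A x y * o y)) (*-assoc (ι 4) (o x) (D x)))
        (Σ-mono entry)
        where
        zero-case : ∀ {y} → o x * (A x y * o y) ≡ 0ℚ →
          c x * o x * (A x y * o y) + o x * (A x y * oc y) ≤ ι 4 * o x * (A x y * o y)
        zero-case {y} e = ≤-reflexive (trans (eq₁ (c x) (o x) (A x y) (o y) (c y)) (trans (cong (λ a → (c x + c y) * a) e)
          (trans (*-zeroʳ (c x + c y)) (sym (trans (*-assoc (ι 4) (o x) (A x y * o y)) (trans (cong (ι 4 *_) e) (*-zeroʳ (ι 4))))))))
          where
          eq₁ = solve 5 (λ cx ox a oy cy → cx :* ox :* (a :* oy) :+ ox :* (a :* (cy :* oy)) := (cx :+ cy) :* (ox :* (a :* oy))) refl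
        entry : ∀ y → c x * o x * (A x y * o y) + o x * (A x y * oc y) ≤ ι 4 * o x * (A x y * o y)
        entry y = go (x ≟ᶠ u) (y ≟ᶠ u) (x ≟ᶠ y) (N x y) refl
          where
          go : Dec (x ≡ u) → Dec (y ≡ u) → Dec (x ≡ y) → ∀ b → N x y ≡ b →
            c x * o x * (A x y * o y) + o x * (A x y * oc y) ≤ ι 4 * o x * (A x y * o y)
          go (yes refl) _ _ _ _ = zero-case (trans (cong (_* (A u y * o y)) o-u) (*-zeroˡ (A u y * o y)))
          go (no _) (yes refl) _ _ _ = zero-case (trans (cong (λ a → o x * (A x u * a)) o-u) (trans (cong (o x *_) (*-zeroʳ (A x u))) (*-zeroʳ (o x))))
          go (no _) (no _) (yes refl) _ _ = zero-case (trans (cong (λ a → o x * (a * o x)) (A-irrefl x)) (trans (cong (o x *_) (*-zeroˡ (o x))) (*-zeroʳ (o x))))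
          go (no _) (no _) (no _) false e = zero-case (trans (cong (λ b → o x * (𝟙 b * o y)) e) (trans (cong (o x *_) (*-zeroˡ (o y))) (*-zeroʳ (o x))))
          go (no x≢u) (no y≢u) (no x≢y) true e = cert≤ (0≤o x ⊠ (A≥0 x y ⊠ 0≤o y) ⊠ ≤-diff (codegrees x≢u y≢u x≢y (cong 𝟙 e)))
            (eq₁ (c x) (o x) (A x y) (o y) (c y))
            where
            eq₁ = solve 5 (λ cx ox a oy cy → # ι 4 :* ox :* (a :* oy) :- (cx :* ox :* (a :* oy) :+ ox :* (a :* (cy :* oy))) := ox :* (a :* oy) :* (# ι 4 :- (cx :+ cy))) refl

-- Edges off the centre and vertices not adjacent to it.

module Surroundings where
  open OrderedField
  open AdjacencyOperators
  open Graphs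
  open Estimates
  open LooseCycles
  open CoreForms using (CoreForm; triangle-ends; triangle-edges; extend-core)
  open import Defs hiding (_≈_; _≤_)
  open import Data.Bool.Base using (true; false; not)
  open import Data.Fin.Base using (Fin; zero; suc; _↑ˡ_)
  open import Data.Fin.Patterns using (0F; 1F; 2F; 3F; 4F; 5F; 6F; 7F; 8F)
  open import Data.Fin.Properties using (any?) renaming (_≟_ to _≟ᶠ_)
  open import Data.Fin.Subset using (_∈_)
  open import Data.Fin.Subset.Properties using (_∈?_)
  open import Data.List.Base as List using (List; []; _∷_; length; filter; allFin; tabulate)
  open import Data.List.Membership.Propositional using () renaming (_∈_ to _∈ˡ_; _∉_ to _∉ˡ_)
  open import Data.List.Membership.Propositional.Properties using (∈-filter⁺; ∈-filter⁻; ∈-allFin; ∈-tabulate⁺; ∈-map⁺; ∈-++⁺ˡ; ∈-++⁺ʳ)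
  open import Data.List.Relation.Unary.All as All using (All; []; _∷_)
  import Data.List.Relation.Unary.All.Properties as Allₚ
  open import Data.List.Relation.Unary.AllPairs using ([]; _∷_)
  open import Data.List.Relation.Unary.Any using (here)
  open import Data.List.Relation.Unary.Unique.Propositional using (Unique)
  import Data.List.Relation.Unary.Unique.Propositional.Properties as Uniqueₚ
  open import Data.Nat.Base as ℕ using (ℕ; zero; suc)
  import Data.Nat.Properties as ℕₚ
  open import Data.Product.Base using (Σ; ∃-syntax; ∃₂; _×_; _,_; proj₁; proj₂)
  open import Data.Sum.Base as Sum⊎ using (_⊎_; inj₁; inj₂)
  open import Data.Empty using () renaming (⊥ to Absurd)
  open import Data.Rational.Base hiding (_⊔_; _⊓_; ∣_∣)
  open import Data.Rational.Properties
  open import Function.Base using (_∘_; id)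
  open import Relation.Nullary using (¬_; Dec; yes; no; does)
  open import Relation.Nullary.Decidable using (_×-dec_; ¬?)
  open import Relation.Nullary.Negation using (contradiction)
  open import Relation.Binary.PropositionalEquality
  open import Relation.Unary using (Decidable)

  ι-injective : ∀ a b → ι a ≡ ι b → a ≡ b
  ι-injective zero    zero    _  = refl
  ι-injective zero    (suc b) eq = contradiction (subst (0ℚ <_) (sym eq) (0<1 ⁺⊞ 0≤ι b)) (<-irrefl refl)
  ι-injective (suc a) zero    eq = contradiction (subst (0ℚ <_) eq (0<1 ⁺⊞ 0≤ι a)) (<-irrefl refl)
  ι-injective (suc a) (suc b) eq = cong suc (ι-injective a b (trans (minus (ι a)) (trans (cong (_- 1ℚ) eq) (sym (minus (ι b))))))
    where
    minus = solve 1 (λ x → x := # 1ℚ :+ x :- # 1ℚ) refl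

  length-filter : ∀ {A : Set} {P : A → Set} (P? : Decidable P) {k} (f : Fin k → A) →
    ι (length (filter P? (tabulate f))) ≡ sum (λ i → 𝟙 (does (P? (f i))))
  length-filter P? {zero}  f = refl
  length-filter P? {suc k} f with does (P? (f zero))
  ... | true  = cong (1ℚ +_) (length-filter P? (f ∘ suc))
  ... | false = trans (length-filter P? (f ∘ suc)) (sym (+-identityˡ _))

  length-partition : ∀ {A : Set} {P : A → Set} (P? : Decidable P) xs →
    length (filter P? xs) ℕ.+ length (filter (¬? ∘ P?) xs) ≡ length xs
  length-partition P? []       = refl
  length-partition P? (x ∷ xs) with does (P? x)
  ... | true  = cong suc (length-partition P? xs)
  ... | false = trans (ℕₚ.+-suc _ _) (cong suc (length-partition P? xs))

  does-∈? : ∀ H {e i} → does (i ∈? edge H e) ≡ inc H e i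
  does-∈? H {e} {i} with i ∈? edge H e | inc H e i in eq
  ... | yes p | true  = refl
  ... | yes p | false = contradiction (trans (sym (∈⇒inc H p)) eq) λ ()
  ... | no ¬p | true  = contradiction (inc⇒∈ H eq) ¬p
  ... | no ¬p | false = refl

  unique-∷ʳ : ∀ {A : Set} {xs : List A} {w} → Unique xs → All (_≢ w) xs → Unique (xs List.++ w ∷ [])
  unique-∷ʳ uniq ≢w = Uniqueₚ.++⁺ uniq ([] ∷ []) λ { (x∈ , here refl) → All.lookup ≢w x∈ refl }

  module Around (G : Hypergraph) (uniform : Uniform 2 G) (connected : Connected G)
    (order+2 : order G ℕ.+ 2 ≡ size G) (u : Fin (order G)) where

    open Estimate G uniform connected order+2 u public

    outer? : (e : Fin k) → Dec (¬ u ∈ edge G e)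
    outer? e = ¬? (u ∈? edge G e)

    es : List (Fin k)
    es = filter outer? (allFin k)

    remote? : (x : Fin n) → Dec (x ≢ u × ¬ (u ≢ x × ∃[ e ] u ∈ edge G e × x ∈ edge G e))
    remote? x = ¬? (x ≟ᶠ u) ×-dec ¬? (adjacent? G u x)

    rs : List (Fin n)
    rs = filter remote? (allFin n)

    ∈es : ∀ {e} → ¬ u ∈ edge G e → e ∈ˡ es
    ∈es {e} = ∈-filter⁺ outer? (∈-allFin e)

    es-∌ : ∀ {e} → e ∈ˡ es → ¬ u ∈ edge G e
    es-∌ e∈ = proj₂ (∈-filter⁻ outer? {xs = allFin k} e∈)

    es-unique : Unique es
    es-unique = Uniqueₚ.filter⁺ outer? (Uniqueₚ.allFin⁺ k)

    length-es : ι (length es) ≡ p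
    length-es = trans (length-filter outer? id) (trans
      (Σ-cong λ e → trans (cong (λ b → 𝟙 (not b)) (does-∈? G {e} {u})) (𝟙-not (inc G e u)))
      (trans (Σ-+ (λ _ → 1ℚ) (λ e → - 1ℚ * 𝟙 (inc G e u))) (trans (cong₂ _+_ (Σ-1 k) (Σ-*ˡ (- 1ℚ) (λ e → 𝟙 (inc G e u)))) (eq (ι k) d))))
      where
      𝟙-not : ∀ b → 𝟙 (not b) ≡ 1ℚ + - 1ℚ * 𝟙 b
      𝟙-not true  = refl
      𝟙-not false = refl
      eq = solve 2 (λ k d → k :+ :- # 1ℚ :* d := k :- d) refl

    length-rs : ι (length rs) ≡ ι n - 1ℚ - d
    length-rs = trans (length-filter remote? id) (trans (Σ-cong pointwise)
      (trans (Σ-+ (λ x → 1ℚ + - 1ℚ * δ u x) (λ x → - 1ℚ * ν x))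
        (trans (cong₂ _+_ (trans (Σ-+ (λ _ → 1ℚ) (λ x → - 1ℚ * δ u x)) (cong₂ _+_ (Σ-1 n)
            (trans (Σ-*ˡ (- 1ℚ) (δ u)) (cong (- 1ℚ *_) (trans (Σ-cong λ x → sym (*-identityʳ (δ u x))) (Σ-δ u (λ _ → 1ℚ)))))))
          (trans (Σ-*ˡ (- 1ℚ) ν) (cong (- 1ℚ *_) (ΣA u)))) (eq (ι n) d))))
      where
      pointwise : ∀ x → 𝟙 (does (remote? x)) ≡ 1ℚ + - 1ℚ * δ u x + - 1ℚ * ν x
      pointwise x = go (x ≟ᶠ u) (adjacent? G u x) refl
        where
        go : ∀ (p : Dec (x ≡ u)) (q : Dec (u ≢ x × ∃[ e ] u ∈ edge G e × x ∈ edge G e)) → N u x ≡ does q →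
          𝟙 (does (¬? p ×-dec ¬? q)) ≡ 1ℚ + - 1ℚ * δ u x + - 1ℚ * ν x
        go (yes refl) q e = trans (sym (cong₂ (λ a b → 1ℚ + - 1ℚ * a + - 1ℚ * b) (δ-refl u) ν-u)) refl
        go (no x≢u) (yes _) e = sym (cong₂ (λ a b → 1ℚ + - 1ℚ * a + - 1ℚ * b) (δ-≢ (x≢u ∘ sym)) (cong 𝟙 e))
        go (no x≢u) (no _) e = sym (cong₂ (λ a b → 1ℚ + - 1ℚ * a + - 1ℚ * b) (δ-≢ (x≢u ∘ sym)) (cong 𝟙 e))
      eq = solve 2 (λ n d → n :+ :- # 1ℚ :* # 1ℚ :+ :- # 1ℚ :* d := n :- # 1ℚ :- d) refl

    -- There are k - d edges avoiding u and n - 1 - d vertices, other than u, not adjacent to it;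
    -- the difference is k - n + 1 = 3. A bound on these edges thus bounds the remote vertices.
    lengths : length es ≡ 3 ℕ.+ length rs
    lengths = ι-injective (length es) (3 ℕ.+ length rs) (trans length-es
      (modulo 1ℚ ιn (trans (eq (ι k) (ι n) d) (sym (trans (ι-+ 3 (length rs)) (cong (ι 3 +_) length-rs))))))
      where
      eq = solve 3 (λ k n d → k :- d :+ # 1ℚ :* (n :+ # ι 2 :- k) := # ι 3 :+ (n :- # 1ℚ :- d)) refl

    spoke : ∀ {x} → x ≢ u → x ∉ˡ rs → ∃[ s ] Joins G s u x
    spoke {x} x≢u x∉ with adjacent? G u x
    ... | yes (u≢x , s , u∈ , x∈) = s , joins u≢x u∈ x∈
    ... | no ¬adj = contradiction (∈-filter⁺ remote? (∈-allFin x) (x≢u , ¬adj)) x∉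

    -- An edge between two neighbours of u, kept with both spokes: a triangle at u.
    record Inner (e : Fin k) : Set where
      field
        {a b s t} : _
        edge-ab : Joins G e a b
        spoke-a : Joins G s u a
        spoke-b : Joins G t u b

    Disjoint : Fin k → Fin k → Set
    Disjoint e f = ∀ {x} → x ∈ edge G e → x ∈ edge G f → Absurd

    flip-inner : ∀ {e} → Inner e → Inner e
    flip-inner {e} i = record { edge-ab = joins-sym {G} {e} edge-ab ; spoke-a = spoke-b ; spoke-b = spoke-a }
      where open Inner i

    oriented : ∀ {e x} → Inner e → x ∈ edge G e → Σ (Inner e) λ i → Inner.a i ≡ x
    oriented i x∈ with proj₂ (proj₂ (proj₂ (Inner.edge-ab i))) x∈
    ... | inj₁ refl = i , refl
    ... | inj₂ refl = flip-inner i , refl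

    inner-∌ : ∀ {e} → Inner e → ¬ u ∈ edge G e
    inner-∌ i u∈ with proj₂ (proj₂ (proj₂ (Inner.edge-ab i))) u∈
    ... | inj₁ refl = proj₁ (Inner.spoke-a i) refl
    ... | inj₂ refl = proj₁ (Inner.spoke-b i) refl

    -- An edge at u ends in the core or at a leaf. The fifth hypothesis excludes an edge of G from u
    -- to a core vertex that E fails to list.
    build : ∀ {p} (o : Fin p) (E : List (Fin p × Fin p)) (ι : Fin p → Fin n) → ι o ≡ u →
      (∀ i j → ι i ≡ ι j → i ≡ j) →
      (∀ {i j} → (i , j) ∈ˡ E → ∃[ e ] Joins G e (ι i) (ι j)) →
      (∀ x → (∀ i → ι i ≢ x) → ∃[ e ] Joins G e (ι o) x) →
      (∀ i → i ≢ o → ((o , i) ∈ˡ E ⊎ (i , o) ∈ˡ E) ⊎ (∀ e → ¬ Joins G e u (ι i))) →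
      (∀ e → ¬ u ∈ edge G e → ∃₂ λ i j → (i , j) ∈ˡ E × Joins G e (ι i) (ι j)) →
      CoreForm o E G
    build {p} o E ι ιo≡u ι-inj core leaf spokes inner = record
      { ι = ι ; ι-inj = ι-inj ; core = core ; leaf = leaf ; cover = cover }
      where
      other : ∀ e → u ∈ edge G e → ∃[ x ] Joins G e u x
      other e u∈ with endpoints e
      ... | a , b , j@(_ , _ , _ , only) with only u∈
      ...   | inj₁ refl = b , j
      ...   | inj₂ refl = a , joins-sym {G} {e} j
      cover : ∀ e → (∃₂ λ i j → (i , j) ∈ˡ E × Joins G e (ι i) (ι j)) ⊎ (∃[ x ] (∀ i → ι i ≢ x) × Joins G e (ι o) x)
      cover e with u ∈? edge G e
      ... | no u∉ = inj₁ (inner e u∉)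
      ... | yes u∈ with other e u∈
      ...   | x , j with any? (λ i → ι i ≟ᶠ x)
      ...     | no x∉ = inj₂ (x , (λ i eq → x∉ (i , eq)) , subst (λ a → Joins G e a x) (sym ιo≡u) j)
      ...     | yes (i , refl) with i ≟ᶠ o
      ...       | yes refl = contradiction (sym ιo≡u) (proj₁ j)
      ...       | no i≢o with spokes i i≢o
      ...         | inj₁ (inj₁ oi∈) = inj₁ (o , i , oi∈ , subst (λ a → Joins G e a (ι i)) (sym ιo≡u) j)
      ...         | inj₁ (inj₂ io∈) = inj₁ (i , o , io∈ , joins-sym {G} {e} (subst (λ a → Joins G e a (ι i)) (sym ιo≡u) j))
      ...         | inj₂ none = contradiction j (none e)

    -- Three triangles sharing only u: disjointness of their outer edges makes the seven vertices
    -- distinct.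
    module Windmill {e₁ e₂ e₃} (i₁ : Inner e₁) (i₂ : Inner e₂) (i₃ : Inner e₃)
      (d₁₂ : Disjoint e₁ e₂) (d₁₃ : Disjoint e₁ e₃) (d₂₃ : Disjoint e₂ e₃) where

      module I₁ = Inner i₁
      module I₂ = Inner i₂
      module I₃ = Inner i₃

      left : ∀ {e} (i : Inner e) → Inner.a i ∈ edge G e
      left i = proj₁ (proj₂ (Inner.edge-ab i))

      right : ∀ {e} (i : Inner e) → Inner.b i ∈ edge G e
      right i = proj₁ (proj₂ (proj₂ (Inner.edge-ab i)))

      apart : ∀ {e f x y} → Disjoint e f → x ∈ edge G e → y ∈ edge G f → x ≢ y
      apart dis x∈ y∈ refl = dis x∈ y∈

      vertices : List (Fin n)
      vertices = u ∷ I₁.a ∷ I₁.b ∷ I₂.a ∷ I₂.b ∷ I₃.a ∷ I₃.b ∷ []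

      unique : Unique vertices
      unique =
        (proj₁ I₁.spoke-a ∷ proj₁ I₁.spoke-b ∷ proj₁ I₂.spoke-a ∷ proj₁ I₂.spoke-b ∷ proj₁ I₃.spoke-a ∷ proj₁ I₃.spoke-b ∷ []) ∷
        (proj₁ I₁.edge-ab ∷ apart d₁₂ (left i₁) (left i₂) ∷ apart d₁₂ (left i₁) (right i₂) ∷ apart d₁₃ (left i₁) (left i₃) ∷ apart d₁₃ (left i₁) (right i₃) ∷ []) ∷
        (apart d₁₂ (right i₁) (left i₂) ∷ apart d₁₂ (right i₁) (right i₂) ∷ apart d₁₃ (right i₁) (left i₃) ∷ apart d₁₃ (right i₁) (right i₃) ∷ []) ∷
        (proj₁ I₂.edge-ab ∷ apart d₂₃ (left i₂) (left i₃) ∷ apart d₂₃ (left i₂) (right i₃) ∷ []) ∷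
        (apart d₂₃ (right i₂) (left i₃) ∷ apart d₂₃ (right i₂) (right i₃) ∷ []) ∷
        (proj₁ I₃.edge-ab ∷ []) ∷ [] ∷ []

      ι₇ : Fin 7 → Fin n
      ι₇ = List.lookup vertices

      Core : ∀ {p} → (Fin p → Fin n) → Fin p × Fin p → Set
      Core ι (i , j) = ∃[ e ] Joins G e (ι i) (ι j)

      core₇ : All (Core ι₇) triangle-edges
      core₇ = (_ , I₁.spoke-a) ∷ (_ , I₁.edge-ab) ∷ (_ , joins-sym {G} {I₁.t} I₁.spoke-b) ∷
        (_ , I₂.spoke-a) ∷ (_ , I₂.edge-ab) ∷ (_ , joins-sym {G} {I₂.t} I₂.spoke-b) ∷
        (_ , I₃.spoke-a) ∷ (_ , I₃.edge-ab) ∷ (_ , joins-sym {G} {I₃.t} I₃.spoke-b) ∷ []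

      ∈triangles : ∀ e → triangle-ends e ∈ˡ triangle-edges
      ∈triangles e = ∈-tabulate⁺ {f = triangle-ends} e

      spokes₇ : ∀ i → i ≢ 0F → (0F , i) ∈ˡ triangle-edges ⊎ (i , 0F) ∈ˡ triangle-edges
      spokes₇ = by-cases
        ((λ i≢0 → contradiction refl i≢0) ∷ (λ _ → inj₁ (∈triangles 0F)) ∷ (λ _ → inj₂ (∈triangles 2F)) ∷
         (λ _ → inj₁ (∈triangles 3F)) ∷ (λ _ → inj₂ (∈triangles 5F)) ∷
         (λ _ → inj₁ (∈triangles 6F)) ∷ (λ _ → inj₂ (∈triangles 8F)) ∷ [])

      windmill : (∀ {x} → x ≢ u → ∃[ s ] Joins G s u x) → (∀ {e} → ¬ u ∈ edge G e → e ∈ˡ e₁ ∷ e₂ ∷ e₃ ∷ []) →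
        CoreForm 0F triangle-edges G
      windmill spoke all = build 0F triangle-edges ι₇ refl (lookup-injective unique)
        (λ ij∈ → All.lookup {P = Core ι₇} core₇ ij∈)
        (λ x x∉ → spoke (λ eq → x∉ 0F (sym eq)))
        (λ i i≢0 → inj₁ (spokes₇ i i≢0))
        (λ e u∉ → All.lookup {P = λ e → ∃₂ λ i j → (i , j) ∈ˡ triangle-edges × Joins G e (ι₇ i) (ι₇ j)}
          ((1F , 2F , ∈triangles 1F , I₁.edge-ab) ∷ (3F , 4F , ∈triangles 4F , I₂.edge-ab) ∷
           (5F , 6F , ∈triangles 7F , I₃.edge-ab) ∷ []) (all u∉))

      module _ {g w} (w≢u : w ≢ u) (w-remote : ∀ e → ¬ Joins G e u w) (edge-aw : Joins G g I₁.a w) where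

        private
          ≢w : ∀ {s x} → Joins G s u x → x ≢ w
          ≢w {s} j x≡w = w-remote s (subst (Joins G s u) x≡w j)

          vertices₈ : List (Fin n)
          vertices₈ = vertices List.++ w ∷ []

          unique₈ : Unique vertices₈
          unique₈ = unique-∷ʳ unique
            (≢-sym w≢u ∷ ≢w I₁.spoke-a ∷ ≢w I₁.spoke-b ∷ ≢w I₂.spoke-a ∷ ≢w I₂.spoke-b ∷ ≢w I₃.spoke-a ∷ ≢w I₃.spoke-b ∷ [])

          ι₈ : Fin 8 → Fin n
          ι₈ = List.lookup vertices₈

          ι₈-old : ∀ i → ι₈ (i ↑ˡ 1) ≡ ι₇ i
          ι₈-old = by-cases (refl ∷ refl ∷ refl ∷ refl ∷ refl ∷ refl ∷ refl ∷ [])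

          E₈ : List (Fin 8 × Fin 8)
          E₈ = extend-core triangle-edges 1F

          raise : ∀ {i j} → (i , j) ∈ˡ triangle-edges → (i ↑ˡ 1 , j ↑ˡ 1) ∈ˡ E₈
          raise ij∈ = ∈-++⁺ˡ (∈-map⁺ (λ (a , b) → a ↑ˡ 1 , b ↑ˡ 1) ij∈)

          raise-spoke : ∀ i → i ≢ 0F → (0F , i ↑ˡ 1) ∈ˡ E₈ ⊎ (i ↑ˡ 1 , 0F) ∈ˡ E₈
          raise-spoke i i≢0 = Sum⊎.map raise raise (spokes₇ i i≢0)

          core₈ : All (Core ι₈) E₈
          core₈ = Allₚ.++⁺ (Allₚ.map⁺ {f = λ (a , b) → a ↑ˡ 1 , b ↑ˡ 1} (All.map
            (λ {(i , j)} (e , joined) → e , subst₂ (Joins G e) (sym (ι₈-old i)) (sym (ι₈-old j)) joined) core₇))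
            ((g , edge-aw) ∷ [])

        windmill-with-pendant : (∀ {x} → x ≢ u → x ≢ w → ∃[ s ] Joins G s u x) →
          (∀ {e} → ¬ u ∈ edge G e → e ∈ˡ g ∷ e₁ ∷ e₂ ∷ e₃ ∷ []) → CoreForm {8} 0F (extend-core triangle-edges 1F) G
        windmill-with-pendant spoke all = build 0F E₈ ι₈ refl (lookup-injective unique₈)
          (λ ij∈ → All.lookup {P = Core ι₈} core₈ ij∈)
          (λ x x∉ → spoke (λ eq → x∉ 0F (sym eq)) (λ eq → x∉ 7F (sym eq)))
          (by-cases ((λ i≢0 → contradiction refl i≢0) ∷ old 1F (λ ()) ∷ old 2F (λ ()) ∷ old 3F (λ ()) ∷ old 4F (λ ()) ∷
            old 5F (λ ()) ∷ old 6F (λ ()) ∷ (λ _ → inj₂ w-remote) ∷ []))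
          (λ e u∉ → All.lookup {P = λ e → ∃₂ λ i j → (i , j) ∈ˡ E₈ × Joins G e (ι₈ i) (ι₈ j)}
            ((1F , 7F , ∈-++⁺ʳ (List.map (λ (a , b) → a ↑ˡ 1 , b ↑ˡ 1) triangle-edges) (here refl) , edge-aw) ∷
             (1F , 2F , raise (∈triangles 1F) , I₁.edge-ab) ∷ (3F , 4F , raise (∈triangles 4F) , I₂.edge-ab) ∷
             (5F , 6F , raise (∈triangles 7F) , I₃.edge-ab) ∷ []) (all u∉))
          where
          old : ∀ i → i ≢ 0F → i ↑ˡ 1 ≢ 0F → ((0F , i ↑ˡ 1) ∈ˡ E₈ ⊎ (i ↑ˡ 1 , 0F) ∈ˡ E₈) ⊎ (∀ e → ¬ Joins G e u (ι₈ (i ↑ˡ 1)))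
          old i i≢0 _ = inj₁ (raise-spoke i i≢0)

-- Graphs with at most one remote vertex, sorted by their cycles.

module SmallStructures where
  open Graphs
  open LooseCycles
  open CyclesThroughVertices
  open CoreForms using (CoreForm; triangle-edges; extend-core)
  open Surroundings
  open import Defs hiding (_≈_; _≤_)
  open import Data.Empty using () renaming (⊥ to Absurd)
  open import Data.Fin.Base using (Fin; suc)
  open import Data.Fin.Patterns using (0F; 1F)
  open import Data.Fin.Properties using () renaming (_≟_ to _≟ᶠ_)
  open import Data.Fin.Subset using (_∈_)
  open import Data.Fin.Subset.Properties using (_∈?_)
  open import Data.List.Base as List using (List; []; _∷_; length; filter; allFin)
  open import Data.List.Membership.Propositional using () renaming (_∈_ to _∈ˡ_; _∉_ to _∉ˡ_)
  open import Data.List.Membership.Propositional.Properties using (∈-filter⁺; ∈-filter⁻; ∈-++⁺ˡ; ∈-++⁺ʳ)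
  open import Data.List.Relation.Unary.All as All using (All; []; _∷_)
  open import Data.List.Relation.Unary.AllPairs using ([]; _∷_)
  open import Data.List.Relation.Unary.Any using (here; there)
  open import Data.List.Relation.Unary.Unique.Propositional using (Unique)
  import Data.List.Relation.Unary.Unique.Propositional.Properties as Uniqueₚ
  open import Data.Nat.Base as ℕ using (ℕ; suc)
  open import Data.Product.Base using (Σ; ∃-syntax; _×_; _,_; proj₁; proj₂)
  open import Data.Sum.Base using (_⊎_; inj₁; inj₂)
  open import Function.Base using (_∘_)
  open import Relation.Nullary using (¬_; Dec; yes; no)
  open import Relation.Nullary.Decidable using (¬?)
  open import Relation.Nullary.Negation using (contradiction)
  open import Relation.Binary.Construct.Closure.ReflexiveTransitive using (Star; ε; _◅_)
  open import Relation.Binary.PropositionalEquality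

  module ThreeCycles (G : Hypergraph) (uniform : Uniform 2 G) (connected : Connected G)
    (order+2 : order G ℕ.+ 2 ≡ size G) (u : Fin (order G))
    (r : ℕ) {H : Hypergraph} (φ : H ≅ power (suc (suc r)) G) (three : ThreeCyclic H) where

    open Around G uniform connected order+2 u
    open AtMostThree r {G} φ three u using (no-four-cycles)
    open ShortCycles G u

    Cycle : List (Fin k) → Set
    Cycle L = CycleAvoiding G u L × All (λ f → ¬ u ∈ edge G f) L

    private
      inˡ : ∀ {f} {L L′ : List (Fin k)} → f ∈ˡ L → All (f ≢_) L′ → Differ L L′
      inˡ f∈ f≢ = inj₁ (_ , f∈ , λ f∈′ → All.lookup f≢ f∈′ refl)

      inʳ : ∀ {f} {L L′ : List (Fin k)} → f ∈ˡ L′ → All (f ≢_) L → Differ L L′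
      inʳ f∈ f≢ = inj₂ (_ , f∈ , λ f∈′ → All.lookup f≢ f∈′ refl)

      four : ∀ {L₀ L₁ L₂ L₃} → Cycle L₀ → Cycle L₁ → Cycle L₂ → Cycle L₃ →
        Differ L₀ L₁ → Differ L₀ L₂ → Differ L₀ L₃ → Differ L₁ L₂ → Differ L₁ L₃ → Differ L₂ L₃ → Absurd
      four {L₀} {L₁} {L₂} {L₃} (c₀ , a₀) (c₁ , a₁) (c₂ , a₂) (c₃ , a₃) =
        no-four-cycles (List.lookup (L₀ ∷ L₁ ∷ L₂ ∷ L₃ ∷ [])) (by-cases (c₀ ∷ c₁ ∷ c₂ ∷ c₃ ∷ [])) (by-cases (a₀ ∷ a₁ ∷ a₂ ∷ a₃ ∷ []))

    inner-triangle : ∀ {e} → Inner e → Cycle (e ∷ [])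
    inner-triangle i = triangle spoke-a spoke-b edge-ab , inner-∌ i ∷ []
      where open Inner i

    -- Two triangles at u on a common spoke form a quadrilateral once this spoke is left out.
    touching : ∀ {e f x} → Inner e → Inner f → e ≢ f → x ∈ edge G e → x ∈ edge G f → Cycle (e ∷ f ∷ [])
    touching {e} {f} i j e≢f x∈e x∈f with oriented i x∈e | oriented j x∈f
    ... | i′ , refl | j′ , eq =
      quadrilateral I.spoke-b J.spoke-b (joins-sym {G} {e} I.edge-ab) edge-f (proj₁ I.spoke-a)
        (λ b≡b′ → e≢f (joins-unique {G} e f I.edge-ab (subst (Joins G f I.a) (sym b≡b′) edge-f))) ,
      inner-∌ i ∷ inner-∌ j ∷ []
      where
      module I = Inner i′
      module J = Inner j′
      edge-f : Joins G f I.a J.b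
      edge-f = subst (λ a → Joins G f a J.b) eq J.edge-ab

    -- If e and f met, their two triangles, the quadrilateral made of them and the further cycle L
    -- would be four cycles.
    inner-disjoint : ∀ {e f g L} → Inner e → Inner f → e ≢ f → Cycle L → g ∈ˡ L → g ≢ e → g ≢ f → Disjoint e f
    inner-disjoint i j e≢f c g∈ g≢e g≢f x∈e x∈f =
      four (inner-triangle i) (inner-triangle j) (touching i j e≢f x∈e x∈f) c
        (inˡ (here refl) (e≢f ∷ []))
        (inʳ (there (here refl)) (≢-sym e≢f ∷ []))
        (inʳ g∈ (g≢e ∷ []))
        (inʳ (here refl) (e≢f ∷ []))
        (inʳ g∈ (g≢f ∷ []))
        (inʳ g∈ (g≢e ∷ g≢f ∷ []))

    three-disjoint : ∀ {e f g} → Inner e → Inner f → Inner g → Unique (e ∷ f ∷ g ∷ []) →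
      Disjoint e f × Disjoint e g × Disjoint f g
    three-disjoint i j l ((e≢f ∷ e≢g ∷ []) ∷ (f≢g ∷ []) ∷ [] ∷ []) =
      inner-disjoint i j e≢f (inner-triangle l) (here refl) (≢-sym e≢g) (≢-sym f≢g) ,
      inner-disjoint i l e≢g (inner-triangle j) (here refl) (≢-sym e≢f) f≢g ,
      inner-disjoint j l f≢g (inner-triangle i) (here refl) e≢f e≢g

    remote-≢ : ∀ {w} → w ∈ˡ rs → w ≢ u
    remote-≢ w∈ = proj₁ (proj₂ (∈-filter⁻ remote? {xs = allFin n} w∈))

    remote-¬joins : ∀ {w} → w ∈ˡ rs → ∀ e → ¬ Joins G e u w
    remote-¬joins w∈ e (u≢w , u∈e , w∈e , _) = proj₂ (proj₂ (∈-filter⁻ remote? {xs = allFin n} w∈)) (u≢w , e , u∈e , w∈e)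

    -- The case of a single remote vertex w: every edge off u either ends in w or joins two
    -- neighbours of u.
    module Remote {w} (w∈rs : w ∈ˡ rs) (spoke : ∀ {x} → x ≢ u → x ≢ w → ∃[ s ] Joins G s u x) where

      w≢u : w ≢ u
      w≢u = remote-≢ w∈rs

      w-remote : ∀ e → ¬ Joins G e u w
      w-remote = remote-¬joins w∈rs

      record Outer (g : Fin k) : Set where
        field
          {a s}   : _
          edge-aw : Joins G g a w
          spoke-a : Joins G s u a

      outer-∌ : ∀ {g} → w ∈ edge G g → ¬ u ∈ edge G g
      outer-∌ {g} w∈ u∈ = w-remote g (joins (≢-sym w≢u) u∈ w∈)

      spoke-≢w : ∀ {s x} → Joins G s u x → x ≢ w
      spoke-≢w js refl = w-remote _ js

      outer : ∀ {g} → w ∈ edge G g → Outer g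
      outer {g} w∈ = go (endpoints g)
        where
        from : ∀ {x} → Joins G g x w → Outer g
        from {x} j = record { edge-aw = j ; spoke-a = proj₂ (spoke
          (λ eq → outer-∌ w∈ (subst (_∈ edge G g) eq (proj₁ (proj₂ j)))) (proj₁ j)) }
        go : (∃[ x ] ∃[ y ] Joins G g x y) → Outer g
        go (x , y , j) with proj₂ (proj₂ (proj₂ j)) w∈
        ... | inj₁ refl = from (joins-sym {G} {g} j)
        ... | inj₂ refl = from j

      inner : ∀ {e} → ¬ u ∈ edge G e → ¬ w ∈ edge G e → Inner e
      inner {e} u∉ w∉ =
        let a , b , j = endpoints e in
        record { edge-ab = j
               ; spoke-a = proj₂ (spoke (λ eq → u∉ (subst (_∈ edge G e) eq (proj₁ (proj₂ j))))
                                        (λ eq → w∉ (subst (_∈ edge G e) eq (proj₁ (proj₂ j)))))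
               ; spoke-b = proj₂ (spoke (λ eq → u∉ (subst (_∈ edge G e) eq (proj₁ (proj₂ (proj₂ j)))))
                                        (λ eq → w∉ (subst (_∈ edge G e) eq (proj₁ (proj₂ (proj₂ j)))))) }

      ends-apart : ∀ {g h} (p : Outer g) (q : Outer h) → g ≢ h → Outer.a p ≢ Outer.a q
      ends-apart {g} {h} p q g≢h eq = g≢h (joins-unique {G} g h (Outer.edge-aw p)
        (subst (λ a → Joins G h a w) (sym eq) (Outer.edge-aw q)))

      w∈ : ∀ {g} → Outer g → w ∈ edge G g
      w∈ p = proj₁ (proj₂ (proj₂ (Outer.edge-aw p)))

      inner-∌w : ∀ {e} → Inner e → ¬ w ∈ edge G e
      inner-∌w i w∈ with oriented i w∈
      ... | i′ , refl = spoke-≢w (Inner.spoke-a i′) refl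

      outer-≢-inner : ∀ {g e} → Outer g → Inner e → g ≢ e
      outer-≢-inner p i refl = inner-∌w i (w∈ p)

      outer-quadrilateral : ∀ {g h} → Outer g → Outer h → g ≢ h → Cycle (g ∷ h ∷ [])
      outer-quadrilateral {g} {h} p q g≢h =
        quadrilateral P.spoke-a Q.spoke-a P.edge-aw (joins-sym {G} {h} Q.edge-aw) (≢-sym w≢u) (ends-apart p q g≢h) ,
        outer-∌ (w∈ p) ∷ outer-∌ (w∈ q) ∷ []
        where
        module P = Outer p
        module Q = Outer q

      -- The edge e continues the path through w to a longer cycle: a pentagon through u in general,
      -- a triangle off u when the far end of e is the other neighbour of w.
      meeting : ∀ {e g h} → Inner e → (p : Outer g) → Outer h → g ≢ h → Outer.a p ∈ edge G e → Cycle (e ∷ g ∷ h ∷ [])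
      meeting {e} {g} {h} i p q g≢h a∈ = go (oriented i a∈)
        where
        module P = Outer p
        module Q = Outer q
        go : Σ (Inner e) (λ i → Inner.a i ≡ P.a) → Cycle (e ∷ g ∷ h ∷ [])
        go (i′ , eq) = by-end (I.b ≟ᶠ Q.a) , inner-∌ i ∷ outer-∌ (w∈ p) ∷ outer-∌ (w∈ q) ∷ []
          where
          module I = Inner i′
          edge-ba : Joins G e I.b P.a
          edge-ba = joins-sym {G} {e} (subst (λ a → Joins G e a I.b) eq I.edge-ab)
          by-end : Dec (I.b ≡ Q.a) → CycleAvoiding G u (e ∷ g ∷ h ∷ [])
          by-end (yes b≡) = outer-triangle (subst (λ b → Joins G e b P.a) b≡ edge-ba) P.edge-aw (joins-sym {G} {h} Q.edge-aw)
          by-end (no b≢) = pentagon I.spoke-b Q.spoke-a edge-ba P.edge-aw (joins-sym {G} {h} Q.edge-aw)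
            (proj₁ P.spoke-a) (≢-sym w≢u) (spoke-≢w I.spoke-b) b≢ (ends-apart p q g≢h)

      -- Otherwise there are four cycles: the triangles of e and f, the quadrilateral of g and h,
      -- and the cycle from `meeting`.
      not-meeting : ∀ {e f g h} → Inner e → Inner f → e ≢ f → (p : Outer g) → Outer h → g ≢ h → ¬ Outer.a p ∈ edge G e
      not-meeting i j e≢f p q g≢h a∈ =
        four (inner-triangle i) (inner-triangle j) (outer-quadrilateral p q g≢h) (meeting i p q g≢h a∈)
          (inˡ (here refl) (e≢f ∷ []))
          (inʳ (here refl) (outer-≢-inner p i ∷ []))
          (inʳ (there (here refl)) (outer-≢-inner p i ∷ []))
          (inʳ (here refl) (outer-≢-inner p j ∷ []))
          (inʳ (here refl) (e≢f ∷ []))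
          (inʳ (here refl) (≢-sym (outer-≢-inner p i) ∷ ≢-sym (outer-≢-inner q i) ∷ []))

      -- Three edges at w already give three quadrilaterals, and whatever the fourth edge is, it
      -- closes another cycle.
      not-three-outer : ∀ {f g h e} → Unique (f ∷ g ∷ h ∷ []) → Outer f → Outer g → Outer h →
        Inner e ⊎ Outer e × e ≢ f × e ≢ g × e ≢ h → Absurd
      not-three-outer ((f≢g ∷ f≢h ∷ []) ∷ (g≢h ∷ []) ∷ [] ∷ []) p q r last =
        with-last last
        where
        fg = outer-quadrilateral p q f≢g
        fh = outer-quadrilateral p r f≢h
        gh = outer-quadrilateral q r g≢h
        with-last : Inner _ ⊎ Outer _ × _ ≢ _ × _ ≢ _ × _ ≢ _ → Absurd
        with-last (inj₁ i) = four fg fh gh (inner-triangle i)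
          (inˡ (there (here refl)) (≢-sym f≢g ∷ g≢h ∷ []))
          (inˡ (here refl) (f≢g ∷ f≢h ∷ []))
          (inˡ (here refl) (outer-≢-inner p i ∷ []))
          (inˡ (here refl) (f≢g ∷ f≢h ∷ []))
          (inˡ (here refl) (outer-≢-inner p i ∷ []))
          (inˡ (here refl) (outer-≢-inner q i ∷ []))
        with-last (inj₂ (s , e≢f , e≢g , e≢h)) = four fg fh gh (outer-quadrilateral p s (≢-sym e≢f))
          (inˡ (there (here refl)) (≢-sym f≢g ∷ g≢h ∷ []))
          (inˡ (here refl) (f≢g ∷ f≢h ∷ []))
          (inʳ (there (here refl)) (e≢f ∷ e≢g ∷ []))
          (inˡ (here refl) (f≢g ∷ f≢h ∷ []))
          (inʳ (there (here refl)) (e≢f ∷ e≢h ∷ []))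
          (inʳ (there (here refl)) (e≢g ∷ e≢h ∷ []))

    -- Three triangles at u and, elsewhere, a path of length two from u.
    record Path : Set where
      field
        {w g e₁ e₂ e₃} : _
        w∈rs     : w ∈ˡ rs
        {x s}    : _
        edge-xw  : Joins G g x w
        spoke-x  : Joins G s u x
        i₁       : Inner e₁
        i₂       : Inner e₂
        i₃       : Inner e₃
        d₁₂      : Disjoint e₁ e₂
        d₁₃      : Disjoint e₁ e₃
        d₂₃      : Disjoint e₂ e₃
        x∉       : All (λ e → ¬ x ∈ edge G e) (e₁ ∷ e₂ ∷ e₃ ∷ [])
        w∉       : All (λ e → ¬ w ∈ edge G e) (e₁ ∷ e₂ ∷ e₃ ∷ [])
        all      : ∀ {e} → ¬ u ∈ edge G e → e ∈ˡ g ∷ e₁ ∷ e₂ ∷ e₃ ∷ []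

    -- Two triangles and a quadrilateral at u.
    record Square : Set where
      field
        {w g h e₁ e₂} : _
        w∈rs     : w ∈ˡ rs
        {a b s t} : _
        edge-aw  : Joins G g a w
        edge-bw  : Joins G h b w
        a≢b      : a ≢ b
        spoke-a  : Joins G s u a
        spoke-b  : Joins G t u b
        i₁       : Inner e₁
        i₂       : Inner e₂
        d₁₂      : Disjoint e₁ e₂
        a∉       : All (λ e → ¬ a ∈ edge G e) (e₁ ∷ e₂ ∷ [])
        b∉       : All (λ e → ¬ b ∈ edge G e) (e₁ ∷ e₂ ∷ [])
        w∉       : All (λ e → ¬ w ∈ edge G e) (e₁ ∷ e₂ ∷ [])
        all      : ∀ {e} → ¬ u ∈ edge G e → e ∈ˡ g ∷ h ∷ e₁ ∷ e₂ ∷ []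

    data Structure : Set where
      all-at-u : CoreForm 0F triangle-edges G → Structure
      one-off  : CoreForm {8} 0F (extend-core triangle-edges 1F) G → Structure
      path     : Path → Structure
      square   : Square → Structure

    private
      without-remote : (∀ {x} → x ≢ u → ∃[ s ] Joins G s u x) → ∀ xs → length xs ≡ 3 → Unique xs →
        (∀ {e} → ¬ u ∈ edge G e → e ∈ˡ xs) → (∀ {e} → e ∈ˡ xs → ¬ u ∈ edge G e) → Structure
      without-remote spoke (e ∷ f ∷ g ∷ []) refl uniq all outside =
        let d₁₂ , d₁₃ , d₂₃ = three-disjoint i₁ i₂ i₃ uniq in
        all-at-u (Windmill.windmill i₁ i₂ i₃ d₁₂ d₁₃ d₂₃ spoke all)
        where
        inner : ∀ {e} → ¬ u ∈ edge G e → Inner e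
        inner {e} u∉ =
          let a , b , j = endpoints e in
          record { edge-ab = j
                 ; spoke-a = proj₂ (spoke λ eq → u∉ (subst (_∈ edge G e) eq (proj₁ (proj₂ j))))
                 ; spoke-b = proj₂ (spoke λ eq → u∉ (subst (_∈ edge G e) eq (proj₁ (proj₂ (proj₂ j))))) }
        i₁ = inner (outside (here refl))
        i₂ = inner (outside (there (here refl)))
        i₃ = inner (outside (there (there (here refl))))

      module OneRemote {w} (w∈rs : w ∈ˡ rs) (spoke : ∀ {x} → x ≢ u → x ≢ w → ∃[ s ] Joins G s u x) where

        open Remote w∈rs spoke

        one-outer : ∀ {g e₁ e₂ e₃} → Outer g → Inner e₁ → Inner e₂ → Inner e₃ → Unique (e₁ ∷ e₂ ∷ e₃ ∷ []) →
          (∀ {e} → ¬ u ∈ edge G e → e ∈ˡ g ∷ e₁ ∷ e₂ ∷ e₃ ∷ []) → Structure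
        one-outer {g} {e₁} {e₂} {e₃} p i₁ i₂ i₃ uniq all with three-disjoint i₁ i₂ i₃ uniq
        ... | d₁₂ , d₁₃ , d₂₃ = go (P.a ∈? edge G e₁) (P.a ∈? edge G e₂) (P.a ∈? edge G e₃)
          where
          module P = Outer p
          attached : ∀ {f f′ f″} → Inner f → P.a ∈ edge G f → Inner f′ → Inner f″ →
            Disjoint f f′ → Disjoint f f″ → Disjoint f′ f″ →
            (∀ {e} → ¬ u ∈ edge G e → e ∈ˡ g ∷ f ∷ f′ ∷ f″ ∷ []) → Structure
          attached i a∈ i′ i″ d d′ d″ all =
            let j , eq = oriented i a∈ in
            one-off (Windmill.windmill-with-pendant j i′ i″ d d′ d″ w≢u w-remote
              (subst (λ a → Joins G g a w) (sym eq) P.edge-aw) spoke all)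
          swap : ∀ {f f′ f″ e : Fin k} → e ∈ˡ g ∷ f ∷ f′ ∷ f″ ∷ [] → e ∈ˡ g ∷ f′ ∷ f ∷ f″ ∷ []
          swap {f} {f′} {f″} = All.lookup {P = _∈ˡ g ∷ f′ ∷ f ∷ f″ ∷ []} (here refl ∷ there (there (here refl)) ∷ there (here refl) ∷ there (there (there (here refl))) ∷ [])
          rotate : ∀ {f f′ f″ e : Fin k} → e ∈ˡ g ∷ f ∷ f′ ∷ f″ ∷ [] → e ∈ˡ g ∷ f″ ∷ f ∷ f′ ∷ []
          rotate {f} {f′} {f″} = All.lookup {P = _∈ˡ g ∷ f″ ∷ f ∷ f′ ∷ []} (here refl ∷ there (there (here refl)) ∷ there (there (there (here refl))) ∷ there (here refl) ∷ [])
          go : Dec (P.a ∈ edge G e₁) → Dec (P.a ∈ edge G e₂) → Dec (P.a ∈ edge G e₃) → Structure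
          go (yes a∈) _ _ = attached i₁ a∈ i₂ i₃ d₁₂ d₁₃ d₂₃ all
          go (no _) (yes a∈) _ = attached i₂ a∈ i₁ i₃ (λ p q → d₁₂ q p) d₂₃ d₁₃ (swap ∘ all)
          go (no _) (no _) (yes a∈) = attached i₃ a∈ i₁ i₂ (λ p q → d₁₃ q p) (λ p q → d₂₃ q p) d₁₂ (rotate ∘ all)
          go (no ∉₁) (no ∉₂) (no ∉₃) = path record
            { w∈rs = w∈rs ; edge-xw = P.edge-aw ; spoke-x = P.spoke-a
            ; i₁ = i₁ ; i₂ = i₂ ; i₃ = i₃ ; d₁₂ = d₁₂ ; d₁₃ = d₁₃ ; d₂₃ = d₂₃
            ; x∉ = ∉₁ ∷ ∉₂ ∷ ∉₃ ∷ [] ; w∉ = inner-∌w i₁ ∷ inner-∌w i₂ ∷ inner-∌w i₃ ∷ [] ; all = all }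

        two-outer : ∀ {g h e₁ e₂} → Outer g → Outer h → g ≢ h → Inner e₁ → Inner e₂ → e₁ ≢ e₂ →
          (∀ {e} → ¬ u ∈ edge G e → e ∈ˡ g ∷ h ∷ e₁ ∷ e₂ ∷ []) → Structure
        two-outer p q g≢h i₁ i₂ e₁≢e₂ all = square record
          { w∈rs = w∈rs ; edge-aw = Outer.edge-aw p ; edge-bw = Outer.edge-aw q ; a≢b = ends-apart p q g≢h
          ; spoke-a = Outer.spoke-a p ; spoke-b = Outer.spoke-a q ; i₁ = i₁ ; i₂ = i₂
          ; d₁₂ = inner-disjoint i₁ i₂ e₁≢e₂ (outer-quadrilateral p q g≢h) (here refl) (outer-≢-inner p i₁) (outer-≢-inner p i₂)
          ; a∉ = not-meeting i₁ i₂ e₁≢e₂ p q g≢h ∷ not-meeting i₂ i₁ (≢-sym e₁≢e₂) p q g≢h ∷ []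
          ; b∉ = not-meeting i₁ i₂ e₁≢e₂ q p (≢-sym g≢h) ∷ not-meeting i₂ i₁ (≢-sym e₁≢e₂) q p (≢-sym g≢h) ∷ []
          ; w∉ = inner-∌w i₁ ∷ inner-∌w i₂ ∷ [] ; all = all }

        -- Four edges avoid u, and the cases are the numbers of those at w. None is impossible by
        -- connectedness, three or four by the number of cycles. One leaves three triangles and an
        -- edge hanging off a triangle or off another neighbour of u; two leave two triangles and a
        -- quadrilateral.
        by-outer : ∀ ws ns → length ws ℕ.+ length ns ≡ 4 → Unique ws → Unique ns →
          (∀ {e} → e ∈ˡ ws → Outer e) → (∀ {e} → e ∈ˡ ns → Inner e) →
          (∀ {e} → ¬ u ∈ edge G e → e ∈ˡ ws List.++ ns) → (∃[ e ] e ∈ˡ ws) → Structure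
        by-outer [] _ _ _ _ _ _ _ (_ , ())
        by-outer (g ∷ []) (e₁ ∷ e₂ ∷ e₃ ∷ []) refl _ uniq o i all _ =
          one-outer (o (here refl)) (i (here refl)) (i (there (here refl))) (i (there (there (here refl)))) uniq all
        by-outer (g ∷ h ∷ []) (e₁ ∷ e₂ ∷ []) refl ((g≢h ∷ []) ∷ _) ((e₁≢e₂ ∷ []) ∷ _) o i all _ =
          two-outer (o (here refl)) (o (there (here refl))) g≢h (i (here refl)) (i (there (here refl))) e₁≢e₂ all
        by-outer (f ∷ g ∷ h ∷ []) (e ∷ []) refl uniq _ o i _ _ =
          contradiction (inj₁ (i (here refl))) (not-three-outer uniq (o (here refl)) (o (there (here refl))) (o (there (there (here refl)))))
        by-outer (e ∷ f ∷ g ∷ h ∷ []) [] refl ((e≢f ∷ e≢g ∷ e≢h ∷ []) ∷ uniq) _ o _ _ _ =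
          contradiction (inj₂ (o (here refl) , e≢f , e≢g , e≢h))
            (not-three-outer uniq (o (there (here refl))) (o (there (there (here refl)))) (o (there (there (there (here refl))))))

    structure : length rs ℕ.≤ 1 → Structure
    structure = by-remote rs refl
      where
      spoke-to : ∀ {x xs} → rs ≡ xs → x ≢ u → x ∉ˡ xs → ∃[ s ] Joins G s u x
      spoke-to eq x≢u x∉ = spoke x≢u (λ x∈ → x∉ (subst (_ ∈ˡ_) eq x∈))
      length-es≡ : ∀ {xs} → rs ≡ xs → length es ≡ 3 ℕ.+ length xs
      length-es≡ eq = trans lengths (cong (λ xs → 3 ℕ.+ length xs) eq)
      by-remote : ∀ xs → rs ≡ xs → length xs ℕ.≤ 1 → Structure
      by-remote [] eq _ = without-remote (λ x≢u → spoke-to eq x≢u λ ()) es (length-es≡ eq) es-unique ∈es es-∌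
      by-remote (w ∷ []) eq _ = OneRemote.by-outer w∈rs spoke′ ws ns
          (trans (length-partition w? es) (length-es≡ eq))
          (Uniqueₚ.filter⁺ w? es-unique) (Uniqueₚ.filter⁺ (¬? ∘ w?) es-unique)
          (λ e∈ → R.outer (proj₂ (∈-filter⁻ w? {xs = es} e∈)))
          (λ e∈ → let e∈es , w∉ = ∈-filter⁻ (¬? ∘ w?) {xs = es} e∈ in R.inner (es-∌ e∈es) w∉)
          all (at-w (connected w u))
        where
        w∈rs : w ∈ˡ rs
        w∈rs = subst (w ∈ˡ_) (sym eq) (here refl)
        spoke′ : ∀ {x} → x ≢ u → x ≢ w → ∃[ s ] Joins G s u x
        spoke′ x≢u x≢w = spoke-to eq x≢u λ { (here x≡w) → x≢w x≡w }
        module R = Remote w∈rs spoke′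
        w? : ∀ e → Dec (w ∈ edge G e)
        w? e = w ∈? edge G e
        ws ns : List (Fin k)
        ws = filter w? es
        ns = filter (¬? ∘ w?) es
        all : ∀ {e} → ¬ u ∈ edge G e → e ∈ˡ ws List.++ ns
        all {e} u∉ with w? e
        ... | yes w∈ = ∈-++⁺ˡ (∈-filter⁺ w? (∈es u∉) w∈)
        ... | no w∉  = ∈-++⁺ʳ ws (∈-filter⁺ (¬? ∘ w?) (∈es u∉) w∉)
        at-w : Star (λ x y → ∃[ e ] x ∈ edge G e × y ∈ edge G e) w u → ∃[ e ] e ∈ˡ ws
        at-w ε = contradiction refl R.w≢u
        at-w ((e , w∈ , _) ◅ _) = e , ∈-filter⁺ w? (∈es (R.outer-∌ w∈)) w∈
      by-remote (_ ∷ _ ∷ _) _ (ℕ.s≤s ())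

-- The extremal hypergraph and a vector with polynomial entries.

module ExtremalVector where
  open OrderedField
  open LinearAlgebra
  open PolynomialRoots
  open AdjacencyOperators
  open PendantEdges
  open import Defs renaming (_≈_ to _≈ʳ_; _≤_ to _≤ʳ_)
  open import Data.Fin.Base using (Fin; zero; suc; combine)
  open import Data.Fin.Patterns using (0F; 1F; 2F; 3F; 4F; 5F; 6F)
  open import Data.Fin.Properties using (all?) renaming (_≟_ to _≟ᶠ_)
  open import Data.Fin.Subset.Properties using (_∈?_)
  open import Data.List.Base as List using ([]; _∷_)
  open import Data.Nat.Base as ℕ using (ℕ; zero; suc)
  open import Data.Product.Base using (_,_)
  open import Data.Vec.Base as Vec using (Vec)
  open import Data.Rational.Base hiding (_⊔_; _⊓_)
  open import Data.Rational.Properties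
  open import Function.Base using (_∘_)
  open import Relation.Nullary.Decidable using (toWitness; _→-dec_; ¬?)
  open import Relation.Binary.PropositionalEquality

  neighbour-sum-cong : ∀ H {x y} → (∀ i → x i ≡ y i) → ∀ i → neighbour-sum H x i ≡ neighbour-sum H y i
  neighbour-sum-cong H eq i = Σ-cong λ e → cong (𝟙 (inc H e i) *_)
    (cong₂ _-_ (Σ-cong λ j → cong (𝟙 (inc H e j) *_) (eq j)) (eq i))

  neighbour-sum-* : ∀ H c x i → neighbour-sum H (λ j → c * x j) i ≡ c * neighbour-sum H x i
  neighbour-sum-* H c x i = trans
    (Σ-cong λ e → trans
      (cong (λ s → 𝟙 (inc H e i) * (s - c * x i))
        (trans (Σ-cong λ j → swap (𝟙 (inc H e j)) c (x j)) (Σ-*ˡ c (λ j → 𝟙 (inc H e j) * x j))))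
      (factor (𝟙 (inc H e i)) c (edge-sum H x e) (x i)))
    (Σ-*ˡ c (λ e → 𝟙 (inc H e i) * (edge-sum H x e - x i)))
    where
    swap = solve 3 (λ a b c → a :* (b :* c) := b :* (a :* c)) refl
    factor = solve 4 (λ a c s x → a :* (c :* s :- c :* x) := c :* (a :* (s :- x))) refl

  Σᵖ : ∀ {n} → (Fin n → Poly) → Poly
  Σᵖ {zero}  P = con 0ℚ
  Σᵖ {suc n} P = P zero ⊕ Σᵖ (P ∘ suc)

  eval-Σᵖ : ∀ {n} (P : Fin n → Poly) f → eval (Σᵖ P) f ≡ sum (λ i → eval (P i) f)
  eval-Σᵖ {zero}  P f = refl
  eval-Σᵖ {suc n} P f = cong (eval (P zero) f +_) (eval-Σᵖ (P ∘ suc) f)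

  triangles-separated : Separated threeTriangles
  triangles-separated {e} {f} {i} {j} = toWitness
    {a? = all? λ e → all? λ f → all? λ i → all? λ j →
      ¬? (i ≟ᶠ j) →-dec ((i ∈? triangles e) →-dec ((j ∈? triangles e) →-dec
        ((i ∈? triangles f) →-dec ((j ∈? triangles f) →-dec (e ≟ᶠ f)))))} _ e f i j

  triangle-sums : (Fin 7 → ℚ) → Fin 7 → ℚ
  triangle-sums x 0F = x 1F + x 2F + x 3F + x 4F + x 5F + x 6F
  triangle-sums x 1F = x 0F + x 2F
  triangle-sums x 2F = x 0F + x 1F
  triangle-sums x 3F = x 0F + x 4F
  triangle-sums x 4F = x 0F + x 3F
  triangle-sums x 5F = x 0F + x 6F
  triangle-sums x 6F = x 0F + x 5F

  neighbour-sum-triangles : ∀ x u → neighbour-sum threeTriangles x u ≡ triangle-sums x u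
  neighbour-sum-triangles x u = trans (sym (adj-neighbour-sum threeTriangles triangles-separated x u)) (go u)
    where
    go : ∀ u → (adj threeTriangles · x) u ≡ triangle-sums x u
    go 0F = eq (x 0F) (x 1F) (x 2F) (x 3F) (x 4F) (x 5F) (x 6F)
      where
      eq = solve 7 (λ a b c d e f g → # 0ℚ :* a :+ (# 1ℚ :* b :+ (# 1ℚ :* c :+ (# 1ℚ :* d :+ (# 1ℚ :* e :+ (# 1ℚ :* f :+ (# 1ℚ :* g :+ # 0ℚ)))))) := b :+ c :+ d :+ e :+ f :+ g) refl
    go 1F = eq (x 0F) (x 1F) (x 2F) (x 3F) (x 4F) (x 5F) (x 6F)
      where
      eq = solve 7 (λ a b c d e f g → # 1ℚ :* a :+ (# 0ℚ :* b :+ (# 1ℚ :* c :+ (# 0ℚ :* d :+ (# 0ℚ :* e :+ (# 0ℚ :* f :+ (# 0ℚ :* g :+ # 0ℚ)))))) := a :+ c) refl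
    go 2F = eq (x 0F) (x 1F) (x 2F) (x 3F) (x 4F) (x 5F) (x 6F)
      where
      eq = solve 7 (λ a b c d e f g → # 1ℚ :* a :+ (# 1ℚ :* b :+ (# 0ℚ :* c :+ (# 0ℚ :* d :+ (# 0ℚ :* e :+ (# 0ℚ :* f :+ (# 0ℚ :* g :+ # 0ℚ)))))) := a :+ b) refl
    go 3F = eq (x 0F) (x 1F) (x 2F) (x 3F) (x 4F) (x 5F) (x 6F)
      where
      eq = solve 7 (λ a b c d e f g → # 1ℚ :* a :+ (# 0ℚ :* b :+ (# 0ℚ :* c :+ (# 0ℚ :* d :+ (# 1ℚ :* e :+ (# 0ℚ :* f :+ (# 0ℚ :* g :+ # 0ℚ)))))) := a :+ e) refl
    go 4F = eq (x 0F) (x 1F) (x 2F) (x 3F) (x 4F) (x 5F) (x 6F)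
      where
      eq = solve 7 (λ a b c d e f g → # 1ℚ :* a :+ (# 0ℚ :* b :+ (# 0ℚ :* c :+ (# 1ℚ :* d :+ (# 0ℚ :* e :+ (# 0ℚ :* f :+ (# 0ℚ :* g :+ # 0ℚ)))))) := a :+ d) refl
    go 5F = eq (x 0F) (x 1F) (x 2F) (x 3F) (x 4F) (x 5F) (x 6F)
      where
      eq = solve 7 (λ a b c d e f g → # 1ℚ :* a :+ (# 0ℚ :* b :+ (# 0ℚ :* c :+ (# 0ℚ :* d :+ (# 0ℚ :* e :+ (# 0ℚ :* f :+ (# 1ℚ :* g :+ # 0ℚ)))))) := a :+ g) refl
    go 6F = eq (x 0F) (x 1F) (x 2F) (x 3F) (x 4F) (x 5F) (x 6F)
      where
      eq = solve 7 (λ a b c d e f g → # 1ℚ :* a :+ (# 0ℚ :* b :+ (# 0ℚ :* c :+ (# 0ℚ :* d :+ (# 0ℚ :* e :+ (# 1ℚ :* f :+ (# 0ℚ :* g :+ # 0ℚ)))))) := a :+ f) refl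

  -- The hypergraph T₂C(c₁ = a, c₂ = 1) for m = d + 2. The entries X of its eigenvector at the
  -- vertices v₁, …, v₇ solve the eigenvalue equations at v₂, …, v₇ identically in f; the
  -- defect of the equation at v₁ is the polynomial P below. The eigenvalue is (f + d) / (m − 1).
  module Extremal (d a : ℕ) where

    open Power d threeTriangles using (vertex; new; fill; fill-vertex; fill-new; spread; spread-vertex; spread-new; by-kind; degree)

    base : Hypergraph
    base = power (suc (suc d)) threeTriangles

    δᵖ : Poly
    δᵖ = con (ι d)

    -- Coefficients from solving without division. With x₀, x₁, x₂ at v₁, v₂, v₃ the equations read
    -- f w (x₀ + x₂) = γ x₁ and w (x₀ + x₁) = β x₂, with determinant Γ. At v₄, ..., v₇ the common
    -- value t satisfies w x₀ = α t. The choice x₀ = α Γ clears all denominators.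
    w β α γ Γ : Poly
    w = var ⊕ con 1ℚ ⊕ δᵖ
    β = var ⊗ w ⊖ δᵖ
    α = β ⊖ w
    γ = (var ⊕ δᵖ) ⊗ (var ⊕ con 1ℚ) ⊗ var ⊖ (con 1ℚ ⊕ con 1ℚ) ⊗ δᵖ ⊗ var ⊖ (con 1ℚ ⊕ δᵖ) ⊗ (var ⊕ con 1ℚ)
    Γ = γ ⊗ β ⊖ var ⊗ w ⊗ w

    X : Fin 7 → Poly
    X 0F = α ⊗ Γ
    X 1F = var ⊗ α ⊗ w ⊗ (β ⊕ w)
    X 2F = α ⊗ w ⊗ (γ ⊕ var ⊗ w)
    X _  = w ⊗ Γ

    P : Poly
    P = (var ⊕ δᵖ) ⊗ var ⊗ (var ⊕ con 1ℚ) ⊗ X 0F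
      ⊖ var ⊗ (w ⊗ (X 1F ⊕ X 2F ⊕ con (ι 4) ⊗ X 3F) ⊕ con (ι 6) ⊗ δᵖ ⊗ X 0F)
      ⊖ con (ι a) ⊗ (con 1ℚ ⊕ δᵖ) ⊗ (var ⊕ con 1ℚ) ⊗ X 0F

    centre : Fin (order base)
    centre = vertex 0F

    pendants : List.List (Fin (order base))
    pendants = List.replicate a centre List.++ vertex 1F ∷ []

    T : Hypergraph
    T = attachAll (suc (suc d)) base (Vec.fromList pendants)

    T-separated : Separated T
    T-separated = Pendants.separated-attachAll d base (Vec.fromList pendants)
      (Power.separated d threeTriangles triangles-separated)

    edgeᵖ : Fin 9 → Poly
    edgeᵖ e = Σᵖ (λ j → con (𝟙 (inc threeTriangles e j)) ⊗ X j)

    spreadᵖ : Fin (order base) → Poly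
    spreadᵖ = fill (λ u → (var ⊕ con 1ℚ) ⊗ X u) edgeᵖ

    fill-map : ∀ {A B : Set} (g : A → B) x y {x′ y′} → (∀ u → x′ u ≡ g (x u)) → (∀ e → y′ e ≡ g (y e)) →
      ∀ i → g (fill x y i) ≡ fill x′ y′ i
    fill-map g x y {x′} {y′} ex ey = by-kind
      (λ u → trans (cong g (fill-vertex x y u)) (trans (sym (ex u)) (sym (fill-vertex x′ y′ u))))
      (λ e t → trans (cong g (fill-new x y e t)) (trans (sym (ey e)) (sym (fill-new x′ y′ e t))))

    module _ (f : ℚ) where

      x : Fin 7 → ℚ
      x u = eval (X u) f

      y : Fin (order base) → ℚ
      y i = eval (spreadᵖ i) f

      y≡spread : ∀ i → y i ≡ spread f x i
      y≡spread = fill-map (λ Q → eval Q f) (λ u → (var ⊕ con 1ℚ) ⊗ X u) edgeᵖ (λ _ → refl)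
        (λ e → sym (eval-Σᵖ (λ j → con (𝟙 (inc threeTriangles e j)) ⊗ X j) f))

      residue : Fin (order base) → ℚ
      residue = fill (λ u → - (δ 0F u * eval P f)) (λ _ → 0ℚ)

      ys : ∀ {p} → Vec (Fin (order base)) p → Vec ℚ p
      ys vs = Vec.map (λ Q → eval Q f) (Vec.map spreadᵖ vs)

      open Pendants d

      -- A pendant entry is the entry at its vertex divided by f. Giving the base the entries f y
      -- makes the pendant entries y, so everything stays polynomial.
      fits : ∀ {p} (vs : Vec (Fin (order base)) p) → Fits f (λ i → f * y i) vs (ys vs)
      fits Vec.[]       = []
      fits (v Vec.∷ vs) = refl ∷ fits vs

      load-pendants : ∀ i → load (Vec.fromList pendants) (ys (Vec.fromList pendants)) i ≡
        ι a * (δ centre i * (ι (suc d) * y centre)) + δ (vertex 1F) i * (ι (suc d) * y (vertex 1F))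
      load-pendants i = go a
        where
        c e : ℚ
        c = δ centre i * (ι (suc d) * y centre)
        e = δ (vertex 1F) i * (ι (suc d) * y (vertex 1F))
        go : ∀ a → let vs = Vec.fromList (List.replicate a centre List.++ vertex 1F ∷ []) in
          load vs (ys vs) i ≡ ι a * c + e
        go zero    = eq c e
          where
          eq = solve 2 (λ c e → e :+ # 0ℚ := # 0ℚ :* c :+ e) refl
        go (suc a) = trans (cong (c +_) (go a)) (eq c e (ι a))
          where
          eq = solve 3 (λ c e a → c :+ (a :* c :+ e) := (# 1ℚ :+ a) :* c :+ e) refl

      base-equation : ∀ i → neighbour-sum base (λ j → f * y j) i + load (Vec.fromList pendants) (ys (Vec.fromList pendants)) i ≡
        (f + ι d) * (f * y i) + residue i
      base-equation = by-kind at-vertex at-new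
        where
        ns : ∀ i → neighbour-sum base (λ j → f * y j) i ≡ f * neighbour-sum base (spread f x) i
        ns i = trans (neighbour-sum-* base f y i) (cong (f *_) (neighbour-sum-cong base y≡spread i))

        y-vertex : ∀ u → y (vertex u) ≡ (f + 1ℚ) * x u
        y-vertex u = trans (y≡spread (vertex u)) (fill-vertex (λ u → (f + 1ℚ) * x u) (edge-sum threeTriangles x) u)

        at-new : ∀ e t → _
        at-new e t = trans
          (cong₂ _+_ (trans (ns (new e t)) (cong (f *_) (trans (spread-new f x e t) (cong ((f + ι d) *_) (sym (y≡spread (new e t)))))))
            (trans (load-pendants (new e t)) (cong₂ (λ p q → ι a * (p * (ι (suc d) * y centre)) + q * (ι (suc d) * y (vertex 1F)))
              (δ-≢ (↑ˡ≢↑ʳ {7} 0F (combine e t))) (δ-≢ (↑ˡ≢↑ʳ {7} 1F (combine e t))))))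
          (trans (eq f (ι d) (y (new e t)) (ι a) (ι (suc d) * y centre) (ι (suc d) * y (vertex 1F)))
            (cong ((f + ι d) * (f * y (new e t)) +_) (sym (fill-new (λ u → - (δ 0F u * eval P f)) (λ _ → 0ℚ) e t))))
          where
          eq = solve 6 (λ f d y a b c → f :* ((f :+ d) :* y) :+ (a :* (# 0ℚ :* b) :+ # 0ℚ :* c) := (f :+ d) :* (f :* y) :+ # 0ℚ) refl

        D : ℚ
        D = ι d

        W : ℚ
        W = eval w f

        Equation : Fin 7 → Set
        Equation u = f * (W * triangle-sums x u + D * (degree u * x u)) +
            (ι a * (δ 0F u * ((1ℚ + D) * ((f + 1ℚ) * x 0F))) + δ 1F u * ((1ℚ + D) * ((f + 1ℚ) * x 1F))) ≡
          (f + D) * (f * ((f + 1ℚ) * x u)) + - (δ 0F u * eval P f)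

        b c g : ℚ
        b = eval β f
        c = eval α f
        g = eval γ f

        x₁-solves : f * W * (x 0F + x 2F) ≡ g * x 1F
        x₁-solves = eq f W c b g
          where
          eq = solve 5 (λ f w α β γ → f :* w :* (α :* (γ :* β :- f :* w :* w) :+ α :* w :* (γ :+ f :* w)) := γ :* (f :* α :* w :* (β :+ w))) refl

        x₂-solves : W * (x 0F + x 1F) ≡ b * x 2F
        x₂-solves = eq f W c b g
          where
          eq = solve 5 (λ f w α β γ → w :* (α :* (γ :* β :- f :* w :* w) :+ f :* α :* w :* (β :+ w)) := β :* (α :* w :* (γ :+ f :* w))) refl

        -- The four vertices v₄, ..., v₇ share one computation: their triangles carry equal values
        -- at the two ends.
        plain : ∀ t x₀ → t ≡ W * eval Γ f → x₀ ≡ c * eval Γ f →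
          f * (W * (x₀ + t) + D * (ι 2 * t)) + (ι a * (0ℚ * ((1ℚ + D) * ((f + 1ℚ) * x 0F))) + 0ℚ * ((1ℚ + D) * ((f + 1ℚ) * x 1F))) ≡
          (f + D) * (f * ((f + 1ℚ) * t)) + - (0ℚ * eval P f)
        plain t x₀ refl refl = eq f D (eval Γ f) (ι a) ((1ℚ + D) * ((f + 1ℚ) * x 0F)) ((1ℚ + D) * ((f + 1ℚ) * x 1F)) (eval P f)
          where
          eq = solve 7 (λ f d Γ a y z p → let w = f :+ # 1ℚ :+ d ; t = w :* Γ ; x₀ = (f :* w :- d :- w) :* Γ in
            f :* (w :* (x₀ :+ t) :+ d :* (# ι 2 :* t)) :+ (a :* (# 0ℚ :* y) :+ # 0ℚ :* z) := (f :+ d) :* (f :* ((f :+ # 1ℚ) :* t)) :+ :- (# 0ℚ :* p)) refl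

        equation : ∀ u → Equation u
        equation 0F = eq f D W (x 0F) (x 1F) (x 2F) (x 3F) (ι a)
          where
          eq = solve 8 (λ f d w x₀ x₁ x₂ t a → f :* (w :* (x₁ :+ x₂ :+ t :+ t :+ t :+ t) :+ d :* (# ι 6 :* x₀)) :+
              (a :* (# 1ℚ :* ((# 1ℚ :+ d) :* ((f :+ # 1ℚ) :* x₀))) :+ # 0ℚ :* ((# 1ℚ :+ d) :* ((f :+ # 1ℚ) :* x₁))) :=
            (f :+ d) :* (f :* ((f :+ # 1ℚ) :* x₀)) :+ :- (# 1ℚ :* ((f :+ d) :* f :* (f :+ # 1ℚ) :* x₀
              :- f :* (w :* (x₁ :+ x₂ :+ # ι 4 :* t) :+ # ι 6 :* d :* x₀) :- a :* (# 1ℚ :+ d) :* (f :+ # 1ℚ) :* x₀))) refl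
        equation 1F = trans (eq f D W (x 0F) (x 1F) (x 2F) (ι a))
          (trans (cong (λ z → z + ι 2 * D * f * x 1F + (1ℚ + D) * (f + 1ℚ) * x 1F) x₁-solves) (eq₂ f D (x 1F) (eval P f)))
          where
          eq = solve 7 (λ f d w x₀ x₁ x₂ a → f :* (w :* (x₀ :+ x₂) :+ d :* (# ι 2 :* x₁)) :+
              (a :* (# 0ℚ :* ((# 1ℚ :+ d) :* ((f :+ # 1ℚ) :* x₀))) :+ # 1ℚ :* ((# 1ℚ :+ d) :* ((f :+ # 1ℚ) :* x₁))) :=
            f :* w :* (x₀ :+ x₂) :+ # ι 2 :* d :* f :* x₁ :+ (# 1ℚ :+ d) :* (f :+ # 1ℚ) :* x₁) refl
          eq₂ = solve 4 (λ f d x₁ p → ((f :+ d) :* (f :+ # 1ℚ) :* f :- (# 1ℚ :+ # 1ℚ) :* d :* f :- (# 1ℚ :+ d) :* (f :+ # 1ℚ)) :* x₁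
              :+ # ι 2 :* d :* f :* x₁ :+ (# 1ℚ :+ d) :* (f :+ # 1ℚ) :* x₁ := (f :+ d) :* (f :* ((f :+ # 1ℚ) :* x₁)) :+ :- (# 0ℚ :* p)) refl
        equation 2F = trans (cong (λ z → f * (z + D * (ι 2 * x 2F)) + (ι a * (0ℚ * ((1ℚ + D) * ((f + 1ℚ) * x 0F))) + 0ℚ * ((1ℚ + D) * ((f + 1ℚ) * x 1F)))) x₂-solves)
          (eq f D (x 2F) (ι a) ((1ℚ + D) * ((f + 1ℚ) * x 0F)) ((1ℚ + D) * ((f + 1ℚ) * x 1F)) (eval P f))
          where
          eq = solve 7 (λ f d x₂ a y z p → f :* ((f :* (f :+ # 1ℚ :+ d) :- d) :* x₂ :+ d :* (# ι 2 :* x₂)) :+ (a :* (# 0ℚ :* y) :+ # 0ℚ :* z) :=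
            (f :+ d) :* (f :* ((f :+ # 1ℚ) :* x₂)) :+ :- (# 0ℚ :* p)) refl
        equation 3F = plain (x 3F) (x 0F) refl refl
        equation 4F = plain (x 4F) (x 0F) refl refl
        equation 5F = plain (x 5F) (x 0F) refl refl
        equation 6F = plain (x 6F) (x 0F) refl refl

        at-vertex : ∀ u → _
        at-vertex u = trans
          (cong₂ _+_ (trans (ns (vertex u)) (cong (f *_) (trans (spread-vertex f x u)
              (cong (λ s → W * s + D * (degree u * x u)) (neighbour-sum-triangles x u)))))
            (trans (load-pendants (vertex u))
              (cong₂ _+_
                (cong₂ (λ p q → ι a * (p * ((1ℚ + D) * q))) (δ-↑ˡ (9 ℕ.* d) 0F u) (y-vertex 0F))
                (cong₂ (λ p q → p * ((1ℚ + D) * q)) (δ-↑ˡ (9 ℕ.* d) 1F u) (y-vertex 1F)))))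
          (trans (equation u)
            (sym (cong₂ (λ p q → (f + D) * (f * p) + q) (y-vertex u) (fill-vertex (λ u → - (δ 0F u * eval P f)) (λ _ → 0ℚ) u))))

-- A real eigenvalue of the extremal hypergraph.

module ExtremalEigenvalues where
  open OrderedField
  open Reals
  open PolynomialRoots
  open AdjacencyOperators
  open PendantEdges
  open RealEigenvectors
  open ExtremalVector
  open import Defs renaming (_≈_ to _≈ʳ_; _≤_ to _≤ʳ_)
  open import Data.Fin.Base using (Fin)
  open import Data.Fin.Patterns using (0F)
  import Data.List.Base as List
  open import Data.Nat.Base using (ℕ)
  open import Data.Product.Base using (proj₁; proj₂)
  open import Data.Vec.Base as Vec using (Vec)
  open import Data.Vec.Properties using (map-replicate)
  open import Data.Rational.Base hiding (_⊔_; _⊓_)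
  open import Data.Rational.Properties
  open import Relation.Binary.PropositionalEquality

  module ExtremalEigenvalue (d a : ℕ) (τ : ℝ)
    (1≤τ : ∀ t → 1ℚ ≤ seq τ t) (1≤X₀ : ∀ t → 1ℚ ≤ eval (Extremal.X d a 0F) (seq τ t))
    (P-null : Null (λ t → eval (Extremal.P d a) (seq τ t))) where

    open Extremal d a
    open Pendants d
    open Power d threeTriangles using (vertex; new; by-kind; fill-vertex; fill-new)

    vs : Vec (Fin (order base)) (List.length pendants)
    vs = Vec.fromList pendants

    V : Fin (order T) → Poly
    V = extend base vs (λ i → var ⊗ spreadᵖ i) (Vec.map spreadᵖ vs)

    R : Fin (order T) → ℕ → ℚ
    R = extend base vs (λ i t → residue (seq τ t) i) (Vec.replicate _ (λ _ → 0ℚ))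

    R-null : ∀ i → Null (R i)
    R-null = extend-all Null base vs _ _ (by-kind {Q = λ i → Null (λ t → residue (seq τ t) i)} at-vertex at-new) null-0
      where
      at-vertex : ∀ u → Null (λ t → residue (seq τ t) (vertex u))
      at-vertex u = null-cong
        (λ t → trans (eq (δ 0F u) (eval P (seq τ t))) (sym (fill-vertex (λ u → - (δ 0F u * eval P (seq τ t))) (λ _ → 0ℚ) u)))
        (null-* P-null (cauchy⇒bounded (fromℚ (- δ 0F u))))
        where
        eq = solve 2 (λ e p → p :* :- e := :- (e :* p)) refl
      at-new : ∀ e t → Null (λ s → residue (seq τ s) (new e t))
      at-new e t = null-cong (λ s → sym (fill-new (λ u → - (δ 0F u * eval P (seq τ s))) (λ _ → 0ℚ) e t)) null-0

    near : ∀ t i → neighbour-sum T (λ j → eval (V j) (seq τ t)) i ≡ (seq τ t + ι d) * eval (V i) (seq τ t) + R i t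
    near t i = trans (neighbour-sum-cong T value i)
      (trans (extend-eigen f base vs (λ i → f * y f i) (ys f vs) (residue f) (fits f vs) (base-equation f) i)
        (cong₂ (λ p q → (f + ι d) * p + q) (sym (value i)) defect))
      where
      f : ℚ
      f = seq τ t
      value : ∀ j → eval (V j) f ≡ extend base vs (λ i → f * y f i) (ys f vs) j
      value j = sym (extend-map (λ Q → eval Q f) base vs (λ i → var ⊗ spreadᵖ i) (λ i → f * y f i) (Vec.map spreadᵖ vs) (λ _ → refl) j)
      defect : extend base vs (residue f) (Vec.replicate _ 0ℚ) i ≡ R i t
      defect = trans (cong (λ zs → extend base vs (residue f) zs i) (sym (map-replicate (λ s → s t) (λ _ → 0ℚ) _)))
        (extend-map (λ s → s t) base vs (λ i t → residue (seq τ t) i) (residue f) (Vec.replicate _ (λ _ → 0ℚ)) (λ _ → refl) i)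

    -- The position of the centre after all attachments; it is enough that some index carries its
    -- entry.
    i₀ : Fin (order T)
    i₀ = proj₁ (extend-base base vs (λ i → var ⊗ spreadᵖ i) (Vec.map spreadᵖ vs) centre)

    1≤V : ∀ t → 1ℚ ≤ eval (V i₀) (seq τ t)
    1≤V t = subst (1ℚ ≤_)
      (sym (trans (cong (λ Q → eval Q f) (proj₂ (extend-base base vs (λ i → var ⊗ spreadᵖ i) (Vec.map spreadᵖ vs) centre)))
        (cong (λ Q → f * eval Q f) (fill-vertex (λ u → (var ⊕ con 1ℚ) ⊗ X u) edgeᵖ 0F))))
      (big f (eval (X 0F) f) (1≤τ t) (1≤X₀ t))
      where
      f : ℚ
      f = seq τ t
      big : ∀ f z → 1ℚ ≤ f → 1ℚ ≤ z → 1ℚ ≤ f * ((f + 1ℚ) * z)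
      big f z p q = cert≤ {t = (f - 1ℚ) + f * (f * (z - 1ℚ) + (f - 1ℚ) + z)}
        (≤-diff p ⊞ 0≤f ⊠ (0≤f ⊠ ≤-diff q ⊞ ≤-diff p ⊞ ≤-trans 0≤1 q)) (eq f z)
        where
        0≤f : 0ℚ ≤ f
        0≤f = ≤-trans 0≤1 p
        eq = solve 2 (λ f z → f :* ((f :+ # 1ℚ) :* z) :- # 1ℚ := (f :- # 1ℚ) :+ f :* (f :* (z :- # 1ℚ) :+ (f :- # 1ℚ) :+ z)) refl

    open RealEigenvalue d T T-separated τ V R near R-null i₀ 1≤V public using (eigenvalue; isEigenvalue)

-- The sign of the extremal polynomial.

module ExtremalSigns where
  open OrderedField
  open PolynomialRoots
  open ExtremalVector
  open import Data.Fin.Patterns using (0F)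
  open import Data.Nat.Base using (ℕ)
  import Data.Integer.Base as ℤ
  open import Data.Product.Base using (_,_)
  open import Data.Rational.Base hiding (_⊔_; _⊓_)
  open import Data.Rational.Properties
  open import Relation.Binary.PropositionalEquality

  -- The sign of P, in the variables f and κ = d / (f + d + 1)

  -- A rational slightly below √55, where 55 = 46 + 9 comes from (k - 4)(m - 1) ≥ 55 + 9d. Its
  -- square 54.76 is still below 55.
  L₀ : ℚ
  L₀ = ℤ.+ 37 / 5

  module Shape (f κ : ℚ) where

    h g φ ψ : ℚ
    h = f - κ
    g = h - 1ℚ
    φ = f * f - ι 2 * κ * f - 1ℚ
    ψ = φ * h - f

    -- This is f (f + κ - κ δ) - δ for δ = a + 6, the degree of the centre of T: the weight which
    -- walks of two steps must supply at the centre.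
    E : ℚ → ℚ
    E a = f * (f - κ * (a + ι 5)) - (a + ι 6)

    N : ℚ → ℚ
    N a = g * ψ * (E a + ι 6) - f * (g * (f * h + ι 2 * f + φ) + ι 4 * ψ)

    -- Shows where a root lies. After division by ψ g² the right side compares E with 6(1 + κ)/g,
    -- the share of the three triangles, plus (1 + κf)/g² and a further positive term.
    gN : ∀ a → g * N a ≡ ψ * (E a * (g * g) - ι 6 * (1ℚ + κ) * g - (1ℚ + κ * f)) - (1ℚ + κ * f) * (1ℚ + κ * f) * h
    gN a = eq f κ (E a)
      where
      eq = solve 3 (λ f κ E → let h = f :- κ ; g = h :- # 1ℚ ; φ = f :* f :- # ι 2 :* κ :* f :- # 1ℚ ; ψ = φ :* h :- f in
        g :* (g :* ψ :* (E :+ # ι 6) :- f :* (g :* (f :* h :+ # ι 2 :* f :+ φ) :+ # ι 4 :* ψ)) :=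
        ψ :* (E :* (g :* g) :- # ι 6 :* (# 1ℚ :+ κ) :* g :- (# 1ℚ :+ κ :* f)) :- (# 1ℚ :+ κ :* f) :* (# 1ℚ :+ κ :* f) :* h) refl

    module Positive (L₀≤f : L₀ ≤ f) (0≤κ : 0ℚ ≤ κ) (κ≤1 : κ ≤ 1ℚ) where

      0<f : 0ℚ < f
      0<f = <-≤-trans (positive⁻¹ L₀) L₀≤f

      0≤f : 0ℚ ≤ f
      0≤f = <⇒≤ 0<f

      g-bound : ℤ.+ 27 / 5 ≤ g
      g-bound = cert≤ {t = (f - L₀) + (1ℚ - κ)} (≤-diff L₀≤f ⊞ ≤-diff κ≤1) (eq f κ)
        where
        eq = solve 2 (λ f κ → f :- κ :- # 1ℚ :- # (ℤ.+ 27 / 5) := (f :- # (ℤ.+ 37 / 5)) :+ (# 1ℚ :- κ)) refl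

      1≤g : 1ℚ ≤ g
      1≤g = ≤-trans by-evaluation g-bound

      0<g : 0ℚ < g
      0<g = <-≤-trans 0<1 1≤g

      0≤h : 0ℚ ≤ h
      0≤h = cert≤ {t = g + 1ℚ} (<⇒≤ 0<g ⊞ 0≤1) (eq f κ)
        where
        eq = solve 2 (λ f κ → f :- κ :- # 0ℚ := f :- κ :- # 1ℚ :+ # 1ℚ) refl

      E-positive : ∀ a → ι 6 * (1ℚ + κ) * g + (1ℚ + κ * f) < E a * (g * g) → 0ℚ < E a
      E-positive a bound = *-cancelʳ-<-nonNeg (g * g) {{nonNegative (<⇒≤ 0<g ⊠ <⇒≤ 0<g)}}
        (subst (_< E a * (g * g)) (sym (*-zeroˡ (g * g)))
          (≤-<-trans (0≤ι 6 ⊠ (0≤1 ⊞ 0≤κ) ⊠ <⇒≤ 0<g ⊞ (0≤1 ⊞ 0≤κ ⊠ 0≤f)) bound))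

      -- Expanded in f, f - `L₀` and 1 - κ, all of them nonnegative, the difference consists of
      -- nonnegative terms.
      f²≤ψ : f * f ≤ ψ
      f²≤ψ = cert≤ {t = f * f * (s + c) + 1ℚ + e * (f * (ι 3 * s + c′) + f - 1ℚ) + ι 2 * f * (e * e)}
        (0≤f ⊠ 0≤f ⊠ (0≤s ⊞ nonNegative⁻¹ c) ⊞ 0≤1 ⊞ 0≤e ⊠ big ⊞ 0≤ι 2 ⊠ 0≤f ⊠ (0≤e ⊠ 0≤e)) (eq f κ)
        where
        s e c c′ : ℚ
        s = f - L₀
        e = 1ℚ - κ
        c = ℤ.+ 17 / 5
        c′ = ℤ.+ 86 / 5
        0≤s : 0ℚ ≤ s
        0≤s = ≤-diff L₀≤f
        0≤e : 0ℚ ≤ e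
        0≤e = ≤-diff κ≤1
        big : 0ℚ ≤ f * (ι 3 * s + c′) + f - 1ℚ
        big = subst (0ℚ ≤_) (eq₂ (f * (ι 3 * s + c′)) f)
          (0≤f ⊠ (0≤ι 3 ⊠ 0≤s ⊞ nonNegative⁻¹ c′) ⊞ (0≤s ⊞ nonNegative⁻¹ (ℤ.+ 32 / 5)))
          where
          eq₂ = solve 2 (λ a f → a :+ (f :- # (ℤ.+ 37 / 5) :+ # (ℤ.+ 32 / 5)) := a :+ f :- # 1ℚ) refl
        eq = solve 2 (λ f κ → (f :* f :- # ι 2 :* κ :* f :- # 1ℚ) :* (f :- κ) :- f :- f :* f :=
          f :* f :* (f :- # (ℤ.+ 37 / 5) :+ # (ℤ.+ 17 / 5)) :+ # 1ℚ
          :+ (# 1ℚ :- κ) :* (f :* (# ι 3 :* (f :- # (ℤ.+ 37 / 5)) :+ # (ℤ.+ 86 / 5)) :+ f :- # 1ℚ) :+ # ι 2 :* f :* ((# 1ℚ :- κ) :* (# 1ℚ :- κ))) refl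

      0<ψ : 0ℚ < ψ
      0<ψ = <-≤-trans (0<f ⊠⁺ 0<f) f²≤ψ

      q : ℚ
      q = 1ℚ + κ * f

      1≤q : 1ℚ ≤ q
      1≤q = cert≤ (0≤κ ⊠ 0≤f) (eq (κ * f))
        where
        eq = solve 1 (λ y → # 1ℚ :+ y :- # 1ℚ := y) refl

      0≤q : 0ℚ ≤ q
      0≤q = ≤-trans 0≤1 1≤q

      -- N need not be nonnegative: in `gN` the last term is q² h with q ≥ 1, at least h = g + 1,
      -- which outweighs a loss smaller than g on the left.
      excess : ∀ a → - 1ℚ < N a → ι 6 * (1ℚ + κ) * g + (1ℚ + κ * f) < E a * (g * g)
      excess a -1<N = diff-< (*-cancelˡ-<-nonNeg ψ {{nonNegative (<⇒≤ 0<ψ)}}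
        (subst₂ _<_ (sym (*-zeroʳ ψ)) refl
          (cert< {t = g * (N a - - 1ℚ) + (h * ((q - 1ℚ) * (q + 1ℚ)) + 1ℚ)}
            (0<g ⊠⁺ <-diff -1<N ⁺⊞ (0≤h ⊠ (≤-diff 1≤q ⊠ (0≤q ⊞ 0≤1)) ⊞ 0≤1))
            (modulo 1ℚ (gN a) (eq ψ (E a) f κ (N a))))))
        where
        eq = solve 5 (λ ψ E f κ N → let g = f :- κ :- # 1ℚ ; q = # 1ℚ :+ κ :* f in
          ψ :* (E :* (g :* g) :- (# ι 6 :* (# 1ℚ :+ κ) :* g :+ q)) :- # 0ℚ
            :+ # 1ℚ :* (g :* N :- (ψ :* (E :* (g :* g) :- # ι 6 :* (# 1ℚ :+ κ) :* g :- q) :- q :* q :* (f :- κ))) :=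
          g :* (N :- :- # 1ℚ) :+ ((f :- κ) :* ((q :- # 1ℚ) :* (q :+ # 1ℚ)) :+ # 1ℚ)) refl

      negative-at : ∀ a → E a ≤ 0ℚ → N a < 0ℚ
      negative-at a E≤0 = diff-< (*-cancelˡ-<-nonNeg g {{nonNegative (<⇒≤ 0<g)}}
        (subst₂ _<_ (sym (*-zeroʳ g)) refl
          (cert< {t = ψ * ((0ℚ - E a) * (g * g) + ι 6 * (1ℚ + κ) * g) + ψ * q + q * q * h}
            ((<⇒≤ 0<ψ ⊠ (≤-diff E≤0 ⊠ (<⇒≤ 0<g ⊠ <⇒≤ 0<g) ⊞ 0≤ι 6 ⊠ (0≤1 ⊞ 0≤κ) ⊠ <⇒≤ 0<g)
              ⊞⁺ 0<ψ ⊠⁺ <-≤-trans 0<1 1≤q) ⁺⊞ 0≤q ⊠ 0≤q ⊠ 0≤h)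
            (modulo 1ℚ (gN a) (eq ψ (E a) f κ (N a))))))
        where
        eq = solve 5 (λ ψ E f κ N → let g = f :- κ :- # 1ℚ ; q = # 1ℚ :+ κ :* f in
          g :* (# 0ℚ :- N) :- # 0ℚ
            :+ # 1ℚ :* (g :* N :- (ψ :* (E :* (g :* g) :- # ι 6 :* (# 1ℚ :+ κ) :* g :- q) :- q :* q :* (f :- κ))) :=
          ψ :* ((# 0ℚ :- E) :* (g :* g) :+ # ι 6 :* (# 1ℚ :+ κ) :* g) :+ ψ :* q :+ q :* q :* (f :- κ)) refl

      -- A crude upper end for bisection. For f = a + 26 the quantity E equals f (1 - κ)(a + 5) + 20
      -- f + 20, so it is at least 20 f + 20 for every κ between 0 and 1.
      positive-at : ∀ a → f ≡ a + ι 26 → 0ℚ ≤ a → 0ℚ ≤ N a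
      positive-at a f≡ 0≤a = cancel-≤ 0<g (subst (_≤ g * N a) (sym (*-zeroʳ g))
        (cert≤ {t = (ψ - f * f) * B + f * f * (B - ι 19 * f) + (ι 19 * f * f * f - q * q * h)}
          (≤-diff f²≤ψ ⊠ 0≤B ⊞ 0≤f ⊠ 0≤f ⊠ ≤-diff 19f≤B ⊞ ≤-diff q²h≤)
          (modulo (- 1ℚ) (gN a) (eq ψ (E a) f κ (N a)))))
        where
        eq = solve 5 (λ ψ E f κ N → let h = f :- κ ; g = h :- # 1ℚ ; q = # 1ℚ :+ κ :* f ; B = E :* (g :* g) :- # ι 6 :* (# 1ℚ :+ κ) :* g :- q in
          g :* N :- # 0ℚ :+ :- # 1ℚ :* (g :* N :- (ψ :* B :- q :* q :* h)) :=
          (ψ :- f :* f) :* B :+ f :* f :* (B :- # ι 19 :* f) :+ (# ι 19 :* f :* f :* f :- q :* q :* h)) refl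
        B : ℚ
        B = E a * (g * g) - ι 6 * (1ℚ + κ) * g - q
        0≤1-κ : 0ℚ ≤ 1ℚ - κ
        0≤1-κ = ≤-diff κ≤1
        0≤g-1 : 0ℚ ≤ g - 1ℚ
        0≤g-1 = ≤-diff 1≤g
        E≡ : E a ≡ f * (1ℚ - κ) * (a + ι 5) + (ι 20 * f + ι 20)
        E≡ = modulo (- (f + 1ℚ)) f≡ (eq₁ f κ a)
          where
          eq₁ = solve 3 (λ f κ a → f :* (f :- κ :* (a :+ # ι 5)) :- (a :+ # ι 6) :+ :- (f :+ # 1ℚ) :* (f :- (a :+ # ι 26)) :=
            f :* (# 1ℚ :- κ) :* (a :+ # ι 5) :+ (# ι 20 :* f :+ # ι 20)) refl
        19f≤B : ι 19 * f ≤ B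
        19f≤B = cert≤ {t = e * (g * g) + (ι 20 * f + ι 20) * g * (g - 1ℚ) + (ι 20 * f + ι 8) * (g - 1ℚ) + ι 7 + ι 6 * (1ℚ - κ) * g + f * (1ℚ - κ)}
          (0≤e ⊠ (<⇒≤ 0<g ⊠ <⇒≤ 0<g) ⊞ (0≤ι 20 ⊠ 0≤f ⊞ 0≤ι 20) ⊠ <⇒≤ 0<g ⊠ 0≤g-1
            ⊞ (0≤ι 20 ⊠ 0≤f ⊞ 0≤ι 8) ⊠ 0≤g-1 ⊞ 0≤ι 7 ⊞ 0≤ι 6 ⊠ 0≤1-κ ⊠ <⇒≤ 0<g ⊞ 0≤f ⊠ 0≤1-κ)
          (trans (cong (λ z → z * (g * g) - ι 6 * (1ℚ + κ) * g - q - ι 19 * f) E≡) (eq₁ f κ e))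
          where
          e : ℚ
          e = f * (1ℚ - κ) * (a + ι 5)
          0≤e : 0ℚ ≤ e
          0≤e = 0≤f ⊠ 0≤1-κ ⊠ (0≤a ⊞ 0≤ι 5)
          eq₁ = solve 3 (λ f κ e → let g = f :- κ :- # 1ℚ in
            (e :+ (# ι 20 :* f :+ # ι 20)) :* (g :* g) :- # ι 6 :* (# 1ℚ :+ κ) :* g :- (# 1ℚ :+ κ :* f) :- # ι 19 :* f :=
            e :* (g :* g) :+ (# ι 20 :* f :+ # ι 20) :* g :* (g :- # 1ℚ) :+ (# ι 20 :* f :+ # ι 8) :* (g :- # 1ℚ) :+ # ι 7 :+ # ι 6 :* (# 1ℚ :- κ) :* g :+ f :* (# 1ℚ :- κ)) refl
        0≤B : 0ℚ ≤ B
        0≤B = ≤-trans (0≤ι 19 ⊠ 0≤f) 19f≤B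
        q²h≤ : q * q * h ≤ ι 19 * f * f * f
        q²h≤ = cert≤ {t = ι 15 * f * f * f + ι 4 * f * f * κ + (f - 1ℚ + f * (1ℚ - κ)) * (ι 2 * f + q) * h}
          (0≤ι 15 ⊠ 0≤f ⊠ 0≤f ⊠ 0≤f ⊞ 0≤ι 4 ⊠ 0≤f ⊠ 0≤f ⊠ 0≤κ
            ⊞ (≤-diff 1≤f ⊞ 0≤f ⊠ 0≤1-κ) ⊠ (0≤ι 2 ⊠ 0≤f ⊞ 0≤q) ⊠ 0≤h) (eq₁ f κ)
          where
          1≤f : 1ℚ ≤ f
          1≤f = cert≤ {t = g - 1ℚ + (κ + 1ℚ)} (0≤g-1 ⊞ (0≤κ ⊞ 0≤1)) (eq₂ f κ)
            where
            eq₂ = solve 2 (λ f κ → f :- # 1ℚ := f :- κ :- # 1ℚ :- # 1ℚ :+ (κ :+ # 1ℚ)) refl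
          eq₁ = solve 2 (λ f κ → let h = f :- κ ; q = # 1ℚ :+ κ :* f in # ι 19 :* f :* f :* f :- q :* q :* h :=
            # ι 15 :* f :* f :* f :+ # ι 4 :* f :* f :* κ :+ (f :- # 1ℚ :+ f :* (# 1ℚ :- κ)) :* (# ι 2 :* f :+ q) :* h) refl

  -- With d = w κ and w = f + d + 1, the polynomials of the extremal hypergraph are
  -- powers of w times polynomials in f and κ.
  module ShapeOf (d a : ℕ) (f κ : ℚ) (wκ : (f + 1ℚ + ι d) * κ ≡ ι d) where
    open Shape f κ
    open Extremal d a

    private
      W D : ℚ
      W = f + 1ℚ + ι d
      D = ι d

      β≡ : eval β f ≡ W * h
      β≡ = modulo (- 1ℚ) wκ (eq f κ D)
        where
        eq = solve 3 (λ f κ d → f :* (f :+ # 1ℚ :+ d) :- d :+ :- # 1ℚ :* ((f :+ # 1ℚ :+ d) :* κ :- d) := (f :+ # 1ℚ :+ d) :* (f :- κ)) refl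

      α≡ : eval α f ≡ W * g
      α≡ = trans (cong (_- W) β≡) (eq W h)
        where
        eq = solve 2 (λ w h → w :* h :- w := w :* (h :- # 1ℚ)) refl

      γ≡ : eval γ f ≡ W * φ
      γ≡ = modulo (- (ι 2 * f)) wκ (eq f κ D)
        where
        eq = solve 3 (λ f κ d → (f :+ d) :* (f :+ # 1ℚ) :* f :- (# 1ℚ :+ # 1ℚ) :* d :* f :- (# 1ℚ :+ d) :* (f :+ # 1ℚ) :+ :- (# ι 2 :* f) :* ((f :+ # 1ℚ :+ d) :* κ :- d) :=
          (f :+ # 1ℚ :+ d) :* (f :* f :- # ι 2 :* κ :* f :- # 1ℚ)) refl

      Γ≡ : eval Γ f ≡ W * W * ψ
      Γ≡ = trans (cong₂ (λ x y → x * y - f * W * W) γ≡ β≡) (eq W φ h f)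
        where
        eq = solve 4 (λ w φ h f → w :* φ :* (w :* h) :- f :* w :* w := w :* w :* (φ :* h :- f)) refl

    X₀≡ : eval (X 0F) f ≡ W * W * W * (g * ψ)
    X₀≡ = trans (cong₂ _*_ α≡ Γ≡) (eq W g ψ)
      where
      eq = solve 3 (λ w g ψ → w :* g :* (w :* w :* ψ) := w :* w :* w :* (g :* ψ)) refl

    P≡ : eval P f ≡ W * W * W * W * N (ι a)
    P≡ = trans
      (eq₁ f D W (eval (X 0F) f) (eval α f) (eval β f) (eval γ f) (eval Γ f) (ι a))
      (trans (cong₂ (λ z y → z * (f * eval (X 0F) f) - y) A≡ refl)
        (trans (cong (λ z → W * (f + κ) * (f * eval (X 0F) f) - (f * (W * (f * eval α f * W * (eval β f + W) + eval α f * W * (eval γ f + f * W) + ι 4 * (W * eval Γ f))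
                 + ι 6 * D * eval (X 0F) f) + ι a * z * eval (X 0F) f)) C≡)
          (trans (subst-all α≡ β≡ γ≡ Γ≡ X₀≡ (sym wκ)) (eq₂ f κ W φ (ι a)))))
      where
      A≡ : (f + D) * (f + 1ℚ) ≡ W * (f + κ)
      A≡ = modulo 1ℚ wκ (eq f κ D)
        where
        eq = solve 3 (λ f κ d → (f :+ d) :* (f :+ # 1ℚ) :+ # 1ℚ :* ((f :+ # 1ℚ :+ d) :* κ :- d) := (f :+ # 1ℚ :+ d) :* (f :+ κ)) refl
      C≡ : (1ℚ + D) * (f + 1ℚ) ≡ W * (1ℚ + κ * f)
      C≡ = modulo f wκ (eq f κ D)
        where
        eq = solve 3 (λ f κ d → (# 1ℚ :+ d) :* (f :+ # 1ℚ) :+ f :* ((f :+ # 1ℚ :+ d) :* κ :- d) := (f :+ # 1ℚ :+ d) :* (# 1ℚ :+ κ :* f)) refl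
      eq₁ = solve 9 (λ f d w x₀ α β γ Γ a →
        (f :+ d) :* f :* (f :+ # 1ℚ) :* x₀ :- f :* (w :* (f :* α :* w :* (β :+ w) :+ α :* w :* (γ :+ f :* w) :+ # ι 4 :* (w :* Γ)) :+ # ι 6 :* d :* x₀)
          :- a :* (# 1ℚ :+ d) :* (f :+ # 1ℚ) :* x₀ :=
        (f :+ d) :* (f :+ # 1ℚ) :* (f :* x₀) :- (f :* (w :* (f :* α :* w :* (β :+ w) :+ α :* w :* (γ :+ f :* w) :+ # ι 4 :* (w :* Γ)) :+ # ι 6 :* d :* x₀)
          :+ a :* ((# 1ℚ :+ d) :* (f :+ # 1ℚ)) :* x₀)) refl
      F : ℚ → ℚ → ℚ → ℚ → ℚ → ℚ → ℚ
      F α β γ Γ x₀ d = W * (f + κ) * (f * x₀) - (f * (W * (f * α * W * (β + W) + α * W * (γ + f * W) + ι 4 * (W * Γ))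
        + ι 6 * d * x₀) + ι a * (W * (1ℚ + κ * f)) * x₀)
      subst-all : ∀ {α α′ β β′ γ γ′ Γ Γ′ x x′ d d′} → α ≡ α′ → β ≡ β′ → γ ≡ γ′ → Γ ≡ Γ′ → x ≡ x′ → d ≡ d′ →
        F α β γ Γ x d ≡ F α′ β′ γ′ Γ′ x′ d′
      subst-all refl refl refl refl refl refl = refl
      eq₂ = solve 5 (λ f κ w φ a → let h = f :- κ ; g = h :- # 1ℚ ; ψ = φ :* h :- f ; x₀ = w :* w :* w :* (g :* ψ) in
        w :* (f :+ κ) :* (f :* x₀) :- (f :* (w :* (f :* (w :* g) :* w :* (w :* h :+ w) :+ w :* g :* w :* (w :* φ :+ f :* w) :+ # ι 4 :* (w :* (w :* w :* ψ)))
          :+ # ι 6 :* (w :* κ) :* x₀) :+ a :* (w :* (# 1ℚ :+ κ :* f)) :* x₀) :=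
        w :* w :* w :* w :* (g :* ψ :* (f :* (f :- κ :* (a :+ # ι 5)) :- (a :+ # ι 6) :+ # ι 6) :- f :* (g :* (f :* h :+ # ι 2 :* f :+ φ) :+ # ι 4 :* ψ))) refl

-- A rational threshold below the spectral radius of T.

module Thresholds where
  open OrderedField
  open Reals
  open PolynomialRoots
  open RealEigenvectors
  open ExtremalVector
  open ExtremalEigenvalues
  open ExtremalSigns
  open import Defs renaming (_≈_ to _≈ʳ_; _≤_ to _≤ʳ_)
  open import Data.Fin.Base using (suc)
  open import Data.Fin.Patterns using (0F)
  open import Data.Nat.Base as ℕ using (ℕ; suc)
  import Data.Integer.Base as ℤ
  open import Data.Product.Base using (Σ; _×_; _,_; proj₁; proj₂)
  open import Data.Rational.Base hiding (_⊔_; _⊓_)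
  open import Data.Rational.Properties
  open import Relation.Nullary using (¬_)
  open import Relation.Binary.PropositionalEquality

  module Parameter (d : ℕ) (f : ℚ) (L₀≤f : L₀ ≤ f) where

    W : ℚ
    W = f + 1ℚ + ι d

    0<f : 0ℚ < f
    0<f = <-≤-trans (positive⁻¹ L₀) L₀≤f

    1≤f : 1ℚ ≤ f
    1≤f = ≤-trans by-evaluation L₀≤f

    1≤W : 1ℚ ≤ W
    1≤W = cert≤ (<⇒≤ 0<f ⊞ 0≤ι d) (eq f (ι d))
      where
      eq = solve 2 (λ f d → f :+ # 1ℚ :+ d :- # 1ℚ := f :+ d) refl

    0<W : 0ℚ < W
    0<W = <-≤-trans 0<1 1≤W

    κ : ℚ
    κ = ι d * proj₁ (recip 0<W)

    Wκ : W * κ ≡ ι d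
    Wκ = trans (eq W (ι d) (proj₁ (recip 0<W))) (trans (cong (ι d *_) (proj₂ (proj₂ (recip 0<W)))) (*-identityʳ (ι d)))
      where
      eq = solve 3 (λ w d y → w :* (d :* y) := d :* (w :* y)) refl

    0≤κ : 0ℚ ≤ κ
    0≤κ = 0≤ι d ⊠ <⇒≤ (proj₁ (proj₂ (recip 0<W)))

    κ≤1 : κ ≤ 1ℚ
    κ≤1 = cancel-≤ 0<W (subst₂ _≤_ (sym Wκ) (sym (*-identityʳ W))
      (cert≤ (<⇒≤ 0<f ⊞ 0≤1) (eq f (ι d))))
      where
      eq = solve 2 (λ f d → f :+ # 1ℚ :+ d :- d := f :+ # 1ℚ) refl

    open Shape f κ public
    open Positive L₀≤f 0≤κ κ≤1 public using (1≤g; 0<g; 0<ψ; f²≤ψ; excess; negative-at; positive-at)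

    W⁴ : ℚ
    W⁴ = W * W * W * W

    1≤* : ∀ {a b} → 1ℚ ≤ a → 1ℚ ≤ b → 1ℚ ≤ a * b
    1≤* {a} {b} p q = cert≤ (≤-diff p ⊠ ≤-trans 0≤1 q ⊞ ≤-diff q) (eq a b)
      where
      eq = solve 2 (λ a b → a :* b :- # 1ℚ := (a :- # 1ℚ) :* b :+ (b :- # 1ℚ)) refl

    1≤W⁴ : 1ℚ ≤ W⁴
    1≤W⁴ = 1≤* (1≤* (1≤* 1≤W 1≤W) 1≤W) 1≤W

    module _ (a : ℕ) where
      open Extremal d a using (X; P)
      open ShapeOf d a f κ Wκ public using (P≡; X₀≡)

      1≤X₀ : 1ℚ ≤ eval (X 0F) f
      1≤X₀ = subst (1ℚ ≤_) (sym X₀≡) (1≤* (1≤* (1≤* 1≤W 1≤W) 1≤W) (1≤* 1≤g (≤-trans (1≤* 1≤f 1≤f) f²≤ψ)))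

      N<0⇒P<0 : N (ι a) < 0ℚ → eval P f < 0ℚ
      N<0⇒P<0 p = subst₂ _<_ (sym P≡) (*-zeroʳ W⁴) (*-monoʳ-<-pos W⁴ {{positive (<-≤-trans 0<1 1≤W⁴)}} p)

      0≤N⇒0≤P : 0ℚ ≤ N (ι a) → 0ℚ ≤ eval P f
      0≤N⇒0≤P p = subst (0ℚ ≤_) (sym P≡) (≤-trans 0≤1 1≤W⁴ ⊠ p)

      -1<P⇒-1<N : - eval P f < 1ℚ → - 1ℚ < N (ι a)
      -1<P⇒-1<N p = *-cancelˡ-<-nonNeg W⁴ {{nonNegative (≤-trans 0≤1 1≤W⁴)}}
        (cert< {t = (1ℚ - - eval P f) + (W⁴ - 1ℚ)} (<-diff p ⁺⊞ ≤-diff 1≤W⁴)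
          (trans (eq W⁴ (N (ι a))) (cong (λ z → (1ℚ - - z) + (W⁴ - 1ℚ)) (sym P≡))))
        where
        eq = solve 2 (λ w n → w :* n :- w :* :- # 1ℚ := (# 1ℚ :- :- (w :* n)) :+ (w :- # 1ℚ)) refl

  -- For a rational f slightly below the value belonging to T: λ = (f + d) / (m − 1) is below
  -- the spectral radius, while the equation at the centre fails only slightly.
  module Threshold (d j : ℕ) (large : 46 ℕ.≤ j ℕ.* suc d) where

    a : ℕ
    a = 3 ℕ.+ j

    open Extremal d a using (P; X; T)
    open Bisection P

    W·E : ∀ f κ d a → (f + 1ℚ + d) * κ ≡ d →
      (f + 1ℚ + d) * Shape.E f κ a ≡ (f + 1ℚ) * (f * (f + d) - (a + ι 6) * (1ℚ + d))
    W·E f κ d a e = modulo (f * (a + ι 5)) e (eq f κ d a)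
      where
      eq = solve 4 (λ f κ d a → (f :+ # 1ℚ :+ d) :* (f :* (f :- κ :* (a :+ # ι 5)) :- (a :+ # ι 6)) :+ f :* (a :+ # ι 5) :* ((f :+ # 1ℚ :+ d) :* κ :- d) :=
        (f :+ # 1ℚ) :* (f :* (f :+ d) :- (a :+ # ι 6) :* (# 1ℚ :+ d))) refl

    46≤ : ι 46 ≤ ι j * (1ℚ + ι d)
    46≤ = subst (ι 46 ≤_) (ι-* j (suc d)) (ι-mono large)

    start : Bracket
    start = bracket L₀ (ι a + ι 26)
      (≤-trans by-evaluation (subst (_≤ ι a + ι 26) (+-identityˡ (ι 26)) (+-monoˡ-≤ (ι 26) (0≤ι a))))
      (L.N<0⇒P<0 a (L.negative-at (ι a) E≤0))
      (U.0≤N⇒0≤P a (U.positive-at (ι a) refl (0≤ι a)))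
      where
      module L = Parameter d L₀ ≤-refl
      module U = Parameter d (ι a + ι 26) (≤-trans by-evaluation (subst (_≤ ι a + ι 26) (+-identityˡ (ι 26)) (+-monoˡ-≤ (ι 26) (0≤ι a))))
      -- The hypothesis with 46 enters here. Up to the factor `L₀` + 1, the gap is the excess over
      -- 46 plus 8d/5 + 6/25, where 8/5 = 9 - 37/5 and 6/25 = 55 - (37/5)².
      E≤0 : L.E (ι a) ≤ 0ℚ
      E≤0 = cancel-≤ L.0<W (subst₂ _≤_ (sym (W·E L₀ L.κ (ι d) (ι a) L.Wκ)) (sym (*-zeroʳ L.W))
        (cert≤ {t = (L₀ + 1ℚ) * ((ι j * (1ℚ + ι d) - ι 46) + (ℤ.+ 8 / 5) * ι d + (ℤ.+ 6 / 25))}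
          (nonNegative⁻¹ (L₀ + 1ℚ) ⊠ (≤-diff 46≤ ⊞ nonNegative⁻¹ (ℤ.+ 8 / 5) ⊠ 0≤ι d ⊞ nonNegative⁻¹ (ℤ.+ 6 / 25)))
          (eq (ι d) (ι j))))
        where
        eq = solve 2 (λ d j → # 0ℚ :- (# L₀ :+ # 1ℚ) :* (# L₀ :* (# L₀ :+ d) :- (# 1ℚ :+ (# 1ℚ :+ (# 1ℚ :+ j)) :+ # ι 6) :* (# 1ℚ :+ d)) :=
          (# L₀ :+ # 1ℚ) :* ((j :* (# 1ℚ :+ d) :- # ι 46) :+ # (ℤ.+ 8 / 5) :* d :+ # (ℤ.+ 6 / 25))) refl

    private
      0≤L₀ : 0ℚ ≤ L₀
      0≤L₀ = nonNegative⁻¹ L₀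

      -- Tolerance 1 suffices: P is W⁴ N with W ≥ 1, so N exceeds -1, which is all that `excess`
      -- asks.
      close : Σ Bracket λ b → L₀ ≤ Bracket.lo b × Bracket.hi b ≤ ι a + ι 26 × - eval P (Bracket.lo b) < 1ℚ
      close = near-root start 0≤L₀ 1ℚ 0<1

      final : Bracket
      final = proj₁ close

    q : ℚ
    q = Bracket.lo final

    L₀≤q : L₀ ≤ q
    L₀≤q = proj₁ (proj₂ close)

    open Parameter d q L₀≤q public using (W; 0<W; κ; Wκ; 0≤κ; κ≤1; h; g; E; 1≤g; 0<g)

    excess : ι 6 * (1ℚ + κ) * g + (1ℚ + κ * q) < E (ι a) * (g * g)
    excess = Q.excess (ι a) (Q.-1<P⇒-1<N a (proj₂ (proj₂ (proj₂ close))))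
      where module Q = Parameter d q L₀≤q

    W·E≡ : W * E (ι a) ≡ (q + 1ℚ) * (q * (q + ι d) - (ι a + ι 6) * (1ℚ + ι d))
    W·E≡ = W·E q κ (ι d) (ι a) Wκ

    private
      τ : ℝ
      τ = root final

      q≤τ : ∀ t → q ≤ seq τ t
      q≤τ = lo≤root final

      module At t = Parameter d (seq τ t) (≤-trans L₀≤q (q≤τ t))

      module T-eigen = ExtremalEigenvalue d a τ (λ t → At.1≤f t) (λ t → At.1≤X₀ t a)
        (null-at-root final (≤-trans 0≤L₀ L₀≤q))

      c : ℚ
      c = 1/[1+ d ]

      0<1+d : 0ℚ < ι (suc d)
      0<1+d = 0<1 ⁺⊞ 0≤ι d

      0<c : 0ℚ < c
      0<c = *-cancelˡ-<-nonNeg (ι (suc d)) {{nonNegative (<⇒≤ 0<1+d)}}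
        (subst₂ _<_ (sym (*-zeroʳ (ι (suc d)))) (sym (1/suc d)) 0<1)

    -- The root τ gives an eigenvalue θ of T with θ ≤ σ, and q is at most every term of τ. If ρ were
    -- equal to σ, then θ would be at most (q + d)/(d + 1), so τ would equal q, contrary to
    -- `root-apart`.
    below-spectral-radius : ∀ {σ} → IsSpectralRadius (adjacency (suc (suc d)) T) σ →
      ∀ {ρ} → ρ ≤ʳ fromℚ ((q + ι d) * c) → ρ ≤ʳ σ × ¬ (ρ ≈ʳ σ)
    below-spectral-radius {σ} isσ {ρ} ρ≤q = ≤ʳ-trans {ρ} {fromℚ v} {σ} ρ≤q (≤ʳ-trans {fromℚ v} {θ} {σ} q≤θ θ≤σ) , strict
      where
      θ : ℝ
      θ = T-eigen.eigenvalue
      v : ℚ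
      v = (q + ι d) * c
      q≤θ : fromℚ v ≤ʳ θ
      q≤θ = pointwise-≤ {fromℚ v} {θ} λ t → subst₂ _≤_ (*-comm c (q + ι d)) (*-comm c (seq τ t + ι d))
        (scale-≤ (<⇒≤ 0<c) (+-monoˡ-≤ (ι d) (q≤τ t)))
      θ≤σ : θ ≤ʳ σ
      θ≤σ = square-cancel-≤ {θ} {σ} (IsSpectralRadius.nonNegative isσ)
        (≤ʳ-trans {θ *ʳ θ} {∣ fromℝ θ ∣²} {σ *ʳ σ}
          (pointwise-≤ {θ *ʳ θ} {∣ fromℝ θ ∣²} λ t → ≤-reflexive (sym (+-identityʳ (seq θ t * seq θ t))))
          (IsSpectralRadius.maximal isσ (fromℝ θ) T-eigen.isEigenvalue))
      strict : ¬ (ρ ≈ʳ σ)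
      strict ρ≈σ = root-apart final (≤-trans 0≤L₀ L₀≤q) λ ε 0<ε →
        let N , b = θ≤q (ε * c) (0<ε ⊠⁺ 0<c) in
        N , λ t N≤t → subst (_< ε) (sym (0≤p⇒∣p∣≡p (≤-diff (q≤τ t))))
          (*-cancelˡ-<-nonNeg c {{nonNegative (<⇒≤ 0<c)}}
            (cert< (<-diff (b t N≤t)) (eq (seq τ t) q (ι d) c ε)))
        where
        θ≤q : θ ≤ʳ fromℚ v
        θ≤q = ≤ʳ-trans {θ} {σ} {fromℚ v} θ≤σ (≤ʳ-trans {σ} {ρ} {fromℚ v} (≈⇒≤ {σ} {ρ} (≈-sym {ρ} {σ} ρ≈σ)) ρ≤q)
        eq = solve 5 (λ s q d c ε → c :* ε :- c :* (s :- q) := (q :+ d) :* c :+ ε :* c :- (s :+ d) :* c) refl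

-- Inequalities excluding five or more edges off the centre.

module Polynomials where
  open OrderedField
  open ExtremalSigns using (L₀)
  import Data.Integer.Base as ℤ
  open import Data.Product.Base using (_,_)
  open import Data.Rational.Base hiding (_⊔_; _⊓_)
  open import Data.Rational.Properties
  open import Relation.Nullary using (¬_; yes; no)
  open import Relation.Nullary.Negation using (contradiction)
  open import Relation.Binary.PropositionalEquality

  absurd-sum : ∀ {a b} → 0ℚ < a → 0ℚ ≤ b → ¬ (a + b ≤ 0ℚ)
  absurd-sum p q r = <-irrefl refl (<-≤-trans (p ⁺⊞ q) r)

  -- Here M bounds the entries away from the centre, and p is the number of edges avoiding it.
  module Inequalities (f κ M : ℚ) (L₀≤f : L₀ ≤ f) (0≤κ : 0ℚ ≤ κ) (κ≤1 : κ ≤ 1ℚ)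
    (f-large : ι 55 - ι 46 * κ ≤ f * f - ι 8 * κ * f) (0≤M : 0ℚ ≤ M) (M≤1 : M ≤ 1ℚ) where

    -- Obtained by bounding f times the weight of two-step walks at the centre and then cancelling 6
    -- against f E, which is larger.
    Centre : ℚ → Set
    Centre p = (p - ι 4) * f * (1ℚ + κ * f) < (ι 4 * p * (1ℚ + κ) + κ * f * (p + ι 3)) * M

    -- Obtained by expanding the inequality twice at a vertex away from the centre whose entry is M.
    Second : ℚ → Set
    Second p = f * f * M ≤ f + ι 3 + ((1ℚ + κ) * (p + ι 3) + κ * f * p) * M

    private
      s : ℚ
      s = f - L₀
      0≤s : 0ℚ ≤ s
      0≤s = ≤-diff L₀≤f
      0≤f : 0ℚ ≤ f
      0≤f = ≤-trans by-evaluation L₀≤f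
      0≤1-κ : 0ℚ ≤ 1ℚ - κ
      0≤1-κ = ≤-diff κ≤1
      0≤1-M : 0ℚ ≤ 1ℚ - M
      0≤1-M = ≤-diff M≤1

    -- From nine edges on, M ≤ 1 is enough: expanded about p = 9 and f = `L₀` the certificate has
    -- nonnegative terms.
    many : ∀ {p} → ι 9 ≤ p → ¬ Centre p
    many {p} 9≤p b = absurd-sum
      {a = (ι 4 * p * (1ℚ + κ) + κ * f * (p + ι 3)) * M - (p - ι 4) * f * (1ℚ + κ * f)}
      {b = (ι 4 * p * (1ℚ + κ) + κ * f * (p + ι 3)) * (1ℚ - M)
        + ((ι 5 + t) * s * (1ℚ + κ * f) + 1ℚ + ℤ.+ 17 / 5 * t + (ℤ.+ 149 / 1) * κ + ι 25 * s * κ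
          + ℤ.+ 1084 / 25 * t * κ + ℤ.+ 32 / 5 * t * s * κ)}
      (<-diff b)
      ((0≤ι 4 ⊠ 0≤p ⊠ (0≤1 ⊞ 0≤κ) ⊞ 0≤κ ⊠ 0≤f ⊠ (0≤p ⊞ 0≤ι 3)) ⊠ 0≤1-M
        ⊞ ((0≤ι 5 ⊞ 0≤t) ⊠ 0≤s ⊠ (0≤1 ⊞ 0≤κ ⊠ 0≤f) ⊞ 0≤1 ⊞ nonNegative⁻¹ (ℤ.+ 17 / 5) ⊠ 0≤t
          ⊞ nonNegative⁻¹ (ℤ.+ 149 / 1) ⊠ 0≤κ ⊞ 0≤ι 25 ⊠ 0≤s ⊠ 0≤κ
          ⊞ nonNegative⁻¹ (ℤ.+ 1084 / 25) ⊠ 0≤t ⊠ 0≤κ ⊞ nonNegative⁻¹ (ℤ.+ 32 / 5) ⊠ 0≤t ⊠ 0≤s ⊠ 0≤κ))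
      (≤-reflexive (eq f κ M p))
      where
      t : ℚ
      t = p - ι 9
      0≤t : 0ℚ ≤ t
      0≤t = ≤-diff 9≤p
      0≤p : 0ℚ ≤ p
      0≤p = ≤-trans (0≤ι 9) 9≤p
      eq = solve 4 (λ f κ M p → let s = f :- # (ℤ.+ 37 / 5) ; t = p :- # ι 9 in
        (# ι 4 :* p :* (# 1ℚ :+ κ) :+ κ :* f :* (p :+ # ι 3)) :* M :- (p :- # ι 4) :* f :* (# 1ℚ :+ κ :* f)
        :+ ((# ι 4 :* p :* (# 1ℚ :+ κ) :+ κ :* f :* (p :+ # ι 3)) :* (# 1ℚ :- M)
        :+ ((# ι 5 :+ t) :* s :* (# 1ℚ :+ κ :* f) :+ # 1ℚ :+ # (ℤ.+ 17 / 5) :* t :+ # (ℤ.+ 149 / 1) :* κ :+ # ι 25 :* s :* κ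
          :+ # (ℤ.+ 1084 / 25) :* t :* κ :+ # (ℤ.+ 32 / 5) :* t :* s :* κ)) := # 0ℚ) refl

    private
      y : ℚ
      y = κ * f
      0≤y : 0ℚ ≤ y
      0≤y = 0≤κ ⊠ 0≤f

      -- Removes p: for p ≥ 6 one has 4p ≤ 12 (p - 4) and p + 3 ≤ (9/2)(p - 4), with equality at 6,
      -- so division by p - 4 leaves the constants 12 and 9/2.
      module Reduce {p} (6≤p : ι 6 ≤ p) (b : Centre p) where
        Q : ℚ
        Q = ι 12 * (1ℚ + κ) + ℤ.+ 9 / 2 * y
        0≤Q : 0ℚ ≤ Q
        0≤Q = 0≤ι 12 ⊠ (0≤1 ⊞ 0≤κ) ⊞ nonNegative⁻¹ (ℤ.+ 9 / 2) ⊠ 0≤y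
        0≤t : 0ℚ ≤ p - ι 6
        0≤t = ≤-diff 6≤p
        reduced : f * (1ℚ + y) < Q * M
        reduced = *-cancelˡ-<-nonNeg (p - ι 6 + ι 2) {{nonNegative (0≤t ⊞ 0≤ι 2)}}
          (cert< (<-diff b ⁺⊞ (0≤ι 8 ⊠ 0≤t ⊠ (0≤1 ⊞ 0≤κ) ⊞ nonNegative⁻¹ (ℤ.+ 7 / 2) ⊠ 0≤t ⊠ 0≤y) ⊠ 0≤M) (eq f κ M p))
          where
          eq = solve 4 (λ f κ M p → let y = κ :* f ; t = p :- # ι 6 in
            (t :+ # ι 2) :* ((# ι 12 :* (# 1ℚ :+ κ) :+ # (ℤ.+ 9 / 2) :* y) :* M) :- (t :+ # ι 2) :* (f :* (# 1ℚ :+ y)) :=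
            (# ι 4 :* p :* (# 1ℚ :+ κ) :+ κ :* f :* (p :+ # ι 3)) :* M :- (p :- # ι 4) :* f :* (# 1ℚ :+ κ :* f) :+ (# ι 8 :* t :* (# 1ℚ :+ κ) :+ # (ℤ.+ 7 / 2) :* t :* y) :* M) refl

    -- For κf ≥ 4 the bound M ≤ 1 already refutes `Centre`. Below that, `Second` with p ≤ 8 gives K
    -- M ≤ f + 3 for K = 44 - 57κ > 0, where K is 55 - 46κ from `f-large` less 11 (1 + κ).
    several : ∀ {p} → ι 6 ≤ p → p ≤ ι 8 → Centre p → ¬ Second p
    several {p} 6≤p p≤8 b c with ι 4 ≤? y
    ... | yes 4≤y = absurd-sum {a = Q * M - f * (1ℚ + y)}
      {b = Q * (1ℚ - M) + (s * (1ℚ + y) + ℤ.+ 473 / 370 * (y - ι 4) + ℤ.+ 60 / 37 * s * κ + ℤ.+ 19 / 37)}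
      (<-diff reduced)
      (0≤Q ⊠ 0≤1-M ⊞ (0≤s ⊠ (0≤1 ⊞ 0≤y) ⊞ nonNegative⁻¹ (ℤ.+ 473 / 370) ⊠ ≤-diff 4≤y ⊞ nonNegative⁻¹ (ℤ.+ 60 / 37) ⊠ 0≤s ⊠ 0≤κ ⊞ nonNegative⁻¹ (ℤ.+ 19 / 37)))
      (≤-reflexive (eq f κ M))
      where
      open Reduce 6≤p b
      eq = solve 3 (λ f κ M → let s = f :- # (ℤ.+ 37 / 5) ; y = κ :* f ; Q = # ι 12 :* (# 1ℚ :+ κ) :+ # (ℤ.+ 9 / 2) :* y in
        Q :* M :- f :* (# 1ℚ :+ y) :+ (Q :* (# 1ℚ :- M) :+ (s :* (# 1ℚ :+ y) :+ # (ℤ.+ 473 / 370) :* (y :- # ι 4) :+ # (ℤ.+ 60 / 37) :* s :* κ :+ # (ℤ.+ 19 / 37))) := # 0ℚ) refl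
    ... | no 4≰y = absurd-sum {a = (ι 44 - ι 57 * κ) * (Q * M - f * (1ℚ + y))}
      {b = Q * (f + ι 3 - (ι 44 - ι 57 * κ) * M) + (f * bracket + ℤ.+ 15 / 37 * Q * s)}
      (0<K ⊠⁺ <-diff reduced)
      (0≤Q ⊠ ≤-diff KM≤ ⊞ (0≤f ⊠ 0≤bracket ⊞ nonNegative⁻¹ (ℤ.+ 15 / 37) ⊠ 0≤Q ⊠ 0≤s))
      (≤-reflexive (eq f κ M))
      where
      open Reduce 6≤p b
      0≤4-y : 0ℚ ≤ ι 4 - y
      0≤4-y = ≤-diff (<⇒≤ (≰⇒> 4≰y))
      bracket : ℚ
      bracket = ℤ.+ 4267 / 1369 * (ι 4 - y) + ℤ.+ 20080 / 1369 + ℤ.+ 285 / 37 * y * (ι 4 - y) + ℤ.+ 5 / 37 * s * κ * (ℤ.+ 2733 / 37 + ι 57 * y)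
      0≤bracket : 0ℚ ≤ bracket
      0≤bracket = nonNegative⁻¹ (ℤ.+ 4267 / 1369) ⊠ 0≤4-y ⊞ nonNegative⁻¹ (ℤ.+ 20080 / 1369) ⊞ nonNegative⁻¹ (ℤ.+ 285 / 37) ⊠ 0≤y ⊠ 0≤4-y
        ⊞ nonNegative⁻¹ (ℤ.+ 5 / 37) ⊠ 0≤s ⊠ 0≤κ ⊠ (nonNegative⁻¹ (ℤ.+ 2733 / 37) ⊞ 0≤ι 57 ⊠ 0≤y)
      0<K : 0ℚ < ι 44 - ι 57 * κ
      0<K = subst (0ℚ <_) (eq₁ f κ) (positive⁻¹ (ℤ.+ 488 / 37) ⁺⊞ nonNegative⁻¹ (ℤ.+ 285 / 37) ⊠ (0≤4-y ⊞ 0≤s ⊠ 0≤κ))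
        where
        eq₁ = solve 2 (λ f κ → # (ℤ.+ 488 / 37) :+ # (ℤ.+ 285 / 37) :* (# ι 4 :- κ :* f :+ (f :- # (ℤ.+ 37 / 5)) :* κ) := # ι 44 :- # ι 57 :* κ) refl
      KM≤ : (ι 44 - ι 57 * κ) * M ≤ f + ι 3
      KM≤ = cert≤ (≤-diff c ⊞ ((1ℚ⊞κ ⊠ ≤-diff p≤8 ⊞ 0≤y ⊠ ≤-diff p≤8) ⊠ 0≤M ⊞ ≤-diff f-large ⊠ 0≤M)) (eq₁ f κ M p)
        where
        1ℚ⊞κ : 0ℚ ≤ 1ℚ + κ
        1ℚ⊞κ = 0≤1 ⊞ 0≤κ
        eq₁ = solve 4 (λ f κ M p → f :+ # ι 3 :- (# ι 44 :- # ι 57 :* κ) :* M :=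
          f :+ # ι 3 :+ ((# 1ℚ :+ κ) :* (p :+ # ι 3) :+ κ :* f :* p) :* M :- f :* f :* M
          :+ (((# 1ℚ :+ κ) :* (# ι 8 :- p) :+ κ :* f :* (# ι 8 :- p)) :* M :+ (f :* f :- # ι 8 :* κ :* f :- (# ι 55 :- # ι 46 :* κ)) :* M)) refl
      eq = solve 3 (λ f κ M → let s = f :- # (ℤ.+ 37 / 5) ; y = κ :* f ; Q = # ι 12 :* (# 1ℚ :+ κ) :+ # (ℤ.+ 9 / 2) :* y in
        (# ι 44 :- # ι 57 :* κ) :* (Q :* M :- f :* (# 1ℚ :+ y)) :+ (Q :* (f :+ # ι 3 :- (# ι 44 :- # ι 57 :* κ) :* M)
          :+ (f :* (# (ℤ.+ 4267 / 1369) :* (# ι 4 :- y) :+ # (ℤ.+ 20080 / 1369) :+ # (ℤ.+ 285 / 37) :* y :* (# ι 4 :- y) :+ # (ℤ.+ 5 / 37) :* s :* κ :* (# (ℤ.+ 2733 / 37) :+ # ι 57 :* y))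
          :+ # (ℤ.+ 15 / 37) :* Q :* s)) := # 0ℚ) refl

    private
      e : ℚ
      e = s - κ
      -- The sharper bound f ≥ 37/5 + κ: for smaller f the hypothesis `f-large` fails. The
      -- certificate for five edges is expanded about it.
      0≤e : 0ℚ ≤ e
      0≤e with κ ≤? s
      ... | yes κ≤s = ≤-diff κ≤s
      ... | no κ≰s = contradiction (≤-diff f-large) (absurd-sum′
          {a = v * (ℤ.+ 39 / 5 + ι 6 * (1ℚ - κ) + (1ℚ - κ) + s) + ι 7 * ((κ - ℤ.+ 4 / 35) * (κ - ℤ.+ 4 / 35))}
          {c = ℤ.+ 26 / 175}
          (<⇒≤ 0<v ⊠ (nonNegative⁻¹ (ℤ.+ 39 / 5) ⊞ 0≤ι 6 ⊠ 0≤1-κ ⊞ 0≤1-κ ⊞ 0≤s) ⊞ 0≤ι 7 ⊠ square≥0 (κ - ℤ.+ 4 / 35))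
          (eq f κ))
        where
        v : ℚ
        v = κ - s
        0<v : 0ℚ < v
        0<v = <-diff (≰⇒> κ≰s)
        absurd-sum′ : ∀ {a b c} → {{Positive c}} → 0ℚ ≤ a → a + c ≡ 0ℚ - b → ¬ (0ℚ ≤ b)
        absurd-sum′ {a} {b} {c} 0≤a eq 0≤b = absurd-sum (positive⁻¹ c) (0≤a ⊞ 0≤b)
          (≤-reflexive (trans (eq₁ a b c) (trans (cong (_+ b) eq) (eq₂ b))))
          where
          eq₁ = solve 3 (λ a b c → c :+ (a :+ b) := a :+ c :+ b) refl
          eq₂ = solve 1 (λ b → # 0ℚ :- b :+ b := # 0ℚ) refl
        eq = solve 2 (λ f κ → let s = f :- # (ℤ.+ 37 / 5) ; v = κ :- s in
          v :* (# (ℤ.+ 39 / 5) :+ # ι 6 :* (# 1ℚ :- κ) :+ (# 1ℚ :- κ) :+ s) :+ # ι 7 :* ((κ :- # (ℤ.+ 4 / 35)) :* (κ :- # (ℤ.+ 4 / 35))) :+ # (ℤ.+ 26 / 175) :=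
          # 0ℚ :- (f :* f :- # ι 8 :* κ :* f :- (# ι 55 :- # ι 46 :* κ))) refl

    five : Centre (ι 5) → ¬ Second (ι 5)
    five b c = absurd-sum {a = K * (Q * M - f * (1ℚ + y))}
      {b = Q * (f + ι 3 - K * M) + (f * bracket + ℤ.+ 15 / 37 * Q * s)}
      (0<K ⊠⁺ subst (0ℚ <_) (eq₀ f κ M) (<-diff b))
      (0≤Q ⊠ ≤-diff KM≤ ⊞ (0≤f ⊠ 0≤bracket ⊞ nonNegative⁻¹ (ℤ.+ 15 / 37) ⊠ 0≤Q ⊠ 0≤s))
      (≤-reflexive (eq f κ M))
      where
      Q K : ℚ
      Q = ι 20 * (1ℚ + κ) + ι 8 * y
      -- From 55 - 46κ + 8κf, the lower bound for f², subtract 8 (1 + κ) + 5κf, the coefficient of M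
      -- in `Second` at p = 5.
      K = ι 47 - ι 54 * κ + ι 3 * y
      0≤Q : 0ℚ ≤ Q
      0≤Q = 0≤ι 20 ⊠ (0≤1 ⊞ 0≤κ) ⊞ 0≤ι 8 ⊠ 0≤y
      eq₀ = solve 3 (λ f κ M → (# ι 4 :* # ι 5 :* (# 1ℚ :+ κ) :+ κ :* f :* (# ι 5 :+ # ι 3)) :* M :- (# ι 5 :- # ι 4) :* f :* (# 1ℚ :+ κ :* f) :=
        (# ι 20 :* (# 1ℚ :+ κ) :+ # ι 8 :* (κ :* f)) :* M :- f :* (# 1ℚ :+ κ :* f)) refl
      0<K : 0ℚ < K
      0<K = subst (0ℚ <_) (eq₁ f κ) (positive⁻¹ (ℤ.+ 76 / 5) ⁺⊞ (nonNegative⁻¹ (ℤ.+ 159 / 5) ⊠ 0≤1-κ ⊞ 0≤ι 3 ⊠ 0≤s ⊠ 0≤κ))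
        where
        eq₁ = solve 2 (λ f κ → # (ℤ.+ 76 / 5) :+ (# (ℤ.+ 159 / 5) :* (# 1ℚ :- κ) :+ # ι 3 :* (f :- # (ℤ.+ 37 / 5)) :* κ) := # ι 47 :- # ι 54 :* κ :+ # ι 3 :* (κ :* f)) refl
      KM≤ : K * M ≤ f + ι 3
      KM≤ = cert≤ (≤-diff c ⊞ ≤-diff f-large ⊠ 0≤M) (eq₁ f κ M)
        where
        eq₁ = solve 3 (λ f κ M → f :+ # ι 3 :- (# ι 47 :- # ι 54 :* κ :+ # ι 3 :* (κ :* f)) :* M :=
          f :+ # ι 3 :+ ((# 1ℚ :+ κ) :* (# ι 5 :+ # ι 3) :+ κ :* f :* # ι 5) :* M :- f :* f :* M :+ (f :* f :- # ι 8 :* κ :* f :- (# ι 55 :- # ι 46 :* κ)) :* M) refl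
      bracket : ℚ
      bracket = ℤ.+ 181821 / 925 * κ * (1ℚ - κ) + ℤ.+ 48 / 5 * κ * (1ℚ - κ) * (1ℚ + κ) + ℤ.+ 1361 / 925 * (1ℚ - κ) + ℤ.+ 16114 / 925
        + ι 3 * κ * κ * κ * κ + e * κ * (ℤ.+ 5394 / 185 + ℤ.+ 48 / 5 * (1ℚ - κ) + ι 6 * κ * κ) + ι 3 * e * e * κ * κ
      0≤bracket : 0ℚ ≤ bracket
      0≤bracket = nonNegative⁻¹ (ℤ.+ 181821 / 925) ⊠ 0≤κ ⊠ 0≤1-κ ⊞ nonNegative⁻¹ (ℤ.+ 48 / 5) ⊠ 0≤κ ⊠ 0≤1-κ ⊠ (0≤1 ⊞ 0≤κ)
        ⊞ nonNegative⁻¹ (ℤ.+ 1361 / 925) ⊠ 0≤1-κ ⊞ nonNegative⁻¹ (ℤ.+ 16114 / 925) ⊞ 0≤ι 3 ⊠ 0≤κ ⊠ 0≤κ ⊠ 0≤κ ⊠ 0≤κ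
        ⊞ 0≤e ⊠ 0≤κ ⊠ (nonNegative⁻¹ (ℤ.+ 5394 / 185) ⊞ nonNegative⁻¹ (ℤ.+ 48 / 5) ⊠ 0≤1-κ ⊞ 0≤ι 6 ⊠ 0≤κ ⊠ 0≤κ)
        ⊞ 0≤ι 3 ⊠ 0≤e ⊠ 0≤e ⊠ 0≤κ ⊠ 0≤κ
      eq = solve 3 (λ f κ M → let s = f :- # (ℤ.+ 37 / 5) ; y = κ :* f ; e = s :- κ ; Q = # ι 20 :* (# 1ℚ :+ κ) :+ # ι 8 :* y ; K = # ι 47 :- # ι 54 :* κ :+ # ι 3 :* y in
        K :* (Q :* M :- f :* (# 1ℚ :+ y)) :+ (Q :* (f :+ # ι 3 :- K :* M) :+ (f :* (# (ℤ.+ 181821 / 925) :* κ :* (# 1ℚ :- κ) :+ # (ℤ.+ 48 / 5) :* κ :* (# 1ℚ :- κ) :* (# 1ℚ :+ κ) :+ # (ℤ.+ 1361 / 925) :* (# 1ℚ :- κ) :+ # (ℤ.+ 16114 / 925)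
        :+ # ι 3 :* κ :* κ :* κ :* κ :+ e :* κ :* (# (ℤ.+ 5394 / 185) :+ # (ℤ.+ 48 / 5) :* (# 1ℚ :- κ) :+ # ι 6 :* κ :* κ) :+ # ι 3 :* e :* e :* κ :* κ) :+ # (ℤ.+ 15 / 37) :* Q :* s)) := # 0ℚ) refl

-- A normalised subsolution and the weight of its two-step walks.

module Subsolutions where
  open OrderedField
  open LinearAlgebra
  open AdjacencyOperators
  open ExtremalSigns using (L₀)
  open Graphs
  open Neighbourhoods
  open Estimates
  open import Defs hiding (_≈_; _≤_)
  open import Data.Fin.Base using (Fin; zero; suc)
  open import Data.Fin.Properties using () renaming (_≟_ to _≟ᶠ_)
  open import Data.Nat.Base as ℕ using (ℕ; zero; suc)
  open import Data.Product.Base using (∃-syntax; _,_)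
  open import Data.Sum.Base using (inj₁; inj₂)
  open import Data.Rational.Base hiding (_⊔_; _⊓_; ∣_∣)
  open import Data.Rational.Properties
  open import Function.Base using (_∘_)
  open import Relation.Nullary using (yes; no)
  open import Relation.Binary.PropositionalEquality

  argmax : ∀ {n} → Fin n → (z : Fin n → ℚ) → ∃[ i ] ∀ j → z j ≤ z i
  argmax {suc zero}    _ z = zero , λ { zero → ≤-refl }
  argmax {suc (suc n)} _ z with argmax zero (z ∘ suc)
  ... | i , h with ≤-total (z zero) (z (suc i))
  ... | inj₁ z₀≤ = suc i , λ { zero → z₀≤ ; (suc j) → h j }
  ... | inj₂ ≤z₀ = zero , λ { zero → ≤-refl ; (suc j) → ≤-trans (h j) ≤z₀ }

  module Sub (G : Hypergraph) (uniform : Uniform 2 G) (connected : Connected G)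
    (order+2 : order G ℕ.+ 2 ≡ size G) (u : Fin (order G))
    (f κ : ℚ) (L₀≤f : L₀ ≤ f) (0≤κ : 0ℚ ≤ κ) (κ≤1 : κ ≤ 1ℚ)
    (z : Fin (order G) → ℚ) (z≥0 : ∀ x → 0ℚ ≤ z x) (z-u : z u ≡ 1ℚ) (z≤1 : ∀ x → z x ≤ 1ℚ)
    (sub : ∀ x → (f + κ) * z x ≤ (adj G · z) x + κ * (Graph.degree G uniform x * z x)) where

    open Estimate G uniform connected order+2 u public

    0≤f : 0ℚ ≤ f
    0≤f = ≤-trans by-evaluation L₀≤f

    ζ : Fin n → ℚ
    ζ x = o x * z x

    0≤ζ : ∀ x → 0ℚ ≤ ζ x
    0≤ζ x = 0≤o x ⊠ z≥0 x

    ζ-≢ : ∀ {x} → x ≢ u → ζ x ≡ z x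
    ζ-≢ {x} x≢u = trans (cong (_* z x) (o-≢ x≢u)) (*-identityˡ (z x))

    T : Fin n → ℚ
    T x = ν x + ((A · ζ) x + κ * (D x * ζ x))

    A·z : ∀ x → (A · z) x ≡ (A · ζ) x + ν x
    A·z x = trans (split-u z x) (cong ((A · ζ) x +_)
      (trans (cong (A x u *_) z-u) (trans (*-identityʳ (A x u)) (adj-sym G x u))))

    -- The degree of x is D x + ν x. For a neighbour of u the κ on the left cancels the share of its
    -- spoke; for any other vertex that κ is simply dropped.
    away : ∀ x → f * ζ x ≤ o x * T x
    away x with x ≟ᶠ u
    ... | yes refl = ≤-reflexive (trans (cong (λ a → f * (a * z u)) o-u) (trans (eq f (z u)) (sym (trans (cong (_* T u) o-u) (*-zeroˡ (T u))))))
      where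
      eq = solve 2 (λ f z → f :* (# 0ℚ :* z) := # 0ℚ) refl
    ... | no x≢u = subst₂ _≤_ (cong (f *_) (sym (ζ-≢ x≢u))) (trans (cong (λ a → ν x + ((A · ζ) x + κ * (D x * a))) (sym (ζ-≢ x≢u))) (sym (trans (cong (_* T x) (o-≢ x≢u)) (*-identityˡ (T x)))))
      (cert≤ (≤-diff (sub x) ⊞ 0≤κ ⊠ z≥0 x ⊠ 0≤1-𝟙 (N u x))
        (trans (eq f κ (z x) ((A · ζ) x) (ν x) (D x))
          (cong₂ (λ a b → a + κ * (b * z x) - (f + κ) * z x + κ * z x * (1ℚ - ν x)) (sym (A·z x)) (sym (D≡ x)))))
      where
      eq = solve 6 (λ f κ z s v d → v :+ (s :+ κ :* (d :* z)) :- f :* z := s :+ v :+ κ :* ((d :+ v) :* z) :- (f :+ κ) :* z :+ κ :* z :* (# 1ℚ :- v)) refl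

    ν-o : ∀ x → ν x * o x ≡ ν x
    ν-o x with x ≟ᶠ u
    ... | yes refl = trans (cong (_* o u) ν-u) (trans (*-zeroˡ (o u)) (sym ν-u))
    ... | no x≢u   = trans (cong (ν x *_) (o-≢ x≢u)) (*-identityʳ (ν x))

    root : f + κ ≤ sum (λ x → ν x * ζ x) + κ * d
    root = subst₂ _≤_ (trans (cong ((f + κ) *_) z-u) (*-identityʳ (f + κ)))
      (cong₂ _+_ (trans (A·z u) (trans (cong ((A · ζ) u +_) ν-u) (+-identityʳ ((A · ζ) u))))
        (cong (κ *_) (trans (cong (d *_) z-u) (*-identityʳ d)))) (sub u)

    -- The weight of the two-step walks from u which do not return to u at once.
    Θ : ℚ
    Θ = sum (λ x → ν x * ((A · ζ) x + κ * (D x * ζ x)))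

    -- Multiply the inequality at u by f and insert `away` at each neighbour: the d walks that
    -- return to u at once give d, and all the others give Θ.
    centre : f * (f + κ - κ * d) ≤ d + Θ
    centre = ≤-trans
      (cert≤ {t = f * (sum (λ x → ν x * ζ x) + κ * d - (f + κ))} (0≤f ⊠ ≤-diff root) (eq f κ d (sum (λ x → ν x * ζ x))))
      (subst₂ _≤_ (Σ-*ˡ f (λ x → ν x * ζ x))
        (trans (Σ-+ ν (λ x → ν x * ((A · ζ) x + κ * (D x * ζ x)))) (cong (_+ Θ) (ΣA u)))
        (Σ-mono λ x → subst₂ _≤_ (eq₁ f (ν x) (ζ x)) (eq₂ x) (scale-≤ (0≤ν x) (away x))))
      where
      eq = solve 4 (λ f κ d s → f :* s :- f :* (f :+ κ :- κ :* d) := f :* (s :+ κ :* d :- (f :+ κ))) refl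
      eq₁ = solve 3 (λ f v z → v :* (f :* z) := f :* (v :* z)) refl
      eq₂ : ∀ x → ν x * (o x * T x) ≡ ν x + ν x * ((A · ζ) x + κ * (D x * ζ x))
      eq₂ x = trans (sym (*-assoc (ν x) (o x) (T x))) (trans (cong (_* T x) (ν-o x))
        (trans (*-distribˡ-+ (ν x) (ν x) _) (cong (_+ ν x * ((A · ζ) x + κ * (D x * ζ x))) (𝟙-idem (N u x)))))

    module Away (M : ℚ) (0≤M : 0ℚ ≤ M) (z≤M : ∀ {x} → x ≢ u → z x ≤ M) where

      ζ≤M : ∀ x → ζ x ≤ M
      ζ≤M x with x ≟ᶠ u
      ... | yes refl = subst (_≤ M) (sym (trans (cong (_* z u) o-u) (*-zeroˡ (z u)))) 0≤M
      ... | no x≢u   = subst (_≤ M) (sym (ζ-≢ x≢u)) (z≤M x≢u)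

      A·ζ≤ : ∀ x → (A · ζ) x ≤ M * D x
      A·ζ≤ x = subst ((A · ζ) x ≤_) (trans (Σ-cong λ y → eq (A x y) M (o y)) (Σ-*ˡ M (λ y → A x y * o y))) (·-mono ζ≤Mo x)
        where
        eq = solve 3 (λ a m o → a :* (m :* o) := m :* (a :* o)) refl
        ζ≤Mo : ∀ y → ζ y ≤ M * o y
        ζ≤Mo y with y ≟ᶠ u
        ... | yes refl = ≤-reflexive (trans (cong (_* z u) o-u) (trans (*-zeroˡ (z u)) (sym (trans (cong (M *_) o-u) (*-zeroʳ M)))))
        ... | no y≢u   = subst₂ _≤_ (sym (ζ-≢ y≢u)) (sym (trans (cong (M *_) (o-≢ y≢u)) (*-identityʳ M))) (z≤M y≢u)

      T≤ : ∀ x → T x ≤ ν x + (1ℚ + κ) * M * D x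
      T≤ x = cert≤ (≤-diff (A·ζ≤ x) ⊞ 0≤κ ⊠ (0≤D x ⊠ ≤-diff (ζ≤M x))) (eq (ν x) κ M (D x) ((A · ζ) x) (ζ x))
        where
        eq = solve 6 (λ v κ m d s z → v :+ (# 1ℚ :+ κ) :* m :* d :- (v :+ (s :+ κ :* (d :* z))) := m :* d :- s :+ κ :* (d :* (m :- z))) refl

      away≤ : ∀ x → f * ζ x ≤ ν x + (1ℚ + κ) * M * (o x * D x)
      away≤ x = ≤-trans (away x) (cert≤ (0≤o x ⊠ ≤-diff (T≤ x))
        (trans (cong (λ a → a + (1ℚ + κ) * M * (o x * D x) - o x * T x) (sym (trans (*-comm (o x) (ν x)) (ν-o x))))
          (eq (o x) (ν x) ((1ℚ + κ) * M) (D x) (T x))))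
        where
        eq = solve 5 (λ o v m d t → o :* v :+ m :* (o :* d) :- o :* t := o :* (v :+ m :* d :- t)) refl

      private
        weighted : ∀ (q : Fin n → ℚ) → (∀ x → 0ℚ ≤ q x) →
          f * sum (λ x → q x * ζ x) ≤ sum (λ x → q x * ν x) + (1ℚ + κ) * M * sum (λ x → q x * (o x * D x))
        weighted q 0≤q = subst₂ _≤_
          (trans (Σ-cong λ x → eq (q x) f (ζ x)) (Σ-*ˡ f (λ x → q x * ζ x)))
          (trans (Σ-cong λ x → eq₁ (q x) (ν x) ((1ℚ + κ) * M) (o x * D x))
            (trans (Σ-+ (λ x → q x * ν x) (λ x → (1ℚ + κ) * M * (q x * (o x * D x))))
              (cong (sum (λ x → q x * ν x) +_) (Σ-*ˡ ((1ℚ + κ) * M) (λ x → q x * (o x * D x))))))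
          (Σ-mono λ x → scale-≤ (0≤q x) (away≤ x))
          where
          eq = solve 3 (λ q f z → q :* (f :* z) := f :* (q :* z)) refl
          eq₁ = solve 4 (λ q v m d → q :* (v :+ m :* d) := q :* v :+ m :* (q :* d)) refl

        0≤κ′M : 0ℚ ≤ (1ℚ + κ) * M
        0≤κ′M = (0≤1 ⊞ 0≤κ) ⊠ 0≤M

      -- Regroup Θ by the last vertex: a vertex x is reached through c x neighbours of u. One more
      -- use of `away≤` leaves Σ c ν ≤ 6 and Σ c D ≤ 4p over the vertices other than u, while the
      -- part with κ needs only Σ ν D ≤ p + 3.
      Θ≤ : f * Θ ≤ ι 6 + (1ℚ + κ) * M * (ι 4 * p) + f * (κ * (M * (p + ι 3)))
      Θ≤ = subst (λ t → f * t ≤ ι 6 + (1ℚ + κ) * M * (ι 4 * p) + f * (κ * (M * (p + ι 3)))) (sym Θ≡)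
        (cert≤ (≤-diff (weighted c 0≤c) ⊞ ≤-diff cν≤ ⊞ 0≤κ′M ⊠ ≤-diff o-c-D
            ⊞ 0≤f ⊠ (0≤κ ⊠ (≤-diff νDζ≤ ⊞ 0≤M ⊠ ≤-diff ν-edges)))
          (eq f κ M p (sum (λ x → c x * ζ x)) (sum (λ x → ν x * (D x * ζ x))) (sum (λ x → c x * ν x)) (sum (λ x → c x * (o x * D x))) ⟨ ν , o ⟩))
        where
        Θ≡ : Θ ≡ sum (λ x → c x * ζ x) + κ * sum (λ x → ν x * (D x * ζ x))
        Θ≡ = trans (Σ-cong λ x → eq₁ (ν x) ((A · ζ) x) κ (D x * ζ x))
          (trans (Σ-+ (λ x → ν x * (A · ζ) x) (λ x → κ * (ν x * (D x * ζ x))))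
            (cong₂ _+_ (trans (form-sym ν ζ) (Σ-cong λ x → *-comm (ζ x) (c x))) (Σ-*ˡ κ (λ x → ν x * (D x * ζ x)))))
          where
          eq₁ = solve 4 (λ v s κ t → v :* (s :+ κ :* t) := v :* s :+ κ :* (v :* t)) refl
        cν≤ : sum (λ x → c x * ν x) ≤ ι 6
        cν≤ = subst (_≤ ι 6) (Σ-cong λ x → *-comm (ν x) (c x)) (neighbourhood u)
        νDζ≤ : sum (λ x → ν x * (D x * ζ x)) ≤ M * ⟨ ν , o ⟩
        νDζ≤ = subst (sum (λ x → ν x * (D x * ζ x)) ≤_) (Σ-*ˡ M (λ x → ν x * D x))
          (Σ-mono λ x → subst₂ _≤_ (eq₁ (ν x) (D x) (ζ x)) (*-comm (ν x * D x) M) (scale-≤ (0≤ν x ⊠ 0≤D x) (ζ≤M x)))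
          where
          eq₁ = solve 3 (λ v d z → v :* d :* z := v :* (d :* z)) refl
        eq = solve 9 (λ f κ M p a b c₁ c₂ q → # ι 6 :+ (# 1ℚ :+ κ) :* M :* (# ι 4 :* p) :+ f :* (κ :* (M :* (p :+ # ι 3))) :- f :* (a :+ κ :* b) :=
          c₁ :+ (# 1ℚ :+ κ) :* M :* c₂ :- f :* a :+ (# ι 6 :- c₁) :+ (# 1ℚ :+ κ) :* M :* (# ι 4 :* p :- c₂)
            :+ f :* (κ :* (M :* q :- b :+ M :* (p :+ # ι 3 :- q)))) refl

      -- At a vertex with entry M, `away` is applied to x and `away≤` to its neighbours. The walks
      -- that end in u give f ν x + c x, bounded by `ν+c`; the others by `two-steps` and D x ≤ p.
      second : ∀ {x} → x ≢ u → z x ≡ M → p ≤ ι 8 →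
        f * f * M ≤ f + ι 3 + ((1ℚ + κ) * (p + ι 3) + κ * f * p) * M
      second {x} x≢u zx p≤8 = cert≤
        (0≤f ⊠ ≤-diff (subst (λ t → f * t ≤ o x * T x) ζx (away x))
          ⊞ (≤-diff (weighted (A x) (A≥0 x)) ⊞ ≤-diff (ν+c f (≤-trans by-evaluation L₀≤f) x≢u p≤8)
          ⊞ 0≤κ′M ⊠ ≤-diff (two-steps x) ⊞ 0≤f ⊠ (0≤κ ⊠ (≤-diff (D≤p x≢u) ⊠ 0≤M))))
        (trans (eq f κ M p (ν x) (sum (λ y → A x y * ζ y)) (D x) (c x) (sum (λ y → A x y * (o y * D y))))
          (cong (λ t → f * (t - f * M) + (c x + (1ℚ + κ) * M * sum (λ y → A x y * (o y * D y)) - f * sum (λ y → A x y * ζ y)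
              + (f + ι 3 - (f * ν x + c x)) + (1ℚ + κ) * M * (p + ι 3 - sum (λ y → A x y * (o y * D y))) + f * (κ * ((p - D x) * M))))
            (sym (trans (cong (_* T x) (o-≢ x≢u)) (trans (*-identityˡ (T x)) (cong (λ t → ν x + ((A · ζ) x + κ * (D x * t))) ζx))))))
        where
        ζx : ζ x ≡ M
        ζx = trans (ζ-≢ x≢u) zx
        eq = solve 9 (λ f κ M p v s d c q → f :+ # ι 3 :+ ((# 1ℚ :+ κ) :* (p :+ # ι 3) :+ κ :* f :* p) :* M :- f :* f :* M :=
          f :* (v :+ (s :+ κ :* (d :* M)) :- f :* M) :+ (c :+ (# 1ℚ :+ κ) :* M :* q :- f :* s
              :+ (f :+ # ι 3 :- (f :* v :+ c)) :+ (# 1ℚ :+ κ) :* M :* (p :+ # ι 3 :- q) :+ f :* (κ :* ((p :- d) :* M)))) refl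

-- At most four edges avoid the maximal vertex.

module FewEdges where
  open OrderedField
  open LinearAlgebra
  open AdjacencyOperators
  open ExtremalSigns using (L₀; module Shape)
  open Graphs
  open Polynomials
  open Subsolutions
  open import Defs hiding (_≈_; _≤_)
  open import Data.Fin.Base using (Fin)
  open import Data.Fin.Properties using () renaming (_≟_ to _≟ᶠ_)
  open import Data.Nat.Base as ℕ using (ℕ)
  import Data.Nat.Properties as ℕₚ
  open import Data.Product.Base using (∃-syntax; _,_)
  open import Data.Empty using () renaming (⊥ to Absurd)
  open import Data.Rational.Base hiding (_⊔_; _⊓_; ∣_∣)
  open import Data.Rational.Properties
  open import Relation.Nullary using (¬_; Dec; yes; no)
  open import Relation.Binary.PropositionalEquality

  module Few (G : Hypergraph) (uniform : Uniform 2 G) (connected : Connected G)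
    (order+2 : order G ℕ.+ 2 ≡ size G) (u : Fin (order G))
    (f κ : ℚ) (L₀≤f : L₀ ≤ f) (0≤κ : 0ℚ ≤ κ) (κ≤1 : κ ≤ 1ℚ)
    (z : Fin (order G) → ℚ) (z≥0 : ∀ x → 0ℚ ≤ z x) (z-u : z u ≡ 1ℚ) (z≤1 : ∀ x → z x ≤ 1ℚ)
    (sub : ∀ x → (f + κ) * z x ≤ (adj G · z) x + κ * (Graph.degree G uniform x * z x))
    (a : ℕ) (size≡ : size G ≡ 10 ℕ.+ a)
    (excess : ι 6 * (1ℚ + κ) * Shape.g f κ + (1ℚ + κ * f) < Shape.E f κ (ι a) * (Shape.g f κ * Shape.g f κ))
    (f-large : ι 55 - ι 46 * κ ≤ f * f - ι 8 * κ * f) where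

    open Sub G uniform connected order+2 u f κ L₀≤f 0≤κ κ≤1 z z≥0 z-u z≤1 sub public
    open Shape f κ public using (g; E)
    open Shape.Positive f κ L₀≤f 0≤κ κ≤1 public using (1≤g; 0<g; E-positive)

    0≤κf : 0ℚ ≤ κ * f
    0≤κf = 0≤κ ⊠ 0≤f

    E>0 : 0ℚ < E (ι a)
    E>0 = E-positive (ι a) excess

    -- The degree of u is a + 6 - (p - 4), that is p - 4 less than at the centre of T. Each missing
    -- edge at u raises the demand on two-step walks by 1 + κf.
    E-centre : f * (f + κ - κ * d) - d ≡ E (ι a) + (p - ι 4) * (1ℚ + κ * f)
    E-centre = modulo (κ * f + 1ℚ) (cong ι size≡) (trans
      (cong (λ t → f * (f + κ - κ * d) - d + (κ * f + 1ℚ) * (ι k - t)) (ι-+ 10 a)) (eq f κ d (ι k) (ι a)))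
      where
      eq = solve 5 (λ f κ d k a → f :* (f :+ κ :- κ :* d) :- d :+ (κ :* f :+ # 1ℚ) :* (k :- (# ι 10 :+ a)) :=
        f :* (f :- κ :* (a :+ # ι 5)) :- (a :+ # ι 6) :+ (k :- d :- # ι 4) :* (# 1ℚ :+ κ :* f)) refl

    -- Dropping positive terms from `excess` leaves 6 < g E, and g < f.
    6<fE : ι 6 < f * E (ι a)
    6<fE = <-≤-trans
      (*-cancelˡ-<-nonNeg g {{nonNegative (<⇒≤ 0<g)}}
        (cert< {t = E (ι a) * (g * g) - (ι 6 * (1ℚ + κ) * g + (1ℚ + κ * f)) + (ι 6 * κ * g + (1ℚ + κ * f))}
          (<-diff excess ⁺⊞ (0≤ι 6 ⊠ 0≤κ ⊠ <⇒≤ 0<g ⊞ (0≤1 ⊞ 0≤κf))) (eq f κ g (E (ι a)))))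
      (cert≤ {t = (κ + 1ℚ) * E (ι a)} ((0≤κ ⊞ 0≤1) ⊠ <⇒≤ E>0) (eq₁ f κ (E (ι a))))
      where
      eq = solve 4 (λ f κ g E → g :* (g :* E) :- g :* # ι 6 := E :* (g :* g) :- (# ι 6 :* (# 1ℚ :+ κ) :* g :+ (# 1ℚ :+ κ :* f)) :+ (# ι 6 :* κ :* g :+ (# 1ℚ :+ κ :* f))) refl
      eq₁ = solve 3 (λ f κ E → f :* E :- (f :- κ :- # 1ℚ) :* E := (κ :+ # 1ℚ) :* E) refl

    module _ (M : ℚ) (0≤M : 0ℚ ≤ M) (M≤1 : M ≤ 1ℚ) (z≤M : ∀ {x} → x ≢ u → z x ≤ M) where

      open Inequalities f κ M L₀≤f 0≤κ κ≤1 f-large 0≤M M≤1 public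
      open Away M 0≤M z≤M public

      centre-inequality : Centre p
      centre-inequality = cert<
        (<-diff 6<fE ⁺⊞ (≤-diff Θ≤ ⊞ 0≤f ⊠ ≤-diff centre))
        (trans (eq₁ f κ M p Θ (E (ι a)))
          (cong (λ t → f * E (ι a) - ι 6 + (ι 6 + (1ℚ + κ) * M * (ι 4 * p) + f * (κ * (M * (p + ι 3))) - f * Θ + f * t))
            (sym (trans (eq₂ d Θ (f * (f + κ - κ * d))) (cong (λ t → Θ - t) E-centre)))))
        where
        eq₁ = solve 6 (λ f κ M p Θ E → (# ι 4 :* p :* (# 1ℚ :+ κ) :+ κ :* f :* (p :+ # ι 3)) :* M :- (p :- # ι 4) :* f :* (# 1ℚ :+ κ :* f) :=
          f :* E :- # ι 6 :+ (# ι 6 :+ (# 1ℚ :+ κ) :* M :* (# ι 4 :* p) :+ f :* (κ :* (M :* (p :+ # ι 3))) :- f :* Θ :+ f :* (Θ :- (E :+ (p :- # ι 4) :* (# 1ℚ :+ κ :* f))))) refl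
        eq₂ = solve 3 (λ d Θ s → d :+ Θ :- s := Θ :- (s :- d)) refl

    -- M is taken as the largest entry away from u, and then five, six to eight, and nine or more
    -- edges are refuted separately.
    few-edges : ∀ q → p ≡ ι q → ¬ (5 ℕ.≤ q)
    few-edges q p≡ 5≤q = go (argmax u ζ)
      where
      5≤p : ι 5 ≤ p
      5≤p = subst (ι 5 ≤_) (sym p≡) (ι-mono 5≤q)
      go : (∃[ x ] ∀ y → ζ y ≤ ζ x) → Absurd
      go (x , h) with x ≟ᶠ u
      -- ζ vanishes at u, so a maximum there means that all other entries are zero; M = 0
      -- contradicts `Centre` directly.
      ... | yes refl = <-irrefl refl (≤-<-trans
          (cert≤ ((≤-diff 5≤p ⊞ 0≤1) ⊠ 0≤f ⊠ (0≤1 ⊞ 0≤κf)) (eq p f (κ * f)))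
          (subst ((p - ι 4) * f * (1ℚ + κ * f) <_) (*-zeroʳ (ι 4 * p * (1ℚ + κ) + κ * f * (p + ι 3)))
            (centre-inequality 0ℚ ≤-refl 0≤1 z≤0)))
        where
        eq = solve 3 (λ p f y → (p :- # ι 4) :* f :* (# 1ℚ :+ y) :- # 0ℚ := (p :- # ι 5 :+ # 1ℚ) :* f :* (# 1ℚ :+ y)) refl
        z≤0 : ∀ {y} → y ≢ u → z y ≤ 0ℚ
        z≤0 {y} y≢u = subst₂ _≤_ (ζ-≢ y≢u) (trans (cong (_* z u) o-u) (*-zeroˡ (z u))) (h y)
      ... | no x≢u = cases (5 ℕₚ.≟ q) (6 ℕₚ.≤? q) (9 ℕₚ.≤? q)
        where
        M : ℚ
        M = z x
        z≤M : ∀ {y} → y ≢ u → z y ≤ M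
        z≤M {y} y≢u = subst₂ _≤_ (ζ-≢ y≢u) (ζ-≢ x≢u) (h y)
        b = centre-inequality M (z≥0 x) (z≤1 x) z≤M
        second-inequality : p ≤ ι 8 → _
        second-inequality = second M (z≥0 x) (z≤1 x) z≤M x≢u refl
        cases : Dec (5 ≡ q) → Dec (6 ℕ.≤ q) → Dec (9 ℕ.≤ q) → Absurd
        cases _ _ (yes 9≤q) = many M (z≥0 x) (z≤1 x) z≤M {p} (subst (ι 9 ≤_) (sym p≡) (ι-mono 9≤q)) b
        cases (yes refl) _ (no _) = five M (z≥0 x) (z≤1 x) z≤M (subst (Centre M (z≥0 x) (z≤1 x) z≤M) p≡ b)
          (subst (Second M (z≥0 x) (z≤1 x) z≤M) p≡ (second-inequality (subst (_≤ ι 8) (sym p≡) (ι-mono (ℕₚ.m≤m+n 5 3)))))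
        cases (no _) (yes 6≤q) (no 9≰q) = several M (z≥0 x) (z≤1 x) z≤M {p} (subst (ι 6 ≤_) (sym p≡) (ι-mono 6≤q)) p≤8 b (second-inequality p≤8)
          where
          p≤8 : p ≤ ι 8
          p≤8 = subst (_≤ ι 8) (sym p≡) (ι-mono (ℕₚ.≤-pred (ℕₚ.≰⇒> 9≰q)))
        cases (no 5≢q) (no 6≰q) _ = 6≰q (ℕₚ.≤∧≢⇒< 5≤q 5≢q)

-- Exact comparison for the two remaining graphs.

module ExcludedShapes where
  open OrderedField
  open LinearAlgebra
  open AdjacencyOperators
  open ExtremalSigns using (L₀; module Shape)
  open Graphs
  open Neighbourhoods
  open FewEdges
  open Isomorphisms using (powerOf-≅)
  open CoreForms using (one-pendant-off; all-pendants-at-centre)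
  open Surroundings
  open SmallStructures
  open import Defs hiding (_≈_; _≤_)
  open import Data.Empty using () renaming (⊥ to Absurd)
  open import Data.Fin.Base using (Fin; suc)
  open import Data.Fin.Properties using (any?) renaming (_≟_ to _≟ᶠ_)
  open import Data.Fin.Subset using (_∈_)
  open import Data.Fin.Subset.Properties using (_∈?_)
  import Data.Integer.Base as ℤ
  import Data.Nat.Properties as ℕₚ
  import Data.Vec.Base as Vec
  open import Data.List.Base using (List; []; _∷_; length)
  open import Data.List.Membership.Propositional using () renaming (_∈_ to _∈ˡ_)
  open import Data.List.Membership.Propositional.Properties using (∈-++⁺ˡ)
  open import Data.List.Relation.Unary.All as All using (All; []; _∷_)
  open import Data.List.Relation.Unary.Any using (here; there)
  open import Data.Nat.Base as ℕ using (ℕ; suc)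
  open import Data.Product.Base using (∃-syntax; _×_; _,_; proj₁; proj₂)
  open import Data.Rational.Base hiding (_⊔_; _⊓_; ∣_∣)
  open import Data.Rational.Properties
  open import Data.Sum.Base using (_⊎_; inj₁; inj₂; [_,_]′)
  open import Function.Base using (_∘_)
  open import Relation.Nullary using (¬_; Dec; yes; no; does)
  open import Relation.Nullary.Decidable using (_×-dec_; ¬?; dec-false)
  open import Relation.Nullary.Negation using (contradiction)
  open import Relation.Binary.PropositionalEquality

  Σˡ : ∀ {n} → (Fin n → ℚ) → List (Fin n) → ℚ
  Σˡ q []      = 0ℚ
  Σˡ q (x ∷ L) = q x + Σˡ q L

  -- The list may repeat elements: r is nonnegative, so overcounting only weakens the bound.
  Σ≤Σˡ : ∀ {n} {q r : Fin n → ℚ} L → (∀ x → 0ℚ ≤ r x) → (∀ x → q x ≤ 0ℚ ⊎ x ∈ˡ L × q x ≤ r x) → sum q ≤ Σˡ r L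
  Σ≤Σˡ {n} {q} {r} L 0≤r h = ≤-trans (Σ-mono pointwise) (≤-reflexive (total L))
    where
    weight : List (Fin n) → Fin n → ℚ
    weight L x = Σˡ (λ v → δ v x * r x) L
    0≤weight : ∀ L x → 0ℚ ≤ weight L x
    0≤weight [] x = ≤-refl
    0≤weight (v ∷ L) x = 0≤δ v x ⊠ 0≤r x ⊞ 0≤weight L x
    r≤ : ∀ {L x} → x ∈ˡ L → r x ≤ weight L x
    r≤ {x ∷ L} (here refl) = cert≤ (0≤weight L x)
      (trans (cong (λ a → a * r x + weight L x - r x) (δ-refl x)) (eq (r x) (weight L x)))
      where
      eq = solve 2 (λ r w → # 1ℚ :* r :+ w :- r := w) refl
    r≤ {v ∷ L} {x} (there x∈) = ≤-trans (r≤ x∈) (cert≤ (0≤δ v x ⊠ 0≤r x) (eq (δ v x * r x) (weight L x)))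
      where
      eq = solve 2 (λ a w → a :+ w :- w := a) refl
    pointwise : ∀ x → q x ≤ weight L x
    pointwise x with h x
    ... | inj₁ q≤0       = ≤-trans q≤0 (0≤weight L x)
    ... | inj₂ (x∈ , q≤) = ≤-trans q≤ (r≤ x∈)
    total : ∀ L → sum (weight L) ≡ Σˡ r L
    total []      = Σ-0 {n} λ _ → refl
    total (v ∷ L) = trans (Σ-+ (λ x → δ v x * r x) (weight L)) (cong₂ _+_ (Σ-δ v r) (total L))

  module Classification (G : Hypergraph) (uniform : Uniform 2 G) (connected : Connected G)
    (order+2 : order G ℕ.+ 2 ≡ size G) (u : Fin (order G))
    (f κ : ℚ) (L₀≤f : L₀ ≤ f) (0≤κ : 0ℚ ≤ κ) (κ≤1 : κ ≤ 1ℚ)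
    (z : Fin (order G) → ℚ) (z≥0 : ∀ x → 0ℚ ≤ z x) (z-u : z u ≡ 1ℚ) (z≤1 : ∀ x → z x ≤ 1ℚ)
    (sub : ∀ x → (f + κ) * z x ≤ (adj G · z) x + κ * (Graph.degree G uniform x * z x))
    (α : ℕ) (size≡ : size G ≡ 10 ℕ.+ α)
    (excess : ι 6 * (1ℚ + κ) * Shape.g f κ + (1ℚ + κ * f) < Shape.E f κ (ι α) * (Shape.g f κ * Shape.g f κ))
    (f-large : ι 55 - ι 46 * κ ≤ f * f - ι 8 * κ * f)
    (r : ℕ) {H : Hypergraph} (φ : H ≅ power (suc (suc r)) G) (three : ThreeCyclic H) where

    open Few G uniform connected order+2 u f κ L₀≤f 0≤κ κ≤1 z z≥0 z-u z≤1 sub α size≡ excess f-large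
    open Around G uniform connected order+2 u using (Inner; Disjoint; oriented; length-es; es; rs; lengths; inner-∌)
    open ThreeCycles G uniform connected order+2 u r φ three using (remote-≢; remote-¬joins; Path; Square; Structure; all-at-u; one-off; path; square; structure)
    open Shape.Positive f κ L₀≤f 0≤κ κ≤1 using (g-bound; 0≤h)

    W : Fin n → ℚ
    W x = (A · ζ) x + κ * (D x * ζ x)

    0≤W : ∀ x → 0ℚ ≤ W x
    0≤W x = Σ-nonneg (λ y → A≥0 x y ⊠ 0≤ζ y) ⊞ 0≤κ ⊠ (0≤D x ⊠ 0≤ζ x)

    Only : Fin n → List (Fin n) → Set
    Only x L = ∀ {e y} → Joins G e x y → ¬ u ∈ edge G e → y ∈ˡ L

    private
      row : ∀ {x L} → x ≢ u → Only x L → ∀ {q} → (∀ y → 0ℚ ≤ q y) → q u ≡ 0ℚ → (A · q) x ≤ Σˡ q L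
      row {x} {L} x≢u only {q} 0≤q q-u = Σ≤Σˡ L 0≤q λ y → entry y (y ≟ᶠ u) (adjacent? G x y)
        where
        entry : ∀ y → Dec (y ≡ u) → (dec : Dec (x ≢ y × ∃[ e ] x ∈ edge G e × y ∈ edge G e)) →
          𝟙 (does dec) * q y ≤ 0ℚ ⊎ y ∈ˡ L × 𝟙 (does dec) * q y ≤ q y
        entry y (yes refl) dec = inj₁ (≤-reflexive (trans (cong (𝟙 (does dec) *_) q-u) (*-zeroʳ (𝟙 (does dec)))))
        entry y (no _) (no _) = inj₁ (≤-reflexive (*-zeroˡ (q y)))
        entry y (no y≢u) (yes (x≢y , e , x∈ , y∈)) = inj₂ (only j u∉ , ≤-reflexive (*-identityˡ (q y)))
          where
          j : Joins G e x y
          j = joins x≢y x∈ y∈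
          u∉ : ¬ u ∈ edge G e
          u∉ u∈ with proj₂ (proj₂ (proj₂ j)) u∈
          ... | inj₁ refl = x≢u refl
          ... | inj₂ refl = y≢u refl

      Σo≤ : ∀ L → Σˡ o L ≤ ι (length L)
      Σo≤ []      = ≤-refl
      Σo≤ (x ∷ L) = +-mono-≤ (o≤1 x) (Σo≤ L)

    W≤ : ∀ {x} L → x ≢ u → Only x L → W x ≤ Σˡ ζ L + κ * (ι (length L) * ζ x)
    W≤ {x} L x≢u only = cert≤
      (≤-diff (row x≢u only 0≤ζ (trans (cong (_* z u) o-u) (*-zeroˡ (z u))))
        ⊞ 0≤κ ⊠ (≤-diff (≤-trans (row x≢u only 0≤o o-u) (Σo≤ L)) ⊠ 0≤ζ x))
      (eq κ (Σˡ ζ L) (ι (length L)) (ζ x) ((A · ζ) x) (D x))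
      where
      eq = solve 6 (λ κ s l z a d → s :+ κ :* (l :* z) :- (a :+ κ :* (d :* z)) := s :- a :+ κ :* ((l :- d) :* z)) refl

    -- A neighbour of u on no edge off u is a leaf, from which no walk continues. Hence only
    -- vertices on those edges need to be listed.
    Θ≤ΣW : ∀ L → (∀ {x e} → ¬ u ∈ edge G e → x ∈ edge G e → ν x ≡ 0ℚ ⊎ x ∈ˡ L) → Θ ≤ Σˡ W L
    Θ≤ΣW L cover = Σ≤Σˡ L 0≤W λ x → entry x (x ≟ᶠ u) (any? λ e → ¬? (u ∈? edge G e) ×-dec (x ∈? edge G e))
      where
      vanish : ∀ {x} → ν x ≡ 0ℚ → ν x * W x ≤ 0ℚ
      vanish {x} eq = ≤-reflexive (trans (cong (_* W x) eq) (*-zeroˡ (W x)))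
      νW≤W : ∀ x → ν x * W x ≤ W x
      νW≤W x = cert≤ (0≤1-𝟙 (N u x) ⊠ 0≤W x) (eq (ν x) (W x))
        where
        eq = solve 2 (λ v w → w :- v :* w := (# 1ℚ :- v) :* w) refl
      entry : ∀ x → Dec (x ≡ u) → Dec (∃[ e ] (¬ u ∈ edge G e) × x ∈ edge G e) → ν x * W x ≤ 0ℚ ⊎ x ∈ˡ L × ν x * W x ≤ W x
      entry x (yes refl) _ = inj₁ (vanish ν-u)
      entry x (no _) (yes (e , u∉ , x∈)) with cover u∉ x∈
      ... | inj₁ ν≡0 = inj₁ (vanish ν≡0)
      ... | inj₂ x∈L = inj₂ (x∈L , νW≤W x)
      entry x (no x≢u) (no none) = inj₁ (≤-trans (νW≤W x)
        (≤-trans (W≤ [] x≢u λ {e} j u∉ → contradiction (e , u∉ , proj₁ (proj₂ j)) none) (≤-reflexive (eq κ (ζ x)))))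
        where
        eq = solve 2 (λ κ z → # 0ℚ :+ κ :* (# 0ℚ :* z) := # 0ℚ) refl

    -- With four edges off u the degree of u is that of the centre of T, so the correction in
    -- `E-centre` vanishes.
    E≤Θ : p ≡ ι 4 → E (ι α) ≤ Θ
    E≤Θ p≡4 = cert≤ (≤-diff centre) (trans (eq Θ (E (ι α)) (1ℚ + κ * f) p p≡4) (trans (cong (λ t → Θ - t) (sym E-centre)) (eq′ Θ (f * (f + κ - κ * d)) d)))
      where
      eq : ∀ t e s p → p ≡ ι 4 → t - e ≡ t - (e + (p - ι 4) * s)
      eq t e s p refl = eq₁ t e s
        where
        eq₁ = solve 3 (λ t e s → t :- e := t :- (e :+ (# ι 4 :- # ι 4) :* s)) refl
      eq′ = solve 3 (λ t c d → t :- (c :- d) := d :+ t :- c) refl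

    fζ≤ : ∀ {x} → x ≢ u → f * ζ x ≤ ν x + W x
    fζ≤ {x} x≢u = subst (f * ζ x ≤_) (trans (cong (_* T x) (o-≢ x≢u)) (*-identityˡ (T x))) (away x)

    W-one : ∀ {x y} → x ≢ u → Only x (y ∷ []) → W x ≤ ζ y + κ * ζ x
    W-one {x} {y} x≢u only = subst (W x ≤_) (eq (ζ y) κ (ζ x)) (W≤ (y ∷ []) x≢u only)
      where
      eq = solve 3 (λ y κ x → y :+ # 0ℚ :+ κ :* (# 1ℚ :* x) := y :+ κ :* x) refl

    fζ-one : ∀ {x y} → x ≢ u → Only x (y ∷ []) → f * ζ x ≤ 1ℚ + (ζ y + κ * ζ x)
    fζ-one {x} x≢u only = ≤-trans (fζ≤ x≢u) (+-mono-≤ (ν≤1 x) (W-one x≢u only))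

    -- Adding the inequalities at both ends gives g (ζ x + ζ y) ≤ 2, and the walks through the pair
    -- weigh at most (1 + κ)(ζ x + ζ y). A triangle thus counts at most 2(1 + κ)/g.
    pair≤ : ∀ {x y} → x ≢ u → y ≢ u → Only x (y ∷ []) → Only y (x ∷ []) → g * (W x + W y) ≤ ι 2 * (1ℚ + κ)
    pair≤ {x} {y} x≢u y≢u only-x only-y = cert≤
      (≤-trans 0≤1 1≤g ⊠ (≤-diff (W-one x≢u only-x) ⊞ ≤-diff (W-one y≢u only-y))
        ⊞ (0≤1 ⊞ 0≤κ) ⊠ (≤-diff (fζ-one x≢u only-x) ⊞ ≤-diff (fζ-one y≢u only-y)))
      (eq f κ (W x) (W y) (ζ x) (ζ y))
      where
      eq = solve 6 (λ f κ s t x y → # ι 2 :* (# 1ℚ :+ κ) :- (f :- κ :- # 1ℚ) :* (s :+ t) :=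
        (f :- κ :- # 1ℚ) :* (y :+ κ :* x :- s :+ (x :+ κ :* y :- t)) :+ (# 1ℚ :+ κ) :* (# 1ℚ :+ (y :+ κ :* x) :- f :* x :+ (# 1ℚ :+ (x :+ κ :* y) :- f :* y))) refl

    Sole : Fin n → Fin k → Set
    Sole x f = ∀ {e} → ¬ u ∈ edge G e → x ∈ edge G e → e ≡ f

    sole-only : ∀ {f x y} → Joins G f x y → Sole x f → Only x (y ∷ [])
    sole-only (_ , _ , _ , only) sole (x≢y′ , x∈ , y′∈ , _) u∉ =
      [ (λ eq → contradiction (sym eq) x≢y′) , here ]′ (only (subst (λ e → _ ∈ edge G e) (sole u∉ x∈) y′∈))

    inner-pair≤ : ∀ {e} (i : Inner e) → (∀ {x} → x ∈ edge G e → Sole x e) → g * (W (Inner.a i) + W (Inner.b i)) ≤ ι 2 * (1ℚ + κ)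
    inner-pair≤ {e} i sole = pair≤ (≢-sym (proj₁ spoke-a)) (≢-sym (proj₁ spoke-b))
      (sole-only edge-ab (sole (proj₁ (proj₂ edge-ab))))
      (sole-only (joins-sym {G} {e} edge-ab) (sole (proj₁ (proj₂ (proj₂ edge-ab)))))
      where open Inner i

    remote-ν : ∀ {w} → (∀ e → ¬ Joins G e u w) → ν w ≡ 0ℚ
    remote-ν {w} w-remote = cong 𝟙 (dec-false (adjacent? G u w) λ (u≢w , e , u∈ , w∈) → w-remote e (joins u≢w u∈ w∈))

    remote-≤ : ∀ {w s} → w ≢ u → (∀ e → ¬ Joins G e u w) → W w ≤ s → f * ζ w ≤ s
    remote-≤ {w} {s} w≢u w-remote W≤s = ≤-trans (fζ≤ w≢u)
      (subst (_≤ s) (sym (trans (cong (_+ W w) (remote-ν w-remote)) (+-identityˡ (W w)))) W≤s)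

    private
      -- From h w ≤ x and h x ≤ 1 + w the path weighs w + κ x ≤ (1 + κh)/(h² - 1), which is at most
      -- (1 + κf)/g² and so falls short of `excess`.
      path-arithmetic : ∀ {s w x} → 0ℚ ≤ w → 0ℚ ≤ x → E (ι α) ≤ w + κ * x + s → g * s ≤ ι 6 * (1ℚ + κ) →
        f * w ≤ x + κ * w → f * x ≤ 1ℚ + (w + κ * x) → Absurd
      path-arithmetic {s} {w} {x} 0≤w 0≤x E≤ gs≤ fw≤ fx≤ = <-irrefl refl (<-≤-trans excess (cert≤
        (0≤g ⊠ 0≤g ⊠ ≤-diff E≤ ⊞ 0≤g ⊠ ≤-diff gs≤
          ⊞ (square≥0 κ ⊞ (0≤h ⊠ ≤-diff fw≤ ⊞ ≤-diff fx≤) ⊞ 0≤κ ⊠ (≤-diff fw≤ ⊞ 0≤h ⊠ ≤-diff fx≤)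
            ⊞ 0≤ι 2 ⊠ 0≤g ⊠ (0≤w ⊞ 0≤κ ⊠ 0≤x)))
        (eq f κ (E (ι α)) s w x)))
        where
        0≤g : 0ℚ ≤ g
        0≤g = <⇒≤ 0<g
        eq = solve 6 (λ f κ e s w x → let h = f :- κ; g = h :- # 1ℚ in
          # ι 6 :* (# 1ℚ :+ κ) :* g :+ (# 1ℚ :+ κ :* f) :- e :* (g :* g) :=
          g :* g :* (w :+ κ :* x :+ s :- e) :+ g :* (# ι 6 :* (# 1ℚ :+ κ) :- g :* s)
            :+ (κ :* κ :+ (h :* (x :+ κ :* w :- f :* w) :+ (# 1ℚ :+ (w :+ κ :* x) :- f :* x))
              :+ κ :* (x :+ κ :* w :- f :* w :+ h :* (# 1ℚ :+ (w :+ κ :* x) :- f :* x)) :+ # ι 2 :* g :* (w :+ κ :* x))) refl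

      -- The quadrilateral weighs no more than the triangle it replaces, 2(1 + κ)/g, and the whole
      -- term 1 + κf of `excess` remains as a gap. The key is h w ≤ 1: eliminating x and y gives (h²
      -- - κh - 2) w ≤ 2, and here h² - κh - 2 ≥ 2h.
      square-arithmetic : ∀ {s w x y} → 0ℚ ≤ w → E (ι α) ≤ w + κ * x + (w + κ * y) + s → g * s ≤ ι 4 * (1ℚ + κ) →
        f * w ≤ x + y + κ * (ι 2 * w) → f * x ≤ 1ℚ + (w + κ * x) → f * y ≤ 1ℚ + (w + κ * y) → Absurd
      square-arithmetic {s} {w} {x} {y} 0≤w E≤ gs≤ fw≤ fx≤ fy≤ = <-irrefl refl (<-≤-trans excess (cert≤
        (0≤g ⊠ (0≤g ⊠ ≤-diff E≤ ⊞ ≤-diff gs≤ ⊞ 0≤ι 2 ⊠ (≤-diff hw≤1 ⊞ 0≤w)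
            ⊞ 0≤κ ⊠ (≤-diff fx≤ ⊞ ≤-diff fy≤ ⊞ (≤-diff fw≤ ⊞ (0≤γ ⊞ nonNegative⁻¹ (ℤ.+ 17 / 5) ⊞ ≤-diff κ≤1) ⊠ 0≤w)))
          ⊞ (0≤1 ⊞ 0≤κf))
        (eq f κ (E (ι α)) s w x y)))
        where
        0≤g : 0ℚ ≤ g
        0≤g = <⇒≤ 0<g
        0≤γ : 0ℚ ≤ g - (ℤ.+ 27 / 5)
        0≤γ = ≤-diff g-bound
        hw≤1 : (f - κ) * w ≤ 1ℚ
        hw≤1 = halve (cert≤
          (0≤h ⊠ ≤-diff fw≤ ⊞ ≤-diff fx≤ ⊞ ≤-diff fy≤
            ⊞ (0≤γ ⊠ 0≤γ ⊞ nonNegative⁻¹ (ℤ.+ 49 / 5) ⊠ 0≤γ ⊞ nonNegative⁻¹ (ℤ.+ 494 / 25) ⊞ ≤-diff κ≤1 ⊠ 0≤h) ⊠ 0≤w)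
          (eq f κ w x y))
          where
          eq = solve 5 (λ f κ w x y → let h = f :- κ; c = h :- # 1ℚ :- # (ℤ.+ 27 / 5) in # 1ℚ :+ # 1ℚ :- (h :* w :+ h :* w) :=
            h :* (x :+ y :+ κ :* (# ι 2 :* w) :- f :* w) :+ (# 1ℚ :+ (w :+ κ :* x) :- f :* x) :+ (# 1ℚ :+ (w :+ κ :* y) :- f :* y)
              :+ (c :* c :+ # (ℤ.+ 49 / 5) :* c :+ # (ℤ.+ 494 / 25) :+ (# 1ℚ :- κ) :* h) :* w) refl
        eq = solve 7 (λ f κ e s w x y → let h = f :- κ; g = h :- # 1ℚ in
          # ι 6 :* (# 1ℚ :+ κ) :* g :+ (# 1ℚ :+ κ :* f) :- e :* (g :* g) :=
          g :* (g :* (w :+ κ :* x :+ (w :+ κ :* y) :+ s :- e) :+ (# ι 4 :* (# 1ℚ :+ κ) :- g :* s) :+ # ι 2 :* (# 1ℚ :- h :* w :+ w)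
            :+ κ :* (# 1ℚ :+ (w :+ κ :* x) :- f :* x :+ (# 1ℚ :+ (w :+ κ :* y) :- f :* y)
              :+ (x :+ y :+ κ :* (# ι 2 :* w) :- f :* w :+ (g :- # (ℤ.+ 27 / 5) :+ # (ℤ.+ 17 / 5) :+ (# 1ℚ :- κ)) :* w)))
            :+ (# 1ℚ :+ κ :* f)) refl

    private
      at : ∀ {e y} (i : Inner e) → y ∈ edge G e → y ∈ˡ Inner.a i ∷ Inner.b i ∷ []
      at i y∈ = [ here , there ∘ here ]′ (proj₂ (proj₂ (proj₂ (Inner.edge-ab i))) y∈)

    module _ (few : length rs ℕ.≤ 1) where

      private
        p≡4 : ∀ {w} → w ∈ˡ rs → p ≡ ι 4
        p≡4 w∈ = trans (sym length-es) (cong ι (trans lengths (cong (3 ℕ.+_) (one rs few w∈))))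
          where
          one : ∀ {w} xs → length xs ℕ.≤ 1 → w ∈ˡ xs → length xs ≡ 1
          one (_ ∷ [])    _ _ = refl
          one (_ ∷ _ ∷ _) (ℕ.s≤s ()) _

      not-path : ¬ Path
      not-path pth = path-arithmetic {Σˡ W V} (0≤ζ w) (0≤ζ x)
        (≤-trans (E≤Θ (p≡4 w∈rs)) (≤-trans (Θ≤ΣW (x ∷ V) cover) (+-monoˡ-≤ (Σˡ W V) (W-one x≢u only-x))))
        (cert≤ (≤-diff (inner-pair≤ i₁ sole₁) ⊞ ≤-diff (inner-pair≤ i₂ sole₂) ⊞ ≤-diff (inner-pair≤ i₃ sole₃))
          (eq κ g (W I₁.a) (W I₁.b) (W I₂.a) (W I₂.b) (W I₃.a) (W I₃.b)))
        (remote-≤ w≢u (remote-¬joins w∈rs) (W-one w≢u only-w))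
        (fζ-one x≢u only-x)
        where
        open Path pth renaming (g to gₓ)
        module I₁ = Inner i₁
        module I₂ = Inner i₂
        module I₃ = Inner i₃
        V : List (Fin n)
        V = I₁.a ∷ I₁.b ∷ I₂.a ∷ I₂.b ∷ I₃.a ∷ I₃.b ∷ []
        w≢u : w ≢ u
        w≢u = remote-≢ w∈rs
        x≢u : x ≢ u
        x≢u = ≢-sym (proj₁ spoke-x)
        ends : ∀ {y} → y ∈ edge G gₓ → y ≡ x ⊎ y ≡ w
        ends = proj₂ (proj₂ (proj₂ edge-xw))
        apart : ∀ {e y} → e ∈ˡ e₁ ∷ e₂ ∷ e₃ ∷ [] → y ∈ edge G e → ¬ y ∈ edge G gₓ
        apart {e} e∈ y∈ y∈g = [ (λ eq → All.lookup x∉ e∈ (subst (_∈ edge G e) eq y∈))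
                              , (λ eq → All.lookup w∉ e∈ (subst (_∈ edge G e) eq y∈)) ]′ (ends y∈g)
        sole : ∀ {y f} → All (λ e → y ∈ edge G e → e ≡ f) (gₓ ∷ e₁ ∷ e₂ ∷ e₃ ∷ []) → Sole y f
        sole {y} {f} h u∉ = All.lookup {P = λ e → y ∈ edge G e → e ≡ f} h (all u∉)
        sole-g : ∀ {y} → y ∈ edge G gₓ → Sole y gₓ
        sole-g y∈ = sole ((λ _ → refl) ∷ (λ p → contradiction y∈ (apart (here refl) p)) ∷
          (λ p → contradiction y∈ (apart (there (here refl)) p)) ∷ (λ p → contradiction y∈ (apart (there (there (here refl))) p)) ∷ [])
        sole₁ : ∀ {y} → y ∈ edge G e₁ → Sole y e₁
        sole₁ y∈ = sole ((λ p → contradiction p (apart (here refl) y∈)) ∷ (λ _ → refl) ∷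
          (λ p → contradiction p (d₁₂ y∈)) ∷ (λ p → contradiction p (d₁₃ y∈)) ∷ [])
        sole₂ : ∀ {y} → y ∈ edge G e₂ → Sole y e₂
        sole₂ y∈ = sole ((λ p → contradiction p (apart (there (here refl)) y∈)) ∷ (λ p → contradiction y∈ (d₁₂ p)) ∷
          (λ _ → refl) ∷ (λ p → contradiction p (d₂₃ y∈)) ∷ [])
        sole₃ : ∀ {y} → y ∈ edge G e₃ → Sole y e₃
        sole₃ y∈ = sole ((λ p → contradiction p (apart (there (there (here refl))) y∈)) ∷ (λ p → contradiction y∈ (d₁₃ p)) ∷
          (λ p → contradiction y∈ (d₂₃ p)) ∷ (λ _ → refl) ∷ [])
        only-x : Only x (w ∷ [])
        only-x = sole-only edge-xw (sole-g (proj₁ (proj₂ edge-xw)))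
        only-w : Only w (x ∷ [])
        only-w = sole-only (joins-sym {G} {gₓ} edge-xw) (sole-g (proj₁ (proj₂ (proj₂ edge-xw))))
        cover : ∀ {y e} → ¬ u ∈ edge G e → y ∈ edge G e → ν y ≡ 0ℚ ⊎ y ∈ˡ x ∷ V
        cover {y} u∉ = All.lookup {P = λ e → y ∈ edge G e → ν y ≡ 0ℚ ⊎ y ∈ˡ x ∷ V}
          ((λ p → [ inj₂ ∘ here , (λ eq → inj₁ (trans (cong ν eq) (remote-ν (remote-¬joins w∈rs)))) ]′ (ends p)) ∷
           (λ p → inj₂ (there (∈-++⁺ˡ (at i₁ p)))) ∷
           (λ p → inj₂ (there (there (there (∈-++⁺ˡ (at i₂ p)))))) ∷
           (λ p → inj₂ (there (there (there (there (there (at i₃ p))))))) ∷ [])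
          (all u∉)
        eq = solve 8 (λ κ g a b c d e f → # ι 6 :* (# 1ℚ :+ κ) :- g :* (a :+ (b :+ (c :+ (d :+ (e :+ (f :+ # 0ℚ)))))) :=
          # ι 2 :* (# 1ℚ :+ κ) :- g :* (a :+ b) :+ (# ι 2 :* (# 1ℚ :+ κ) :- g :* (c :+ d)) :+ (# ι 2 :* (# 1ℚ :+ κ) :- g :* (e :+ f))) refl

      not-square : ¬ Square
      not-square sq = square-arithmetic {Σˡ W V} (0≤ζ w)
        (≤-trans (E≤Θ (p≡4 w∈rs)) (≤-trans (Θ≤ΣW (a ∷ b ∷ V) cover)
          (cert≤ (≤-diff (W-one a≢u only-a) ⊞ ≤-diff (W-one b≢u only-b)) (eq₁ (W a) (W b) (Σˡ W V) (ζ w + κ * ζ a) (ζ w + κ * ζ b)))))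
        (cert≤ (≤-diff (inner-pair≤ i₁ sole₁) ⊞ ≤-diff (inner-pair≤ i₂ sole₂))
          (eq κ g (W I₁.a) (W I₁.b) (W I₂.a) (W I₂.b)))
        (remote-≤ w≢u (remote-¬joins w∈rs) (subst (W w ≤_) (eq₂ κ (ζ a) (ζ b) (ζ w)) (W≤ (a ∷ b ∷ []) w≢u only-w)))
        (fζ-one a≢u only-a)
        (fζ-one b≢u only-b)
        where
        open Square sq renaming (g to gₐ; h to hᵦ)
        module I₁ = Inner i₁
        module I₂ = Inner i₂
        V : List (Fin n)
        V = I₁.a ∷ I₁.b ∷ I₂.a ∷ I₂.b ∷ []
        w≢u : w ≢ u
        w≢u = remote-≢ w∈rs
        a≢u : a ≢ u
        a≢u = ≢-sym (proj₁ spoke-a)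
        b≢u : b ≢ u
        b≢u = ≢-sym (proj₁ spoke-b)
        ends-a : ∀ {y} → y ∈ edge G gₐ → y ≡ a ⊎ y ≡ w
        ends-a = proj₂ (proj₂ (proj₂ edge-aw))
        ends-b : ∀ {y} → y ∈ edge G hᵦ → y ≡ b ⊎ y ≡ w
        ends-b = proj₂ (proj₂ (proj₂ edge-bw))
        apart-a : ∀ {e y} → e ∈ˡ e₁ ∷ e₂ ∷ [] → y ∈ edge G e → ¬ y ∈ edge G gₐ
        apart-a {e} e∈ y∈ y∈g = [ (λ eq → All.lookup a∉ e∈ (subst (_∈ edge G e) eq y∈))
                                , (λ eq → All.lookup w∉ e∈ (subst (_∈ edge G e) eq y∈)) ]′ (ends-a y∈g)
        apart-b : ∀ {e y} → e ∈ˡ e₁ ∷ e₂ ∷ [] → y ∈ edge G e → ¬ y ∈ edge G hᵦ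
        apart-b {e} e∈ y∈ y∈h = [ (λ eq → All.lookup b∉ e∈ (subst (_∈ edge G e) eq y∈))
                                , (λ eq → All.lookup w∉ e∈ (subst (_∈ edge G e) eq y∈)) ]′ (ends-b y∈h)
        sole : ∀ {y f} → All (λ e → y ∈ edge G e → e ≡ f) (gₐ ∷ hᵦ ∷ e₁ ∷ e₂ ∷ []) → Sole y f
        sole {y} {f} h u∉ = All.lookup {P = λ e → y ∈ edge G e → e ≡ f} h (all u∉)
        sole-a : Sole a gₐ
        sole-a = sole ((λ _ → refl) ∷
          (λ p → [ (λ eq → contradiction eq a≢b) , (λ eq → contradiction eq (proj₁ edge-aw)) ]′ (ends-b p)) ∷
          (λ p → contradiction p (All.lookup a∉ (here refl))) ∷ (λ p → contradiction p (All.lookup a∉ (there (here refl)))) ∷ [])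
        sole-b : Sole b hᵦ
        sole-b = sole
          ((λ p → [ (λ eq → contradiction (sym eq) a≢b) , (λ eq → contradiction eq (proj₁ edge-bw)) ]′ (ends-a p)) ∷ (λ _ → refl) ∷
          (λ p → contradiction p (All.lookup b∉ (here refl))) ∷ (λ p → contradiction p (All.lookup b∉ (there (here refl)))) ∷ [])
        sole₁ : ∀ {y} → y ∈ edge G e₁ → Sole y e₁
        sole₁ y∈ = sole ((λ p → contradiction p (apart-a (here refl) y∈)) ∷ (λ p → contradiction p (apart-b (here refl) y∈)) ∷
          (λ _ → refl) ∷ (λ p → contradiction p (d₁₂ y∈)) ∷ [])
        sole₂ : ∀ {y} → y ∈ edge G e₂ → Sole y e₂
        sole₂ y∈ = sole ((λ p → contradiction p (apart-a (there (here refl)) y∈)) ∷ (λ p → contradiction p (apart-b (there (here refl)) y∈)) ∷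
          (λ p → contradiction y∈ (d₁₂ p)) ∷ (λ _ → refl) ∷ [])
        only-a : Only a (w ∷ [])
        only-a = sole-only edge-aw sole-a
        only-b : Only b (w ∷ [])
        only-b = sole-only edge-bw sole-b
        only-w : Only w (a ∷ b ∷ [])
        only-w {_} {y} (w≢y , w∈ , y∈ , _) u∉ = All.lookup {P = λ e → w ∈ edge G e → y ∈ edge G e → y ∈ˡ a ∷ b ∷ []}
          ((λ _ p → [ here , (λ eq → contradiction (sym eq) w≢y) ]′ (ends-a p)) ∷
           (λ _ p → [ there ∘ here , (λ eq → contradiction (sym eq) w≢y) ]′ (ends-b p)) ∷
           (λ q _ → contradiction q (All.lookup w∉ (here refl))) ∷ (λ q _ → contradiction q (All.lookup w∉ (there (here refl)))) ∷ [])
          (all u∉) w∈ y∈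
        cover : ∀ {y e} → ¬ u ∈ edge G e → y ∈ edge G e → ν y ≡ 0ℚ ⊎ y ∈ˡ a ∷ b ∷ V
        cover {y} u∉ = All.lookup {P = λ e → y ∈ edge G e → ν y ≡ 0ℚ ⊎ y ∈ˡ a ∷ b ∷ V}
          ((λ p → [ inj₂ ∘ here , at-w ]′ (ends-a p)) ∷ (λ p → [ inj₂ ∘ there ∘ here , at-w ]′ (ends-b p)) ∷
           (λ p → inj₂ (there (there (∈-++⁺ˡ (at i₁ p))))) ∷ (λ p → inj₂ (there (there (there (there (at i₂ p)))))) ∷ [])
          (all u∉)
          where
          at-w : ∀ {B : Set} → y ≡ w → ν y ≡ 0ℚ ⊎ B
          at-w eq = inj₁ (trans (cong ν eq) (remote-ν (remote-¬joins w∈rs)))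
        eq = solve 6 (λ κ g a b c d → # ι 4 :* (# 1ℚ :+ κ) :- g :* (a :+ (b :+ (c :+ (d :+ # 0ℚ)))) :=
          # ι 2 :* (# 1ℚ :+ κ) :- g :* (a :+ b) :+ (# ι 2 :* (# 1ℚ :+ κ) :- g :* (c :+ d))) refl
        eq₁ = solve 5 (λ a b s x y → x :+ y :+ s :- (a :+ (b :+ s)) := x :- a :+ (y :- b)) refl
        eq₂ = solve 4 (λ κ a b w → a :+ (b :+ # 0ℚ) :+ κ :* (# ι 2 :* w) := a :+ b :+ κ :* (# ι 2 :* w)) refl

    classification :
      H ≅ T₂C (suc (suc r)) (α Vec.∷ 1 Vec.∷ 0 Vec.∷ 0 Vec.∷ 0 Vec.∷ 0 Vec.∷ 0 Vec.∷ Vec.[]) ⊎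
      H ≅ T₂C (suc (suc r)) (suc α Vec.∷ 0 Vec.∷ 0 Vec.∷ 0 Vec.∷ 0 Vec.∷ 0 Vec.∷ 0 Vec.∷ Vec.[])
    classification = go (structure few)
      where
      few : length rs ℕ.≤ 1
      -- Two remote vertices would mean five edges avoiding u, by `lengths`.
      few = ℕₚ.≮⇒≥ λ 2≤ → few-edges (length es) (sym length-es) (subst (5 ℕ.≤_) (sym lengths) (ℕₚ.+-monoʳ-≤ 3 2≤))
      order≡ : order G ≡ 8 ℕ.+ α
      order≡ = ℕₚ.+-cancelʳ-≡ 2 (order G) (8 ℕ.+ α) (trans order+2 (trans size≡ (ℕₚ.+-comm 2 (8 ℕ.+ α))))
      go : Structure → _
      go (all-at-u C) = inj₂ (all-pendants-at-centre r (suc α) (powerOf-≅ φ) C order≡)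
      go (one-off C)  = inj₁ (one-pendant-off r α (powerOf-≅ φ) C order≡)
      go (path P)     = contradiction P (not-path few)
      go (square S)   = contradiction S (not-square few)

-- From hypergraphs back to graphs, and the conclusion.

module Conclusions where
  open OrderedField
  open LinearAlgebra
  open AdjacencyOperators
  open RealEigenvectors using (1/[1+_])
  open ExtremalVector using (module Extremal)
  open ExtremalSigns using (L₀; module Shape)
  open Thresholds
  open Graphs
  open Subsolutions
  open ExcludedShapes
  open import Defs renaming (_≈_ to _≈ʳ_; _≤_ to _≤ʳ_)
  open import Data.Fin.Base using (Fin; suc)
  open import Data.Fin.Permutation using (↔⇒≡)
  open import Data.Fin.Subset using (_∈_)
  open import Data.List.Base using ([]; _∷_)
  open import Data.Nat.Base as ℕ using (ℕ; suc; _∸_)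
  import Data.Nat.Properties as ℕₚ
  open import Data.Product.Base using (∃-syntax; ∃₂; _×_; _,_; proj₁; proj₂)
  open import Data.Rational.Base hiding (_⊔_; _⊓_; ∣_∣)
  open import Data.Rational.Properties
  open import Data.Sum.Base using (_⊎_; inj₁; inj₂)
  import Data.Vec.Base as Vec
  open import Function.Base using (_∘_; id)
  open import Function.Bundles using (Inverse; Equivalence)
  open import Relation.Nullary using (¬_)
  open import Relation.Nullary.Negation using (contradiction)
  open import Relation.Binary.Construct.Closure.ReflexiveTransitive using (Star; gmap)
  open import Relation.Binary.PropositionalEquality

  module PowerOfGraph (d : ℕ) {G H : Hypergraph} (φ : H ≅ power (suc (suc d)) G) where

    open Power d G using (P; vertex; new; fill; fill-vertex; fill-new; by-kind; vertex∈; new∈)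
    module V = Inverse (_≅_.vertices φ)

    private
      π : Fin (order P) → Fin (order G)
      π = fill id (proj₁ ∘ nonempty G)

      π-∈ : ∀ {e} x → x ∈ edge P e → π x ∈ edge G e
      π-∈ {e} = by-kind {Q = λ x → x ∈ edge P e → π x ∈ edge G e}
        (λ u p → subst (_∈ edge G e) (sym (fill-vertex id (proj₁ ∘ nonempty G) u)) (vertex∈ p))
        (λ f t p → subst₂ (λ x e → x ∈ edge G e) (sym (fill-new id (proj₁ ∘ nonempty G) f t)) (sym (new∈ p)) (proj₂ (nonempty G f)))

      π-from : ∀ u → π (V.to (V.from (vertex u))) ≡ u
      π-from u = trans (cong π (V.strictlyInverseˡ (vertex u))) (fill-vertex id (proj₁ ∘ nonempty G) u)

    -- The map π collapses the new vertices of an edge to one of its ends, so vertices sharing an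
    -- edge of H are sent to vertices sharing an edge of G, and walks go to walks.
    connected-graph : Connected H → Connected G
    connected-graph connected u v = subst₂ (Star _) (π-from u) (π-from v)
      (gmap (π ∘ V.to)
        (λ (e , x∈ , y∈) → Inverse.to (_≅_.edges φ) e ,
          π-∈ _ (Equivalence.to (_≅_.incidence φ _ e) x∈) , π-∈ _ (Equivalence.to (_≅_.incidence φ _ e) y∈))
        (connected (V.from (vertex u)) (V.from (vertex v))))

    size-graph : size G ≡ size H
    size-graph = sym (↔⇒≡ (_≅_.edges φ))

    -- The power has n + k d vertices, so n + k d + 2 = k (d + 1) leaves n + 2 = k.
    order-graph : TypeII (suc (suc d)) H → order G ℕ.+ 2 ≡ size G
    order-graph typeII = ℕₚ.+-cancelʳ-≡ (size G ℕ.* d) (order G ℕ.+ 2) (size G) (begin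
      order G ℕ.+ 2 ℕ.+ size G ℕ.* d   ≡⟨ ℕₚ.+-assoc (order G) 2 _ ⟩
      order G ℕ.+ (2 ℕ.+ size G ℕ.* d) ≡⟨ cong (order G ℕ.+_) (ℕₚ.+-comm 2 (size G ℕ.* d)) ⟩
      order G ℕ.+ (size G ℕ.* d ℕ.+ 2) ≡⟨ sym (ℕₚ.+-assoc (order G) (size G ℕ.* d) 2) ⟩
      order P ℕ.+ 2                    ≡⟨ cong (ℕ._+ 2) (sym (↔⇒≡ (_≅_.vertices φ))) ⟩
      order H ℕ.+ 2                    ≡⟨ typeII ⟩
      size H ℕ.* suc d                 ≡⟨ cong (ℕ._* suc d) (sym size-graph) ⟩
      size G ℕ.* suc d                 ≡⟨ ℕₚ.*-suc (size G) d ⟩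
      size G ℕ.+ size G ℕ.* d          ∎)
      where open ≡-Reasoning

  module _ (G : Hypergraph) (uniform : Uniform 2 G) where

    open Graph G uniform

    -- Division by f + 1 + d brings the inequality to the form with κ, and scaling makes the largest
    -- entry 1; its vertex becomes the centre.
    normalise : ∀ d f κ → 0ℚ < f + 1ℚ + ι d → (f + 1ℚ + ι d) * κ ≡ ι d → Subsolution (Reduced d f) →
      ∃₂ λ u (z : Fin n → ℚ) → (∀ x → 0ℚ ≤ z x) × z u ≡ 1ℚ × (∀ x → z x ≤ 1ℚ) ×
        (∀ x → (f + κ) * z x ≤ (A · z) x + κ * (degree x * z x))
    normalise d f κ 0<W Wκ (z , z≥0 , (i , 0<zi) , Mz≤0) = go (argmax i z)
      where
      sub : ∀ x → (f + κ) * z x ≤ (A · z) x + κ * (degree x * z x)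
      sub x = cancel-≤ 0<W (cert≤ (≤-diff (subst (_≤ 0ℚ) (Reduced-· d f z x) (Mz≤0 x)))
        (modulo (z x - degree x * z x) Wκ (eq f κ (ι d) (z x) ((A · z) x) (degree x))))
        where
        eq = solve 6 (λ f κ d z a g → (f :+ # 1ℚ :+ d) :* (a :+ κ :* (g :* z)) :- (f :+ # 1ℚ :+ d) :* ((f :+ κ) :* z) :+ (z :- g :* z) :* ((f :+ # 1ℚ :+ d) :* κ :- d) :=
          # 0ℚ :- ((f :+ d) :* (f :+ # 1ℚ) :* z :- ((f :+ # 1ℚ :+ d) :* a :+ d :* (g :* z)))) refl
      go : (∃[ u ] ∀ x → z x ≤ z u) → _
      go (u , z≤) = scaled (recip (<-≤-trans 0<zi (z≤ i)))
        where
        scaled : (∃[ t ] 0ℚ < t × z u * t ≡ 1ℚ) → _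
        scaled (t , 0<t , ut) = u , (λ x → t * z x) , (λ x → <⇒≤ 0<t ⊠ z≥0 x) , tu≡1 ,
          (λ x → subst (t * z x ≤_) tu≡1 (scale-≤ (<⇒≤ 0<t) (z≤ x))) ,
          λ x → subst₂ _≤_ (eq t (f + κ) (z x))
            (trans (eq₁ t ((A · z) x) κ (degree x) (z x)) (cong (_+ κ * (degree x * (t * z x)))
              (sym (trans (Σ-cong λ y → eq (A x y) t (z y)) (Σ-*ˡ t (λ y → A x y * z y))))))
            (scale-≤ (<⇒≤ 0<t) (sub x))
          where
          tu≡1 : t * z u ≡ 1ℚ
          tu≡1 = trans (*-comm t (z u)) ut
          eq = solve 3 (λ t s z → t :* (s :* z) := s :* (t :* z)) refl
          eq₁ = solve 5 (λ t a κ g z → t :* (a :+ κ :* (g :* z)) := t :* a :+ κ :* (g :* (t :* z))) refl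

  one-off-centre all-at-centre : ℕ → ℕ → Hypergraph
  one-off-centre d a = T₂C (suc (suc d)) (a Vec.∷ 1 Vec.∷ 0 Vec.∷ 0 Vec.∷ 0 Vec.∷ 0 Vec.∷ 0 Vec.∷ Vec.[])
  all-at-centre  d a = T₂C (suc (suc d)) (suc a Vec.∷ 0 Vec.∷ 0 Vec.∷ 0 Vec.∷ 0 Vec.∷ 0 Vec.∷ 0 Vec.∷ Vec.[])

  module Dichotomy (d α : ℕ) (f κ : ℚ) (L₀≤f : L₀ ≤ f) (0≤κ : 0ℚ ≤ κ) (κ≤1 : κ ≤ 1ℚ)
    (0<W : 0ℚ < f + 1ℚ + ι d) (Wκ : (f + 1ℚ + ι d) * κ ≡ ι d)
    (excess : ι 6 * (1ℚ + κ) * Shape.g f κ + (1ℚ + κ * f) < Shape.E f κ (ι α) * (Shape.g f κ * Shape.g f κ))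
    (f-large : ι 55 - ι 46 * κ ≤ f * f - ι 8 * κ * f) where

    dichotomy : (H : Hypergraph) → Connected H → ThreeCyclic H → size H ≡ 10 ℕ.+ α → TypeII (suc (suc d)) H → IsPower (suc (suc d)) H →
      (∀ {ρ} → IsSpectralRadius (adjacency (suc (suc d)) H) ρ → ρ ≤ʳ fromℚ ((f + ι d) * 1/[1+ d ])) ⊎ (H ≅ one-off-centre d α ⊎ H ≅ all-at-centre d α)
    dichotomy H connected three size≡ typeII (G , uniform , φ) = go (super-or-sub (Reduced d f) (Reduced-off-diagonal d f 0≤f))
      where
      open Graph G uniform using (Reduced; Reduced-off-diagonal; radius-bound)
      open PowerOfGraph d {G} φ
      0≤f : 0ℚ ≤ f
      0≤f = ≤-trans by-evaluation L₀≤f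
      go : Supersolution (Reduced d f) ⊎ Subsolution (Reduced d f) →
        (∀ {ρ} → IsSpectralRadius (adjacency (suc (suc d)) H) ρ → ρ ≤ʳ fromℚ ((f + ι d) * 1/[1+ d ])) ⊎ (H ≅ one-off-centre d α ⊎ H ≅ all-at-centre d α)
      go (inj₁ sup) = inj₁ λ {ρ} → radius-bound d f 0≤f sup {H} {ρ} φ
      go (inj₂ sub) = let u , z , z≥0 , z-u , z≤1 , sub′ = normalise G uniform d f κ 0<W Wκ sub in
        inj₂ (Classification.classification G uniform (connected-graph connected) (order-graph typeII) u f κ L₀≤f 0≤κ κ≤1
          z z≥0 z-u z≤1 sub′ α (trans size-graph size≡) excess f-large d {H} φ three)

  -- Unfolding `concatMap` over the seven vertices yields exactly `pendants`, even for symbolic a,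
  -- as the copies of the centre come first.
  extremal-T : ∀ d a → Extremal.T d a ≡ one-off-centre d a
  extremal-T d a = refl

  module Conclusion (d j : ℕ) (large : 46 ℕ.≤ j ℕ.* suc d) where

    open Threshold d j large

    0<E : 0ℚ < E (ι a)
    0<E = Shape.Positive.E-positive q κ L₀≤q 0≤κ κ≤1 (ι a) excess

    -- The second use of 46. Positivity of E gives q (q + d) > (j + 9)(1 + d) ≥ 55 + 9d; expressing
    -- d through κ and dividing by W turns this into a bound free of d and j.
    f-large : ι 55 - ι 46 * κ ≤ q * q - ι 8 * κ * q
    f-large = cancel-≤ 0<W (cert≤ {t = W * E (ι a) + (q + 1ℚ) * (ι j * (1ℚ + ι d) - ι 46)}
      (<⇒≤ 0<W ⊠ <⇒≤ 0<E ⊞ (≤-trans by-evaluation L₀≤q ⊞ 0≤1) ⊠ ≤-diff 46≤)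
      (trans (modulo (ι 8 * q - ι 46) Wκ (eq q κ (ι d) (ι j)))
        (cong (_+ (q + 1ℚ) * (ι j * (1ℚ + ι d) - ι 46)) (sym W·E≡))))
      where
      eq = solve 4 (λ f κ d j → (f :+ # 1ℚ :+ d) :* (f :* f :- # ι 8 :* κ :* f) :- (f :+ # 1ℚ :+ d) :* (# ι 55 :- # ι 46 :* κ)
          :+ (# ι 8 :* f :- # ι 46) :* ((f :+ # 1ℚ :+ d) :* κ :- d) :=
        (f :+ # 1ℚ) :* (f :* (f :+ d) :- (# 1ℚ :+ (# 1ℚ :+ (# 1ℚ :+ j)) :+ # ι 6) :* (# 1ℚ :+ d)) :+ (f :+ # 1ℚ) :* (j :* (# 1ℚ :+ d) :- # ι 46)) refl

    open Dichotomy d a q κ L₀≤q 0≤κ κ≤1 0<W Wκ excess f-large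

    below : ∀ {ρ σ} → IsSpectralRadius (adjacency (suc (suc d)) (one-off-centre d a)) σ → ρ ≤ʳ fromℚ ((q + ι d) * 1/[1+ d ]) → ρ ≤ʳ σ × ¬ (ρ ≈ʳ σ)
    below {ρ} {σ} isσ = below-spectral-radius {σ} (subst (λ T → IsSpectralRadius (adjacency (suc (suc d)) T) σ) (sym (extremal-T d a)) isσ) {ρ}

    conclusion : (H : Hypergraph) → Connected H → ThreeCyclic H → size H ≡ 13 ℕ.+ j → TypeII (suc (suc d)) H → IsPower (suc (suc d)) H →
      ¬ (H ≅ all-at-centre d a) → (ρ σ : ℝ) → IsSpectralRadius (adjacency (suc (suc d)) H) ρ → IsSpectralRadius (adjacency (suc (suc d)) (one-off-centre d a)) σ →
      (ρ ≤ʳ σ) × (ρ ≈ʳ σ → H ≅ one-off-centre d a)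
    conclusion H connected three size≡ typeII power H≇T″ ρ σ isρ isσ = go (dichotomy H connected three size≡ typeII power)
      where
      go : (∀ {ρ} → IsSpectralRadius (adjacency (suc (suc d)) H) ρ → ρ ≤ʳ fromℚ ((q + ι d) * 1/[1+ d ])) ⊎ (H ≅ one-off-centre d a ⊎ H ≅ all-at-centre d a) →
        (ρ ≤ʳ σ) × (ρ ≈ʳ σ → H ≅ one-off-centre d a)
      go (inj₁ bound)       = proj₁ both , λ ρ≈σ → contradiction ρ≈σ (proj₂ both)
        where
        both : ρ ≤ʳ σ × ¬ (ρ ≈ʳ σ)
        both = below {ρ} {σ} isσ (bound {ρ} isρ)
      go (inj₂ (inj₁ H≅T′)) = spectral-radius-≅ {d} {H} {one-off-centre d a} {ρ} {σ} H≅T′ isρ isσ , λ _ → H≅T′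
      go (inj₂ (inj₂ H≅T″)) = contradiction H≅T″ H≇T″

  -- Subtraction is truncated: k ≤ 13 would make the product zero.
  exceeds-13 : ∀ k r → 46 ℕ.≤ (k ∸ 13) ℕ.* r → ∃[ j ] k ≡ 13 ℕ.+ j
  exceeds-13 k r large with ℕₚ.≤-total 13 k
  ... | inj₁ 13≤k = k ∸ 13 , sym (ℕₚ.m+[n∸m]≡n 13≤k)
  ... | inj₂ k≤13 with subst (λ i → 46 ℕ.≤ i ℕ.* r) (ℕₚ.m≤n⇒m∸n≡0 k≤13) large
  ...   | ()

open Conclusions
open import Data.Nat.Base using (suc)
open import Data.Product.Base using (_,_)
open import Relation.Binary.PropositionalEquality using (refl)
open import Defs
open import Data.Nat.Base using (ℕ; _*_; _∸_; _≥_; NonTrivial)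
open import Data.Product.Base using (_×_)
open import Data.Vec.Base using ([]; _∷_)
open import Relation.Binary.PropositionalEquality using (_≡_)
open import Relation.Nullary using (¬_)

theorem5p2p2 : (m k : ℕ) → .{{_ : NonTrivial m}} →
    (H : Hypergraph) →
    Uniform m H → Linear H → Connected H → ThreeCyclic H →
    size H ≡ k → TypeII m H → IsPower m H →
    (k ∸ 13) * (m ∸ 1) ≥ 46 →
    ¬ (H ≅ T₂C m (k ∸ 9 ∷ 0 ∷ 0 ∷ 0 ∷ 0 ∷ 0 ∷ 0 ∷ [])) →
    let T = T₂C m (k ∸ 10 ∷ 1 ∷ 0 ∷ 0 ∷ 0 ∷ 0 ∷ 0 ∷ []) in
    (ρ σ : ℝ) →
    IsSpectralRadius (adjacency m H) ρ →
    IsSpectralRadius (adjacency m T) σ →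
    (ρ ≤ σ) × (ρ ≈ σ → H ≅ T)
theorem5p2p2 (suc (suc d)) k H _ _ connected three size≡k typeII power large with exceeds-13 k (suc d) large
... | j , refl = Conclusion.conclusion d j large H connected three size≡k typeII power
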